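{- The following decision problem is solvable in polynomial time (i.e. it is in $\mathcal{P}$): given a finite directed acyclic graph $D$, decide whether $D$ has at least one topological additive numbering.
   Context: For a directed acyclic graph $D=(V,A)$, $N(v)$ denotes the set of neighbors of $v$ in the undirected underlying graph of $D$ (both in- and out-neighbors). $\mathbb{N}$ denotes the positive integers. A labeling $f:V\to\mathbb{N}$ is a topological additive numbering of $D$ if, with $S(v)=\sum_{w\in N(v)}f(w)$, one has $S(u)<S(v)$ for every $(u,v)\in A$. -}

module Defs where

open import Data.Bool using (Bool; true; false; T; _∨_)
open import Data.Fin using (Fin)
open import Data.List using (List; []; _∷_; _++_; length; map; replicate; filterᵇ; allFin; cartesianProduct)
open import Data.Nat using (ℕ; suc; _+_; _*_; _^_; _≤_; _<_)
open import Data.Nat.GeneralisedArithmetic using (iterate)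
open import Data.Nat.ListAction using (sum)
open import Data.Product using (∃; ∃-syntax; Σ-syntax; _×_; _,_; proj₁; proj₂; uncurry)
import Data.Vec as Vec
open Vec using (Vec)
open import Function.Bundles using (_↔_)
open import Relation.Binary.Construct.Closure.Transitive using (TransClosure)
open import Relation.Binary.PropositionalEquality using (_≡_)
open import Relation.Nullary using (¬_; Reflects)

record DAG : Set where
  field
    order : ℕ
    arc   : Fin order → Fin order → Bool

  V : Set
  V = Fin order

  _⟶_ : V → V → Set
  u ⟶ v = T (arc u v)

  field
    acyclic : ∀ v → ¬ TransClosure _⟶_ v v

  N : V → List V
  N v = filterᵇ (λ w → arc v w ∨ arc w v) (allFin order)

  S : (V → ℕ) → V → ℕ
  S f v = sum (map f (N v))

-- Labels are positive integers, whereas ℕ contains 0.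
record IsTopologicalAdditiveNumbering (D : DAG) (f : DAG.V D → ℕ) : Set where
  open DAG D
  field
    positive   : ∀ v → 0 < f v
    increasing : ∀ {u v} → u ⟶ v → S f u < S f v

HasTopologicalAdditiveNumbering : DAG → Set
HasTopologicalAdditiveNumbering D = ∃ (IsTopologicalAdditiveNumbering D)

data Symbol (Γ : Set) : Set where
  blank : Symbol Γ
  bit   : Bool → Symbol Γ
  aux   : Γ → Symbol Γ

data Control (Q : Set) : Set where
  run  : Q → Control Q
  halt : (accept : Bool) → Control Q

data Move : Set where
  left stay right : Move

IsFinite : Set → Set
IsFinite A = ∃[ n ] (A ↔ Fin n)

record TuringMachine : Set₁ where
  field
    Q        : Set
    Q-finite : IsFinite Q
    Γ        : Set
    Γ-finite : IsFinite Γ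
    extra    : ℕ

  tapes : ℕ
  tapes = suc extra

  field
    start : Q
    δ     : Q → Vec (Symbol Γ) tapes → Control Q × Vec (Symbol Γ × Move) tapes

-- A two-way infinite tape. Both lists run away from the head, and all cells
-- beyond their ends are blank.
record Tape (Γ : Set) : Set where
  constructor tape
  field
    before : List (Symbol Γ)
    here   : Symbol Γ
    after  : List (Symbol Γ)

module _ {Γ : Set} where

  fromList : List (Symbol Γ) → Tape Γ
  fromList []       = tape [] blank []
  fromList (x ∷ xs) = tape [] x xs

  move : Move → Tape Γ → Tape Γ
  move left  (tape []       x rs)       = tape [] blank (x ∷ rs)
  move left  (tape (l ∷ ls) x rs)       = tape ls l (x ∷ rs)
  move stay  t                          = t
  move right (tape ls       x [])       = tape (x ∷ ls) blank []
  move right (tape ls       x (r ∷ rs)) = tape (x ∷ ls) r rs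

  act : Symbol Γ × Move → Tape Γ → Tape Γ
  act (s , m) t = move m (record t { here = s })

module Run (M : TuringMachine) where
  open TuringMachine M

  record Configuration : Set where
    constructor config
    field
      control  : Control Q
      contents : Vec (Tape Γ) tapes

  initial : List Bool → Configuration
  initial w = config (run start)
    (fromList (map bit w) Vec.∷ Vec.replicate extra (fromList []))

  step : Configuration → Configuration
  step c@(config (halt _) _) = c
  step (config (run q) ts)   = config (proj₁ r) (Vec.zipWith act (proj₂ r) ts)
    where r = δ q (Vec.map Tape.here ts)

  HaltsIn : ℕ → List Bool → Bool → Set
  HaltsIn t w b = Configuration.control (iterate step (initial w) t) ≡ halt b

Language : Set₁
Language = List Bool → Set

DecidesInTime : TuringMachine → (ℕ → ℕ) → Language → Set
DecidesInTime M time L = ∀ w →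
  ∃[ b ] ∃[ t ] (t ≤ time (length w) × Run.HaltsIn M t w b × Reflects (L w) b)

-- The outer summand c is needed only for inputs of length 0, where n ^ k may
-- vanish.
InP : Language → Set₁
InP L = Σ[ M ∈ TuringMachine ] ∃[ c ] ∃[ k ]
  DecidesInTime M (λ n → c * n ^ k + c) L

-- The number of vertices in unary, a separator, and the adjacency matrix
-- row by row.
encode : DAG → List Bool
encode D = replicate order true ++ false ∷
           map (uncurry arc) (cartesianProduct (allFin order) (allFin order))
  where open DAG D

languageOf : (DAG → Set) → Language
languageOf P w = ∃[ D ] (w ≡ encode D × P D)

-- The conditions on f are strict homogeneous inequalities a · x > 0 with entries
-- of a in {-1, 0, 1}; they force acyclicity, so only their feasibility over ℤ has
-- to be decided. This is done by a perceptron algorithm with rescaling. Some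
-- violated row r is added to z, and x = G z is tried next, where the matrix G
-- describes an ellipsoid that contains every suitably scaled solution x. Then
-- q(z) = zᵀ G z grows at most linearly, so that a row r which has been added often
-- satisfies 2 (r · x) ≤ H on that solution; the row is doubled, and G is shrunk in
-- its direction by a rank one update, rounded in such a way that the ellipsoid can
-- only grow. By the pigeonhole principle (Siegel's lemma), applied to the tight
-- constraints at a vertex, a feasible system has a solution with
-- 1 ≤ a · x ≤ H = 2 ^ ℓ where ℓ is polynomial, and then no row can be doubled more
-- than ℓ times. Hence a polynomial number of steps without success proves
-- infeasibility.
--
-- Functions between encoded types are polynomial-time computable by programs on
-- four stacks, with values stored as trees in prefix order. These functions are
-- closed under composition, pairing, case distinction and folds whose
-- intermediate values stay polynomially small, and a stack program becomes a
-- Turing machine with one tape per stack.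

module Submission where

open import Data.Bool using (Bool; T; _xor_; _∧_; _∨_; false; if_then_else_; not; true)
open import Data.Empty using (⊥; ⊥-elim)
open import Data.List as List using (List; []; _++_; _∷_; allFin; applyUpTo; cartesianProduct;
  concat; downFrom; filterᵇ; foldl; foldr; length; map; replicate; reverse; tabulate; upTo)
open import Data.List.Properties using (++-assoc; ++-identityʳ; foldl-++; length-++; length-map;
  length-replicate; length-reverse; length-tabulate; length-upTo; map-++; map-upTo; map-∘;
  reverse-downFrom; reverse-foldr; reverse-involutive; unfold-reverse; upTo-∷ʳ)
open import Data.Nat.GeneralisedArithmetic using (fold; iterate)
open import Data.Product using (_,_; _×_; proj₁; proj₂; uncurry; Σ-syntax; ∃-syntax)
open import Data.Sum using (_⊎_; inj₁; inj₂)
open import Function.Base using (_∘_; id)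
open import Relation.Binary.PropositionalEquality using (_≡_; _≢_; cong; cong₂; module ≡-Reasoning;
  refl; subst; subst₂; sym; trans)
open import Relation.Nullary using (Reflects; no; ofʸ; ofⁿ; yes)

-- Soundness is cheap, since the last candidate is checked against the original rows. The analysis
-- serves completeness and is carried out relative to one hypothetical small solution. The running
-- time, however, must be polynomial on infeasible systems too, where no invariant holds: hence
-- entries of the matrix are clipped by force and sizes are bounded separately. Arithmetic is
-- integral. Quotients are compared after cross-multiplication, and an inequality is derived by
-- writing a positive multiple of its gap as a combination of nonnegative terms, which leaves a ring
-- identity. Rounding errors of at most 1 per entry are paid for by adding n times the identity, and
-- the scale P is so large that the drift over all doublings stays below a quarter of P. Through the
-- pairs of equal vertices, a loopless graph contributes a unit row for every coordinate. These rows
-- make the polyhedron of solutions pointed, so that it has a vertex; they put the entries of the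
-- small solution between 0 and H; and they bound the diagonal of the matrix, so that clipping
-- changes nothing on a feasible system.

-- Structured programs on four stacks and their compilation to Turing machines

module StackMachine where

  open import Defs
  open import Data.Fin using (Fin; zero; suc)
  open import Data.Fin.Patterns using (0F; 1F; 2F; 3F)
  open import Data.Fin.Properties using (_≟_; +↔⊎; 1↔⊤; *↔×; 0↔⊥; 2↔Bool)
  open import Data.Maybe using (Maybe; just; nothing)
  open import Data.Nat using (ℕ; zero; suc; _+_; _≤_; z≤n; s≤s)
  open import Data.Nat.Properties using (+-comm; +-suc; ≤-refl; ≤-trans; ≤-reflexive; +-mono-≤; +-monoˡ-≤; m≤n⇒m≤1+n)
  open import Data.Product.Function.NonDependent.Propositional using (_×-↔_)
  open import Data.Sum.Function.Propositional using (_⊎-↔_)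
  open import Data.Unit using (⊤; tt)
  open import Data.Vec as Vec using (Vec; []; _∷_; lookup; _[_]≔_)
  open import Data.Vec.Properties using (lookup-zipWith; lookup-map; lookup∘update; lookup∘update′)
  open import Function.Construct.Composition using (_↔-∘_)
  open import Function.Construct.Symmetry using (↔-sym)
  open import Function.Construct.Identity using (↔-id)

  Stacks : Set
  Stacks = Vec (List Bool) 4

  data Cmd : Set where
    skip  : Cmd
    push  : Fin 4 → Bool → Cmd
    _▸_   : Cmd → Cmd → Cmd
    -- Pops a stack and branches on empty, false or true.
    match : Fin 4 → Cmd → Cmd → Cmd → Cmd
    -- Runs the body, pops stack 3 and repeats as long as the popped bit is true.
    loop  : Cmd → Cmd

  infixr 5 _▸_

  select : {A : Set} → List Bool → A → A → A → A
  select []          a b c = a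
  select (false ∷ _) a b c = b
  select (true  ∷ _) a b c = c

  popped : Fin 4 → Stacks → Stacks
  popped i s = s [ i ]≔ List.drop 1 (lookup s i)

  pushed : Fin 4 → Bool → Stacks → Stacks
  pushed i b s = s [ i ]≔ (b ∷ lookup s i)

  infix 3 _⊢_⇓[_]_

  -- Only terminating runs have a derivation, so a step count includes termination. `skip` and `▸`
  -- cost nothing because compilation leaves no instruction for them.
  data _⊢_⇓[_]_ : Cmd → Stacks → ℕ → Stacks → Set where
    ⇓skip  : ∀ {s} → skip ⊢ s ⇓[ 0 ] s
    ⇓push  : ∀ {i b s} → push i b ⊢ s ⇓[ 1 ] pushed i b s
    ⇓▸     : ∀ {c d s s′ s″ t u} → c ⊢ s ⇓[ t ] s′ → d ⊢ s′ ⇓[ u ] s″ → c ▸ d ⊢ s ⇓[ t + u ] s″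
    ⇓match : ∀ {i a b c s s′ t} → select (lookup s i) a b c ⊢ popped i s ⇓[ t ] s′ →
             match i a b c ⊢ s ⇓[ suc t ] s′
    ⇓stop  : ∀ {c s s′ t} → c ⊢ s ⇓[ t ] s′ → select (lookup s′ 3F) true true false ≡ true →
             loop c ⊢ s ⇓[ t + 1 ] popped 3F s′
    ⇓again : ∀ {c s s′ s″ t u} → c ⊢ s ⇓[ t ] s′ → select (lookup s′ 3F) true true false ≡ false →
             loop c ⊢ popped 3F s′ ⇓[ u ] s″ → loop c ⊢ s ⇓[ t + suc u ] s″

  data Instr (X : Set) : Set where
    push : Fin 4 → Bool → X → Instr X
    pop  : Fin 4 → X → X → X → Instr X

  -- Addresses of the instructions of a command. Being nested sums, they give finiteness of the
  -- state set by recursion. The extra `⊤` is the pop of a `match` and the test behind the body of a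
  -- `loop`.
  Pos : Cmd → Set
  Pos skip            = ⊥
  Pos (push _ _)      = ⊤
  Pos (c ▸ d)         = Pos c ⊎ Pos d
  Pos (match _ a b c) = ⊤ ⊎ (Pos a ⊎ (Pos b ⊎ Pos c))
  Pos (loop c)        = ⊤ ⊎ Pos c

  -- Continuation style: `f` embeds the addresses of `c` into those of the whole program, and `k` is
  -- the address reached afterwards. A command without instructions is entered at `k` itself.
  entry : ∀ c {X : Set} → (Pos c → X) → X → X
  entry skip            f k = k
  entry (push _ _)      f k = f tt
  entry (c ▸ d)         f k = entry c (f ∘ inj₁) (entry d (f ∘ inj₂) k)
  entry (match _ _ _ _) f k = f (inj₁ tt)
  entry (loop c)        f k = entry c (f ∘ inj₂) (f (inj₁ tt))

  code : ∀ c {X : Set} → (Pos c → X) → X → Pos c → Instr X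
  code (push i b)      f k tt = push i b k
  code (c ▸ d)         f k (inj₁ p) = code c (f ∘ inj₁) (entry d (f ∘ inj₂) k) p
  code (c ▸ d)         f k (inj₂ p) = code d (f ∘ inj₂) k p
  code (match i a b c) f k (inj₁ tt) =
    pop i (entry a (f ∘ inj₂ ∘ inj₁) k) (entry b (f ∘ inj₂ ∘ inj₂ ∘ inj₁) k) (entry c (f ∘ inj₂ ∘ inj₂ ∘ inj₂) k)
  code (match i a b c) f k (inj₂ (inj₁ p))        = code a (f ∘ inj₂ ∘ inj₁) k p
  code (match i a b c) f k (inj₂ (inj₂ (inj₁ p))) = code b (f ∘ inj₂ ∘ inj₂ ∘ inj₁) k p
  code (match i a b c) f k (inj₂ (inj₂ (inj₂ p))) = code c (f ∘ inj₂ ∘ inj₂ ∘ inj₂) k p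
  code (loop c)        f k (inj₁ tt) = pop 3F k k (entry (loop c) f k)
  code (loop c)        f k (inj₂ p)  = code c (f ∘ inj₂) (f (inj₁ tt)) p

  data Steps {X : Set} (prog : X → Maybe (Instr X)) : X → Stacks → ℕ → X → Stacks → Set where
    done  : ∀ {x s} → Steps prog x s 0 x s
    spush : ∀ {x i b y s t z s′} → prog x ≡ just (push i b y) →
            Steps prog y (pushed i b s) t z s′ → Steps prog x s (suc t) z s′
    spop  : ∀ {x i y₀ y₁ y₂ s t z s′} → prog x ≡ just (pop i y₀ y₁ y₂) →
            Steps prog (select (lookup s i) y₀ y₁ y₂) (popped i s) t z s′ → Steps prog x s (suc t) z s′

  module _ {X : Set} {prog : X → Maybe (Instr X)} where

    _⊕_ : ∀ {x s t y s′ u z s″} → Steps prog x s t y s′ → Steps prog y s′ u z s″ → Steps prog x s (t + u) z s″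
    done      ⊕ r = r
    spush e p ⊕ r = spush e (p ⊕ r)
    spop e p  ⊕ r = spop e (p ⊕ r)

    -- The hypothesis on `prog` restricts to subcommands along `f`, so one induction treats code
    -- placed anywhere. In the case `⇓again` only the derivation gets smaller: the loop reenters its
    -- own code.
    simulate : ∀ c (f : Pos c → X) k → (∀ p → prog (f p) ≡ just (code c f k p)) →
               ∀ {s t s′} → c ⊢ s ⇓[ t ] s′ → Steps prog (entry c f k) s t k s′
    simulate skip f k h ⇓skip = done
    simulate (push i b) f k h ⇓push = spush (h tt) done
    simulate (c ▸ d) f k h (⇓▸ p q) =
      simulate c _ _ (h ∘ inj₁) p ⊕ simulate d _ _ (h ∘ inj₂) q
    simulate (match i a b c) f k h {s} (⇓match p) = spop (h (inj₁ tt)) (branch (lookup s i) p)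
      where
      branch : ∀ l {s t s′} → select l a b c ⊢ s ⇓[ t ] s′ → Steps prog (select l _ _ _) s t k s′
      branch []          = simulate a _ _ (h ∘ inj₂ ∘ inj₁)
      branch (false ∷ _) = simulate b _ _ (h ∘ inj₂ ∘ inj₂ ∘ inj₁)
      branch (true ∷ _)  = simulate c _ _ (h ∘ inj₂ ∘ inj₂ ∘ inj₂)
    simulate (loop c) f k h (⇓stop {s′ = s′} p e) =
      simulate c _ _ (h ∘ inj₂) p ⊕ spop (h (inj₁ tt)) (stop (lookup s′ 3F) e)
      where
      stop : ∀ l {s} → select l true true false ≡ true → Steps prog (select l k k (entry (loop c) f k)) s 0 k s
      stop []          e = done
      stop (false ∷ _) e = done
    simulate (loop c) f k h (⇓again {s′ = s′} p e r) =
      simulate c _ _ (h ∘ inj₂) p ⊕ spop (h (inj₁ tt)) (again (lookup s′ 3F) e (simulate (loop c) f k h r))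
      where
      again : ∀ l {s u s″} → select l true true false ≡ false → Steps prog (entry (loop c) f k) s u k s″ →
              Steps prog (select l k k (entry (loop c) f k)) s u k s″
      again (true ∷ _) e r = r

  finitePos : ∀ c → IsFinite (Pos c)
  finitePos skip       = 0 , ↔-sym 0↔⊥
  finitePos (push _ _) = 1 , ↔-sym 1↔⊤
  finitePos (c ▸ d)    = _ , ↔-sym +↔⊎ ↔-∘ (proj₂ (finitePos c) ⊎-↔ proj₂ (finitePos d))
  finitePos (match _ a b c) =
    _ , ↔-sym +↔⊎ ↔-∘ (↔-sym 1↔⊤ ⊎-↔ (↔-sym +↔⊎ ↔-∘ (proj₂ (finitePos a) ⊎-↔ (↔-sym +↔⊎ ↔-∘ (proj₂ (finitePos b) ⊎-↔ proj₂ (finitePos c))))))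
  finitePos (loop c)   = _ , ↔-sym +↔⊎ ↔-∘ (↔-sym 1↔⊤ ⊎-↔ proj₂ (finitePos c))

  -- The whole program followed by a state that reads the answer off stack 0. A
  -- push takes the machine two steps, hence the second component of the state.
  module Machine (c : Cmd) where

    X : Set
    X = Pos c ⊎ ⊤

    prog : X → Maybe (Instr X)
    prog (inj₁ p) = just (code c inj₁ (inj₂ tt) p)
    prog (inj₂ _) = nothing

    Action : Set
    Action = Symbol (Fin 0) × Move

    bitOf : Symbol (Fin 0) → Bool
    bitOf (bit b) = b
    bitOf blank   = false

    at : Fin 4 → Action → Vec (Symbol (Fin 0)) 4 → Vec Action 4
    at i a r = Vec.map (_, stay) r [ i ]≔ a

    choose : {A : Set} → Symbol (Fin 0) → A → A → A → A
    choose blank       a b c = a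
    choose (bit false) a b c = b
    choose (bit true)  a b c = c

    δ : X × Bool → Vec (Symbol (Fin 0)) 4 → Control (X × Bool) × Vec Action 4
    δ (x , phase) r with prog x
    ... | nothing             = halt (bitOf (lookup r 0F)) , Vec.map (_, stay) r
    ... | just (pop i a b c)  = run (choose (lookup r i) a b c , false) ,
            at i (choose (lookup r i) (blank , stay) (blank , right) (blank , right)) r
    ... | just (push i b y) with phase
    ...   | false = run (x , true) , at i (lookup r i , left) r
    ...   | true  = run (y , false) , at i (bit b , stay) r

    machine : TuringMachine
    machine = record
      { Q = X × Bool
      ; Q-finite = _ , ↔-sym *↔× ↔-∘ ((↔-sym +↔⊎ ↔-∘ (proj₂ (finitePos c) ⊎-↔ ↔-sym 1↔⊤)) ×-↔ ↔-sym 2↔Bool)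
      ; Γ = Fin 0
      ; Γ-finite = 0 , ↔-id _
      ; extra = 3
      ; start = entry c inj₁ (inj₂ tt) , false
      ; δ = δ
      }

    open Run machine

    Cells : List Bool → List (Symbol (Fin 0)) → Set
    Cells []      []       = ⊤
    Cells []      (x ∷ xs) = x ≡ blank × Cells [] xs
    Cells (b ∷ s) []       = ⊥
    Cells (b ∷ s) (x ∷ xs) = x ≡ bit b × Cells s xs

    -- The top of the stack lies under the head and the rest to its right, followed by blanks only.
    -- The cells to the left are arbitrary, since a push moves there and overwrites.
    Holds : List Bool → Tape (Fin 0) → Set
    Holds s t = Cells s (Tape.here t ∷ Tape.after t)

    Represents : Stacks → Vec (Tape (Fin 0)) 4 → Set
    Represents s ts = ∀ i → Holds (lookup s i) (lookup ts i)

    enact : Fin 4 → Action → Vec (Tape (Fin 0)) 4 → Vec (Tape (Fin 0)) 4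
    enact i a ts = Vec.zipWith act (at i a (Vec.map Tape.here ts)) ts

    enact-here : ∀ i a ts → lookup (enact i a ts) i ≡ act a (lookup ts i)
    enact-here i a ts = trans (lookup-zipWith act i (at i a (Vec.map Tape.here ts)) ts)
      (cong (λ z → act z (lookup ts i)) (lookup∘update i (Vec.map (_, stay) (Vec.map Tape.here ts)) a))

    enact-there : ∀ {i j} a ts → j ≢ i → lookup (enact i a ts) j ≡ lookup ts j
    enact-there {i} {j} a ts j≢i = trans (lookup-zipWith act j (at i a (Vec.map Tape.here ts)) ts)
      (cong (λ z → act z (lookup ts j)) {y = Tape.here (lookup ts j) , stay}
        (trans (lookup∘update′ j≢i (Vec.map (_, stay) (Vec.map Tape.here ts)) a)
          (trans (lookup-map j (_, stay) (Vec.map Tape.here ts)) (cong (_, stay) (lookup-map j Tape.here ts)))))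

    represents-update : ∀ s ts i v a → Represents s ts → Holds v (act a (lookup ts i)) →
                        Represents (s [ i ]≔ v) (enact i a ts)
    represents-update s ts i v a r h j with j ≟ i
    ... | yes refl rewrite lookup∘update i s v | enact-here i a ts = h
    ... | no j≢i   rewrite lookup∘update′ j≢i s v | enact-there a ts j≢i = r j

    holds-push : ∀ b s t → Holds s t → Holds (b ∷ s) (act (bit b , stay) (act (Tape.here t , left) t))
    holds-push b s (tape [] x rs)      h = refl , h
    holds-push b s (tape (_ ∷ _) x rs) h = refl , h

    holds-drop : ∀ b s t → Holds (b ∷ s) t → Holds s (act (blank , right) t)
    holds-drop b []      (tape _ _ [])      (_ , h) = refl , tt
    holds-drop b (_ ∷ _) (tape _ _ [])      (_ , ())
    holds-drop b s       (tape _ _ (_ ∷ _)) (_ , h) = h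

    δ-pop : ∀ {x i a b c} φ r → prog x ≡ just (pop i a b c) →
            δ (x , φ) r ≡ (run (choose (lookup r i) a b c , false) ,
              at i (choose (lookup r i) (blank , stay) (blank , right) (blank , right)) r)
    δ-pop {x} φ r e with prog x | e
    ... | just (pop i a b c) | refl = refl

    δ-push₁ : ∀ {x i b y} r → prog x ≡ just (push i b y) →
              δ (x , false) r ≡ (run (x , true) , at i (lookup r i , left) r)
    δ-push₁ {x} r e with prog x | e
    ... | just (push i b y) | refl = refl

    δ-push₂ : ∀ {x i b y} r → prog x ≡ just (push i b y) →
              δ (x , true) r ≡ (run (y , false) , at i (bit b , stay) r)
    δ-push₂ {x} r e with prog x | e
    ... | just (push i b y) | refl = refl

    step-≡ : ∀ q {q′ i a} ts → δ q (Vec.map Tape.here ts) ≡ (run q′ , at i a (Vec.map Tape.here ts)) →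
             step (config (run q) ts) ≡ config (run q′) (enact i a ts)
    step-≡ q ts e rewrite e = refl

    heads : ∀ i (ts : Vec (Tape (Fin 0)) 4) → lookup (Vec.map Tape.here ts) i ≡ Tape.here (lookup ts i)
    heads i ts = lookup-map i Tape.here ts

    iterate-+ : ∀ {A : Set} (f : A → A) x m n → iterate f x (m + n) ≡ iterate f (iterate f x m) n
    iterate-+ f x zero    n = refl
    iterate-+ f x (suc m) n = iterate-+ f (f x) m n

    popped-represents : ∀ s ts i → Represents s ts →
      let h = Tape.here (lookup ts i) in
      Represents (popped i s) (enact i (choose h (blank , stay) (blank , right) (blank , right)) ts) ×
      (∀ {A : Set} (a b c : A) → choose h a b c ≡ select (lookup s i) a b c)
    popped-represents s ts i r with lookup s i | lookup ts i in e | r i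
    ... | [] | tape ls _ rs | refl , h =
      represents-update s ts i [] (blank , stay) r (subst (λ t → Holds [] (act (blank , stay) t)) (sym e) (refl , h)) , λ _ _ _ → refl
    ... | false ∷ l | t@(tape ls _ rs) | h@(refl , _) =
      represents-update s ts i l (blank , right) r (subst (λ t → Holds l (act (blank , right) t)) (sym e) (holds-drop false l t h)) , λ _ _ _ → refl
    ... | true ∷ l | t@(tape ls _ rs) | h@(refl , _) =
      represents-update s ts i l (blank , right) r (subst (λ t → Holds l (act (blank , right) t)) (sym e) (holds-drop true l t h)) , λ _ _ _ → refl

    realise : ∀ {x s t y s′ ts} → Steps prog x s t y s′ → Represents s ts →
              ∃[ u ] ∃[ ts′ ] (u ≤ t + t × iterate step (config (run (x , false)) ts) u ≡ config (run (y , false)) ts′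
                               × Represents s′ ts′)
    realise done r = 0 , _ , z≤n , refl , r
    realise {s = s} {suc t} {ts = ts} (spush {x = x} {i = i} {b} e p) r =
      let ts₁ = enact i (lookup (Vec.map Tape.here ts) i , left) ts
          ts₂ = enact i (bit b , stay) ts₁
          r₂ : Represents (pushed i b s) ts₂
          r₂ j = rep j
          u , ts′ , u≤ , e′ , r′ = realise p r₂
      in 2 + u , ts′ , ≤-trans (s≤s (s≤s u≤)) (s≤s (≤-reflexive (sym (+-suc t t)))) ,
         trans (cong (λ c → iterate step c (suc u)) (step-≡ (x , false) ts (δ-push₁ {x = x} _ e)))
           (trans (cong (λ c → iterate step c u) (step-≡ (x , true) ts₁ (δ-push₂ {x = x} _ e))) e′) , r′
      where
      ts₁ = enact i (lookup (Vec.map Tape.here ts) i , left) ts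
      rep : Represents (pushed i b s) (enact i (bit b , stay) ts₁)
      rep j with j ≟ i
      ... | yes refl rewrite lookup∘update i s (b ∷ lookup s i) | enact-here i (bit b , stay) ts₁
                           | enact-here i (lookup (Vec.map Tape.here ts) i , left) ts | heads i ts
        = holds-push b (lookup s i) (lookup ts i) (r i)
      ... | no j≢i rewrite lookup∘update′ j≢i s (b ∷ lookup s i) | enact-there (bit b , stay) ts₁ j≢i
                         | enact-there (lookup (Vec.map Tape.here ts) i , left) ts j≢i = r j
    realise {s = s} {suc t} {ts = ts} (spop {x = x} {i = i} {y₀} {y₁} {y₂} e p) r =
      let r₁ , sel = popped-represents s ts i r
          u , ts′ , u≤ , e′ , r′ = realise p r₁
      in suc u , ts′ , s≤s (≤-trans u≤ (≤-trans (m≤n⇒m≤1+n ≤-refl) (≤-reflexive (sym (+-suc t t))))) ,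
         trans (cong (λ c → iterate step c u) (step-≡ (x , false) {i = i} ts (trans (δ-pop {x = x} false _ e)
           (cong (λ h → run (choose h y₀ y₁ y₂ , false) , at i (choose h (blank , stay) (blank , right) (blank , right)) (Vec.map Tape.here ts)) (heads i ts)))))
           (trans (cong (λ y → iterate step (config (run (y , false)) _) u) (sel y₀ y₁ y₂)) e′) , r′

    input : List Bool → Stacks
    input w = w ∷ [] ∷ [] ∷ [] ∷ []

    decides : ∀ {L : Language} {time : ℕ → ℕ} →
      (∀ w → ∃[ b ] ∃[ t ] ∃[ s ] ∃[ l ] (c ⊢ input w ⇓[ t ] s × lookup s 0F ≡ b ∷ l × t ≤ time (length w) × Reflects (L w) b)) →
      DecidesInTime machine (λ n → suc (time n + time n)) L
    decides {time = time} h w with h w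
    ... | b , t , s , l , run-c , top , t≤ , refl-L =
      -- The additional step is the one in which the final state reads the head of tape 0 and halts.
      b , u + 1 , ≤-trans (+-monoˡ-≤ 1 (≤-trans u≤ (+-mono-≤ t≤ t≤))) (≤-reflexive (+-comm _ 1)) , halts , refl-L
      where
      holds-input : ∀ w → Holds w (fromList (List.map bit w))
      holds-input []      = refl , tt
      holds-input (b ∷ w) = refl , cells w
        where
        cells : ∀ w → Cells w (List.map bit w)
        cells []      = tt
        cells (b ∷ w) = refl , cells w
      r₀ : Represents (input w) (Configuration.contents (initial w))
      r₀ 0F = holds-input w
      r₀ 1F = refl , tt
      r₀ 2F = refl , tt
      r₀ 3F = refl , tt
      result = realise (simulate c inj₁ (inj₂ tt) (λ p → refl) run-c) r₀
      u = proj₁ result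
      ts = proj₁ (proj₂ result)
      u≤ = proj₁ (proj₂ (proj₂ result))
      top-cell : ∀ {l} t → Holds (b ∷ l) t → bitOf (Tape.here t) ≡ b
      top-cell t (e , _) = cong bitOf e
      halts : Configuration.control (iterate step (initial w) (u + 1)) ≡ halt b
      halts = trans (cong Configuration.control (iterate-+ step (initial w) u 1))
        (trans (cong (Configuration.control ∘ step) (proj₁ (proj₂ (proj₂ (proj₂ result)))))
          (cong halt (trans (cong bitOf (heads 0F ts)) (top-cell (lookup ts 0F)
            (subst (λ l → Holds l (lookup ts 0F)) top (proj₂ (proj₂ (proj₂ (proj₂ result))) 0F))))))

-- Polynomial bounds and stack programs that move serialised trees

module TreeStack where

  open StackMachine
  open import Data.Fin.Patterns using (0F; 1F; 2F; 3F)
  open import Data.Nat using (ℕ; zero; suc; _+_; _*_; _^_; _≤_; z≤n; s≤s)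
  open import Data.Nat.Properties
  open import Data.Nat.Tactic.RingSolver using (solve-∀)
  open import Data.Vec using ([]; _∷_; lookup)

  data Poly : Set where
    var : Poly
    con : ℕ → Poly
    _⊞_ _⊠_ _⊚_ : Poly → Poly → Poly

  infixl 6 _⊞_
  infixl 7 _⊠_
  infixr 8 _⊚_

  eval : Poly → ℕ → ℕ
  eval var     n = n
  eval (con c) n = c
  eval (p ⊞ q) n = eval p n + eval q n
  eval (p ⊠ q) n = eval p n * eval q n
  eval (p ⊚ q) n = eval p (eval q n)

  eval-mono : ∀ p {m n} → m ≤ n → eval p m ≤ eval p n
  eval-mono var     h = h
  eval-mono (con c) h = ≤-refl
  eval-mono (p ⊞ q) h = +-mono-≤ (eval-mono p h) (eval-mono q h)
  eval-mono (p ⊠ q) h = *-mono-≤ (eval-mono p h) (eval-mono q h)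
  eval-mono (p ⊚ q) h = eval-mono p (eval-mono q h)

  ≤-by : ∀ {m n} k → m + k ≡ n → m ≤ n
  ≤-by {m} k refl = m≤m+n m k

  private
    m≤2^m : ∀ m → suc m ≤ 2 ^ m
    m≤2^m zero    = ≤-refl
    m≤2^m (suc m) = ≤-trans (s≤s (m≤2^m m)) (≤-trans (+-monoˡ-≤ (2 ^ m) (m^n>0 2 m)) (≤-reflexive (cong (2 ^ m +_) (sym (+-identityʳ _)))))

    base-mono : ∀ n {k l} → k ≤ l → (2 + n) ^ k ≤ (2 + n) ^ l
    base-mono n = ^-monoʳ-≤ (2 + n)

    double≤ : ∀ n k → (2 + n) ^ k + (2 + n) ^ k ≤ (2 + n) ^ suc k
    double≤ n k = ≤-trans (≤-reflexive (cong ((2 + n) ^ k +_) (sym (+-identityʳ _)))) (*-monoˡ-≤ ((2 + n) ^ k) (s≤s (s≤s (z≤n {n}))))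

  -- The base `2 + n` is at least 2 even at `n = 0`: a constant `c` is below its `c`-th power, a sum
  -- of two powers costs one more factor, and `2 + eval q n` is again below a power of the base,
  -- which handles composition.
  degree : ∀ p → ∃[ k ] (∀ n → eval p n ≤ (2 + n) ^ k)
  degree var     = 1 , λ n → ≤-by 2 (h n)
    where
    h : ∀ n → n + 2 ≡ (2 + n) * 1
    h = solve-∀
  degree (con c) = c , λ n → ≤-trans (<⇒≤ (m≤2^m c)) (^-monoˡ-≤ c (s≤s (s≤s z≤n)))
  degree (p ⊞ q) with degree p | degree q
  ... | k , hp | l , hq = suc (k + l) , λ n →
    ≤-trans (+-mono-≤ (≤-trans (hp n) (base-mono n (m≤m+n k l))) (≤-trans (hq n) (base-mono n (m≤n+m l k)))) (double≤ n (k + l))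
  degree (p ⊠ q) with degree p | degree q
  ... | k , hp | l , hq = k + l , λ n → ≤-trans (*-mono-≤ (hp n) (hq n)) (≤-reflexive (sym (^-distribˡ-+-* (2 + n) k l)))
  degree (p ⊚ q) with degree p | degree q
  ... | k , hp | l , hq = (2 + l) * k , λ n → ≤-trans (hp (eval q n)) (≤-trans (^-monoˡ-≤ k (step n)) (≤-reflexive (^-*-assoc (2 + n) (2 + l) k)))
    where
    4m≤ : ∀ n m → 4 * m ≤ (2 + n) * ((2 + n) * m)
    4m≤ n m = ≤-by (n * n * m + 4 * (n * m)) (h n m)
      where
      h : ∀ n m → 4 * m + (n * n * m + 4 * (n * m)) ≡ (2 + n) * ((2 + n) * m)
      h = solve-∀
    step : ∀ n → 2 + eval q n ≤ (2 + n) ^ (2 + l)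
    step n with (2 + n) ^ l | hq n | m^n>0 (2 + n) l
    ... | suc m | h | _ = ≤-trans (s≤s (s≤s h)) (≤-trans (≤-by (suc (3 * m)) (g m)) (4m≤ n (suc m)))
      where
      g : ∀ m → 3 + m + suc (3 * m) ≡ 4 * suc m
      g = solve-∀

  record Ex (c : Cmd) (s s′ : Stacks) (n : ℕ) : Set where
    constructor ex
    field
      {time}  : ℕ
      within  : time ≤ n
      derived : c ⊢ s ⇓[ time ] s′

  weaken : ∀ {c s s′ m n} → m ≤ n → Ex c s s′ m → Ex c s s′ n
  weaken h (ex t d) = ex (≤-trans t h) d

  infixr 5 _▷_
  _▷_ : ∀ {c d s s′ s″ m n} → Ex c s s′ m → Ex d s′ s″ n → Ex (c ▸ d) s s″ (m + n)
  ex t p ▷ ex u q = ex (+-mono-≤ t u) (⇓▸ p q)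

  skipped : ∀ {s} → Ex skip s s 0
  skipped = ex ≤-refl ⇓skip

  pushes : ∀ i b {s} → Ex (push i b) s (pushed i b s) 1
  pushes i b = ex ≤-refl ⇓push

  matched : ∀ {i a b c s s′ n} → Ex (select (lookup s i) a b c) (popped i s) s′ n → Ex (match i a b c) s s′ (suc n)
  matched (ex t p) = ex (s≤s t) (⇓match p)

  -- What is left of a loop once its body has run. As the premise of `looped` it lets inductions
  -- over data assemble the derivation from its end.
  Test : Cmd → Stacks → Stacks → ℕ → Set
  Test c s s′ n = (select (lookup s 3F) true true false ≡ true × s′ ≡ popped 3F s)
                ⊎ (select (lookup s 3F) true true false ≡ false × Ex (loop c) (popped 3F s) s′ n)

  looped : ∀ {c s s₁ s′ m n} → Ex c s s₁ m → Test c s₁ s′ n → Ex (loop c) s s′ (m + suc n)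
  looped {m = m} (ex t p) (inj₁ (e , refl)) = ex (+-mono-≤ t (s≤s z≤n)) (⇓stop p e)
  looped (ex t p) (inj₂ (e , ex u q)) = ex (+-mono-≤ t (s≤s u)) (⇓again p e q)

  data Tree : Set where
    leaf : Tree
    node : Tree → Tree → Tree

  size : Tree → ℕ
  size leaf       = 1
  size (node l r) = suc (size l + size r)

  size>0 : ∀ t → 1 ≤ size t
  size>0 leaf       = s≤s z≤n
  size>0 (node _ _) = s≤s z≤n

  ser : Tree → List Bool → List Bool
  ser leaf       a = false ∷ a
  ser (node l r) a = true ∷ ser l (ser r a)

  -- The stack onto which a serialised tree has been moved bit by bit, hence in reverse order.
  rev-ser : Tree → List Bool → List Bool
  rev-ser leaf       a = false ∷ a
  rev-ser (node l r) a = rev-ser r (rev-ser l (true ∷ a))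

  onto : List Bool → List Bool → List Bool
  onto []       a = a
  onto (x ∷ xs) a = onto xs (x ∷ a)

  onto-rev-ser : ∀ t xs a → onto (rev-ser t xs) a ≡ onto xs (ser t a)
  onto-rev-ser leaf       xs a = refl
  onto-rev-ser (node l r) xs a = trans (onto-rev-ser r _ a) (onto-rev-ser l _ _)

  length-ser : ∀ t a → length (ser t a) ≡ size t + length a
  length-ser leaf       a = refl
  length-ser (node l r) a = cong suc (trans (length-ser l _) (trans (cong (size l +_) (length-ser r a)) (sym (+-assoc (size l) _ _))))

  length-rev-ser : ∀ t a → length (rev-ser t a) ≡ size t + length a
  length-rev-ser leaf       a = refl
  length-rev-ser (node l r) a = trans (length-rev-ser r _) (trans (cong (size r +_) (length-rev-ser l _)) (lemma (size l) (size r) (length a)))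
    where
    lemma : ∀ l r a → r + (l + suc a) ≡ suc (l + r + a)
    lemma = solve-∀

  ⟨_,_,_,_⟩ : List Bool → List Bool → List Bool → List Bool → Stacks
  ⟨ a , b , c , d ⟩ = a ∷ b ∷ c ∷ d ∷ []

  data Target : Set where
    to₁ to₂ both : Target

  on₁ on₂ : Target → (List Bool → List Bool) → List Bool → List Bool
  on₁ to₁  f = f
  on₁ to₂  f = λ x → x
  on₁ both f = f
  on₂ to₁  f = λ x → x
  on₂ to₂  f = f
  on₂ both f = f

  emit : Target → Bool → Cmd
  emit to₁  x = push 1F x
  emit to₂  x = push 2F x
  emit both x = push 1F x ▸ push 2F x

  emits : ∀ T x {a b c d} → Ex (emit T x) ⟨ a , b , c , d ⟩ ⟨ a , on₁ T (x ∷_) b , on₂ T (x ∷_) c , d ⟩ 2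
  emits to₁  x = weaken (s≤s z≤n) (pushes 1F x)
  emits to₂  x = weaken (s≤s z≤n) (pushes 2F x)
  emits both x = pushes 1F x ▷ pushes 2F x

  -- Below its end marker, stack 3 holds one true for every subtree still to be
  -- moved, so that these bits double as the flags of the loop.
  mv-body : Target → Cmd
  mv-body T = match 0F skip (emit T false) (emit T true ▸ push 3F true ▸ push 3F true)

  mv : Target → Cmd
  mv T = push 3F false ▸ loop (mv-body T)

  private
    on₁-node : ∀ T l r b → on₁ T (rev-ser (node l r)) b ≡ on₁ T (rev-ser r) (on₁ T (rev-ser l) (on₁ T (true ∷_) b))
    on₁-node to₁  l r b = refl
    on₁-node to₂  l r b = refl
    on₁-node both l r b = refl

    on₂-node : ∀ T l r b → on₂ T (rev-ser (node l r)) b ≡ on₂ T (rev-ser r) (on₂ T (rev-ser l) (on₂ T (true ∷_) b))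
    on₂-node to₁  l r b = refl
    on₂-node to₂  l r b = refl
    on₂-node both l r b = refl

    on₁-leaf : ∀ T b → on₁ T (rev-ser leaf) b ≡ on₁ T (false ∷_) b
    on₁-leaf to₁  b = refl
    on₁-leaf to₂  b = refl
    on₁-leaf both b = refl

    on₂-leaf : ∀ T b → on₂ T (rev-ser leaf) b ≡ on₂ T (false ∷_) b
    on₂-leaf to₁  b = refl
    on₂-leaf to₂  b = refl
    on₂-leaf both b = refl

    -- The premise is the rest of the run after this subtree. At a node two flags are pushed: the
    -- test consumes one to start on the left subtree, and after it the other to start on the right
    -- one, so the two induction hypotheses are chained through their premises. The price per tree
    -- node is 8.
    mv-tree : ∀ T t {a b c d s n} →
              Test (mv-body T) ⟨ a , on₁ T (rev-ser t) b , on₂ T (rev-ser t) c , d ⟩ s n →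
              Ex (loop (mv-body T)) ⟨ ser t a , b , c , d ⟩ s (n + 8 * size t)
    mv-tree T leaf {b = b} {c} {n = n} h rewrite on₁-leaf T b | on₂-leaf T c =
      weaken (≤-by 4 (e n)) (looped (matched (emits T false)) h)
      where
      e : ∀ n → 3 + suc n + 4 ≡ n + 8
      e = solve-∀
    mv-tree T (node l r) {b = b} {c} {n = n} h rewrite on₁-node T l r b | on₂-node T l r c =
      weaken (≤-by 2 (e n (size l) (size r)))
        (looped (matched (emits T true ▷ pushes 3F true ▷ pushes 3F true))
          (inj₂ (refl , mv-tree T l (inj₂ (refl , mv-tree T r h)))))
      where
      e : ∀ n l r → 5 + suc (n + 8 * r + 8 * l) + 2 ≡ n + 8 * suc (l + r)
      e = solve-∀

  mv-ok : ∀ T t {a b c d} →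
    Ex (mv T) ⟨ ser t a , b , c , d ⟩ ⟨ a , on₁ T (rev-ser t) b , on₂ T (rev-ser t) c , d ⟩ (1 + 8 * size t)
  mv-ok T t = pushes 3F false ▷ mv-tree T t {n = 0} (inj₁ (refl , refl))

  pour₁ pour₂ : (Bool → Cmd) → Cmd
  pour₁ c = loop (match 1F (push 3F false) (c false ▸ push 3F true) (c true ▸ push 3F true))
  pour₂ c = loop (match 2F (push 3F false) (c false ▸ push 3F true) (c true ▸ push 3F true))

  private
    pour-time : ∀ n → 3 + suc (4 + 6 * n) ≤ 4 + 6 * suc n
    pour-time n = ≤-by 2 (e n)
      where
      e : ∀ n → 3 + suc (4 + 6 * n) + 2 ≡ 4 + 6 * suc n
      e = solve-∀

  pour₁-ok : ∀ b {a c d} → Ex (pour₁ (push 0F)) ⟨ a , b , c , d ⟩ ⟨ onto b a , [] , c , d ⟩ (4 + 6 * length b)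
  pour₁-ok []          = weaken (n≤1+n 3) (looped {n = 0} (matched (pushes 3F false)) (inj₁ (refl , refl)))
  pour₁-ok (false ∷ b) = weaken (pour-time (length b)) (looped (matched (pushes 0F false ▷ pushes 3F true)) (inj₂ (refl , pour₁-ok b)))
  pour₁-ok (true ∷ b)  = weaken (pour-time (length b)) (looped (matched (pushes 0F true ▷ pushes 3F true)) (inj₂ (refl , pour₁-ok b)))

  pour₂-ok : ∀ c {a b d} → Ex (pour₂ (push 0F)) ⟨ a , b , c , d ⟩ ⟨ onto c a , b , [] , d ⟩ (4 + 6 * length c)
  pour₂-ok []          = weaken (n≤1+n 3) (looped {n = 0} (matched (pushes 3F false)) (inj₁ (refl , refl)))
  pour₂-ok (false ∷ c) = weaken (pour-time (length c)) (looped (matched (pushes 0F false ▷ pushes 3F true)) (inj₂ (refl , pour₂-ok c)))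
  pour₂-ok (true ∷ c)  = weaken (pour-time (length c)) (looped (matched (pushes 0F true ▷ pushes 3F true)) (inj₂ (refl , pour₂-ok c)))

  clear₁-ok : ∀ b {a c d} → Ex (pour₁ (λ _ → skip)) ⟨ a , b , c , d ⟩ ⟨ a , [] , c , d ⟩ (4 + 6 * length b)
  clear₁-ok []          = weaken (n≤1+n 3) (looped {n = 0} (matched (pushes 3F false)) (inj₁ (refl , refl)))
  clear₁-ok (false ∷ b) = weaken (≤-trans (n≤1+n _) (pour-time (length b))) (looped (matched (skipped ▷ pushes 3F true)) (inj₂ (refl , clear₁-ok b)))
  clear₁-ok (true ∷ b)  = weaken (≤-trans (n≤1+n _) (pour-time (length b))) (looped (matched (skipped ▷ pushes 3F true)) (inj₂ (refl , clear₁-ok b)))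

  -- Between commands all data is on stack 0.
  main : List Bool → Stacks
  main a = ⟨ a , [] , [] , [] ⟩

  drop dup swap : Cmd
  drop = mv to₁ ▸ pour₁ (λ _ → skip)
  dup  = mv both ▸ pour₁ (push 0F) ▸ pour₂ (push 0F)
  swap = mv to₁ ▸ mv to₂ ▸ pour₁ (push 0F) ▸ pour₂ (push 0F)

  private
    length-rev-ser₀ : ∀ t → length (rev-ser t []) ≡ size t
    length-rev-ser₀ t = trans (length-rev-ser t []) (+-identityʳ _)

    pour₁-tree : ∀ t {a c} → Ex (pour₁ (push 0F)) ⟨ a , rev-ser t [] , c , [] ⟩ ⟨ ser t a , [] , c , [] ⟩ (4 + 6 * size t)
    pour₁-tree t {a} {c} with h ← pour₁-ok (rev-ser t []) {a} {c} {[]}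
      rewrite onto-rev-ser t [] a | length-rev-ser₀ t = h

    pour₂-tree : ∀ t {a b} → Ex (pour₂ (push 0F)) ⟨ a , b , rev-ser t [] , [] ⟩ ⟨ ser t a , b , [] , [] ⟩ (4 + 6 * size t)
    pour₂-tree t {a} {b} with h ← pour₂-ok (rev-ser t []) {a} {b} {[]}
      rewrite onto-rev-ser t [] a | length-rev-ser₀ t = h

  drop-ok : ∀ t {a} → Ex drop (main (ser t a)) (main a) (10 + 20 * size t)
  drop-ok t {a} with h ← clear₁-ok (rev-ser t []) {a} {[]} {[]} rewrite length-rev-ser₀ t =
    weaken (bound (size t)) (mv-ok to₁ t ▷ h)
    where
    bound : ∀ n → 1 + 8 * n + (4 + 6 * n) ≤ 10 + 20 * n
    bound n = ≤-by (5 + 6 * n) (e n)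
      where
      e : ∀ n → 1 + 8 * n + (4 + 6 * n) + (5 + 6 * n) ≡ 10 + 20 * n
      e = solve-∀

  dup-ok : ∀ t {a} → Ex dup (main (ser t a)) (main (ser t (ser t a))) (10 + 20 * size t)
  dup-ok t {a} = weaken (bound (size t)) (mv-ok both t ▷ pour₁-tree t ▷ pour₂-tree t)
    where
    bound : ∀ n → 1 + 8 * n + (4 + 6 * n + (4 + 6 * n)) ≤ 10 + 20 * n
    bound n = ≤-by 1 (e n)
      where
      e : ∀ n → 1 + 8 * n + (4 + 6 * n + (4 + 6 * n)) + 1 ≡ 10 + 20 * n
      e = solve-∀

  swap-ok : ∀ t u {a} → Ex swap (main (ser t (ser u a))) (main (ser u (ser t a))) (10 + 20 * (size t + size u))
  swap-ok t u = weaken (bound (size t) (size u)) (mv-ok to₁ t ▷ mv-ok to₂ u ▷ pour₁-tree t ▷ pour₂-tree u)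
    where
    bound : ∀ m n → 1 + 8 * m + (1 + 8 * n + (4 + 6 * m + (4 + 6 * n))) ≤ 10 + 20 * (m + n)
    bound m n = ≤-by (6 * m + 6 * n) (e m n)
      where
      e : ∀ m n → 1 + 8 * m + (1 + 8 * n + (4 + 6 * m + (4 + 6 * n))) + (6 * m + 6 * n) ≡ 10 + 20 * (m + n)
      e = solve-∀

-- Polynomial-time functions between encoded types

module PolyTime where

  open StackMachine
  open TreeStack
  open import Data.Fin.Patterns using (0F; 1F; 2F; 3F)
  open import Data.Integer as ℤ using (ℤ; -[1+_]) renaming (+_ to pos)
  open import Data.Nat using (ℕ; zero; suc; _+_; _≤_; z≤n; s≤s)
  open import Data.Nat.Properties
  open import Data.Nat.Tactic.RingSolver using (solve-∀)
  open import Data.Vec using ([]; _∷_)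
  open import Data.Fin using (Fin; zero; suc)

  increment : List Bool → List Bool
  increment []           = true ∷ []
  increment (false ∷ bs) = true ∷ bs
  increment (true ∷ bs)  = false ∷ increment bs

  -- Least significant bit first, without a leading zero.
  toBits : ℕ → List Bool
  toBits zero    = []
  toBits (suc n) = increment (toBits n)

  infixr 4 _⊗_

  data Ty : Set where
    bool un bn int : Ty
    _⊗_  : Ty → Ty → Ty
    list : Ty → Ty

  ⟦_⟧ : Ty → Set
  ⟦ bool ⟧   = Bool
  ⟦ un ⟧     = ℕ
  ⟦ bn ⟧     = ℕ
  ⟦ int ⟧    = ℤ
  ⟦ σ ⊗ τ ⟧  = ⟦ σ ⟧ × ⟦ τ ⟧
  ⟦ list σ ⟧ = List ⟦ σ ⟧

  _⁺ _⁻ : ℤ → ℕ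
  pos n    ⁺ = n
  -[1+ n ] ⁺ = 0
  pos n    ⁻ = 0
  -[1+ n ] ⁻ = suc n

  encBool : Bool → Tree
  encBool false = leaf
  encBool true  = node leaf leaf

  encBits : List Bool → Tree
  encBits []       = leaf
  encBits (b ∷ bs) = node (encBool b) (encBits bs)

  -- Type un holds numbers in unary, type bn in binary.
  enc : ∀ σ → ⟦ σ ⟧ → Tree
  enc bool     b        = encBool b
  enc un       zero     = leaf
  enc un       (suc n)  = node leaf (enc un n)
  enc bn       n        = encBits (toBits n)
  enc int      z        = node (encBits (toBits (z ⁺))) (encBits (toBits (z ⁻)))
  enc (σ ⊗ τ)  (x , y)  = node (enc σ x) (enc τ y)
  enc (list σ) []       = leaf
  enc (list σ) (x ∷ xs) = node (enc σ x) (enc (list σ) xs)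

  sz : ∀ σ → ⟦ σ ⟧ → ℕ
  sz σ x = size (enc σ x)

  -- The command finds the argument on top of stack 0 and must leave the part `a` below it intact.
  -- This frame is what allows intermediate results to be parked on the same stack.
  record PT {σ τ : Ty} (f : ⟦ σ ⟧ → ⟦ τ ⟧) : Set where
    constructor pt
    field
      cmd   : Cmd
      bound : Poly
      run   : ∀ x a → Ex cmd (main (ser (enc σ x) a)) (main (ser (enc τ (f x)) a)) (eval bound (sz σ x))

  weight : Stacks → ℕ
  weight (a ∷ b ∷ c ∷ d ∷ []) = length a + (length b + (length c + length d))

  private
    drop≤ : ∀ (a : List Bool) → length (List.drop 1 a) ≤ length a
    drop≤ []      = z≤n
    drop≤ (_ ∷ a) = n≤1+n _

    weight-popped : ∀ i s → weight (popped i s) ≤ weight s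
    weight-popped 0F (a ∷ b ∷ c ∷ d ∷ []) = +-monoˡ-≤ _ (drop≤ a)
    weight-popped 1F (a ∷ b ∷ c ∷ d ∷ []) = +-monoʳ-≤ (length a) (+-monoˡ-≤ _ (drop≤ b))
    weight-popped 2F (a ∷ b ∷ c ∷ d ∷ []) = +-monoʳ-≤ (length a) (+-monoʳ-≤ (length b) (+-monoˡ-≤ _ (drop≤ c)))
    weight-popped 3F (a ∷ b ∷ c ∷ d ∷ []) = +-monoʳ-≤ (length a) (+-monoʳ-≤ (length b) (+-monoʳ-≤ (length c) (drop≤ d)))

    weight-pushed : ∀ i b s → weight (pushed i b s) ≡ suc (weight s)
    weight-pushed 0F _ (a ∷ b ∷ c ∷ d ∷ []) = refl
    weight-pushed 1F _ (a ∷ b ∷ c ∷ d ∷ []) = +-suc (length a) _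
    weight-pushed 2F _ (a ∷ b ∷ c ∷ d ∷ []) = trans (cong (length a +_) (+-suc (length b) _)) (+-suc (length a) _)
    weight-pushed 3F _ (a ∷ b ∷ c ∷ d ∷ []) =
      trans (cong (length a +_) (trans (cong (length b +_) (+-suc (length c) _)) (+-suc (length b) _))) (+-suc (length a) _)

  -- A step adds at most one cell. So the time bound also bounds the size of the result, which is
  -- why `PT` has a single bound and `sz-out` needs nothing further.
  weight-grows : ∀ {c s s′ t} → c ⊢ s ⇓[ t ] s′ → weight s′ ≤ t + weight s
  weight-grows ⇓skip = ≤-refl
  weight-grows (⇓push {i} {b} {s}) = ≤-reflexive (weight-pushed i b s)
  weight-grows (⇓▸ {s = s} {t = t} {u} p q) =
    ≤-trans (weight-grows q) (≤-trans (+-monoʳ-≤ u (weight-grows p)) (≤-reflexive (e t u (weight s))))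
    where
    e : ∀ t u w → u + (t + w) ≡ t + u + w
    e = solve-∀
  weight-grows (⇓match {i} {s = s} {t = t} p) = m≤n⇒m≤1+n (≤-trans (weight-grows p) (+-monoʳ-≤ t (weight-popped i s)))
  weight-grows (⇓stop {s = s} {s′} {t} p _) =
    ≤-trans (weight-popped 3F s′) (≤-trans (weight-grows p) (+-monoˡ-≤ (weight s) (m≤m+n t 1)))
  weight-grows (⇓again {s = s} {s′} {t = t} {u} p _ q) =
    ≤-trans (weight-grows q) (≤-trans (+-monoʳ-≤ u (≤-trans (weight-popped 3F s′) (weight-grows p))) (≤-by 1 (e t u (weight s))))
    where
    e : ∀ t u w → u + (t + w) + 1 ≡ t + suc u + w
    e = solve-∀

  module _ {σ τ : Ty} {f : ⟦ σ ⟧ → ⟦ τ ⟧} where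

    out : PT f → Poly
    out p = PT.bound p ⊞ var

    sz-out : ∀ (p : PT f) x → sz τ (f x) ≤ eval (out p) (sz σ x)
    sz-out p x with ex {t} t≤ d ← PT.run p x [] =
      ≤-trans (≤-reflexive (w τ (f x))) (≤-trans (weight-grows d) (+-mono-≤ t≤ (≤-reflexive (sym (w σ x)))))
      where
      w : ∀ ρ y → sz ρ y ≡ weight (main (ser (enc ρ y) []))
      w ρ y = sym (trans (+-identityʳ _) (trans (length-ser (enc ρ y) []) (+-identityʳ _)))

    abstract
      pt-ext : ∀ {g : ⟦ σ ⟧ → ⟦ τ ⟧} → (∀ x → f x ≡ g x) → PT f → PT g
      pt-ext h (pt c b r) = pt c b λ x a → subst (λ y → Ex c _ (main (ser (enc τ y) a)) _) (h x) (r x a)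

      -- Types whose values have equal trees share their programs; for instance numbers in binary
      -- and lists of bits, or unary numbers and lists of `false`.
      pt-recode : ∀ {ρ} {g : ⟦ σ ⟧ → ⟦ ρ ⟧} → (∀ x → enc τ (f x) ≡ enc ρ (g x)) → PT f → PT {σ} {ρ} g
      pt-recode h (pt c b r) = pt c b λ x a → subst (λ t → Ex c (main (ser (enc σ x) a)) (main (ser t a)) (eval b (sz σ x))) (h x) (r x a)

      pt-retype : (∀ x → enc σ x ≡ enc τ (f x)) → PT f
      pt-retype h = pt skip (con 0) λ x a → subst (λ t → Ex skip _ (main (ser t a)) 0) (h x) skipped

  abstract
    pt-id : ∀ {σ} → PT {σ} {σ} id
    pt-id = pt-retype λ _ → refl

    pt-∘ : ∀ {ρ σ τ} {g : ⟦ σ ⟧ → ⟦ τ ⟧} {f : ⟦ ρ ⟧ → ⟦ σ ⟧} → PT {σ} {τ} g → PT {ρ} {σ} f → PT {ρ} {τ} (λ x → g (f x))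
    pt-∘ {f = f} p q = pt (PT.cmd q ▸ PT.cmd p) (PT.bound q ⊞ PT.bound p ⊚ out q) λ x a →
      weaken (+-monoʳ-≤ (eval (PT.bound q) _) (eval-mono (PT.bound p) (sz-out q x))) (PT.run q x a ▷ PT.run p (f x) a)

  linear : Poly
  linear = con 10 ⊞ con 20 ⊠ var

  abstract
    pt-pair : ∀ {ρ σ τ} {f : ⟦ ρ ⟧ → ⟦ σ ⟧} {g : ⟦ ρ ⟧ → ⟦ τ ⟧} →
              PT {ρ} {σ} f → PT {ρ} {τ} g → PT {ρ} {σ ⊗ τ} (λ x → f x , g x)
    pt-pair {ρ} {σ} {τ} {f} {g} p q =
      -- The second component is computed first and swapped below the copy of the argument, because
      -- the first one precedes it in prefix order. The last push is the tag of the pair.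
      pt (dup ▸ PT.cmd q ▸ swap ▸ PT.cmd p ▸ push 0F true)
         (linear ⊞ (PT.bound q ⊞ (linear ⊚ (out q ⊞ var) ⊞ (PT.bound p ⊞ con 1))))
         λ x a → dup-ok (enc ρ x) ▷ PT.run q x _ ▷
                 weaken (eval-mono linear (+-monoˡ-≤ (sz ρ x) (sz-out q x))) (swap-ok (enc τ (g x)) (enc ρ x)) ▷
                 PT.run p x _ ▷ pushes 0F true

  pop₀ : Cmd
  pop₀ = match 0F skip skip skip

  pops₀ : ∀ b {a} → Ex pop₀ (main (b ∷ a)) (main a) 1
  pops₀ false = matched skipped
  pops₀ true  = matched skipped

  abstract
    pt-fst : ∀ {σ τ} → PT {σ ⊗ τ} {σ} proj₁
    pt-fst {σ} {τ} = pt (pop₀ ▸ swap ▸ drop) (con 1 ⊞ (linear ⊞ linear)) λ (x , y) a →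
      pops₀ true ▷ weaken (eval-mono linear (n≤1+n _)) (swap-ok (enc σ x) (enc τ y)) ▷
      weaken (eval-mono linear (m≤n+m (sz τ y) (suc (sz σ x)))) (drop-ok (enc τ y))

    pt-snd : ∀ {σ τ} → PT {σ ⊗ τ} {τ} proj₂
    pt-snd {σ} {τ} = pt (pop₀ ▸ drop) (con 1 ⊞ linear) λ (x , y) a →
      pops₀ true ▷ weaken (eval-mono linear (m≤n⇒m≤1+n (m≤m+n (sz σ x) (sz τ y)))) (drop-ok (enc σ x))

  private
    pushTree : Tree → Cmd
    pushTree leaf       = push 0F false
    pushTree (node l r) = pushTree r ▸ pushTree l ▸ push 0F true

    pushTree-ok : ∀ t {a} → Ex (pushTree t) (main a) (main (ser t a)) (size t)
    pushTree-ok leaf       = pushes 0F false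
    pushTree-ok (node l r) = weaken (≤-reflexive (e (size r) (size l))) (pushTree-ok r ▷ pushTree-ok l ▷ pushes 0F true)
      where
      e : ∀ r l → r + (l + 1) ≡ suc (l + r)
      e = solve-∀

  abstract
    pt-const : ∀ {ρ σ} (y : ⟦ σ ⟧) → PT {ρ} {σ} (λ _ → y)
    pt-const {ρ} {σ} y = pt (drop ▸ pushTree (enc σ y)) (linear ⊞ con (sz σ y)) λ x a →
      drop-ok (enc ρ x) ▷ pushTree-ok (enc σ y)

    pt-if : ∀ {ρ σ} {c : ⟦ ρ ⟧ → Bool} {f g : ⟦ ρ ⟧ → ⟦ σ ⟧} →
            PT {ρ} {bool} c → PT {ρ} {σ} f → PT {ρ} {σ} g → PT {ρ} {σ} (λ x → if c x then f x else g x)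
    pt-if {ρ} {σ} {c} {f} {g} pc pf pg =
      -- After the tag of the pair, the first bit is already the value of the condition.
      -- `encBool true` has two more bits, its leaves, which are discarded before `f` runs.
      pt (PT.cmd pcx ▸ pop₀ ▸ match 0F skip (PT.cmd pg) (pop₀ ▸ pop₀ ▸ PT.cmd pf))
         (PT.bound pcx ⊞ (con 1 ⊞ (con 3 ⊞ PT.bound pf ⊞ PT.bound pg)))
         λ x a → PT.run pcx x a ▷ pops₀ true ▷ branch x a
      where
      pcx : PT {ρ} {bool ⊗ ρ} (λ x → c x , x)
      pcx = pt-pair pc (pt-id {ρ})
      branch : ∀ x a → Ex (match 0F skip (PT.cmd pg) (pop₀ ▸ pop₀ ▸ PT.cmd pf))
        (main (ser (encBool (c x)) (ser (enc ρ x) a))) (main (ser (enc σ (if c x then f x else g x)) a))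
        (3 + eval (PT.bound pf) (sz ρ x) + eval (PT.bound pg) (sz ρ x))
      branch x a with c x
      ... | false = weaken (s≤s (m≤n+m _ (2 + _))) (matched (PT.run pg x a))
      ... | true  = weaken (m≤m+n _ _) (matched (pops₀ false ▷ pops₀ false ▷ PT.run pf x a))

  caseList : ∀ {A E B : Set} → (E → B) → ((A × List A) × E → B) → List A × E → B
  caseList g h ([] , e)     = g e
  caseList g h (x ∷ xs , e) = h ((x , xs) , e)

  abstract
    pt-caseList : ∀ {σ ε τ} {g : ⟦ ε ⟧ → ⟦ τ ⟧} {h : ⟦ (σ ⊗ list σ) ⊗ ε ⟧ → ⟦ τ ⟧} →
                  PT {ε} {τ} g → PT {(σ ⊗ list σ) ⊗ ε} {τ} h → PT {list σ ⊗ ε} {τ} (caseList g h)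
    pt-caseList {σ} {ε} {τ} {g} {h} pg ph =
      -- A nonempty list and a pair of head and tail have the same tree. The tags of the list cell
      -- and of the outer pair were consumed by the test, and two pushes restore them as the tags of
      -- the nested pair.
      pt (pop₀ ▸ match 0F skip (PT.cmd pg) (push 0F true ▸ push 0F true ▸ PT.cmd ph))
         (con 1 ⊞ (con 3 ⊞ PT.bound pg ⊞ PT.bound ph)) λ (xs , e) a → pops₀ true ▷ branch xs e a
      where
      branch : ∀ xs e a → Ex (match 0F skip (PT.cmd pg) (push 0F true ▸ push 0F true ▸ PT.cmd ph))
        (main (ser (enc (list σ) xs) (ser (enc ε e) a))) (main (ser (enc τ (caseList g h (xs , e))) a))
        (3 + eval (PT.bound pg) (sz (list σ ⊗ ε) (xs , e)) + eval (PT.bound ph) (sz (list σ ⊗ ε) (xs , e)))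
      branch [] e a = weaken (≤-trans (s≤s (≤-trans (eval-mono (PT.bound pg) (m≤n+m (sz ε e) 2)) (m≤n+m _ 2))) (m≤m+n _ _))
        (matched (PT.run pg e a))
      branch (x ∷ xs) e a = weaken (s≤s (s≤s (s≤s (m≤n+m _ _))))
        (matched (pushes 0F true ▷ pushes 0F true ▷ PT.run ph ((x , xs) , e) a))

-- Folds with polynomially bounded accumulators

module PolyTimeFold where

  open StackMachine
  open TreeStack
  open PolyTime
  open import Data.Fin.Patterns using (0F; 3F)
  open import Data.Nat using (ℕ; zero; suc; _+_; _*_; _≤_; z≤n; s≤s)
  open import Data.Nat.Properties
  open import Data.Nat.Tactic.RingSolver using (solve-∀)

  sz>0 : ∀ σ x → 1 ≤ sz σ x
  sz>0 σ x = size>0 (enc σ x)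

  length≤sz : ∀ σ xs → length xs ≤ sz (list σ) xs
  length≤sz σ []       = z≤n
  length≤sz σ (x ∷ xs) = s≤s (≤-trans (length≤sz σ xs) (m≤n+m _ (sz σ x)))

  sz-++ : ∀ σ xs ys → sz (list σ) (xs ++ ys) + 1 ≡ sz (list σ) xs + sz (list σ) ys
  sz-++ σ []       ys = +-comm _ 1
  sz-++ σ (x ∷ xs) ys = cong suc (trans (+-assoc (sz σ x) _ 1) (trans (cong (sz σ x +_) (sz-++ σ xs ys)) (sym (+-assoc (sz σ x) _ _))))

  sz-prefix : ∀ σ xs ys → sz (list σ) xs ≤ sz (list σ) (xs ++ ys)
  sz-prefix σ []       ys = sz>0 (list σ) ys
  sz-prefix σ (x ∷ xs) ys = s≤s (+-monoʳ-≤ (sz σ x) (sz-prefix σ xs ys))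

  module _ {γ σ α : Ty} {body : ⟦ (γ ⊗ α) ⊗ σ ⟧ → ⟦ α ⟧} (pb : PT {(γ ⊗ α) ⊗ σ} {α} body) where

    private
      advance : ⟦ (σ ⊗ list σ) ⊗ (α ⊗ γ) ⟧ → ⟦ list σ ⊗ (α ⊗ γ) ⟧
      advance ((x , xs) , (s , g)) = xs , (body ((g , s) , x) , g)

      abstract
        turn : PT {(σ ⊗ list σ) ⊗ (α ⊗ γ)} {list σ ⊗ (α ⊗ γ)} advance
        turn = pt-pair (pt-∘ pt-snd pt-fst)
                 (pt-pair (pt-∘ pb (pt-pair (pt-pair (pt-∘ pt-snd pt-snd) (pt-∘ pt-fst pt-snd)) (pt-∘ pt-fst pt-fst)))
                          (pt-∘ pt-snd pt-snd))

      iteration : Cmd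
      iteration = pop₀ ▸ match 0F skip (push 3F false) (push 0F true ▸ push 0F true ▸ PT.cmd turn ▸ push 3F true)

      step : ⟦ γ ⟧ → ⟦ α ⟧ → ⟦ σ ⟧ → ⟦ α ⟧
      step g s x = body ((g , s) , x)

      loop-run : ∀ g zs s q M a → (∀ ys ys′ → zs ≡ ys ++ ys′ → sz α (foldl (step g) s ys) ≤ q) →
        2 + sz (list σ) zs + q + sz γ g ≤ M →
        Ex (loop iteration) (main (ser (enc (list σ ⊗ (α ⊗ γ)) (zs , (s , g))) a))
           (main (ser (enc (α ⊗ γ) (foldl (step g) s zs , g)) a)) (suc (length zs) * (eval (PT.bound turn) M + 10))
      loop-run g [] s q M a h _ = weaken (≤-trans (≤-trans (+-monoʳ-≤ 4 (z≤n {6})) (m≤n+m 10 (eval (PT.bound turn) M))) (m≤m+n _ 0))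
        (looped {n = 0} (pops₀ true ▷ matched (pushes 3F false)) (inj₁ (refl , refl)))
      loop-run g (x ∷ zs) s q M a h hM =
        weaken (cost (eval (PT.bound turn) M) (suc (length zs) * (eval (PT.bound turn) M + 10)))
          (looped (pops₀ true ▷ matched (pushes 0F true ▷ pushes 0F true ▷
              weaken (eval-mono (PT.bound turn) small) (PT.run turn ((x , zs) , (s , g)) a) ▷ pushes 3F true))
            (inj₂ (refl , loop-run g zs (step g s x) q M a (λ ys ys′ eq → h (x ∷ ys) ys′ (cong (x ∷_) eq))
              (≤-trans (+-monoˡ-≤ (sz γ g) (+-monoˡ-≤ q (s≤s (s≤s (m≤n⇒m≤1+n (m≤n+m _ (sz σ x))))))) hM))))
        where
        small : sz ((σ ⊗ list σ) ⊗ (α ⊗ γ)) ((x , zs) , (s , g)) ≤ M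
        small = ≤-trans (≤-reflexive (e₁ (sz σ x) (sz (list σ) zs) (sz α s) (sz γ g)))
          (≤-trans (+-monoˡ-≤ (sz γ g) (+-monoʳ-≤ (2 + suc (sz σ x + sz (list σ) zs)) (h [] (x ∷ zs) refl))) hM)
          where
          e₁ : ∀ x z s g → suc (suc (x + z) + suc (s + g)) ≡ 2 + suc (x + z) + s + g
          e₁ = solve-∀
        cost : ∀ b r → 1 + suc (1 + (1 + (b + 1))) + suc r ≤ b + 10 + r
        cost b r = ≤-by 4 (e b r)
          where
          e : ∀ b r → 1 + suc (1 + (1 + (b + 1))) + suc r + 4 ≡ b + 10 + r
          e = solve-∀

    -- The bound `q` on the accumulators at all prefixes is essential: duplicating the accumulator
    -- takes polynomial time, but iterating that yields exponential size. With the bound, every turn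
    -- of the loop works on input of size at most `M`.
    pt-foldl : ∀ {xs : ⟦ γ ⟧ → List ⟦ σ ⟧} {s : ⟦ γ ⟧ → ⟦ α ⟧} → PT {γ} {list σ} xs → PT {γ} {α} s → (q : Poly) →
      (∀ g ys ys′ → xs g ≡ ys ++ ys′ → sz α (foldl (λ s x → body ((g , s) , x)) (s g) ys) ≤ eval q (sz γ g)) →
      PT {γ} {α} (λ g → foldl (λ s x → body ((g , s) , x)) (s g) (xs g))
    pt-foldl {xs} {s} pxs ps q h = pt (PT.cmd init ▸ loop iteration ▸ PT.cmd (pt-fst {α} {γ})) bound run
      where
      init = pt-pair pxs (pt-pair ps (pt-id {γ}))
      M = con 2 ⊞ out pxs ⊞ q ⊞ var
      bound = PT.bound init ⊞ ((con 1 ⊞ out pxs) ⊠ (PT.bound turn ⊚ M ⊞ con 10) ⊞ PT.bound (pt-fst {α} {γ}) ⊚ M)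
      result : ⟦ γ ⟧ → ⟦ α ⟧
      result g = foldl (step g) (s g) (xs g)
      run : ∀ g a → Ex _ (main (ser (enc γ g) a)) (main (ser (enc α (result g)) a)) (eval bound (sz γ g))
      run g a = PT.run init g a ▷
        weaken (*-monoˡ-≤ _ (s≤s (≤-trans (length≤sz σ (xs g)) (sz-out pxs g))))
          (loop-run g (xs g) (s g) (eval q (sz γ g)) (eval M (sz γ g)) a (h g)
            (+-monoˡ-≤ (sz γ g) (+-monoˡ-≤ (eval q (sz γ g)) (+-monoʳ-≤ 2 (sz-out pxs g))))) ▷
        weaken (eval-mono (PT.bound (pt-fst {α} {γ})) (+-monoˡ-≤ (sz γ g)
            (s≤s (≤-trans (h g (xs g) [] (sym (++-identityʳ _))) (m≤n+m _ (1 + eval (out pxs) (sz γ g)))))))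
          (PT.run (pt-fst {α} {γ}) (result g , g) a)

    -- The size of the accumulator is controlled by a measure μ which every step
    -- increases by an amount that does not depend on the accumulator.
    module _ {xs : ⟦ γ ⟧ → List ⟦ σ ⟧} {s : ⟦ γ ⟧ → ⟦ α ⟧} (pxs : PT {γ} {list σ} xs) (ps : PT {γ} {α} s) where

      pt-foldlᵐ : (μ : ⟦ α ⟧ → ℕ) (t u r : Poly) → (∀ s → sz α s ≤ eval t (μ s)) → (∀ g → μ (s g) ≤ eval u (sz γ g)) →
        (∀ g s x → μ (body ((g , s) , x)) ≤ μ s + eval r (sz γ g + sz σ x)) →
        PT {γ} {α} (λ g → foldl (λ s x → body ((g , s) , x)) (s g) (xs g))
      pt-foldlᵐ μ t u r ht hu h = pt-foldl pxs ps (t ⊚ (u ⊞ out pxs ⊠ r ⊚ (var ⊞ out pxs))) λ g ys ys′ eq →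
        let le : sz (list σ) ys ≤ eval (out pxs) (sz γ g)
            le = ≤-trans (sz-prefix σ ys ys′) (subst (λ l → sz (list σ) l ≤ _) eq (sz-out pxs g))
        in ≤-trans (ht _) (eval-mono t (≤-trans (grow g ys (s g) _ le) (+-mono-≤ (hu g) (*-monoˡ-≤ _ (≤-trans (length≤sz σ ys) le)))))
        where
        grow : ∀ g ys s N → sz (list σ) ys ≤ N → μ (foldl (step g) s ys) ≤ μ s + length ys * eval r (sz γ g + N)
        grow g []       s N _  = m≤m+n _ _
        grow g (y ∷ ys) s N le = ≤-trans (grow g ys (step g s y) N (≤-trans (m≤n⇒m≤1+n (m≤n+m _ (sz σ y))) le))
          (≤-trans (+-monoˡ-≤ _ (≤-trans (h g s y) (+-monoʳ-≤ (μ s) (eval-mono r (+-monoʳ-≤ (sz γ g) (≤-trans (m≤n⇒m≤1+n (m≤m+n (sz σ y) _)) le))))))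
            (≤-reflexive (+-assoc (μ s) _ _)))

      pt-foldl⁺ : (r : Poly) → (∀ g s x → sz α (body ((g , s) , x)) ≤ sz α s + eval r (sz γ g + sz σ x)) →
        PT {γ} {α} (λ g → foldl (λ s x → body ((g , s) , x)) (s g) (xs g))
      pt-foldl⁺ r = pt-foldlᵐ (sz α) var (out ps) r (λ _ → ≤-refl) (sz-out ps)

-- Polynomial-time functions on lists, booleans and unary numbers

module PolyTimeList where

  open StackMachine
  open TreeStack
  open import Data.Fin.Patterns using (0F)
  open PolyTime
  open PolyTimeFold
  open import Data.Nat using (ℕ; zero; suc; _+_; _*_; _∸_; _^_; _≤_; z≤n; s≤s; pred; _≡ᵇ_)
  open import Data.Nat.Properties
  open import Data.Nat.Tactic.RingSolver using (solve-∀)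

  abstract
    pt-cons : ∀ {γ σ} {x : ⟦ γ ⟧ → ⟦ σ ⟧} {xs : ⟦ γ ⟧ → List ⟦ σ ⟧} →
              PT {γ} {σ} x → PT {γ} {list σ} xs → PT {γ} {list σ} (λ g → x g ∷ xs g)
    pt-cons {σ = σ} p q = pt-∘ (pt-retype {σ ⊗ list σ} {list σ} {λ y → proj₁ y ∷ proj₂ y} λ _ → refl) (pt-pair p q)

    pt-reverse : ∀ {γ σ} {xs : ⟦ γ ⟧ → List ⟦ σ ⟧} → PT {γ} {list σ} xs → PT {γ} {list σ} (λ g → reverse (xs g))
    pt-reverse {γ} {σ} p = pt-foldl⁺ {γ} {σ} {list σ} {λ ((g , s) , x) → x ∷ s}
      (pt-cons pt-snd (pt-∘ pt-snd pt-fst)) p (pt-const {σ = list σ} []) (con 1 ⊞ var)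
      λ g s x → ≤-trans (≤-reflexive (+-comm (suc (sz σ x)) (sz (list σ) s))) (+-monoʳ-≤ (sz (list σ) s) (s≤s (m≤n+m _ (sz γ g))))

  private
    foldl-cons : ∀ {A B : Set} (f : A → B) xs acc → foldl (λ s x → f x ∷ s) acc xs ≡ reverse (map f xs) ++ acc
    foldl-cons f []       acc = refl
    foldl-cons f (x ∷ xs) acc = trans (foldl-cons f xs (f x ∷ acc))
      (trans (sym (++-assoc (reverse (map f xs)) (f x ∷ []) acc)) (cong (_++ acc) (sym (unfold-reverse (f x) (map f xs)))))

  abstract
    pt-map : ∀ {γ σ τ} {f : ⟦ γ ⊗ σ ⟧ → ⟦ τ ⟧} {xs : ⟦ γ ⟧ → List ⟦ σ ⟧} →
             PT {γ ⊗ σ} {τ} f → PT {γ} {list σ} xs → PT {γ} {list τ} (λ g → map (λ x → f (g , x)) (xs g))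
    pt-map {γ} {σ} {τ} {f} {xs} pf pxs = pt-ext
      (λ g → trans (cong reverse (trans (foldl-cons (λ x → f (g , x)) (xs g) []) (++-identityʳ _))) (reverse-involutive _))
      (pt-reverse (pt-foldl⁺ {γ} {σ} {list τ} {λ ((g , s) , x) → f (g , x) ∷ s}
        (pt-cons (pt-∘ pf (pt-pair (pt-∘ pt-fst pt-fst) pt-snd)) (pt-∘ pt-snd pt-fst)) pxs (pt-const {σ = list τ} [])
        (con 1 ⊞ out pf ⊚ (con 1 ⊞ var))
        λ g s x → ≤-trans (≤-reflexive (+-comm (suc (sz τ (f (g , x)))) (sz (list τ) s)))
          (+-monoʳ-≤ (sz (list τ) s) (s≤s (sz-out pf (g , x))))))

    pt-++ : ∀ {γ σ} {xs ys : ⟦ γ ⟧ → List ⟦ σ ⟧} → PT {γ} {list σ} xs → PT {γ} {list σ} ys →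
            PT {γ} {list σ} (λ g → xs g ++ ys g)
    pt-++ {γ} {σ} {xs} {ys} p q = pt-ext
      (λ g → trans (foldl-cons id (reverse (xs g)) (ys g))
        (cong (_++ ys g) (trans (cong reverse (map-id (reverse (xs g)))) (reverse-involutive (xs g)))))
      (pt-foldl⁺ {γ} {σ} {list σ} {λ ((g , s) , x) → x ∷ s}
        (pt-cons pt-snd (pt-∘ pt-snd pt-fst)) (pt-reverse p) q (con 1 ⊞ var)
        λ g s x → ≤-trans (≤-reflexive (+-comm (suc (sz σ x)) (sz (list σ) s))) (+-monoʳ-≤ (sz (list σ) s) (s≤s (m≤n+m _ (sz γ g)))))
      where
      map-id : ∀ {A : Set} (l : List A) → map id l ≡ l
      map-id []      = refl
      map-id (x ∷ l) = cong (x ∷_) (map-id l)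

    pt-concat : ∀ {γ σ} {xss : ⟦ γ ⟧ → List (List ⟦ σ ⟧)} → PT {γ} {list (list σ)} xss → PT {γ} {list σ} (λ g → concat (xss g))
    pt-concat {γ} {σ} {xss} p = pt-ext (λ g → acc-concat (xss g) [])
      (pt-foldl⁺ {γ} {list σ} {list σ} {λ ((g , s) , x) → s ++ x}
        (pt-++ (pt-∘ pt-snd pt-fst) pt-snd) p (pt-const {σ = list σ} []) var
        λ g s x → ≤-trans (≤-trans (m≤m+n _ 1) (≤-reflexive (sz-++ σ s x))) (+-monoʳ-≤ (sz (list σ) s) (m≤n+m _ (sz γ g))))
      where
      acc-concat : ∀ {A : Set} (xss : List (List A)) acc → foldl _++_ acc xss ≡ acc ++ concat xss
      acc-concat []         acc = sym (++-identityʳ acc)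
      acc-concat (xs ∷ xss) acc = trans (acc-concat xss (acc ++ xs)) (++-assoc acc xs (concat xss))

    -- The two trees coincide, so counted loops are folds over this list, and unary arithmetic can
    -- use the operations on lists.
    pt-un→list : PT {un} {list bool} (λ n → replicate n false)
    pt-un→list = pt-retype enc-replicate
      where
      enc-replicate : ∀ n → enc un n ≡ enc (list bool) (replicate n false)
      enc-replicate zero    = refl
      enc-replicate (suc n) = cong (node leaf) (enc-replicate n)

  sz-un : ∀ n → sz un n ≡ suc (n + n)
  sz-un zero    = refl
  sz-un (suc n) = cong suc (trans (cong suc (sz-un n)) (cong suc (sym (+-suc n n))))

  ≤sz-un : ∀ n → n ≤ sz un n
  ≤sz-un n = ≤-trans (m≤m+n n n) (≤-trans (n≤1+n _) (≤-reflexive (sym (sz-un n))))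

  fold-shift : ∀ {A : Set} (f : A → A) z n → fold (f z) f n ≡ f (fold z f n)
  fold-shift f z zero    = refl
  fold-shift f z (suc n) = cong f (fold-shift f z n)

  private
    foldl-replicate : ∀ {A : Set} (f : A → A) z n → foldl (λ s (_ : Bool) → f s) z (replicate n false) ≡ fold z f n
    foldl-replicate f z zero    = refl
    foldl-replicate f z (suc n) = trans (foldl-replicate f (f z) n) (fold-shift f z n)

    replicate-prefix : ∀ n (ys ys′ : List Bool) → replicate n false ≡ ys ++ ys′ → ∃[ k ] (k ≤ n × ys ≡ replicate k false)
    replicate-prefix n       []           ys′ e = 0 , z≤n , refl
    replicate-prefix (suc n) (false ∷ ys) ys′ e with replicate-prefix n ys ys′ (cong (List.drop 1) e)
    ... | k , le , e′ = suc k , s≤s le , cong (false ∷_) e′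

  module _ {γ α : Ty} {f : ⟦ γ ⊗ α ⟧ → ⟦ α ⟧} (pf : PT {γ ⊗ α} {α} f)
           {n : ⟦ γ ⟧ → ℕ} {z : ⟦ γ ⟧ → ⟦ α ⟧} (pn : PT {γ} {un} n) (pz : PT {γ} {α} z) where

    abstract
      pt-fold : (q : Poly) → (∀ g k → k ≤ n g → sz α (fold (z g) (λ s → f (g , s)) k) ≤ eval q (sz γ g)) →
                PT {γ} {α} (λ g → fold (z g) (λ s → f (g , s)) (n g))
      pt-fold q h = pt-ext (λ g → foldl-replicate (λ s → f (g , s)) (z g) (n g))
        (pt-foldl {γ} {bool} {α} {λ ((g , s) , _) → f (g , s)} (pt-∘ pf pt-fst) (pt-∘ pt-un→list pn) pz q λ g ys ys′ e →
          let k , k≤n , e′ = replicate-prefix (n g) ys ys′ e in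
          subst (λ l → sz α (foldl (λ s _ → f (g , s)) (z g) l) ≤ eval q (sz γ g)) (sym e′)
            (subst (λ v → sz α v ≤ eval q (sz γ g)) (sym (foldl-replicate (λ s → f (g , s)) (z g) k)) (h g k k≤n)))

      pt-fold⁺ : (r : Poly) → (∀ g s → sz α (f (g , s)) ≤ sz α s + eval r (sz γ g)) →
                 PT {γ} {α} (λ g → fold (z g) (λ s → f (g , s)) (n g))
      pt-fold⁺ r h = pt-ext (λ g → foldl-replicate (λ s → f (g , s)) (z g) (n g))
        (pt-foldl⁺ {γ} {bool} {α} {λ ((g , s) , _) → f (g , s)} (pt-∘ pf pt-fst) (pt-∘ pt-un→list pn) pz r λ g s x →
          ≤-trans (h g s) (+-monoʳ-≤ (sz α s) (eval-mono r (m≤m+n (sz γ g) _))))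

  tail : {A : Set} → List A → List A
  tail = List.drop 1

  headOr : {A : Set} → A → List A → A
  headOr d []      = d
  headOr d (x ∷ _) = x

  nth : {A : Set} → A → List A → ℕ → A
  nth d []       i       = d
  nth d (x ∷ xs) zero    = x
  nth d (x ∷ xs) (suc i) = nth d xs i

  null : {A : Set} → List A → Bool
  null []      = true
  null (_ ∷ _) = false

  abstract
    pt-tail : ∀ {γ σ} {xs : ⟦ γ ⟧ → List ⟦ σ ⟧} → PT {γ} {list σ} xs → PT {γ} {list σ} (λ g → tail (xs g))
    pt-tail {γ} {σ} {xs} p = pt-ext (λ g → e (xs g) g)
      (pt-∘ (pt-caseList {σ} {γ} {list σ} (pt-const {σ = list σ} []) (pt-∘ pt-snd pt-fst)) (pt-pair p pt-id))
      where
      e : ∀ xs g → caseList {⟦ σ ⟧} {⟦ γ ⟧} (λ _ → []) (λ y → proj₂ (proj₁ y)) (xs , g) ≡ tail xs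
      e []       g = refl
      e (x ∷ xs) g = refl

    pt-headOr : ∀ {γ σ} d {xs : ⟦ γ ⟧ → List ⟦ σ ⟧} → PT {γ} {list σ} xs → PT {γ} {σ} (λ g → headOr d (xs g))
    pt-headOr {γ} {σ} d {xs} p = pt-ext (λ g → e (xs g) g)
      (pt-∘ (pt-caseList {σ} {γ} {σ} (pt-const {σ = σ} d) (pt-∘ pt-fst pt-fst)) (pt-pair p pt-id))
      where
      e : ∀ xs g → caseList {⟦ σ ⟧} {⟦ γ ⟧} (λ _ → d) (λ y → proj₁ (proj₁ y)) (xs , g) ≡ headOr d xs
      e []       g = refl
      e (x ∷ xs) g = refl

    pt-null : ∀ {γ σ} {xs : ⟦ γ ⟧ → List ⟦ σ ⟧} → PT {γ} {list σ} xs → PT {γ} {bool} (λ g → null (xs g))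
    pt-null {γ} {σ} {xs} p = pt-ext (λ g → e (xs g) g)
      (pt-∘ (pt-caseList {σ} {γ} {bool} (pt-const {σ = bool} true) (pt-const {σ = bool} false)) (pt-pair p pt-id))
      where
      e : ∀ xs g → caseList {⟦ σ ⟧} {⟦ γ ⟧} (λ _ → true) (λ y → false) (xs , g) ≡ null xs
      e []       g = refl
      e (x ∷ xs) g = refl

    pt-nth : ∀ {γ σ} d {xs : ⟦ γ ⟧ → List ⟦ σ ⟧} {i : ⟦ γ ⟧ → ℕ} → PT {γ} {list σ} xs → PT {γ} {un} i →
             PT {γ} {σ} (λ g → nth d (xs g) (i g))
    pt-nth {γ} {σ} d {xs} {i} p q = pt-ext (λ g → e (xs g) (i g))
      (pt-headOr d (pt-fold⁺ {γ} {list σ} {λ y → tail (proj₂ y)} (pt-tail pt-snd) q p (con 0) λ g s → shrink s))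
      where
      shrink : ∀ xs → sz (list σ) (tail xs) ≤ sz (list σ) xs + 0
      shrink []       = ≤-refl
      shrink (x ∷ xs) = ≤-trans (m≤n⇒m≤1+n (m≤n+m _ (sz σ x))) (m≤m+n _ 0)
      e : ∀ xs i → headOr d (fold xs tail i) ≡ nth d xs i
      e []       zero    = refl
      e []       (suc i) = trans (cong (headOr d) (sym (fold-shift tail [] i))) (e [] i)
      e (x ∷ xs) zero    = refl
      e (x ∷ xs) (suc i) = trans (cong (headOr d) (sym (fold-shift tail (x ∷ xs) i))) (e xs i)

    pt-not : ∀ {γ} {b : ⟦ γ ⟧ → Bool} → PT {γ} {bool} b → PT {γ} {bool} (λ g → not (b g))
    pt-not {γ} {b} p = pt-ext (λ g → e (b g)) (pt-if p (pt-const {σ = bool} false) (pt-const {σ = bool} true))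
      where
      e : ∀ b → (if b then false else true) ≡ not b
      e false = refl
      e true  = refl

    pt-∧ : ∀ {γ} {b c : ⟦ γ ⟧ → Bool} → PT {γ} {bool} b → PT {γ} {bool} c → PT {γ} {bool} (λ g → b g ∧ c g)
    pt-∧ {γ} {b} {c} p q = pt-ext (λ g → e (b g) (c g)) (pt-if p q (pt-const {σ = bool} false))
      where
      e : ∀ b c → (if b then c else false) ≡ b ∧ c
      e false c = refl
      e true  c = refl

    pt-∨ : ∀ {γ} {b c : ⟦ γ ⟧ → Bool} → PT {γ} {bool} b → PT {γ} {bool} c → PT {γ} {bool} (λ g → b g ∨ c g)
    pt-∨ {γ} {b} {c} p q = pt-ext (λ g → e (b g) (c g)) (pt-if p (pt-const {σ = bool} true) q)
      where
      e : ∀ b c → (if b then true else c) ≡ b ∨ c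
      e false c = refl
      e true  c = refl

    pt-suc : ∀ {γ} {n : ⟦ γ ⟧ → ℕ} → PT {γ} {un} n → PT {γ} {un} (λ g → suc (n g))
    pt-suc p = pt-∘ (pt {un} {un} {suc} (push 0F false ▸ push 0F true) (con 2) λ x a → pushes 0F false ▷ pushes 0F true) p

    pt-+ᵘ : ∀ {γ} {m n : ⟦ γ ⟧ → ℕ} → PT {γ} {un} m → PT {γ} {un} n → PT {γ} {un} (λ g → m g + n g)
    pt-+ᵘ {γ} {m} {n} p q = pt-ext (λ g → e (m g) (n g))
      (pt-fold⁺ {γ} {un} {λ y → suc (proj₂ y)} (pt-suc pt-snd) p q (con 2) λ g s → ≤-reflexive (+-comm 2 _))
      where
      e : ∀ m n → fold n suc m ≡ m + n
      e zero    n = refl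
      e (suc m) n = cong suc (e m n)

    pt-*ᵘ : ∀ {γ} {m n : ⟦ γ ⟧ → ℕ} → PT {γ} {un} m → PT {γ} {un} n → PT {γ} {un} (λ g → m g * n g)
    pt-*ᵘ {γ} {m} {n} p q = pt-ext (λ g → e (m g) (n g))
      (pt-fold⁺ {γ} {un} {λ y → n (proj₁ y) + proj₂ y} (pt-+ᵘ (pt-∘ q pt-fst) pt-snd) p (pt-const {σ = un} 0) (out q) λ g s →
        ≤-trans (≤-trans (≤-by 1 (h (n g) s)) (+-monoʳ-≤ (sz un s) ≤-refl)) (+-monoʳ-≤ (sz un s) (sz-out q g)))
      where
      e : ∀ m n → fold 0 (n +_) m ≡ m * n
      e zero    n = refl
      e (suc m) n = cong (n +_) (e m n)
      h : ∀ n s → sz un (n + s) + 1 ≡ sz un s + sz un n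
      h n s rewrite sz-un (n + s) | sz-un s | sz-un n = h′ n s
        where
        h′ : ∀ n s → suc (n + s + (n + s)) + 1 ≡ suc (s + s) + suc (n + n)
        h′ = solve-∀

    pt-^ᵘ : ∀ {γ} k {m : ⟦ γ ⟧ → ℕ} → PT {γ} {un} m → PT {γ} {un} (λ g → m g ^ k)
    pt-^ᵘ zero    p = pt-const {σ = un} 1
    pt-^ᵘ (suc k) p = pt-*ᵘ p (pt-^ᵘ k p)

    pt-length : ∀ {γ σ} {xs : ⟦ γ ⟧ → List ⟦ σ ⟧} → PT {γ} {list σ} xs → PT {γ} {un} (λ g → length (xs g))
    pt-length {γ} {σ} {xs} p = pt-ext (λ g → trans (e (xs g) 0) (+-identityʳ _))
        (pt-foldl⁺ {γ} {σ} {un} {λ ((g , s) , _) → suc s} (pt-suc (pt-∘ pt-snd pt-fst))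
          p (pt-const {σ = un} 0) (con 2) λ g s x → ≤-reflexive (+-comm 2 _))
      where
      e : ∀ (xs : List ⟦ σ ⟧) k → foldl (λ s _ → suc s) k xs ≡ length xs + k
      e []       k = refl
      e (_ ∷ xs) k = trans (e xs (suc k)) (+-suc (length xs) k)

    pt-pred : ∀ {γ} {n : ⟦ γ ⟧ → ℕ} → PT {γ} {un} n → PT {γ} {un} (λ g → pred (n g))
    pt-pred {γ} {n} p = pt-ext (λ g → e (n g)) (pt-length (pt-tail (pt-∘ pt-un→list p)))
      where
      e : ∀ n → length (tail (replicate n false)) ≡ pred n
      e zero          = refl
      e (suc zero)    = refl
      e (suc (suc n)) = cong suc (e (suc n))

    pt-∸ᵘ : ∀ {γ} {m n : ⟦ γ ⟧ → ℕ} → PT {γ} {un} m → PT {γ} {un} n → PT {γ} {un} (λ g → m g ∸ n g)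
    pt-∸ᵘ {γ} {m} {n} p q = pt-ext (λ g → e (m g) (n g))
      (pt-fold⁺ {γ} {un} {λ y → pred (proj₂ y)} (pt-pred pt-snd) q p (con 0) λ g s → ≤-trans (shrink s) (m≤m+n _ 0))
      where
      shrink : ∀ s → sz un (pred s) ≤ sz un s
      shrink zero    = ≤-refl
      shrink (suc s) = m≤n+m _ 2
      e : ∀ m n → fold m pred n ≡ m ∸ n
      e m zero    = refl
      e m (suc n) = trans (cong pred (e m n)) (pred[m∸n]≡m∸[1+n] m n)

    pt-≡ᵘ : ∀ {γ} {m n : ⟦ γ ⟧ → ℕ} → PT {γ} {un} m → PT {γ} {un} n → PT {γ} {bool} (λ g → m g ≡ᵇ n g)
    pt-≡ᵘ {γ} {m} {n} p q = pt-ext (λ g → e (m g) (n g))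
      (pt-null (pt-∘ pt-un→list (pt-+ᵘ (pt-∸ᵘ p q) (pt-∸ᵘ q p))))
      where
      e : ∀ m n → null (replicate ((m ∸ n) + (n ∸ m)) false) ≡ (m ≡ᵇ n)
      e zero    zero    = refl
      e zero    (suc n) = refl
      e (suc m) zero    = refl
      e (suc m) (suc n) = e m n

    pt-upTo : ∀ {γ} {n : ⟦ γ ⟧ → ℕ} → PT {γ} {un} n → PT {γ} {list un} (λ g → upTo (n g))
    pt-upTo {γ} {n} p = pt-ext (λ g → trans (cong (reverse ∘ proj₂) (e (n g))) (reverse-downFrom (n g)))
      -- The counter travels with the list, which comes out in descending order. Its size is
      -- quadratic in that of the unary bound, hence the square in the polynomial.
      (pt-reverse (pt-∘ pt-snd (pt-fold {γ} {un ⊗ list un} {λ (_ , (k , ks)) → suc k , k ∷ ks}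
        (pt-pair (pt-suc (pt-∘ pt-fst pt-snd)) (pt-cons (pt-∘ pt-fst pt-snd) (pt-∘ pt-snd pt-snd)))
        p (pt-const {σ = un ⊗ list un} (0 , []))
        (con 2 ⊞ out p ⊞ (out p ⊠ out p) ⊞ out p)
        λ g k k≤n → ≤-trans (≤-reflexive (cong (sz (un ⊗ list un)) (e k)))
          (≤-trans (size-down k) (mono (≤-trans (sz-mono k≤n) (sz-out p g)) )))))
      where
      e : ∀ n → fold (0 , []) (λ (k , ks) → suc k , k ∷ ks) n ≡ (n , downFrom n)
      e zero    = refl
      e (suc n) rewrite e n = refl
      sz-mono : ∀ {k n} → k ≤ n → sz un k ≤ sz un n
      sz-mono {k} {n} le rewrite sz-un k | sz-un n = s≤s (+-mono-≤ le le)
      mono : ∀ {a b} → a ≤ b → 2 + a + a * a + a ≤ 2 + b + b * b + b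
      mono le = +-mono-≤ (+-mono-≤ (s≤s (s≤s le)) (*-mono-≤ le le)) le
      down : ∀ k → sz (list un) (downFrom k) ≤ 1 + sz un k * sz un k
      down zero    = s≤s z≤n
      down (suc k) = ≤-trans (s≤s (+-monoʳ-≤ (sz un k) (down k))) (s≤s (≤-by _ (h (sz un k))))
        where
        h : ∀ u → u + (1 + u * u) + (3 + 3 * u) ≡ (2 + u) * (2 + u)
        h = solve-∀
      size-down : ∀ k → sz (un ⊗ list un) (k , downFrom k) ≤ 2 + sz un k + sz un k * sz un k + sz un k
      size-down k = ≤-trans (s≤s (+-monoʳ-≤ (sz un k) (down k))) (≤-by (sz un k) (h (sz un k)))
        where
        h : ∀ u → suc (u + (1 + u * u)) + u ≡ 2 + u + u * u + u
        h = solve-∀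

-- Binary numerals: canonical form, addition and truncated subtraction

module Binary where

  open TreeStack
  open PolyTime
  open PolyTimeFold
  open PolyTimeList
  open import Data.Integer as ℤ using (ℤ) renaming (+_ to pos)
  import Data.Integer.Properties as ℤ
  open import Data.Nat using (ℕ; zero; suc; _+_; _*_; _∸_; _^_; _≤_; _<_; z≤n; s≤s; ⌊_/2⌋)
  open import Data.Nat.Properties
  open import Data.Nat.Tactic.RingSolver using (solve-∀)

  weightOf : Bool → ℕ
  weightOf false = 0
  weightOf true  = 1

  val : List Bool → ℕ
  val []       = 0
  val (b ∷ bs) = weightOf b + (val bs + val bs)

  -- Puts a least significant bit in front. Since `cons false []` is empty, no leading zero arises,
  -- and folding with it turns any bit list into the canonical numeral of its value.
  cons : Bool → List Bool → List Bool
  cons false []         = []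
  cons false bs@(_ ∷ _) = false ∷ bs
  cons true  bs         = true ∷ bs

  val-increment : ∀ bs → val (increment bs) ≡ suc (val bs)
  val-increment []           = refl
  val-increment (false ∷ bs) = refl
  val-increment (true ∷ bs)  rewrite val-increment bs = cong suc (+-suc (val bs) (val bs))

  val-toBits : ∀ n → val (toBits n) ≡ n
  val-toBits zero    = refl
  val-toBits (suc n) = trans (val-increment (toBits n)) (cong suc (val-toBits n))

  private
    increment-cons : ∀ bs → increment (increment (cons false bs)) ≡ cons false (increment bs)
    increment-cons []           = refl
    increment-cons (false ∷ bs) = refl
    increment-cons (true ∷ bs)  = refl

    increment-false : ∀ bs → increment (cons false bs) ≡ cons true bs
    increment-false []      = refl
    increment-false (b ∷ bs) = refl

    toBits-even : ∀ k → toBits (k + k) ≡ cons false (toBits k)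
    toBits-even zero    = refl
    toBits-even (suc k) rewrite +-suc k k | toBits-even k = increment-cons (toBits k)

  toBits-cons : ∀ b k → toBits (weightOf b + (k + k)) ≡ cons b (toBits k)
  toBits-cons false k = toBits-even k
  toBits-cons true  k = trans (cong increment (toBits-even k)) (increment-false (toBits k))

  toBits-val : ∀ bs → foldr cons [] bs ≡ toBits (val bs)
  toBits-val []       = refl
  toBits-val (b ∷ bs) = trans (cong (cons b) (toBits-val bs)) (sym (toBits-cons b (val bs)))

  encBits-list : ∀ bs → encBits bs ≡ enc (list bool) bs
  encBits-list []       = refl
  encBits-list (b ∷ bs) = cong (node (encBool b)) (encBits-list bs)

  val< : ∀ bs → val bs < 2 ^ length bs
  val< []       = s≤s z≤n
  val< (b ∷ bs) = ≤-trans (s≤s (+-monoˡ-≤ (val bs + val bs) (w≤ b))) (≤-trans (≤-reflexive (sym (cong suc (+-suc (val bs) (val bs)))))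
      (≤-trans (+-mono-≤ (val< bs) (val< bs)) (≤-reflexive (cong (2 ^ length bs +_) (sym (+-identityʳ _))))))
    where
    w≤ : ∀ b → weightOf b ≤ 1
    w≤ false = z≤n
    w≤ true  = ≤-refl

  bitLength : ℕ → ℕ
  bitLength n = length (toBits n)

  <2^bitLength : ∀ n → n < 2 ^ bitLength n
  <2^bitLength n = subst (_< 2 ^ bitLength n) (val-toBits n) (val< (toBits n))

  half-cons : ∀ b k → ⌊ weightOf b + (k + k) /2⌋ ≡ k
  half-cons false zero    = refl
  half-cons true  zero    = refl
  half-cons false (suc k) rewrite +-suc k k = cong suc (half-cons false k)
  half-cons true  (suc k) rewrite +-suc k k = cong suc (half-cons true k)

  val-tail : ∀ bs → val (tail bs) ≡ ⌊ val bs /2⌋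
  val-tail []       = refl
  val-tail (b ∷ bs) = sym (half-cons b (val bs))

  odd : ℕ → Bool
  odd n = headOr false (toBits n)

  half-spec : ∀ n → n ≡ weightOf (odd n) + (⌊ n /2⌋ + ⌊ n /2⌋)
  half-spec n = subst (λ m → m ≡ weightOf (odd n) + (⌊ m /2⌋ + ⌊ m /2⌋)) (val-toBits n) (e (toBits n))
    where
    e : ∀ bs → val bs ≡ weightOf (headOr false bs) + (⌊ val bs /2⌋ + ⌊ val bs /2⌋)
    e []       = refl
    e (b ∷ bs) = cong (weightOf b +_) (cong₂ _+_ (sym (half-cons b (val bs))) (sym (half-cons b (val bs))))

  length-cons : ∀ b bs → length (cons b bs) ≤ suc (length bs)
  length-cons false []      = z≤n
  length-cons false (_ ∷ _) = ≤-refl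
  length-cons true  bs      = ≤-refl

  bitLength≤ : ∀ k {n} → n < 2 ^ k → bitLength n ≤ k
  bitLength≤ zero    {zero}  h = z≤n
  bitLength≤ zero    {suc n} (s≤s ())
  bitLength≤ (suc k) {n} h rewrite half-spec n =
    ≤-trans (≤-reflexive (cong length (toBits-cons (odd n) ⌊ n /2⌋))) (≤-trans (length-cons (odd n) _) (s≤s (bitLength≤ k half<)))
    where
    half< : ⌊ n /2⌋ < 2 ^ k
    half< = *-cancelˡ-< 2 ⌊ n /2⌋ (2 ^ k) (≤-trans (s≤s (≤-trans (≤-reflexive (cong (⌊ n /2⌋ +_) (+-identityʳ _)))
      (m≤n+m _ (weightOf (odd n))))) h)

  bitLength-mono : ∀ {m n} → m ≤ n → bitLength m ≤ bitLength n
  bitLength-mono {m} {n} le = bitLength≤ (bitLength n) (≤-trans (s≤s le) (<2^bitLength n))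

  2^-sum : ∀ {a b} k l → a < 2 ^ k → b < 2 ^ l → a + b < 2 ^ suc (k + l)
  2^-sum {a} {b} k l p q = ≤-trans (≤-trans (n≤1+n _) (≤-reflexive (sym (cong suc (+-suc a b))))) (≤-trans
    (+-mono-≤ (≤-trans p (^-monoʳ-≤ 2 (m≤m+n k l))) (≤-trans q (^-monoʳ-≤ 2 (m≤n+m l k))))
    (≤-reflexive (cong (2 ^ (k + l) +_) (sym (+-identityʳ _)))))

  bitLength-+ : ∀ m n → bitLength (m + n) ≤ suc (bitLength m + bitLength n)
  bitLength-+ m n = bitLength≤ _ (2^-sum (bitLength m) (bitLength n) (<2^bitLength m) (<2^bitLength n))

  sz-bits : ∀ bs → size (encBits bs) ≤ 1 + 4 * length bs
  sz-bits []       = ≤-refl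
  sz-bits (b ∷ bs) = ≤-trans (s≤s (+-mono-≤ (w b) (sz-bits bs))) (≤-reflexive (e (length bs)))
    where
    w : ∀ b → size (encBool b) ≤ 3
    w false = s≤s z≤n
    w true  = ≤-refl
    e : ∀ n → suc (3 + (1 + 4 * n)) ≡ 1 + 4 * suc n
    e = solve-∀

  length≤bits : ∀ bs → length bs ≤ size (encBits bs)
  length≤bits []       = z≤n
  length≤bits (b ∷ bs) = s≤s (≤-trans (length≤bits bs) (m≤n+m _ (size (encBool b))))

  bitLength≤sz : ∀ n → bitLength n ≤ sz bn n
  bitLength≤sz n = length≤bits (toBits n)

  ripple : Bool → Bool → List Bool → List Bool → List Bool
  carry  : Bool → Bool → List Bool → List Bool → Bool

  -- The carry of an addition, and the borrow of a subtraction when f is true.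
  carryBit : Bool → Bool → Bool → Bool → Bool
  carryBit f x y c = if x xor f then y ∨ c else y ∧ c

  ripple f c []       ys = []
  ripple f c (x ∷ xs) ys = (x xor (headOr false ys xor c)) ∷ ripple f (carryBit f x (headOr false ys) c) xs (tail ys)

  carry f c []       ys = c
  carry f c (x ∷ xs) ys = carry f (carryBit f x (headOr false ys) c) xs (tail ys)

  val-head-tail : ∀ ys → val ys ≡ weightOf (headOr false ys) + (val (tail ys) + val (tail ys))
  val-head-tail []       = refl
  val-head-tail (y ∷ ys) = refl

  private
    adder : ∀ x y c → weightOf (x xor (y xor c)) + 2 * weightOf (carryBit false x y c) ≡ weightOf x + weightOf y + weightOf c
    adder false false false = refl
    adder false false true  = refl
    adder false true  false = refl
    adder false true  true  = refl
    adder true  false false = refl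
    adder true  false true  = refl
    adder true  true  false = refl
    adder true  true  true  = refl

    subtractor : ∀ x y c → weightOf (x xor (y xor c)) + weightOf y + weightOf c ≡ weightOf x + 2 * weightOf (carryBit true x y c)
    subtractor false false false = refl
    subtractor false false true  = refl
    subtractor false true  false = refl
    subtractor false true  true  = refl
    subtractor true  false false = refl
    subtractor true  false true  = refl
    subtractor true  true  false = refl
    subtractor true  true  true  = refl

  length-tail : ∀ {A : Set} (ys : List A) {n} → length ys ≤ suc n → length (tail ys) ≤ n
  length-tail []       h = z≤n
  length-tail (y ∷ ys) (s≤s h) = h

  -- The digit identity `adder` is applied at the lowest position and the rest is doubled; the carry
  -- that remains weighs `2 ^ length xs`. The recursion is on `xs`, so the length condition
  -- guarantees that no digit of `ys` is lost.
  ripple-add : ∀ c xs ys → length ys ≤ length xs →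
    val (ripple false c xs ys) + 2 ^ length xs * weightOf (carry false c xs ys) ≡ val xs + val ys + weightOf c
  ripple-add c []       []       _ = +-identityʳ _
  ripple-add c []       (_ ∷ _)  ()
  ripple-add c (x ∷ xs) ys le = begin
    s + (r + r) + (p + (p + 0)) * k          ≡⟨ e₁ s r p k ⟩
    s + 2 * (r + p * k)                      ≡⟨ cong (λ t → s + 2 * t) (ripple-add c′ xs (tail ys) (length-tail ys le)) ⟩
    s + 2 * (val xs + val (tail ys) + w c′)  ≡⟨ e₂ s (w c′) (val xs) (val (tail ys)) ⟩
    (s + 2 * w c′) + 2 * (val xs + val (tail ys)) ≡⟨ cong (_+ 2 * (val xs + val (tail ys))) (adder x (headOr false ys) c) ⟩
    (w x + w (headOr false ys) + w c) + 2 * (val xs + val (tail ys)) ≡⟨ e₃ (w x) (w (headOr false ys)) (w c) (val xs) (val (tail ys)) ⟩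
    w x + (val xs + val xs) + (w (headOr false ys) + (val (tail ys) + val (tail ys))) + w c
      ≡⟨ cong (λ t → w x + (val xs + val xs) + t + w c) (sym (val-head-tail ys)) ⟩
    w x + (val xs + val xs) + val ys + w c   ∎
    where
    open ≡-Reasoning
    w = weightOf
    c′ = carryBit false x (headOr false ys) c
    s = w (x xor (headOr false ys xor c))
    r = val (ripple false c′ xs (tail ys))
    p = 2 ^ length xs
    k = w (carry false c′ xs (tail ys))
    e₁ : ∀ s r p k → s + (r + r) + (p + (p + 0)) * k ≡ s + 2 * (r + p * k)
    e₁ = solve-∀
    e₂ : ∀ s c x y → s + 2 * (x + y + c) ≡ (s + 2 * c) + 2 * (x + y)
    e₂ = solve-∀
    e₃ : ∀ a b c x y → (a + b + c) + 2 * (x + y) ≡ a + (x + x) + (b + (y + y)) + c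
    e₃ = solve-∀

  ripple-sub : ∀ c xs ys → length ys ≤ length xs →
    val (ripple true c xs ys) + val ys + weightOf c ≡ val xs + 2 ^ length xs * weightOf (carry true c xs ys)
  ripple-sub c []       []       _ = sym (+-identityʳ _)
  ripple-sub c []       (_ ∷ _)  ()
  ripple-sub c (x ∷ xs) ys le = begin
    s + (r + r) + val ys + w c ≡⟨ cong (λ t → s + (r + r) + t + w c) (val-head-tail ys) ⟩
    s + (r + r) + (h + (t + t)) + w c ≡⟨ e₁ s r h t (w c) ⟩
    (s + h + w c) + 2 * (r + t) ≡⟨ cong (_+ 2 * (r + t)) (subtractor x y c) ⟩
    (w x + 2 * w c′) + 2 * (r + t) ≡⟨ e₂ (w x) (w c′) r t ⟩
    w x + 2 * (r + t + w c′) ≡⟨ cong (λ u → w x + 2 * u) (ripple-sub c′ xs (tail ys) (length-tail ys le)) ⟩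
    w x + 2 * (val xs + p * k) ≡⟨ e₃ (w x) (val xs) p k ⟩
    w x + (val xs + val xs) + (p + (p + 0)) * k ∎
    where
    open ≡-Reasoning
    w = weightOf
    y = headOr false ys
    h = w y
    t = val (tail ys)
    c′ = carryBit true x y c
    s = w (x xor (y xor c))
    r = val (ripple true c′ xs (tail ys))
    p = 2 ^ length xs
    k = w (carry true c′ xs (tail ys))
    e₁ : ∀ s r h t c → s + (r + r) + (h + (t + t)) + c ≡ (s + h + c) + 2 * (r + t)
    e₁ = solve-∀
    e₂ : ∀ x c r t → (x + 2 * c) + 2 * (r + t) ≡ x + 2 * (r + t + c)
    e₂ = solve-∀
    e₃ : ∀ a x p k → a + 2 * (x + p * k) ≡ a + (x + x) + (p + (p + 0)) * k
    e₃ = solve-∀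

  length-ripple : ∀ f c xs ys → length (ripple f c xs ys) ≡ length xs
  length-ripple f c []       ys = refl
  length-ripple f c (x ∷ xs) ys = cong suc (length-ripple f _ xs (tail ys))

  val-++ : ∀ xs ys → val (xs ++ ys) ≡ val xs + 2 ^ length xs * val ys
  val-++ []       ys = sym (+-identityʳ _)
  val-++ (x ∷ xs) ys rewrite val-++ xs ys = e (weightOf x) (val xs) (2 ^ length xs) (val ys)
    where
    e : ∀ w x p y → w + (x + p * y + (x + p * y)) ≡ w + (x + x) + (p + (p + 0)) * y
    e = solve-∀

  zeros : List Bool → List Bool
  zeros = map (λ _ → false)

  val-zeros : ∀ xs → val (zeros xs) ≡ 0
  val-zeros []       = refl
  val-zeros (x ∷ xs) rewrite val-zeros xs = refl

  padded : List Bool → List Bool → List Bool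
  padded xs ys = xs ++ zeros ys

  val-padded : ∀ xs ys → val (padded xs ys) ≡ val xs
  val-padded xs ys rewrite val-++ xs (zeros ys) | val-zeros ys | *-zeroʳ (2 ^ length xs) = +-identityʳ _

  length-padded : ∀ xs ys → length ys ≤ length (padded xs ys)
  length-padded xs ys rewrite length-++ xs {zeros ys} | length-map (λ _ → false) ys = m≤n+m _ _

  add-spec : ∀ xs ys → val (ripple false false (padded xs ys) ys ++ carry false false (padded xs ys) ys ∷ []) ≡ val xs + val ys
  add-spec xs ys with h ← ripple-add false (padded xs ys) ys (length-padded xs ys)
    rewrite val-++ (ripple false false (padded xs ys) ys) (carry false false (padded xs ys) ys ∷ [])
          | length-ripple false false (padded xs ys) ys
          | +-identityʳ (weightOf (carry false false (padded xs ys) ys))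
    = trans h (trans (+-identityʳ _) (cong (_+ val ys) (val-padded xs ys)))

  sub-spec : ∀ xs ys → (if carry true false (padded xs ys) ys then 0 else val (ripple true false (padded xs ys) ys)) ≡ val xs ∸ val ys
  sub-spec xs ys with carry true false (padded xs ys) ys | ripple-sub false (padded xs ys) ys (length-padded xs ys)
  ... | false | h = trans (sym (m+n∸n≡m _ (val ys))) (cong (_∸ val ys) (trans (trans (sym (+-identityʳ _)) h)
      (trans (cong (val (padded xs ys) +_) (*-zeroʳ (2 ^ length (padded xs ys)))) (trans (+-identityʳ _) (val-padded xs ys)))))
  -- A borrow is left over. The digits of the result represent a number below `p`, so the equation
  -- of `ripple-sub` forces `val xs < val ys`, and the truncated difference is 0.
  ... | true | h  = sym (m≤n⇒m∸n≡0 (<⇒≤ (+-cancelˡ-< p _ _ (begin-strict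
      p + val xs                              ≡⟨ +-comm p _ ⟩
      val xs + p                              ≡⟨ cong₂ _+_ (sym (val-padded xs ys)) (sym (*-identityʳ p)) ⟩
      val (padded xs ys) + p * 1              ≡⟨ sym h ⟩
      val r + val ys + 0                      ≡⟨ +-identityʳ _ ⟩
      val r + val ys                          <⟨ +-monoˡ-< (val ys) (subst (λ n → val r < 2 ^ n) (length-ripple true false (padded xs ys) ys) (val< r)) ⟩
      p + val ys                              ∎))))
    where
    open ≤-Reasoning
    p = 2 ^ length (padded xs ys)
    r = ripple true false (padded xs ys) ys

-- Polynomial-time arithmetic on binary naturals and integers

module PolyTimeArithmetic where

  open TreeStack
  open PolyTime
  open PolyTimeFold
  open PolyTimeList
  open Binary
  open import Data.Integer as ℤ using (ℤ; -[1+_]; _⊖_; ∣_∣) renaming (+_ to pos)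
  import Data.Integer.Properties as ℤ
  open import Data.Nat using (ℕ; zero; suc; _+_; _*_; _∸_; _^_; _≤_; _<_; z≤n; s≤s; ⌊_/2⌋)
  open import Data.Nat.Properties
  open import Data.Nat.Tactic.RingSolver using (solve-∀)

  sz-bool : ∀ b → sz bool b ≤ 3
  sz-bool false = s≤s z≤n
  sz-bool true  = ≤-refl

  sz-tail : ∀ σ xs → sz (list σ) (tail xs) ≤ sz (list σ) xs
  sz-tail σ []       = ≤-refl
  sz-tail σ (x ∷ xs) = m≤n⇒m≤1+n (m≤n+m _ (sz σ x))

  module _ {γ : Ty} where

    abstract
      pt-toBits : ∀ {n : ⟦ γ ⟧ → ℕ} → PT {γ} {bn} n → PT {γ} {list bool} (λ g → toBits (n g))
      pt-toBits = pt-∘ (pt-retype {bn} {list bool} {toBits} λ n → encBits-list (toBits n))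

      pt-val : ∀ {bs : ⟦ γ ⟧ → List Bool} → PT {γ} {list bool} bs → PT {γ} {bn} (λ g → val (bs g))
      pt-val {bs} p = pt-∘ trimmed p
        where
        step : PT {(list bool ⊗ list bool) ⊗ bool} {list bool} (λ ((_ , s) , x) → cons x s)
        step = pt-ext (λ ((_ , s) , x) → e x s)
          (pt-if pt-snd (pt-cons pt-snd (pt-∘ pt-snd pt-fst))
            (pt-if (pt-null (pt-∘ pt-snd pt-fst)) (pt-const {σ = list bool} []) (pt-cons pt-snd (pt-∘ pt-snd pt-fst))))
          where
          e : ∀ x s → (if x then x ∷ s else if null s then [] else x ∷ s) ≡ cons x s
          e false []      = refl
          e false (_ ∷ _) = refl
          e true  s       = refl
        grow : ∀ x s → sz (list bool) (cons x s) ≤ 4 + sz (list bool) s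
        grow false []      = s≤s z≤n
        grow false (y ∷ s) = +-monoˡ-≤ (sz (list bool) (y ∷ s)) {2} {4} (s≤s (s≤s z≤n))
        grow true  s       = ≤-refl
        trim : PT {list bool} {list bool} (foldr cons [])
        trim = pt-ext (λ bs → trans (sym (reverse-foldr cons [] (reverse bs))) (cong (foldr cons []) (reverse-involutive bs)))
          (pt-foldl⁺ {list bool} {bool} {list bool} {λ ((_ , s) , x) → cons x s} step (pt-reverse pt-id) (pt-const {σ = list bool} []) (con 4)
            λ g s x → ≤-trans (grow x s) (≤-reflexive (+-comm 4 _)))
        trimmed : PT {list bool} {bn} val
        trimmed = pt-recode (λ bs → trans (cong (enc (list bool)) (toBits-val bs)) (sym (encBits-list (toBits (val bs))))) trim

      pt-xor : ∀ {b c : ⟦ γ ⟧ → Bool} → PT {γ} {bool} b → PT {γ} {bool} c → PT {γ} {bool} (λ g → b g xor c g)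
      pt-xor {b} {c} p q = pt-ext (λ g → e (b g) (c g)) (pt-if p (pt-not q) q)
        where
        e : ∀ b c → (if b then not c else c) ≡ b xor c
        e false c = refl
        e true  c = refl

      pt-carryBit : ∀ f {x y c : ⟦ γ ⟧ → Bool} → PT {γ} {bool} x → PT {γ} {bool} y → PT {γ} {bool} c →
                    PT {γ} {bool} (λ g → carryBit f (x g) (y g) (c g))
      pt-carryBit f p q r = pt-if (pt-xor p (pt-const {σ = bool} f)) (pt-∨ q r) (pt-∧ q r)

  rippleTy : Ty
  rippleTy = (bool ⊗ list bool) ⊗ list bool

  Ripple : Set
  Ripple = ⟦ rippleTy ⟧

  ripple-step : Bool → Ripple → Bool → Ripple
  ripple-step f ((c , ys) , zs) x =
    (carryBit f x (headOr false ys) c , tail ys) , (x xor (headOr false ys xor c)) ∷ zs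

  ripple-foldl : ∀ f c xs ys zs → let s = foldl (ripple-step f) ((c , ys) , zs) xs in
    proj₁ (proj₁ s) ≡ carry f c xs ys × reverse (proj₂ s) ≡ reverse zs ++ ripple f c xs ys
  ripple-foldl f c []       ys zs = refl , sym (++-identityʳ _)
  ripple-foldl f c (x ∷ xs) ys zs with ripple-foldl f (carryBit f x (headOr false ys) c) xs (tail ys) ((x xor (headOr false ys xor c)) ∷ zs)
  ... | e₁ , e₂ = e₁ , trans e₂ (trans (cong (_++ ripple f (carryBit f x (headOr false ys) c) xs (tail ys)) (unfold-reverse _ zs)) (++-assoc (reverse zs) _ _))

  module _ {γ : Ty} where

    abstract
      pt-ripple : ∀ f {xs ys : ⟦ γ ⟧ → List Bool} → PT {γ} {list bool} xs → PT {γ} {list bool} ys →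
                  PT {γ} {rippleTy} (λ g → foldl (ripple-step f) ((false , ys g) , []) (xs g))
      pt-ripple f p q = pt-foldl⁺ {γ} {bool} {rippleTy} {λ ((_ , s) , x) → ripple-step f s x}
        (pt-pair (pt-pair (pt-carryBit f pt-snd y c) (pt-tail ys)) (pt-cons (pt-xor pt-snd (pt-xor y c)) (pt-∘ pt-snd (pt-∘ pt-snd pt-fst))))
        p (pt-pair (pt-pair (pt-const {σ = bool} false) q) (pt-const {σ = list bool} [])) (con 6)
        λ g s x → grow s x
        where
        c : PT {(γ ⊗ rippleTy) ⊗ bool} {bool} (λ ((_ , ((c , _) , _)) , _) → c)
        c = pt-∘ pt-fst (pt-∘ pt-fst (pt-∘ pt-snd pt-fst))
        ys : PT {(γ ⊗ rippleTy) ⊗ bool} {list bool} (λ ((_ , ((_ , ys) , _)) , _) → ys)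
        ys = pt-∘ pt-snd (pt-∘ pt-fst (pt-∘ pt-snd pt-fst))
        y : PT {(γ ⊗ rippleTy) ⊗ bool} {bool} (λ ((_ , ((_ , ys) , _)) , _) → headOr false ys)
        y = pt-headOr false ys
        grow : ∀ s x → sz rippleTy (ripple-step f s x) ≤ sz rippleTy s + 6
        grow ((c , ys) , zs) x = ≤-trans
          (s≤s (+-mono-≤ (s≤s (+-mono-≤ (sz-bool (carryBit f x (headOr false ys) c)) (sz-tail bool ys)))
            (s≤s (+-monoˡ-≤ (sz (list bool) zs) (sz-bool (x xor (headOr false ys xor c)))))))
          (≤-trans (≤-reflexive (e (sz (list bool) ys) (sz (list bool) zs)))
            (+-monoˡ-≤ 6 (s≤s (+-monoˡ-≤ (sz (list bool) zs) (s≤s (+-monoˡ-≤ (sz (list bool) ys) (sz>0 bool c)))))))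
          where
          e : ∀ y z → suc (suc (3 + y) + suc (3 + z)) ≡ suc (suc (1 + y) + z) + 6
          e = solve-∀

      private
        pt-padded : ∀ {xs ys : ⟦ γ ⟧ → List Bool} → PT {γ} {list bool} xs → PT {γ} {list bool} ys →
                    PT {γ} {list bool} (λ g → padded (xs g) (ys g))
        pt-padded p q = pt-++ p (pt-map (pt-const {σ = bool} false) q)

      pt-+ᵇ : ∀ {m n : ⟦ γ ⟧ → ℕ} → PT {γ} {bn} m → PT {γ} {bn} n → PT {γ} {bn} (λ g → m g + n g)
      pt-+ᵇ {m} {n} p q = pt-ext (λ g → e (m g) (n g))
        (pt-∘ (pt-val {rippleTy} (pt-reverse (pt-cons (pt-∘ pt-fst pt-fst) pt-snd)))
          (pt-ripple false (pt-padded (pt-toBits p) (pt-toBits q)) (pt-toBits q)))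
        where
        e : ∀ m n → let s = foldl (ripple-step false) ((false , toBits n) , []) (padded (toBits m) (toBits n)) in
            val (reverse (proj₁ (proj₁ s) ∷ proj₂ s)) ≡ m + n
        e m n with foldl (ripple-step false) ((false , toBits n) , []) (padded (toBits m) (toBits n))
                 | ripple-foldl false false (padded (toBits m) (toBits n)) (toBits n) []
        ... | (c , _) , zs | e₁ , e₂ = trans (cong val (trans (unfold-reverse c zs) (cong₂ (λ l b → l ++ b ∷ []) e₂ e₁)))
          (trans (add-spec (toBits m) (toBits n)) (cong₂ _+_ (val-toBits m) (val-toBits n)))

      pt-∸ᵇ : ∀ {m n : ⟦ γ ⟧ → ℕ} → PT {γ} {bn} m → PT {γ} {bn} n → PT {γ} {bn} (λ g → m g ∸ n g)
      pt-∸ᵇ {m} {n} p q = pt-ext (λ g → e (m g) (n g))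
        (pt-∘ (pt-if {rippleTy} {bn} (pt-∘ pt-fst pt-fst) (pt-const {σ = bn} 0) (pt-val (pt-reverse pt-snd)))
          (pt-ripple true (pt-padded (pt-toBits p) (pt-toBits q)) (pt-toBits q)))
        where
        e : ∀ m n → let s = foldl (ripple-step true) ((false , toBits n) , []) (padded (toBits m) (toBits n)) in
            (if proj₁ (proj₁ s) then 0 else val (reverse (proj₂ s))) ≡ m ∸ n
        e m n with foldl (ripple-step true) ((false , toBits n) , []) (padded (toBits m) (toBits n))
                 | ripple-foldl true false (padded (toBits m) (toBits n)) (toBits n) []
        ... | (c , _) , zs | e₁ , e₂ = trans (cong₂ (λ l b → if b then 0 else val l) e₂ e₁)
          (trans (sub-spec (toBits m) (toBits n)) (cong₂ _∸_ (val-toBits m) (val-toBits n)))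

      pt-half : ∀ {n : ⟦ γ ⟧ → ℕ} → PT {γ} {bn} n → PT {γ} {bn} (λ g → ⌊ n g /2⌋)
      pt-half {n} p = pt-ext (λ g → trans (val-tail (toBits (n g))) (cong ⌊_/2⌋ (val-toBits (n g)))) (pt-val (pt-tail (pt-toBits p)))

      pt-double : ∀ {n : ⟦ γ ⟧ → ℕ} → PT {γ} {bn} n → PT {γ} {bn} (λ g → n g + n g)
      pt-double p = pt-+ᵇ p p

      pt-zero? : ∀ {n : ⟦ γ ⟧ → ℕ} → PT {γ} {bn} n → PT {γ} {bool} (λ g → null (toBits (n g)))
      pt-zero? p = pt-null (pt-toBits p)

  horner : ℕ → ℕ → Bool → ℕ
  horner y s b = (s + s) + (if b then y else 0)

  horner-foldl : ∀ y bs → foldl (horner y) 0 (reverse bs) ≡ val bs * y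
  horner-foldl y bs = trans (sym (reverse-foldr (λ b s → horner y s b) 0 (reverse bs)))
    (trans (cong (foldr (λ b s → horner y s b) 0) (reverse-involutive bs)) (e bs))
    where
    e : ∀ bs → foldr (λ b s → horner y s b) 0 bs ≡ val bs * y
    e []           = refl
    e (false ∷ bs) rewrite e bs = trans (+-identityʳ _) (sym (*-distribʳ-+ y (val bs) (val bs)))
    e (true ∷ bs)  rewrite e bs = trans (+-comm _ y) (cong (y +_) (sym (*-distribʳ-+ y (val bs) (val bs))))

  sz-bn : ∀ n → sz bn n ≤ 1 + 4 * bitLength n
  sz-bn n = sz-bits (toBits n)

  bitLength-double : ∀ n → bitLength (n + n) ≤ suc (bitLength n)
  bitLength-double n = bitLength≤ _ (≤-trans (≤-trans (n≤1+n _) (≤-reflexive (sym (cong suc (+-suc n n)))))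
    (≤-trans (+-mono-≤ (<2^bitLength n) (<2^bitLength n)) (≤-reflexive (cong (2 ^ bitLength n +_) (sym (+-identityʳ _))))))

  module _ {γ : Ty} where

    abstract
      -- Horner's scheme from the most significant bit. The measure is the bit length instead of the
      -- size of the encoding: a step changes digits, and `true` has a larger tree than `false`,
      -- whereas the length grows only by an amount depending on the second factor.
      pt-*ᵇ : ∀ {m n : ⟦ γ ⟧ → ℕ} → PT {γ} {bn} m → PT {γ} {bn} n → PT {γ} {bn} (λ g → m g * n g)
      pt-*ᵇ {m} {n} p q = pt-ext (λ g → trans (horner-foldl (n g) (toBits (m g))) (cong (_* n g) (val-toBits (m g))))
        (pt-foldlᵐ {γ} {bool} {bn} {λ ((g , s) , b) → horner (n g) s b}
          (pt-+ᵇ (pt-double (pt-∘ pt-snd pt-fst)) (pt-if pt-snd (pt-∘ q (pt-∘ pt-fst pt-fst)) (pt-const {σ = bn} 0)))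
          (pt-reverse (pt-toBits p)) (pt-const {σ = bn} 0)
          bitLength (con 1 ⊞ con 4 ⊠ var) (con 0) (con 2 ⊞ out q) sz-bn (λ _ → z≤n)
          λ g s b → ≤-trans (grow (n g) s b) (+-monoʳ-≤ (bitLength s)
            (s≤s (s≤s (≤-trans (≤-trans (bitLength≤sz (n g)) (sz-out q g)) (eval-mono (out q) (m≤m+n (sz γ g) (sz bool b))))))))
        where
        grow : ∀ y s b → bitLength (horner y s b) ≤ bitLength s + (2 + bitLength y)
        grow y s b = ≤-trans (bitLength-+ (s + s) (if b then y else 0))
          (≤-trans (s≤s (+-mono-≤ (bitLength-double s) (le b))) (≤-reflexive (e (bitLength s) (bitLength y))))
          where
          le : ∀ b → bitLength (if b then y else 0) ≤ bitLength y
          le false = z≤n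
          le true  = ≤-refl
          e : ∀ s y → suc (suc s + y) ≡ s + (2 + y)
          e = solve-∀

      pt-un→bn : ∀ {n : ⟦ γ ⟧ → ℕ} → PT {γ} {un} n → PT {γ} {bn} n
      pt-un→bn {n} p = pt-ext (λ g → e (n g)) (pt-fold {γ} {bn} {λ y → 1 + proj₂ y} (pt-+ᵇ (pt-const {σ = bn} 1) pt-snd)
        p (pt-const {σ = bn} 0) (con 1 ⊞ con 4 ⊠ out p) λ g k k≤n → ≤-trans (≤-reflexive (cong (sz bn) (e k)))
          (≤-trans (sz-bn k) (s≤s (*-monoʳ-≤ 4 (≤-trans (bitLength≤ k (k<2^k k)) (≤-trans k≤n (≤-trans (≤sz-un (n g)) (sz-out p g))))))))
        where
        e : ∀ n → fold 0 suc n ≡ n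
        e zero    = refl
        e (suc n) = cong suc (e n)
        k<2^k : ∀ k → k < 2 ^ k
        k<2^k zero    = s≤s z≤n
        k<2^k (suc k) = ≤-trans (s≤s (k<2^k k)) (≤-trans (+-monoˡ-≤ (2 ^ k) (m^n>0 2 k)) (≤-reflexive (cong (2 ^ k +_) (sym (+-identityʳ _)))))

  ⁺-⊖ : ∀ m n → (m ⊖ n) ⁺ ≡ m ∸ n
  ⁺-⊖ zero    zero    = refl
  ⁺-⊖ (suc m) zero    = refl
  ⁺-⊖ zero    (suc n) = refl
  ⁺-⊖ (suc m) (suc n) rewrite ℤ.[1+m]⊖[1+n]≡m⊖n m n = ⁺-⊖ m n

  ⁻-⊖ : ∀ m n → (m ⊖ n) ⁻ ≡ n ∸ m
  ⁻-⊖ zero    zero    = refl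
  ⁻-⊖ (suc m) zero    = refl
  ⁻-⊖ zero    (suc n) = refl
  ⁻-⊖ (suc m) (suc n) rewrite ℤ.[1+m]⊖[1+n]≡m⊖n m n = ⁻-⊖ m n

  +-⊖ : ∀ a b → (a ⁺ + b ⁺) ⊖ (a ⁻ + b ⁻) ≡ a ℤ.+ b
  +-⊖ (pos m)    (pos n)    = refl
  +-⊖ (pos m)    (-[1+ n ]) = cong (_⊖ suc n) (+-identityʳ m)
  +-⊖ (-[1+ m ]) (pos n)    = cong (n ⊖_) (+-identityʳ (suc m))
  +-⊖ (-[1+ m ]) (-[1+ n ]) = cong (-[1+_]) (+-suc m n)

  -- Integers are stored as positive and negative part, of which one is 0; the product expands like
  -- that of two differences, and `pt-⊖` restores this normal form.
  *-⊖ : ∀ a b → (a ⁺ * b ⁺ + a ⁻ * b ⁻) ⊖ (a ⁺ * b ⁻ + a ⁻ * b ⁺) ≡ a ℤ.* b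
  *-⊖ (pos m) (pos n) rewrite +-identityʳ (m * n) | *-zeroʳ m = ℤ.pos-* m n
  *-⊖ (pos m) (-[1+ n ]) rewrite *-zeroʳ m | +-identityʳ (m * suc n) with m
  ... | zero  = refl
  ... | suc k = refl
  *-⊖ (-[1+ m ]) (pos n) rewrite *-zeroʳ m with n
  ... | zero  rewrite *-zeroʳ m = refl
  ... | suc k = refl
  *-⊖ (-[1+ m ]) (-[1+ n ]) rewrite *-zeroʳ m = refl

  nonPositive : ℤ → Bool
  nonPositive z = null (toBits (z ⁺))

  sz-int : ∀ z → sz int z ≤ 3 + 8 * bitLength ∣ z ∣
  sz-int (pos n)    = ≤-trans (s≤s (+-monoˡ-≤ 1 (sz-bn n))) (≤-by (4 * bitLength n) (e (bitLength n)))
    where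
    e : ∀ l → suc (1 + 4 * l + 1) + 4 * l ≡ 3 + 8 * l
    e = solve-∀
  sz-int (-[1+ n ]) = ≤-trans (s≤s (s≤s (sz-bn (suc n)))) (≤-by (4 * bitLength (suc n)) (e (bitLength (suc n))))
    where
    e : ∀ l → suc (suc (1 + 4 * l)) + 4 * l ≡ 3 + 8 * l
    e = solve-∀

  bitLength≤sz-int : ∀ z → bitLength ∣ z ∣ ≤ sz int z
  bitLength≤sz-int (pos n)    = ≤-trans (bitLength≤sz n) (≤-trans (m≤m+n _ 1) (n≤1+n _))
  bitLength≤sz-int (-[1+ n ]) = ≤-trans (bitLength≤sz (suc n)) (m≤n+m _ 2)

  module _ {γ : Ty} where

    abstract
      pt-⁺ : ∀ {z : ⟦ γ ⟧ → ℤ} → PT {γ} {int} z → PT {γ} {bn} (λ g → z g ⁺)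
      pt-⁺ p = pt-∘ pt-fst (pt-∘ (pt-retype {int} {bn ⊗ bn} {λ z → z ⁺ , z ⁻} λ _ → refl) p)

      pt-⁻ : ∀ {z : ⟦ γ ⟧ → ℤ} → PT {γ} {int} z → PT {γ} {bn} (λ g → z g ⁻)
      pt-⁻ p = pt-∘ pt-snd (pt-∘ (pt-retype {int} {bn ⊗ bn} {λ z → z ⁺ , z ⁻} λ _ → refl) p)

      pt-⊖ : ∀ {m n : ⟦ γ ⟧ → ℕ} → PT {γ} {bn} m → PT {γ} {bn} n → PT {γ} {int} (λ g → m g ⊖ n g)
      pt-⊖ {m} {n} p q = pt-recode
        (λ g → sym (cong₂ node (cong (encBits ∘ toBits) (⁺-⊖ (m g) (n g))) (cong (encBits ∘ toBits) (⁻-⊖ (m g) (n g)))))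
        (pt-pair {τ = bn} (pt-∸ᵇ p q) (pt-∸ᵇ q p))

      pt-+ : ∀ {a b : ⟦ γ ⟧ → ℤ} → PT {γ} {int} a → PT {γ} {int} b → PT {γ} {int} (λ g → a g ℤ.+ b g)
      pt-+ {a} {b} p q = pt-ext (λ g → +-⊖ (a g) (b g)) (pt-⊖ (pt-+ᵇ (pt-⁺ p) (pt-⁺ q)) (pt-+ᵇ (pt-⁻ p) (pt-⁻ q)))

      pt-* : ∀ {a b : ⟦ γ ⟧ → ℤ} → PT {γ} {int} a → PT {γ} {int} b → PT {γ} {int} (λ g → a g ℤ.* b g)
      pt-* {a} {b} p q = pt-ext (λ g → *-⊖ (a g) (b g))
        (pt-⊖ (pt-+ᵇ (pt-*ᵇ (pt-⁺ p) (pt-⁺ q)) (pt-*ᵇ (pt-⁻ p) (pt-⁻ q))) (pt-+ᵇ (pt-*ᵇ (pt-⁺ p) (pt-⁻ q)) (pt-*ᵇ (pt-⁻ p) (pt-⁺ q))))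

      pt-pos : ∀ {n : ⟦ γ ⟧ → ℕ} → PT {γ} {bn} n → PT {γ} {int} (λ g → pos (n g))
      pt-pos p = pt-⊖ p (pt-const {σ = bn} 0)

      pt-nonPositive : ∀ {z : ⟦ γ ⟧ → ℤ} → PT {γ} {int} z → PT {γ} {bool} (λ g → nonPositive (z g))
      pt-nonPositive p = pt-zero? (pt-⁺ p)

-- Integer inequalities, finite sums and vectors

module Sums where

  open import Data.Integer using (ℤ; -[1+_]; +≤+; +<+; 0ℤ; 1ℤ; _+_; _*_; _-_; -_; _≤_; _<_; ∣_∣) renaming (+_ to pos)
  open import Data.Integer.Properties
  open import Data.Integer.Tactic.RingSolver using (solve-∀)
  open import Data.Nat as ℕ using (ℕ; zero; suc; z≤n; s≤s; _≡ᵇ_)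
  import Data.Nat.Properties as ℕ

  0≤+ : ∀ {a b} → 0ℤ ≤ a → 0ℤ ≤ b → 0ℤ ≤ a + b
  0≤+ = +-mono-≤

  0≤* : ∀ {a b} → 0ℤ ≤ a → 0ℤ ≤ b → 0ℤ ≤ a * b
  0≤* {pos m} {pos n} _ _ = subst (0ℤ ≤_) (pos-* m n) (+≤+ z≤n)

  0≤pos : ∀ n → 0ℤ ≤ pos n
  0≤pos n = +≤+ z≤n

  0≤square : ∀ a → 0ℤ ≤ a * a
  0≤square (pos n)    = 0≤* (0≤pos n) (0≤pos n)
  0≤square (-[1+ n ]) = +≤+ z≤n

  gap : ∀ {a b} → a ≤ b → 0ℤ ≤ b - a
  gap = i≤j⇒0≤j-i

  -- Replaces division in all estimates below: a positive multiple of the wanted difference is shown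
  -- to be a nonnegative combination of known gaps, where the equality is an instance of the ring
  -- solver.
  cancel-0≤ : ∀ c {a} → 0ℤ < c → 0ℤ ≤ c * a → 0ℤ ≤ a
  cancel-0≤ (pos (suc c)) {pos n}    _ _ = 0≤pos n
  cancel-0≤ (pos (suc c)) { -[1+ n ]} _ ()
  cancel-0≤ (pos zero) (+<+ ()) _

  cancel-≤ : ∀ c {a b} → 0ℤ < c → c * a ≤ c * b → a ≤ b
  cancel-≤ c {a} {b} 0<c h = 0≤i-j⇒j≤i (cancel-0≤ c 0<c (subst (0ℤ ≤_) (e c a b) (gap h)))
    where
    e : ∀ c a b → c * b - c * a ≡ c * (b - a)
    e = solve-∀

  0<* : ∀ {a b} → 0ℤ < a → 0ℤ < b → 0ℤ < a * b
  0<* {pos (suc m)} {pos (suc n)} _ _ = +<+ (s≤s z≤n)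
  0<* {pos zero} (+<+ ()) _
  0<* {pos (suc m)} {pos zero} _ (+<+ ())

  *≡0 : ∀ {a b} → a ≢ 0ℤ → a * b ≡ 0ℤ → b ≡ 0ℤ
  *≡0 {a} a≢0 e with i*j≡0⇒i≡0∨j≡0 a e
  ... | inj₁ a≡0 = ⊥-elim (a≢0 a≡0)
  ... | inj₂ b≡0 = b≡0

  δ : ℕ → ℕ → ℤ
  δ i j = if i ≡ᵇ j then 1ℤ else 0ℤ

  ≡ᵇ-refl : ∀ i → (i ≡ᵇ i) ≡ true
  ≡ᵇ-refl zero    = refl
  ≡ᵇ-refl (suc i) = ≡ᵇ-refl i

  ≢⇒≡ᵇ-false : ∀ i j → i ≢ j → (i ≡ᵇ j) ≡ false
  ≢⇒≡ᵇ-false zero    zero    ne = ⊥-elim (ne refl)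
  ≢⇒≡ᵇ-false zero    (suc j) ne = refl
  ≢⇒≡ᵇ-false (suc i) zero    ne = refl
  ≢⇒≡ᵇ-false (suc i) (suc j) ne = ≢⇒≡ᵇ-false i j λ e → ne (cong suc e)

  δ-refl : ∀ i → δ i i ≡ 1ℤ
  δ-refl i rewrite ≡ᵇ-refl i = refl

  δ-≢ : ∀ {i j} → i ≢ j → δ i j ≡ 0ℤ
  δ-≢ {i} {j} ne rewrite ≢⇒≡ᵇ-false i j ne = refl

  ≡ᵇ-sym : ∀ i j → (i ≡ᵇ j) ≡ (j ≡ᵇ i)
  ≡ᵇ-sym zero    zero    = refl
  ≡ᵇ-sym zero    (suc j) = refl
  ≡ᵇ-sym (suc i) zero    = refl
  ≡ᵇ-sym (suc i) (suc j) = ≡ᵇ-sym i j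

  δ-sym : ∀ i j → δ i j ≡ δ j i
  δ-sym i j rewrite ≡ᵇ-sym i j = refl

  Σ : ℕ → (ℕ → ℤ) → ℤ
  Σ zero    f = 0ℤ
  Σ (suc n) f = Σ n f + f n

  private
    ext : ∀ {n} {P : ℕ → Set} → (∀ i → i ℕ.< suc n → P i) → ∀ i → i ℕ.< n → P i
    ext h i i<n = h i (ℕ.m≤n⇒m≤1+n i<n)

  Σ-cong : ∀ n {f g} → (∀ i → i ℕ.< n → f i ≡ g i) → Σ n f ≡ Σ n g
  Σ-cong zero    h = refl
  Σ-cong (suc n) h = cong₂ _+_ (Σ-cong n (ext h)) (h n ℕ.≤-refl)

  Σ-mono : ∀ n {f g} → (∀ i → i ℕ.< n → f i ≤ g i) → Σ n f ≤ Σ n g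
  Σ-mono zero    h = ≤-refl
  Σ-mono (suc n) h = +-mono-≤ (Σ-mono n (ext h)) (h n ℕ.≤-refl)

  Σ-zero : ∀ n {f} → (∀ i → i ℕ.< n → f i ≡ 0ℤ) → Σ n f ≡ 0ℤ
  Σ-zero zero    h = refl
  Σ-zero (suc n) h = cong₂ _+_ (Σ-zero n (ext h)) (h n ℕ.≤-refl)

  Σ-nonneg : ∀ n {f} → (∀ i → i ℕ.< n → 0ℤ ≤ f i) → 0ℤ ≤ Σ n f
  Σ-nonneg n {f} h = subst (_≤ Σ n f) (Σ-zero n {λ _ → 0ℤ} λ _ _ → refl) (Σ-mono n h)

  Σ-+ : ∀ n f g → Σ n (λ i → f i + g i) ≡ Σ n f + Σ n g
  Σ-+ zero    f g = refl
  Σ-+ (suc n) f g rewrite Σ-+ n f g = e (Σ n f) (Σ n g) (f n) (g n)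
    where
    e : ∀ a b c d → a + b + (c + d) ≡ a + c + (b + d)
    e = solve-∀

  Σ-* : ∀ n c f → Σ n (λ i → c * f i) ≡ c * Σ n f
  Σ-* zero    c f = sym (*-zeroʳ c)
  Σ-* (suc n) c f rewrite Σ-* n c f = sym (*-distribˡ-+ c (Σ n f) (f n))

  Σ-swap : ∀ m n (f : ℕ → ℕ → ℤ) → Σ m (λ i → Σ n (f i)) ≡ Σ n (λ j → Σ m (λ i → f i j))
  Σ-swap zero    n f = sym (Σ-zero n λ _ _ → refl)
  Σ-swap (suc m) n f = trans (cong (_+ Σ n (f m)) (Σ-swap m n f)) (sym (Σ-+ n (λ j → Σ m (λ i → f i j)) (f m)))

  Σ-only : ∀ n k {f} → k ℕ.< n → (∀ i → i ℕ.< n → i ≢ k → f i ≡ 0ℤ) → Σ n f ≡ f k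
  Σ-only (suc n) k {f} (s≤s k≤n) h with ℕ.m≤n⇒m<n∨m≡n k≤n
  ... | inj₁ k<n  = trans (cong₂ _+_ (Σ-only n k k<n (ext h)) (h n ℕ.≤-refl λ e → ℕ.<⇒≢ k<n (sym e))) (+-identityʳ _)
  ... | inj₂ refl = trans (cong (_+ f n) (Σ-zero n λ i i<n → h i (ℕ.m≤n⇒m≤1+n i<n) (ℕ.<⇒≢ i<n))) (+-identityˡ _)

  Σ-δ : ∀ n k (f : ℕ → ℤ) → k ℕ.< n → Σ n (λ i → δ k i * f i) ≡ f k
  Σ-δ n k f k<n = trans (Σ-only n k {λ i → δ k i * f i} k<n other) (trans (cong (λ d → d * f k) (δ-refl k)) (*-identityˡ (f k)))
    where
    other : ∀ i → i ℕ.< n → i ≢ k → δ k i * f i ≡ 0ℤ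
    other i _ i≢k = trans (cong (λ d → d * f i) (δ-≢ λ e → i≢k (sym e))) (*-zeroˡ (f i))

  Σ-const : ∀ n c → Σ n (λ _ → c) ≡ pos n * c
  Σ-const zero    c = refl
  Σ-const (suc n) c = trans (cong (_+ c) (Σ-const n c)) (e (pos n) c)
    where
    e : ∀ n c → n * c + c ≡ (1ℤ + n) * c
    e = solve-∀

  term≤Σ : ∀ n k {f} → k ℕ.< n → (∀ i → i ℕ.< n → 0ℤ ≤ f i) → f k ≤ Σ n f
  term≤Σ (suc n) k {f} (s≤s k≤n) h with ℕ.m≤n⇒m<n∨m≡n k≤n
  ... | inj₁ k<n  = subst (_≤ Σ n f + f n) (+-identityʳ (f k)) (+-mono-≤ (term≤Σ n k k<n (ext h)) (h n ℕ.≤-refl))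
  ... | inj₂ refl = subst (_≤ Σ n f + f n) (+-identityˡ (f n)) (+-monoˡ-≤ (f n) (Σ-nonneg n (ext h)))

  ∣Σ∣≤ : ∀ n {f} c → (∀ i → i ℕ.< n → ∣ f i ∣ ℕ.≤ c) → ∣ Σ n f ∣ ℕ.≤ n ℕ.* c
  ∣Σ∣≤ zero        c h = z≤n
  ∣Σ∣≤ (suc n) {f} c h = ℕ.≤-trans (∣i+j∣≤∣i∣+∣j∣ (Σ n f) (f n))
    (ℕ.≤-trans (ℕ.+-mono-≤ (∣Σ∣≤ n c (ext h)) (h n ℕ.≤-refl)) (ℕ.≤-reflexive (ℕ.+-comm (n ℕ.* c) c)))

  -- Defined on all of `ℕ`, of which only an initial segment counts; dimensions appear in the
  -- operations and not in the type, so vectors can be extended by a coordinate without conversion.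
  Vector : Set
  Vector = ℕ → ℤ

  dot : ℕ → Vector → Vector → ℤ
  dot n u v = Σ n (λ i → u i * v i)

  infixl 6 _⊕_
  infixl 7 _⊙_

  _⊕_ : Vector → Vector → Vector
  (u ⊕ v) i = u i + v i

  _⊙_ : ℤ → Vector → Vector
  (c ⊙ u) i = c * u i

  dot-cong : ∀ n {u u′ v v′} → (∀ i → i ℕ.< n → u i ≡ u′ i) → (∀ i → i ℕ.< n → v i ≡ v′ i) → dot n u v ≡ dot n u′ v′
  dot-cong n h k = Σ-cong n λ i i<n → cong₂ _*_ (h i i<n) (k i i<n)

  dot-sym : ∀ n u v → dot n u v ≡ dot n v u
  dot-sym n u v = Σ-cong n λ i _ → *-comm (u i) (v i)

  dot-⊕ : ∀ n u v w → dot n u (v ⊕ w) ≡ dot n u v + dot n u w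
  dot-⊕ n u v w = trans (Σ-cong n λ i _ → *-distribˡ-+ (u i) (v i) (w i)) (Σ-+ n (λ i → u i * v i) (λ i → u i * w i))

  dot-⊙ : ∀ n c u v → dot n u (c ⊙ v) ≡ c * dot n u v
  dot-⊙ n c u v = trans (Σ-cong n λ i _ → e (u i) c (v i)) (Σ-* n c (λ i → u i * v i))
    where
    e : ∀ u c v → u * (c * v) ≡ c * (u * v)
    e = solve-∀

  dot-⊕ˡ : ∀ n u v w → dot n (u ⊕ v) w ≡ dot n u w + dot n v w
  dot-⊕ˡ n u v w = trans (dot-sym n (u ⊕ v) w) (trans (dot-⊕ n w u v) (cong₂ _+_ (dot-sym n w u) (dot-sym n w v)))

  dot-⊙ˡ : ∀ n c u v → dot n (c ⊙ u) v ≡ c * dot n u v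
  dot-⊙ˡ n c u v = trans (dot-sym n (c ⊙ u) v) (trans (dot-⊙ n c v u) (cong (c *_) (dot-sym n v u)))

  dot-Σ : ∀ n k u (v : ℕ → Vector) → dot n u (λ j → Σ k (λ l → v l j)) ≡ Σ k (λ l → dot n u (v l))
  dot-Σ n k u v = trans (Σ-cong n λ i _ → sym (Σ-* k (u i) (λ l → v l i))) (Σ-swap n k (λ i l → u i * v l i))

-- Siegel's lemma on small solutions of homogeneous systems

module Pigeonhole where

  open Sums
  open import Data.Fin as Fin using (Fin; toℕ; fromℕ<; finToFun; funToFin)
  import Data.Fin.Properties as Fin
  open import Data.Integer using (ℤ; -[1+_]; +≤+; 0ℤ; -1ℤ; _+_; _*_; _-_; -_; _≤_; _<_; ∣_∣; _⊖_) renaming (+_ to pos)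
  open import Data.Integer.Properties
  open import Data.Integer.Tactic.RingSolver using (solve-∀)
  open import Data.Nat as ℕ using (ℕ; zero; suc; z≤n; s≤s)
  import Data.Nat.Properties as ℕ
  import Data.Nat.Tactic.RingSolver as ℕ-Solver

  NonZeroVector : ℕ → Vector → Set
  NonZeroVector n v = ∃[ j ] (j ℕ.< n × v j ≢ 0ℤ)

  decideZero : ∀ n v → NonZeroVector n v ⊎ (∀ j → j ℕ.< n → v j ≡ 0ℤ)
  decideZero zero    v = inj₂ λ _ ()
  decideZero (suc n) v with decideZero n v | v n ≟ 0ℤ
  ... | inj₁ (j , j<n , ne) | _      = inj₁ (j , ℕ.m≤n⇒m≤1+n j<n , ne)
  ... | inj₂ _              | no ne  = inj₁ (n , ℕ.≤-refl , ne)
  ... | inj₂ z              | yes e  = inj₂ λ j j<1+n → zeros j (ℕ.m≤n⇒m<n∨m≡n (ℕ.≤-pred j<1+n))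
    where
    zeros : ∀ j → j ℕ.< n ⊎ j ≡ n → v j ≡ 0ℤ
    zeros j (inj₁ j<n)  = z j j<n
    zeros j (inj₂ refl) = e

  -- A crude form of the classical bound, without the root of order `N - k`. The exponent `k` is
  -- exactly what the count `few` requires.
  siegelBound : ℕ → ℕ → ℕ → ℕ
  siegelBound k N M = suc (2 ℕ.* (N ℕ.* M)) ℕ.^ k

  extend : ∀ {N} → (Fin N → ℕ) → ℕ → ℕ
  extend {N} f j with j ℕ.<? N
  ... | yes j<N = f (fromℕ< j<N)
  ... | no _    = 0

  extend-toℕ : ∀ {N} (f : Fin N → ℕ) i → extend f (toℕ i) ≡ f i
  extend-toℕ {N} f i with toℕ i ℕ.<? N
  ... | yes i<N = cong f (Fin.fromℕ<-toℕ i i<N)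
  ... | no  i≮N = ⊥-elim (i≮N (Fin.toℕ<n i))

  extend≤ : ∀ {N} (f : Fin N → ℕ) B → (∀ i → f i ℕ.≤ B) → ∀ j → extend f j ℕ.≤ B
  extend≤ {N} f B h j with j ℕ.<? N
  ... | yes j<N = h (fromℕ< j<N)
  ... | no _    = z≤n

  -- Two distinct points of the box [0, B]^N have the same image by the pigeonhole
  -- principle; their difference is the solution.
  module Siegel (k N : ℕ) (φ : ℕ → Vector) (M : ℕ) (k<N : k ℕ.< N) (hφ : ∀ i j → i ℕ.< k → j ℕ.< N → ∣ φ i j ∣ ℕ.≤ M) where

    B C R : ℕ
    B = siegelBound k N M
    C = N ℕ.* (M ℕ.* B)
    R = suc (C ℕ.+ C)

    Point : Set
    Point = Fin (suc B ℕ.^ N)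

    coordinate : Point → Fin N → ℕ
    coordinate p i = toℕ (finToFun {suc B} {N} p i)

    point : Point → ℕ → ℕ
    point p = extend (coordinate p)

    point≤ : ∀ p j → point p j ℕ.≤ B
    point≤ p = extend≤ (coordinate p) B λ i → ℕ.≤-pred (Fin.toℕ<n (finToFun {suc B} {N} p i))

    value : Point → ℕ → ℤ
    value p i = dot N (φ i) (λ j → pos (point p j))

    ∣value∣ : ∀ p i → i ℕ.< k → ∣ value p i ∣ ℕ.≤ C
    ∣value∣ p i i<k = ∣Σ∣≤ N (M ℕ.* B) λ j j<N →
      ℕ.≤-trans (ℕ.≤-reflexive (abs-* (φ i j) (pos (point p j)))) (ℕ.*-mono-≤ (hφ i j i<k j<N) (point≤ p j))

    shifted< : ∀ p i → i ℕ.< k → ∣ value p i + pos C ∣ ℕ.< R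
    shifted< p i i<k = s≤s (ℕ.≤-trans (∣i+j∣≤∣i∣+∣j∣ (value p i) (pos C)) (ℕ.+-monoˡ-≤ C (∣value∣ p i i<k)))

    0≤shifted : ∀ p i → i ℕ.< k → 0ℤ ≤ value p i + pos C
    0≤shifted p i i<k = subst (_≤ value p i + pos C) (+-inverseˡ (pos C)) (+-monoˡ-≤ (pos C) (lower (value p i) (∣value∣ p i i<k)))
      where
      lower : ∀ z → ∣ z ∣ ℕ.≤ C → - pos C ≤ z
      lower (pos n)    _ = ≤-trans (neg-mono-≤ (0≤pos C)) (0≤pos n)
      lower (-[1+ n ]) h = neg-mono-≤ (+≤+ h)

    image : Point → Fin (R ℕ.^ k)
    image p = funToFin {k} {R} λ i → fromℕ< (shifted< p (toℕ i) (Fin.toℕ<n i))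

    -- Write `b` for the base of `B = b ^ k`. Each equation takes at most `R ≤ b * suc B` values, so
    -- there are at most `B * suc B ^ k` images, which is less than `suc B ^ suc k` and hence than
    -- the number of points.
    few : R ℕ.^ k ℕ.< suc B ℕ.^ N
    few = ℕ.<-≤-trans (s≤s (ℕ.≤-trans (ℕ.^-monoˡ-≤ k R≤) (ℕ.≤-reflexive (^-distribʳ-* k))))
      (ℕ.≤-trans less (ℕ.^-monoʳ-≤ (suc B) k<N))
      where
      b = suc (2 ℕ.* (N ℕ.* M))
      ^-distribʳ-* : ∀ k → (b ℕ.* suc B) ℕ.^ k ≡ b ℕ.^ k ℕ.* suc B ℕ.^ k
      ^-distribʳ-* zero    = refl
      ^-distribʳ-* (suc k) rewrite ^-distribʳ-* k = e b (suc B) (b ℕ.^ k) (suc B ℕ.^ k)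
        where
        e : ∀ b c x y → b ℕ.* c ℕ.* (x ℕ.* y) ≡ b ℕ.* x ℕ.* (c ℕ.* y)
        e = ℕ-Solver.solve-∀
      R≤ : R ℕ.≤ b ℕ.* suc B
      R≤ = ℕ.≤-trans (ℕ.m≤m+n R (2 ℕ.* (N ℕ.* M) ℕ.+ B)) (ℕ.≤-reflexive (e N M B))
        where
        e : ∀ N M B → suc (N ℕ.* (M ℕ.* B) ℕ.+ N ℕ.* (M ℕ.* B)) ℕ.+ (2 ℕ.* (N ℕ.* M) ℕ.+ B) ≡ suc (2 ℕ.* (N ℕ.* M)) ℕ.* suc B
        e = ℕ-Solver.solve-∀
      less : suc (B ℕ.* suc B ℕ.^ k) ℕ.≤ suc B ℕ.^ suc k
      less = ℕ.+-monoˡ-≤ (B ℕ.* suc B ℕ.^ k) (ℕ.m^n>0 (suc B) k)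

    solution : ∃[ Z ] (NonZeroVector N Z × (∀ i → i ℕ.< k → dot N (φ i) Z ≡ 0ℤ) × (∀ j → ∣ Z j ∣ ℕ.≤ B))
    solution with Fin.pigeonhole few image
    ... | p , q , p<q , same = Z , nonzero (decideZero N Z) , annihilated , bounded
      where
      P Q Z : Vector
      P j = pos (point p j)
      Q j = pos (point q j)
      Z = P ⊕ -1ℤ ⊙ Q
      Z≡ : ∀ j → Z j ≡ point p j ⊖ point q j
      Z≡ j = trans (cong (P j +_) (-1*i≡-i (Q j))) (m-n≡m⊖n (point p j) (point q j))
      bounded : ∀ j → ∣ Z j ∣ ℕ.≤ B
      bounded j rewrite Z≡ j = ℕ.≤-trans (∣m⊝n∣≤m⊔n (point p j) (point q j)) (ℕ.⊔-lub (point≤ p j) (point≤ q j))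
      nonzero : NonZeroVector N Z ⊎ (∀ j → j ℕ.< N → Z j ≡ 0ℤ) → NonZeroVector N Z
      nonzero (inj₁ nz) = nz
      nonzero (inj₂ z)  = ⊥-elim (Fin.<⇒≢ p<q p≡q)
        where
        agree : ∀ i → finToFun {suc B} {N} p i ≡ finToFun {suc B} {N} q i
        agree i = Fin.toℕ-injective (subst₂ _≡_ (extend-toℕ (coordinate p) i) (extend-toℕ (coordinate q) i)
          (+-injective (i-j≡0⇒i≡j (P (toℕ i)) (Q (toℕ i))
            (trans (m-n≡m⊖n (point p (toℕ i)) (point q (toℕ i))) (trans (sym (Z≡ (toℕ i))) (z (toℕ i) (Fin.toℕ<n i)))))))
        funToFin-cong : ∀ {m n} {f g : Fin m → Fin n} → (∀ i → f i ≡ g i) → funToFin f ≡ funToFin g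
        funToFin-cong {zero}  h = refl
        funToFin-cong {suc m} h = cong₂ Fin.combine (h Fin.zero) (funToFin-cong (h ∘ Fin.suc))
        p≡q : p ≡ q
        p≡q = trans (sym (Fin.funToFin-finToFin {N} {suc B} p)) (trans (funToFin-cong agree) (Fin.funToFin-finToFin {N} {suc B} q))
      annihilated : ∀ i → i ℕ.< k → dot N (φ i) Z ≡ 0ℤ
      annihilated i i<k = trans (dot-⊕ N (φ i) P (-1ℤ ⊙ Q)) (trans (cong (value p i +_) (dot-⊙ N -1ℤ (φ i) Q))
        (trans (cong (λ v → v + -1ℤ * value q i) values) (e (value q i))))
        where
        e : ∀ v → v + -1ℤ * v ≡ 0ℤ
        e = solve-∀
        i′ = fromℕ< i<k
        images : fromℕ< (shifted< p (toℕ i′) (Fin.toℕ<n i′)) ≡ fromℕ< (shifted< q (toℕ i′) (Fin.toℕ<n i′))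
        images = trans (sym (Fin.finToFun-funToFin {k} {R} (λ i → fromℕ< (shifted< p (toℕ i) (Fin.toℕ<n i))) i′))
          (trans (cong (λ x → finToFun {R} {k} x i′) same)
                 (Fin.finToFun-funToFin {k} {R} (λ i → fromℕ< (shifted< q (toℕ i) (Fin.toℕ<n i))) i′))
        absolute : ∣ value p (toℕ i′) + pos C ∣ ≡ ∣ value q (toℕ i′) + pos C ∣
        absolute = trans (sym (Fin.toℕ-fromℕ< (shifted< p (toℕ i′) (Fin.toℕ<n i′))))
          (trans (cong toℕ images) (Fin.toℕ-fromℕ< (shifted< q (toℕ i′) (Fin.toℕ<n i′))))
        absolute′ : ∣ value p i + pos C ∣ ≡ ∣ value q i + pos C ∣
        absolute′ = subst (λ i → ∣ value p i + pos C ∣ ≡ ∣ value q i + pos C ∣) (Fin.toℕ-fromℕ< i<k) absolute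
        values : value p i ≡ value q i
        values = cancel (value p i) (value q i) (pos C) (trans (sym (0≤i⇒+∣i∣≡i (0≤shifted p i i<k)))
          (trans (cong pos absolute′) (0≤i⇒+∣i∣≡i (0≤shifted q i i<k))))
          where
          cancel : ∀ x y c → x + c ≡ y + c → x ≡ y
          cancel x y c h = i-j≡0⇒i≡j x y (trans (e′ x y c) (i≡j⇒i-j≡0 h))
            where
            e′ : ∀ x y c → x - y ≡ (x + c) - (y + c)
            e′ = solve-∀

  abstract
    siegel : ∀ k N (φ : ℕ → Vector) M → k ℕ.< N → (∀ i j → i ℕ.< k → j ℕ.< N → ∣ φ i j ∣ ℕ.≤ M) →
      ∃[ Z ] (NonZeroVector N Z × (∀ i → i ℕ.< k → dot N (φ i) Z ≡ 0ℤ) × (∀ j → ∣ Z j ∣ ℕ.≤ siegelBound k N M))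
    siegel k N φ M k<N h = Siegel.solution k N φ M k<N h

-- A feasible pointed polyhedron has a small integral solution

module SmallSolution where

  open Sums
  open Pigeonhole
  open import Data.Integer using (ℤ; 0ℤ; -1ℤ; _+_; _*_; _-_; -_; _≤_; _<_; ∣_∣) renaming (+_ to pos)
  open import Data.Integer.Properties
  open import Data.Integer.Tactic.RingSolver using (solve-∀)
  open import Data.Nat as ℕ using (ℕ; zero; suc; z≤n; s≤s; _≡ᵇ_)
  import Data.Nat.Properties as ℕ
  open import Relation.Binary.Definitions using (Tri; tri<; tri≈; tri>)

  update : {A : Set} → (ℕ → A) → ℕ → A → ℕ → A
  update f k v l = if l ≡ᵇ k then v else f l

  update-at : ∀ {A : Set} (f : ℕ → A) k v → update f k v k ≡ v
  update-at f k v rewrite ≡ᵇ-refl k = refl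

  update-< : ∀ {A : Set} (f : ℕ → A) k v {l} → l ℕ.< k → update f k v l ≡ f l
  update-< f k v {l} l<k rewrite ≢⇒≡ᵇ-false l k (ℕ.<⇒≢ l<k) = refl

  <suc : ∀ {l k} → l ℕ.< suc k → l ℕ.< k ⊎ l ≡ k
  <suc l<1+k = ℕ.m≤n⇒m<n∨m≡n (ℕ.≤-pred l<1+k)

  bounded : ∀ a b (f : ℕ → ℕ → ℤ) → ∃[ M ] (∀ i j → i ℕ.< a → j ℕ.< b → ∣ f i j ∣ ℕ.≤ M)
  bounded zero    b f = 0 , λ i j ()
  bounded (suc a) b f with bounded a b f | row b
    where
    row : ∀ b → ∃[ M ] (∀ j → j ℕ.< b → ∣ f a j ∣ ℕ.≤ M)
    row zero    = 0 , λ j ()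
    row (suc b) with row b
    ... | M , h = M ℕ.⊔ ∣ f a b ∣ , λ j j< → cases j (<suc j<)
      where
      cases : ∀ j → j ℕ.< b ⊎ j ≡ b → ∣ f a j ∣ ℕ.≤ M ℕ.⊔ ∣ f a b ∣
      cases j (inj₁ j<b)  = ℕ.≤-trans (h j j<b) (ℕ.m≤m⊔n M _)
      cases j (inj₂ refl) = ℕ.m≤n⊔m M _
  ... | M , h | L , g = M ℕ.⊔ L , λ i j i< j<b → cases i j j<b (<suc i<)
    where
    cases : ∀ i j → j ℕ.< b → i ℕ.< a ⊎ i ≡ a → ∣ f i j ∣ ℕ.≤ M ℕ.⊔ L
    cases i j j<b (inj₁ i<a)  = ℕ.≤-trans (h i j i<a j<b) (ℕ.m≤m⊔n M L)
    cases i j j<b (inj₂ refl) = ℕ.≤-trans (g j j<b) (ℕ.m≤n⊔m M L)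

  0<- : ∀ {b} → b < 0ℤ → 0ℤ < - b
  0<- = neg-mono-<

  -- The step length in the direction β at which the first of the nonnegative
  -- slacks α vanishes, cross-multiplied.
  firstHit : ∀ m (α β : Vector) → (∀ i → i ℕ.< m → 0ℤ ≤ α i) →
    (∃[ i ] (i ℕ.< m × β i < 0ℤ × (∀ l → l ℕ.< m → 0ℤ ≤ - β i * α l + α i * β l))) ⊎ (∀ l → l ℕ.< m → 0ℤ ≤ β l)
  firstHit zero    α β hα = inj₂ λ l ()
  firstHit (suc m) α β hα with firstHit m α β (λ i i<m → hα i (ℕ.m≤n⇒m≤1+n i<m)) | β m <? 0ℤ
  ... | inj₂ hβ | no βm≮0 = inj₂ λ l l< → cases l (<suc l<)
    where
    cases : ∀ l → l ℕ.< m ⊎ l ≡ m → 0ℤ ≤ β l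
    cases l (inj₁ l<m)  = hβ l l<m
    cases l (inj₂ refl) = ≮⇒≥ βm≮0
  ... | inj₂ hβ | yes βm<0 = inj₁ (m , ℕ.≤-refl , βm<0 , λ l l< → cases l (<suc l<))
    where
    e : ∀ a b → 0ℤ ≡ - b * a + a * b
    e = solve-∀
    cases : ∀ l → l ℕ.< m ⊎ l ≡ m → 0ℤ ≤ - β m * α l + α m * β l
    cases l (inj₁ l<m)  = 0≤+ (0≤* (<⇒≤ (0<- βm<0)) (hα l (ℕ.m≤n⇒m≤1+n l<m))) (0≤* (hα m ℕ.≤-refl) (hβ l l<m))
    cases l (inj₂ refl) = ≤-reflexive (e (α m) (β m))
  ... | inj₁ (i , i<m , βi<0 , h) | βm<0? with 0ℤ ≤? - β i * α m + α i * β m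
  ...   | yes keep = inj₁ (i , ℕ.m≤n⇒m≤1+n i<m , βi<0 , λ l l< → cases l (<suc l<))
    where
    cases : ∀ l → l ℕ.< m ⊎ l ≡ m → 0ℤ ≤ - β i * α l + α i * β l
    cases l (inj₁ l<m)  = h l l<m
    cases l (inj₂ refl) = keep
  ...   | no worse with βm<0?
  ...     | no βm≮0  = ⊥-elim (worse (0≤+ (0≤* (<⇒≤ (0<- βi<0)) (hα m ℕ.≤-refl)) (0≤* (hα i (ℕ.m≤n⇒m≤1+n i<m)) (≮⇒≥ βm≮0))))
  ...     | yes βm<0 = inj₁ (m , ℕ.≤-refl , βm<0 , λ l l< → cases l (<suc l<))
    where
    e₀ : ∀ a b → 0ℤ ≡ - b * a + a * b
    e₀ = solve-∀
    -- Transitivity of the order of hitting times, cleared of denominators: row `m` is hit before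
    -- row `i`, and row `i` not after row `l`. The positive factor `- bi` is cancelled afterwards.
    e : ∀ ai bi am bm al bl → - bm * (- bi * al + ai * bl) + (- bl) * (- (- bi * am + ai * bm)) ≡ - bi * (- bm * al + am * bl)
    e = solve-∀
    cases : ∀ l → l ℕ.< m ⊎ l ≡ m → 0ℤ ≤ - β m * α l + α m * β l
    cases l (inj₂ refl) = ≤-reflexive (e₀ (α m) (β m))
    cases l (inj₁ l<m) with β l <? 0ℤ
    ... | no βl≮0  = 0≤+ (0≤* (<⇒≤ (0<- βm<0)) (hα l (ℕ.m≤n⇒m≤1+n l<m))) (0≤* (hα m ℕ.≤-refl) (≮⇒≥ βl≮0))
    ... | yes βl<0 = cancel-0≤ (- β i) (0<- βi<0) (subst (0ℤ ≤_) (e (α i) (β i) (α m) (β m) (α l) (β l))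
      (0≤+ (0≤* (<⇒≤ (0<- βm<0)) (h l l<m)) (0≤* (<⇒≤ (0<- βl<0)) (<⇒≤ (neg-mono-< (≰⇒> worse))))))

  module Vertex (n m : ℕ) (φ : ℕ → Vector) (∣φ∣≤1 : ∀ i j → i ℕ.< m → j ℕ.< suc n → ∣ φ i j ∣ ℕ.≤ 1)
    (pointed : ∀ D → NonZeroVector (suc n) D → D n ≡ 0ℤ → ∃[ i ] (i ℕ.< m × dot (suc n) (φ i) D ≢ 0ℤ)) where

    N : ℕ
    N = suc n

    infix 7 _·_
    _·_ : ℕ → Vector → ℤ
    i · X = dot N (φ i) X

    -- The last coordinate is homogenising: `X` stands for the rational point with coordinates
    -- `X j / X n`. In these terms `pointed` says that the polyhedron contains no line.
    InCone : Vector → Set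
    InCone X = (∀ i → i ℕ.< m → 0ℤ ≤ i · X) × 0ℤ < X n

    ·-comb : ∀ i a X b Y → i · (a ⊙ X ⊕ b ⊙ Y) ≡ a * (i · X) + b * (i · Y)
    ·-comb i a X b Y = trans (dot-⊕ N (φ i) (a ⊙ X) (b ⊙ Y)) (cong₂ _+_ (dot-⊙ N a (φ i) X) (dot-⊙ N b (φ i) Y))

    -- The directions `D` certify that the tight rows are linearly independent: the products of rows
    -- with directions form a triangular matrix with nonzero diagonal. This form is extended by one
    -- row and one direction without any elimination.
    record Face (k : ℕ) (X : Vector) : Set where
      field
        t        : ℕ → ℕ
        D        : ℕ → Vector
        index    : ∀ {l} → l ℕ.< k → t l ℕ.< m
        tight    : ∀ {l} → l ℕ.< k → t l · X ≡ 0ℤ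
        diagonal : ∀ {l} → l ℕ.< k → t l · D l ≢ 0ℤ
        upper    : ∀ {l l′} → l ℕ.< l′ → l′ ℕ.< k → t l · D l′ ≡ 0ℤ

    -- The triangular system makes D 0, …, D n and X linearly independent, but
    -- n + 2 integer vectors with n + 1 entries are dependent.
    independent : ∀ {X} → 0ℤ < X n → Face N X → ⊥
    independent {X} 0<Xn F = contradict nonzero
      where
      open Face F
      V : ℕ → Vector
      V = update D N X
      M = proj₁ (bounded N (suc N) (λ j l → V l j))
      dependency = siegel N (suc N) (λ j l → V l j) M ℕ.≤-refl (proj₂ (bounded N (suc N) (λ j l → V l j)))
      c : Vector
      c = proj₁ dependency
      nonzero = proj₁ (proj₂ dependency)
      relation : ∀ j → j ℕ.< N → Σ (suc N) (λ l → c l * V l j) ≡ 0ℤ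
      relation j j<N = trans (Σ-cong (suc N) λ l _ → *-comm (c l) (V l j)) (proj₁ (proj₂ (proj₂ dependency)) j j<N)
      applied : ∀ i → Σ (suc N) (λ l → c l * (i · V l)) ≡ 0ℤ
      applied i = trans (Σ-cong (suc N) λ l _ → sym (dot-⊙ N (c l) (φ i) (V l)))
        (trans (sym (dot-Σ N (suc N) (φ i) (λ l → c l ⊙ V l)))
          (Σ-zero N λ j j<N → trans (cong (φ i j *_) (relation j j<N)) (*-zeroʳ (φ i j))))
      -- The row `t l` is applied to the relation. Earlier coefficients are 0 by induction, later
      -- directions and `X` itself are killed by the row, so only the diagonal term with `c l`
      -- survives.
      vanish : ∀ b → b ℕ.≤ N → ∀ l → l ℕ.< b → c l ≡ 0ℤ
      vanish (suc b) b<N l l<1+b with <suc l<1+b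
      ... | inj₁ l<b  = vanish b (ℕ.<⇒≤ b<N) l l<b
      ... | inj₂ refl = *≡0 (diagonal b<N) (trans (*-comm (t l · D l) (c l))
          (trans (cong (λ v → c l * (t l · v)) (sym (update-< D N X b<N)))
            (trans (sym (Σ-only (suc N) l {λ l′ → c l′ * (t l · V l′)} (ℕ.m≤n⇒m≤1+n b<N) others)) (applied (t l)))))
        where
        others : ∀ l′ → l′ ℕ.< suc N → l′ ≢ l → c l′ * (t l · V l′) ≡ 0ℤ
        others l′ l′< ne with ℕ.<-cmp l′ l | <suc l′<
        ... | tri< l′<l _ _ | _ = trans (cong (_* (t l · V l′)) (vanish l (ℕ.<⇒≤ b<N) l′ l′<l)) (*-zeroˡ (t l · V l′))
        ... | tri≈ _ eq _   | _ = ⊥-elim (ne eq)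
        ... | tri> _ _ l<l′ | inj₁ l′<N = trans (cong (c l′ *_) (trans (cong (t l ·_) (update-< D N X l′<N)) (upper l<l′ l′<N))) (*-zeroʳ (c l′))
        ... | tri> _ _ l<l′ | inj₂ refl = trans (cong (c N *_) (trans (cong (t l ·_) (update-at D N X)) (tight b<N))) (*-zeroʳ (c N))
      last : c N ≡ 0ℤ
      last = *≡0 (λ e → <-irrefl (sym e) 0<Xn) (trans (*-comm (X n) (c N)) (trans (cong (λ v → c N * v n) (sym (update-at D N X)))
        (trans (sym (Σ-only (suc N) N {λ l → c l * V l n} ℕ.≤-refl λ l l< ne → trans (cong (_* V l n) (vanish N ℕ.≤-refl l (lower l< ne))) (*-zeroˡ (V l n))))
          (relation n ℕ.≤-refl))))
        where
        lower : ∀ {l} → l ℕ.< suc N → l ≢ N → l ℕ.< N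
        lower l< ne with <suc l<
        ... | inj₁ l<N = l<N
        ... | inj₂ e   = ⊥-elim (ne e)
      contradict : NonZeroVector (suc N) c → ⊥
      contradict (l , l< , ne) with <suc l<
      ... | inj₁ l<N  = ne (vanish N ℕ.≤-refl l l<N)
      ... | inj₂ refl = ne last

    Small : Set
    Small = ∃[ X ] (InCone X × (∀ j → ∣ X j ∣ ℕ.≤ siegelBound n N 1))

    -- Z solves the tight equations. Either it is a multiple of X, or X can be
    -- moved in the plane spanned by X and Z until another constraint is tight.
    advance : ∀ k X → k ℕ.< N → InCone X → Face k X → Small ⊎ ∃[ X′ ] (InCone X′ × Face (suc k) X′)
    advance k X k<N (0≤φX , 0<Xn) F = cases (decideZero N D₀)
      where
      open Face F
      found = siegel k N (λ l → φ (t l)) 1 k<N (λ l j l<k j<N → ∣φ∣≤1 (t l) j (index l<k) j<N)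
      Z : Vector
      Z = proj₁ found
      Z≢0 = proj₁ (proj₂ found)
      tight-Z : ∀ {l} → l ℕ.< k → t l · Z ≡ 0ℤ
      tight-Z {l} = proj₁ (proj₂ (proj₂ found)) l
      ∣Z∣≤ : ∀ j → ∣ Z j ∣ ℕ.≤ siegelBound n N 1
      ∣Z∣≤ j = ℕ.≤-trans (proj₂ (proj₂ (proj₂ found)) j) (ℕ.^-monoʳ-≤ (suc (2 ℕ.* (N ℕ.* 1))) (ℕ.≤-pred k<N))
      -- The combination of `X` and `Z` whose last coordinate cancels, that is, the direction from
      -- one rational point towards the other. It is 0 exactly when the two vectors are
      -- proportional, since `X n` is positive.
      D₀ : Vector
      D₀ = X n ⊙ Z ⊕ (- Z n) ⊙ X
      D₀n : D₀ n ≡ 0ℤ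
      D₀n = e (X n) (Z n)
        where
        e : ∀ x z → x * z + - z * x ≡ 0ℤ
        e = solve-∀
      tight-D₀ : ∀ {l} → l ℕ.< k → t l · D₀ ≡ 0ℤ
      tight-D₀ {l} l<k = trans (·-comb (t l) (X n) Z (- Z n) X)
        (trans (cong₂ (λ a b → X n * a + - Z n * b) (tight-Z l<k) (tight l<k)) (e (X n) (Z n)))
        where
        e : ∀ x z → x * 0ℤ + - z * 0ℤ ≡ 0ℤ
        e = solve-∀

      move : ∀ E → E n ≡ 0ℤ → (∀ {l} → l ℕ.< k → t l · E ≡ 0ℤ) → ∃[ i ] (i ℕ.< m × i · E < 0ℤ) → ∃[ X′ ] (InCone X′ × Face (suc k) X′)
      move E En tight-E (i₀ , i₀<m , neg) with firstHit m (_· X) (_· E) 0≤φX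
      ... | inj₂ none = ⊥-elim (<⇒≱ neg (none i₀ i₀<m))
      ... | inj₁ (i , i<m , βi<0 , h) = X′ , (inside , 0<X′n) , record
        { t = update t k i
        ; D = update D k E
        ; index = λ l< → index′ (<suc l<)
        ; tight = λ l< → tight′ (<suc l<)
        ; diagonal = λ l< → diagonal′ (<suc l<)
        ; upper = λ l<l′ l′< → upper′ l<l′ (<suc l′<)
        }
        where
        -- `X` moved along `E` up to the first constraint that becomes tight, multiplied by the
        -- positive denominator `- (i · E)` of the step length.
        X′ : Vector
        X′ = (- (i · E)) ⊙ X ⊕ (i · X) ⊙ E
        inside : ∀ l → l ℕ.< m → 0ℤ ≤ l · X′
        inside l l<m = subst (0ℤ ≤_) (sym (·-comb l (- (i · E)) X (i · X) E)) (h l l<m)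
        0<X′n : 0ℤ < X′ n
        0<X′n = subst (0ℤ <_) (sym (trans (cong (λ z → - (i · E) * X n + (i · X) * z) En) (e (- (i · E) * X n) (i · X)))) (0<* (0<- βi<0) 0<Xn)
          where
          e : ∀ a b → a + b * 0ℤ ≡ a
          e = solve-∀
        index′ : ∀ {l} → l ℕ.< k ⊎ l ≡ k → update t k i l ℕ.< m
        index′ {l} (inj₁ l<k) rewrite update-< t k i l<k = index l<k
        index′ (inj₂ refl) rewrite update-at t k i = i<m
        tight′ : ∀ {l} → l ℕ.< k ⊎ l ≡ k → update t k i l · X′ ≡ 0ℤ
        tight′ {l} (inj₁ l<k) = trans (cong (_· X′) (update-< t k i l<k)) (trans (·-comb (t l) (- (i · E)) X (i · X) E)
            (trans (cong₂ (λ a b → - (i · E) * a + (i · X) * b) (tight l<k) (tight-E l<k)) (e (- (i · E)) (i · X))))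
          where
          e : ∀ a b → a * 0ℤ + b * 0ℤ ≡ 0ℤ
          e = solve-∀
        tight′ (inj₂ refl) = trans (cong (_· X′) (update-at t k i)) (trans (·-comb i (- (i · E)) X (i · X) E) (e (i · E) (i · X)))
          where
          e : ∀ a b → - a * b + b * a ≡ 0ℤ
          e = solve-∀
        diagonal′ : ∀ {l} → l ℕ.< k ⊎ l ≡ k → update t k i l · update D k E l ≢ 0ℤ
        diagonal′ (inj₁ l<k) rewrite update-< t k i l<k | update-< D k E l<k = diagonal l<k
        diagonal′ (inj₂ refl) rewrite update-at t k i | update-at D k E = λ e → <-irrefl e βi<0
        upper′ : ∀ {l l′} → l ℕ.< l′ → l′ ℕ.< k ⊎ l′ ≡ k → update t k i l · update D k E l′ ≡ 0ℤ
        upper′ l<l′ (inj₁ l′<k) rewrite update-< t k i (ℕ.<-trans l<l′ l′<k) | update-< D k E l′<k = upper l<l′ l′<k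
        upper′ l<l′ (inj₂ refl) rewrite update-< t k i l<l′ | update-at D k E = tight-E l<l′

      cases : NonZeroVector N D₀ ⊎ (∀ j → j ℕ.< N → D₀ j ≡ 0ℤ) → Small ⊎ ∃[ X′ ] (InCone X′ × Face (suc k) X′)
      cases (inj₁ nz) = inj₂ (direction (pointed D₀ nz D₀n))
        where
        direction : ∃[ i ] (i ℕ.< m × i · D₀ ≢ 0ℤ) → ∃[ X′ ] (InCone X′ × Face (suc k) X′)
        direction (i , i<m , ne) with <-cmp (i · D₀) 0ℤ
        ... | tri< neg _ _ = move D₀ D₀n tight-D₀ (i , i<m , neg)
        ... | tri≈ _ z _   = ⊥-elim (ne z)
        -- Only a decreasing slack can be hit, so here the direction is reversed.
        ... | tri> _ _ p   = move (-1ℤ ⊙ D₀) (cong (-1ℤ *_) D₀n)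
          (λ {l} l<k → trans (dot-⊙ N -1ℤ (φ (t l)) D₀) (cong (-1ℤ *_) (tight-D₀ l<k)))
          (i , i<m , subst (_< 0ℤ) (sym (trans (dot-⊙ N -1ℤ (φ i) D₀) (-1*i≡-i (i · D₀)))) (neg-mono-< p))
      cases (inj₂ zero-D) = inj₁ (scaled (<-cmp (Z n) 0ℤ))
        where
        proportional : ∀ i → X n * (i · Z) ≡ Z n * (i · X)
        proportional i = i-j≡0⇒i≡j _ _ (trans (e (X n) (Z n) (i · Z) (i · X)) (trans (sym (·-comb i (X n) Z (- Z n) X))
          (Σ-zero N λ j j<N → trans (cong (φ i j *_) (zero-D j j<N)) (*-zeroʳ (φ i j)))))
          where
          e : ∀ x z a b → x * a - z * b ≡ x * a + - z * b
          e = solve-∀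
        scaled : Tri (Z n < 0ℤ) (Z n ≡ 0ℤ) (0ℤ < Z n) → Small
        scaled (tri> _ _ 0<Zn) = Z , ((λ i i<m → cancel-0≤ (X n) 0<Xn (subst (0ℤ ≤_) (sym (proportional i)) (0≤* (<⇒≤ 0<Zn) (0≤φX i i<m)))) , 0<Zn) , ∣Z∣≤
        scaled (tri< Zn<0 _ _) = -1ℤ ⊙ Z ,
          ((λ i i<m → cancel-0≤ (X n) 0<Xn (subst (0ℤ ≤_) (sym (trans (cong (X n *_) (dot-⊙ N -1ℤ (φ i) Z))
              (trans (e (X n) (i · Z)) (trans (cong -_ (proportional i)) (neg-distribˡ-* (Z n) (i · X)))))) (0≤* (<⇒≤ (0<- Zn<0)) (0≤φX i i<m))))
            , subst (0ℤ <_) (sym (-1*i≡-i (Z n))) (0<- Zn<0)) ,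
          λ j → subst (ℕ._≤ siegelBound n N 1) (sym (trans (cong ∣_∣ (-1*i≡-i (Z j))) (∣-i∣≡∣i∣ (Z j)))) (∣Z∣≤ j)
          where
          e : ∀ x a → x * (-1ℤ * a) ≡ - (x * a)
          e = solve-∀
        scaled (tri≈ _ Zn≡0 _) = ⊥-elim (absurd Z≢0)
          where
          absurd : NonZeroVector N Z → ⊥
          absurd (j , j<N , ne) = ne (*≡0 (λ e → <-irrefl (sym e) 0<Xn)
            (trans (sym (trans (cong (λ z → X n * Z j + - z * X j) Zn≡0) (e (X n * Z j) (X j)))) (zero-D j j<N)))
            where
            e : ∀ a x → a + - 0ℤ * x ≡ a
            e = solve-∀

    small : ∀ X → InCone X → Small
    small X X∈C = walk N 0 refl X X∈C record
      { t = λ _ → 0 ; D = λ _ _ → 0ℤ ; index = λ () ; tight = λ () ; diagonal = λ () ; upper = λ _ () }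
      where
      walk : ∀ r k → k ℕ.+ r ≡ N → ∀ X → InCone X → Face k X → Small
      walk zero    k e X X∈C F rewrite trans (sym (ℕ.+-identityʳ k)) e = ⊥-elim (independent (proj₂ X∈C) F)
      walk (suc r) k e X X∈C F with advance k X (subst (k ℕ.<_) e (ℕ.m<m+n k (s≤s z≤n))) X∈C F
      ... | inj₁ done = done
      ... | inj₂ (X′ , X′∈C , F′) = walk r (suc k) (trans (sym (ℕ.+-suc k r)) e) X′ X′∈C F′

-- Quadratic forms, rounded rank one updates and ellipsoids

module Forms where

  open Sums
  open import Data.Integer using (ℤ; -[1+_]; +<+; 0ℤ; 1ℤ; -1ℤ; _+_; _*_; _-_; -_; _≤_; _<_; ∣_∣) renaming (+_ to pos)
  open import Data.Integer.Properties
  open import Data.Integer.Tactic.RingSolver using (solve-∀)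
  open import Data.Nat as ℕ using (ℕ; zero; suc; z≤n; s≤s)
  import Data.Nat.Properties as ℕ

  dot-comb : ∀ n u a v b w → dot n u (a ⊙ v ⊕ b ⊙ w) ≡ a * dot n u v + b * dot n u w
  dot-comb n u a v b w = trans (dot-⊕ n u (a ⊙ v) (b ⊙ w)) (cong₂ _+_ (dot-⊙ n a u v) (dot-⊙ n b u w))

  Matrix : Set
  Matrix = ℕ → ℕ → ℤ

  2ℤ : ℤ
  2ℤ = pos 2

  0<2 : 0ℤ < pos 2
  0<2 = +<+ (s≤s z≤n)

  0<4 : 0ℤ < pos 4
  0<4 = +<+ (s≤s z≤n)

  -- A combination of `(a - b)²` and `(a + b)²` with the weights `d + e` and `d - e`. Applied to
  -- each pair of indices, it turns a bound on the entries of an error matrix into one on its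
  -- quadratic form.
  young : ∀ d e a b → 0ℤ ≤ d + e → 0ℤ ≤ d - e → 0ℤ ≤ d * (a * a) + d * (b * b) - 2ℤ * (e * (a * b))
  young d e a b h h′ = cancel-0≤ 2ℤ 0<2 (subst (0ℤ ≤_) (eq d e a b)
    (0≤+ (0≤* h (0≤square (a - b))) (0≤* h′ (0≤square (a + b)))))
    where
    eq : ∀ d e a b → (d + e) * ((a - b) * (a - b)) + (d - e) * ((a + b) * (a + b)) ≡ pos 2 * (d * (a * a) + d * (b * b) - pos 2 * (e * (a * b)))
    eq = solve-∀

  -- The Cauchy–Schwarz inequality (α + β)² ≤ (K + M) (α² / K + β² / M), without
  -- divisions.
  cauchy : ∀ P K M α β Q₁ Q₂ → 0ℤ ≤ P → 0ℤ < K → 0ℤ < M → P * (α * α) ≤ K * Q₁ → P * (β * β) ≤ M * Q₂ →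
           P * ((α + β) * (α + β)) ≤ (K + M) * (Q₁ + Q₂)
  cauchy P K M α β Q₁ Q₂ 0≤P 0<K 0<M h₁ h₂ = 0≤i-j⇒j≤i (cancel-0≤ (K * M) (0<* 0<K 0<M)
    (subst (0ℤ ≤_) (eq P K M α β Q₁ Q₂)
      (0≤+ (0≤+ (0≤* (<⇒≤ (0<* 0<M (+-mono-< 0<K 0<M))) (gap h₁)) (0≤* (<⇒≤ (0<* 0<K (+-mono-< 0<K 0<M))) (gap h₂)))
           (0≤* 0≤P (0≤square (M * α - K * β))))))
    where
    eq : ∀ P K M a b q r →
      M * (K + M) * (K * q - P * (a * a)) + K * (K + M) * (M * r - P * (b * b)) + P * ((M * a - K * b) * (M * a - K * b))
      ≡ K * M * ((K + M) * (q + r) - P * ((a + b) * (a + b)))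
    eq = solve-∀

  module Quadratic (n : ℕ) where

    double : (ℕ → ℕ → ℤ) → ℤ
    double f = Σ n (λ i → Σ n (f i))

    double-cong : ∀ {f g} → (∀ i j → i ℕ.< n → j ℕ.< n → f i j ≡ g i j) → double f ≡ double g
    double-cong h = Σ-cong n λ i i<n → Σ-cong n λ j j<n → h i j i<n j<n

    double-nonneg : ∀ {f} → (∀ i j → i ℕ.< n → j ℕ.< n → 0ℤ ≤ f i j) → 0ℤ ≤ double f
    double-nonneg h = Σ-nonneg n λ i i<n → Σ-nonneg n λ j j<n → h i j i<n j<n

    double-lin : ∀ a (f g : ℕ → ℕ → ℤ) → double (λ i j → a * f i j + g i j) ≡ a * double f + double g
    double-lin a f g = trans (Σ-cong n λ i _ → trans (Σ-+ n (λ j → a * f i j) (g i)) (cong (_+ Σ n (g i)) (Σ-* n a (f i))))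
      (trans (Σ-+ n (λ i → a * Σ n (f i)) (λ i → Σ n (g i))) (cong (_+ double g) (Σ-* n a (λ i → Σ n (f i)))))

    form : Matrix → Vector → Vector → ℤ
    form G u v = dot n u (λ i → dot n (G i) v)

    form-double : ∀ G u v → form G u v ≡ double (λ i j → u i * (G i j * v j))
    form-double G u v = Σ-cong n λ i _ → sym (Σ-* n (u i) (λ j → G i j * v j))

    Symmetric : Matrix → Set
    Symmetric G = ∀ i j → i ℕ.< n → j ℕ.< n → G i j ≡ G j i

    form-sym : ∀ G → Symmetric G → ∀ u v → form G u v ≡ form G v u
    form-sym G s u v = trans (form-double G u v) (trans (Σ-swap n n (λ i j → u i * (G i j * v j)))
      (trans (double-cong λ i j i<n j<n → trans (cong (λ g → u j * (g * v i)) (s j i j<n i<n)) (e (u j) (G i j) (v i)))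
        (sym (form-double G v u))))
      where
      e : ∀ u g v → u * (g * v) ≡ v * (g * u)
      e = solve-∀

    form-comb : ∀ G u a v b w → form G u (a ⊙ v ⊕ b ⊙ w) ≡ a * form G u v + b * form G u w
    form-comb G u a v b w = trans (dot-cong n {u} {u} (λ _ _ → refl) λ i _ → dot-comb n (G i) a v b w)
      (dot-comb n u a (λ i → dot n (G i) v) b (λ i → dot n (G i) w))

    q : Matrix → Vector → ℤ
    q G w = form G w w

    q-comb : ∀ G → Symmetric G → ∀ a v b w → q G (a ⊙ v ⊕ b ⊙ w) ≡ a * a * q G v + 2ℤ * (a * b) * form G v w + b * b * q G w
    q-comb G s a v b w = begin
      form G c c                                ≡⟨ form-comb G c a v b w ⟩
      a * form G c v + b * form G c w           ≡⟨ cong₂ (λ s t → a * s + b * t) (form-sym G s c v) (form-sym G s c w) ⟩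
      a * form G v c + b * form G w c           ≡⟨ cong₂ (λ s t → a * s + b * t) (form-comb G v a v b w) (form-comb G w a v b w) ⟩
      a * (a * q G v + b * form G v w) + b * (a * form G w v + b * q G w)
        ≡⟨ cong (λ t → a * (a * q G v + b * form G v w) + b * (a * t + b * q G w)) (form-sym G s w v) ⟩
      a * (a * q G v + b * form G v w) + b * (a * form G v w + b * q G w) ≡⟨ e a b (q G v) (form G v w) (q G w) ⟩
      a * a * q G v + 2ℤ * (a * b) * form G v w + b * b * q G w ∎
      where
      open ≡-Reasoning
      c = a ⊙ v ⊕ b ⊙ w
      e : ∀ a b x y z → a * (a * x + b * y) + b * (a * y + b * z) ≡ a * a * x + pos 2 * (a * b) * y + b * b * z
      e = solve-∀

    norm² : Vector → ℤ
    norm² w = dot n w w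

    N : ℤ
    N = pos n

    -- G′ is G - g gᵀ / d + n I up to rounding errors of at most 1 in each entry.
    Rounded : ℤ → Matrix → Vector → Matrix → Set
    Rounded d G g G′ = ∀ i j → i ℕ.< n → j ℕ.< n →
      let e = d * (G i j + N * δ i j - G′ i j) - g i * g j in 0ℤ ≤ d + e × 0ℤ ≤ d - e

    -- The estimates of the quadratic form sum entrywise inequalities over all pairs of indices.
    -- Both rounding bounds and the later Cauchy-Schwarz inequality are combinations of these six
    -- terms, so one evaluation with suitable coefficients serves all three.
    expand : ∀ c₁ c₂ c₃ c₄ c₅ c₆ G′ G g w →
      double (λ i j → c₁ * (w i * (G′ i j * w j)) + (c₂ * (w i * (G i j * w j)) + (c₃ * (δ i j * (w i * w j))
        + (c₄ * (w i * g i * (w j * g j)) + (c₅ * (w i * w i) + (c₆ * (w j * w j) + 0ℤ))))))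
      ≡ c₁ * q G′ w + (c₂ * q G w + (c₃ * norm² w + (c₄ * (dot n w g * dot n w g) + (c₅ * (N * norm² w) + (c₆ * (N * norm² w) + 0ℤ)))))
    expand c₁ c₂ c₃ c₄ c₅ c₆ G′ G g w =
      trans (double-lin c₁ f₁ _) (cong₂ (λ s t → c₁ * s + t) (sym (form-double G′ w w))
      (trans (double-lin c₂ f₂ _) (cong₂ (λ s t → c₂ * s + t) (sym (form-double G w w))
      (trans (double-lin c₃ f₃ _) (cong₂ (λ s t → c₃ * s + t) (Σ-cong n λ i i<n → Σ-δ n i (λ j → w i * w j) i<n)
      (trans (double-lin c₄ f₄ _) (cong₂ (λ s t → c₄ * s + t) product
      (trans (double-lin c₅ f₅ _) (cong₂ (λ s t → c₅ * s + t) (trans (Σ-cong n λ i _ → Σ-const n (w i * w i)) (Σ-* n N (λ i → w i * w i)))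
      (trans (double-lin c₆ f₆ _) (cong₂ (λ s t → c₆ * s + t) (Σ-const n (norm² w))
        (Σ-zero n λ i _ → Σ-zero n λ j _ → refl))))))))))))
      where
      f₁ f₂ f₃ f₄ f₅ f₆ : ℕ → ℕ → ℤ
      f₁ i j = w i * (G′ i j * w j)
      f₂ i j = w i * (G i j * w j)
      f₃ i j = δ i j * (w i * w j)
      f₄ i j = w i * g i * (w j * g j)
      f₅ i j = w i * w i
      f₆ i j = w j * w j
      product : double f₄ ≡ dot n w g * dot n w g
      product = trans (Σ-cong n λ i _ → trans (Σ-* n (w i * g i) (λ j → w j * g j)) (*-comm (w i * g i) (dot n w g)))
        (Σ-* n (dot n w g) (λ i → w i * g i))

    -- Errors of at most 1 per entry change the form by at most the sum of all `|w i * w j|`, which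
    -- is at most `N * norm² w`. The summand n I of `Rounded` makes up for this, so the rounded form
    -- is never too small.
    rounded-lower : ∀ {d G g G′} → Rounded d G g G′ → ∀ w → d * q G w - dot n w g * dot n w g ≤ d * q G′ w
    rounded-lower {d} {G} {g} {G′} h w = 0≤i-j⇒j≤i (cancel-0≤ 2ℤ 0<2 (subst (0ℤ ≤_)
      (trans (expand (2ℤ * d) (- (2ℤ * d)) (- (2ℤ * (d * N))) 2ℤ d d G′ G g w) (final d (q G′ w) (q G w) N (norm² w) (dot n w g)))
      (double-nonneg λ i j i<n j<n → subst (0ℤ ≤_) (entry d (G i j) (G′ i j) N (δ i j) (g i) (g j) (w i) (w j))
        (young d _ (w i) (w j) (proj₁ (h i j i<n j<n)) (proj₂ (h i j i<n j<n))))))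
      where
      entry : ∀ d G G′ N D a b u v →
        d * (u * u) + d * (v * v) - pos 2 * ((d * (G + N * D - G′) - a * b) * (u * v)) ≡
        pos 2 * d * (u * (G′ * v)) + (- (pos 2 * d) * (u * (G * v)) + (- (pos 2 * (d * N)) * (D * (u * v))
          + (pos 2 * (u * a * (v * b)) + (d * (u * u) + (d * (v * v) + pos 0)))))
      entry = solve-∀
      final : ∀ d Q′ Q N W p →
        pos 2 * d * Q′ + (- (pos 2 * d) * Q + (- (pos 2 * (d * N)) * W + (pos 2 * (p * p) + (d * (N * W) + (d * (N * W) + pos 0))))) ≡
        pos 2 * (d * Q′ - (d * Q - p * p))
      final = solve-∀

    -- In the other direction the error and the summand n I add up, whence the factor 2.
    rounded-upper : ∀ {d G g G′} → Rounded d G g G′ → ∀ w →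
      d * q G′ w ≤ d * q G w - dot n w g * dot n w g + d * (2ℤ * (N * norm² w))
    rounded-upper {d} {G} {g} {G′} h w = 0≤i-j⇒j≤i (cancel-0≤ 2ℤ 0<2 (subst (0ℤ ≤_)
      (trans (expand (- (2ℤ * d)) (2ℤ * d) (2ℤ * (d * N)) (- 2ℤ) d d G′ G g w) (final d (q G′ w) (q G w) N (norm² w) (dot n w g)))
      (double-nonneg λ i j i<n j<n → subst (0ℤ ≤_) (entry d (G i j) (G′ i j) N (δ i j) (g i) (g j) (w i) (w j))
        (young d (- (d * (G i j + N * δ i j - G′ i j) - g i * g j)) (w i) (w j) (proj₂ (h i j i<n j<n))
          (subst (λ e → 0ℤ ≤ d + e) (sym (neg-involutive (d * (G i j + N * δ i j - G′ i j) - g i * g j))) (proj₁ (h i j i<n j<n)))))))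
      where
      entry : ∀ d G G′ N D a b u v →
        d * (u * u) + d * (v * v) - pos 2 * (- (d * (G + N * D - G′) - a * b) * (u * v)) ≡
        - (pos 2 * d) * (u * (G′ * v)) + (pos 2 * d * (u * (G * v)) + (pos 2 * (d * N) * (D * (u * v))
          + (- pos 2 * (u * a * (v * b)) + (d * (u * u) + (d * (v * v) + pos 0)))))
      entry = solve-∀
      final : ∀ d Q′ Q N W p →
        - (pos 2 * d) * Q′ + (pos 2 * d * Q + (pos 2 * (d * N) * W + (- pos 2 * (p * p) + (d * (N * W) + (d * (N * W) + pos 0))))) ≡
        pos 2 * (d * Q - p * p + d * (pos 2 * (N * W)) - d * Q′)
      final = solve-∀

    basis : ℕ → Vector
    basis i j = δ i j

    form-basis : ∀ G i j → i ℕ.< n → j ℕ.< n → form G (basis i) (basis j) ≡ G i j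
    form-basis G i j i<n j<n = trans (Σ-δ n i (λ i → dot n (G i) (basis j)) i<n)
      (trans (dot-sym n (G i) (basis j)) (Σ-δ n j (G i) j<n))

    -- P (w · x)² ≤ K q(w): the point x lies in the ellipsoid given by G.
    record Contains (P : ℤ) (x : Vector) (G : Matrix) (K : ℤ) : Set where
      field
        symmetric : Symmetric G
        0<K       : 0ℤ < K
        contains  : ∀ w → P * (dot n w x * dot n w x) ≤ K * q G w

    module _ {P x G K} (0<P : 0ℤ < P) (C : Contains P x G K) where
      open Contains C

      q≥0 : ∀ w → 0ℤ ≤ q G w
      q≥0 w = cancel-0≤ K 0<K (≤-trans (0≤* (<⇒≤ 0<P) (0≤square (dot n w x))) (contains w))

      -- The form is nonnegative, since it dominates a multiple of a square. Its values at sum and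
      -- difference of two unit vectors bound an entry by the mean of the two diagonal ones.
      entry≤ : ∀ B → (∀ j → j ℕ.< n → q G (basis j) ≤ pos B) → ∀ i j → i ℕ.< n → j ℕ.< n → ∣ G i j ∣ ℕ.≤ B
      entry≤ B h i j i<n j<n = bound (G i j) (half (e₁ a b g (pos B)) (value 1ℤ)) (half (e₂ a b g (pos B)) (value -1ℤ))
        where
        a = q G (basis i)
        b = q G (basis j)
        g = G i j
        value : ∀ s → 0ℤ ≤ 1ℤ * 1ℤ * a + 2ℤ * (1ℤ * s) * g + s * s * b
        value s = subst (0ℤ ≤_) (trans (q-comb G symmetric 1ℤ (basis i) s (basis j))
            (cong (λ t → 1ℤ * 1ℤ * a + 2ℤ * (1ℤ * s) * t + s * s * b) (form-basis G i j i<n j<n)))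
          (q≥0 (1ℤ ⊙ basis i ⊕ s ⊙ basis j))
        half : ∀ {t u} → t + ((pos B - a) + (pos B - b)) ≡ 2ℤ * (pos B - u) → 0ℤ ≤ t → u ≤ pos B
        half {t} {u} e 0≤t = 0≤i-j⇒j≤i (cancel-0≤ 2ℤ 0<2 (subst (0ℤ ≤_) e (0≤+ 0≤t (0≤+ (gap (h i i<n)) (gap (h j j<n))))))
        e₁ : ∀ a b g B → pos 1 * pos 1 * a + pos 2 * (pos 1 * pos 1) * g + pos 1 * pos 1 * b + ((B - a) + (B - b)) ≡ pos 2 * (B - - g)
        e₁ = solve-∀
        e₂ : ∀ a b g B → pos 1 * pos 1 * a + pos 2 * (pos 1 * -1ℤ) * g + -1ℤ * -1ℤ * b + ((B - a) + (B - b)) ≡ pos 2 * (B - g)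
        e₂ = solve-∀
        bound : ∀ g → - g ≤ pos B → g ≤ pos B → ∣ g ∣ ℕ.≤ B
        bound (pos k)    _ h = drop‿+≤+ h
        bound (-[1+ k ]) h _ = drop‿+≤+ h

      -- Split `w` as `v + (μ / d) r` with `μ = form G w r`, and apply `cauchy` to the values of
      -- both parts at `x`. The two bounds `q G v` and `μ² (d - q G r) / d²` add up to
      -- `q G w - μ² / d`, the form after the exact rank one update.
      contains-rounded : ∀ {d M r G′} → 0ℤ < d → 0ℤ < M → Symmetric G′ →
        Rounded d G (λ i → dot n (G i) r) G′ → P * (dot n r x * dot n r x) ≤ M * (d - q G r) → Contains P x G′ (K + M)
      contains-rounded {d} {M} {r} {G′} 0<d 0<M sym′ R h = record
        { symmetric = sym′ ; 0<K = +-mono-< 0<K 0<M ; contains = λ w → cancel-≤ (d * d) (0<* 0<d 0<d) (step w) }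
        where
        step : ∀ w → d * d * (P * (dot n w x * dot n w x)) ≤ d * d * ((K + M) * q G′ w)
        step w = begin
          d * d * (P * (wx * wx))          ≡⟨ trans (e₁ d P wx μ rx) (cong (λ t → P * ((t + μ * rx) * (t + μ * rx))) (sym dot-v)) ⟩
          P * ((dot n v x + μ * rx) * (dot n v x + μ * rx)) ≤⟨ cauchy P K M (dot n v x) (μ * rx) (q G v) (μ * μ * (d - q G r)) (<⇒≤ 0<P) 0<K 0<M (contains v) second ⟩
          (K + M) * (q G v + μ * μ * (d - q G r)) ≡⟨ cong (λ t → (K + M) * (t + μ * μ * (d - q G r))) (q-comb G symmetric d w (- μ) r) ⟩
          (K + M) * (d * d * q G w + 2ℤ * (d * - μ) * μ + - μ * - μ * q G r + μ * μ * (d - q G r)) ≡⟨ e₂ (K + M) d (q G w) μ (q G r) ⟩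
          (K + M) * d * (d * q G w - μ * μ) ≤⟨ 0≤i-j⇒j≤i (subst (0ℤ ≤_) (e₃ ((K + M) * d) (d * q G w - μ * μ) (d * q G′ w))
                                                (0≤* (0≤* (<⇒≤ (+-mono-< 0<K 0<M)) (<⇒≤ 0<d)) (gap (rounded-lower {d} {G} {λ i → dot n (G i) r} {G′} R w)))) ⟩
          (K + M) * d * (d * q G′ w)        ≡⟨ e₄ (K + M) d (q G′ w) ⟩
          d * d * ((K + M) * q G′ w)        ∎
          where
          open ≤-Reasoning
          wx = dot n w x
          rx = dot n r x
          μ = form G w r
          v = d ⊙ w ⊕ (- μ) ⊙ r
          dot-v : dot n v x ≡ d * wx + - μ * rx
          dot-v = trans (dot-⊕ˡ n (d ⊙ w) ((- μ) ⊙ r) x) (cong₂ _+_ (dot-⊙ˡ n d w x) (dot-⊙ˡ n (- μ) r x))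
          second : P * (μ * rx * (μ * rx)) ≤ M * (μ * μ * (d - q G r))
          second = 0≤i-j⇒j≤i (subst (0ℤ ≤_) (e μ M (d - q G r) P rx) (0≤* (0≤square μ) (gap h)))
            where
            e : ∀ u M b P r → u * u * (M * b - P * (r * r)) ≡ M * (u * u * b) - P * (u * r * (u * r))
            e = solve-∀
          e₁ : ∀ d P w u r → d * d * (P * (w * w)) ≡ P * ((d * w + - u * r + u * r) * (d * w + - u * r + u * r))
          e₁ = solve-∀
          e₂ : ∀ K d Q u b → K * (d * d * Q + pos 2 * (d * - u) * u + - u * - u * b + u * u * (d - b)) ≡ K * d * (d * Q - u * u)
          e₂ = solve-∀
          e₃ : ∀ k a b → k * (b - a) ≡ k * b - k * a
          e₃ = solve-∀
          e₄ : ∀ K d Q → K * d * (d * Q) ≡ d * d * (K * Q)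
          e₄ = solve-∀

    ridge : Vector → ℤ
    ridge w = 2ℤ * (N * norm² w)

    -- Subtracting first half of g gᵀ / P and then, with the new g, all of it makes
    -- q(r) drop below P / 4, so that the row r can be doubled.
    module TwoSteps {P x G K R E r G₁ G₂} (0<P : 0ℤ < P) (0<R : 0ℤ < R) (C : Contains P x G K)
      (ρ≤R : dot n r x * dot n r x ≤ R) (q≤ : pos 4 * q G r ≤ pos 5 * P) (4E≤P : pos 4 * E ≤ P) (r≤E : ridge r ≤ E)
      (S₁ : Symmetric G₁) (S₂ : Symmetric G₂)
      (R₁ : Rounded (2ℤ * P) G (λ i → dot n (G i) r) G₁) (R₂ : Rounded P G₁ (λ i → dot n (G₁ i) r) G₂) where

      private
        ρ b b₁ : ℤ
        ρ = dot n r x * dot n r x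
        b = q G r
        b₁ = q G₁ r

        0≤P = <⇒≤ 0<P
        0≤R = <⇒≤ 0<R

        4R : ℤ
        4R = pos 4 * R

        0<4R : 0ℤ < 4R
        0<4R = 0<* 0<4 0<R

        C₁ : Contains P x G₁ (K + 4R)
        -- The value at `r` may reach 5/4 of `P`, so `P` is not yet admissible as denominator. With
        -- `2ℤ * P` the difference `d - q G r` is at least 3/4 of `P`, and `4R` suffices as the
        -- increase of `K`.
        C₁ = contains-rounded 0<P C {2ℤ * P} {4R} {r} {G₁} (0<* 0<2 0<P) 0<4R S₁ R₁
          (0≤i-j⇒j≤i (subst (0ℤ ≤_) (e P R ρ b) (0≤+ (0≤+ (0≤* 0≤P (gap ρ≤R)) (0≤* 0≤R (gap q≤))) (0≤* (0≤* (0≤pos 2) 0≤R) 0≤P))))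
          where
          e : ∀ P R ρ b → P * (R - ρ) + R * (pos 5 * P - pos 4 * b) + pos 2 * R * P ≡ pos 4 * R * (pos 2 * P - b) - P * ρ
          e = solve-∀

        upper₁ : ∀ w → 2ℤ * P * q G₁ w ≤ 2ℤ * P * q G w - form G w r * form G w r + 2ℤ * P * ridge w
        upper₁ = rounded-upper {2ℤ * P} {G} {λ i → dot n (G i) r} {G₁} R₁

        upper₂ : ∀ w → P * q G₂ w ≤ P * q G₁ w - form G₁ w r * form G₁ w r + P * ridge w
        upper₂ = rounded-upper {P} {G₁} {λ i → dot n (G₁ i) r} {G₂} R₂

        -- Up to rounding `b₁` is `b - b² / (2 P)`, whose maximum `P / 2` is attained at `b = P`;
        -- hence the square of `P - b`. Now `P` itself is an admissible denominator.
        b₁≤ : 2ℤ * b₁ ≤ P + 2ℤ * E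
        b₁≤ = 0≤i-j⇒j≤i (cancel-0≤ (2ℤ * P) (0<* 0<2 0<P) (subst (0ℤ ≤_) (e P b b₁ E (ridge r))
          (0≤+ (0≤+ (0≤* (0≤pos 2) (gap (upper₁ r))) (0≤* (0≤pos 2) (0≤square (P - b)))) (0≤* (0≤* (0≤pos 4) 0≤P) (gap r≤E)))))
          where
          e : ∀ P b c E ε → pos 2 * (pos 2 * P * b - b * b + pos 2 * P * ε - pos 2 * P * c) + pos 2 * ((P - b) * (P - b)) + pos 4 * P * (E - ε)
                ≡ pos 2 * P * (P + pos 2 * E - pos 2 * c)
          e = solve-∀

      contains₂ : Contains P x G₂ (K + 4R + 4R)
      contains₂ = contains-rounded 0<P C₁ {P} {4R} {r} {G₂} 0<P 0<4R S₂ R₂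
        (0≤i-j⇒j≤i (subst (0ℤ ≤_) (e P R ρ b₁ E) (0≤+ (0≤+ (0≤* 0≤P (gap ρ≤R)) (0≤* (0≤* (0≤pos 2) 0≤R) (gap b₁≤))) (0≤* 0≤R (gap 4E≤P)))))
        where
        e : ∀ P R ρ b E → P * (R - ρ) + pos 2 * R * (P + pos 2 * E - pos 2 * b) + R * (P - pos 4 * E) ≡ pos 4 * R * (P - b) - P * ρ
        e = solve-∀

      grows : ∀ w → ridge w ≤ E → q G₂ w ≤ q G w + 2ℤ * E
      grows w w≤E = ≤-trans q₂≤ (≤-trans (+-monoˡ-≤ E q₁≤) (≤-reflexive (e (q G w) E)))
        where
        e : ∀ a E → a + E + E ≡ a + pos 2 * E
        e = solve-∀
        q₁≤ : q G₁ w ≤ q G w + E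
        q₁≤ = 0≤i-j⇒j≤i (cancel-0≤ (2ℤ * P) (0<* 0<2 0<P) (subst (0ℤ ≤_) (e′ P (q G w) (q G₁ w) (form G w r) E (ridge w))
          (0≤+ (0≤+ (gap (upper₁ w)) (0≤square (form G w r))) (0≤* (0≤* (0≤pos 2) 0≤P) (gap w≤E)))))
          where
          e′ : ∀ P a c u E ε → pos 2 * P * a - u * u + pos 2 * P * ε - pos 2 * P * c + u * u + pos 2 * P * (E - ε) ≡ pos 2 * P * (a + E - c)
          e′ = solve-∀
        q₂≤ : q G₂ w ≤ q G₁ w + E
        q₂≤ = 0≤i-j⇒j≤i (cancel-0≤ P 0<P (subst (0ℤ ≤_) (e′ P (q G₁ w) (q G₂ w) (form G₁ w r) E (ridge w))
          (0≤+ (0≤+ (gap (upper₂ w)) (0≤square (form G₁ w r))) (0≤* 0≤P (gap w≤E)))))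
          where
          e′ : ∀ P a c u E ε → P * a - u * u + P * ε - P * c + u * u + P * (E - ε) ≡ P * (a + E - c)
          e′ = solve-∀

      -- Up to rounding the new value is `b₁ - b₁² / P`, at most `P / 4` because of the square of
      -- `P - 2ℤ * b₁`. The factor 4 is what doubling the row costs.
      shrinks : pos 4 * q G₂ r ≤ P + pos 4 * E
      shrinks = 0≤i-j⇒j≤i (cancel-0≤ P 0<P (subst (0ℤ ≤_) (e P b₁ (q G₂ r) E (ridge r))
        (0≤+ (0≤+ (0≤* (0≤pos 4) (gap (upper₂ r))) (0≤square (P - 2ℤ * b₁))) (0≤* (0≤* (0≤pos 4) 0≤P) (gap r≤E)))))
        where
        e : ∀ P b c E ε → pos 4 * (P * b - b * b + P * ε - P * c) + (P - pos 2 * b) * (P - pos 2 * b) + pos 4 * P * (E - ε)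
              ≡ P * (P + pos 4 * E - pos 4 * c)
        e = solve-∀

-- The perceptron with rescaling: invariant and potential

module Invariant where

  open Sums
  open Forms
  open import Data.Integer using (ℤ; -[1+_]; +≤+; +<+; 0ℤ; 1ℤ; _+_; _*_; _-_; -_; _≤_; _<_; ∣_∣) renaming (+_ to pos)
  open import Data.Integer.Properties
  open import Data.Integer.Tactic.RingSolver using (solve-∀)
  open import Data.Nat as ℕ using (ℕ; zero; suc; z≤n; s≤s)
  import Data.Nat.Properties as ℕ

  square-reflects-≤ : ∀ {a b} → 0ℤ ≤ a → 0ℤ ≤ b → a * a ≤ b * b → a ≤ b
  square-reflects-≤ {a} {b} 0≤a 0≤b h with a ≤? b
  ... | yes a≤b = a≤b
  ... | no a≰b = ⊥-elim (<⇒≱ (0<* 0<c 0<s) (0≤-contra (≰⇒> a≰b)))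
    where
    0<c : 0ℤ < a - b
    0<c = subst (_< a - b) (+-inverseʳ b) (+-monoˡ-< (- b) (≰⇒> a≰b))
    0<s : 0ℤ < a + b
    0<s = +-mono-<-≤ (≤-<-trans 0≤b (≰⇒> a≰b)) 0≤b
    e : ∀ a b → (a - b) * (a + b) ≡ a * a - b * b
    e = solve-∀
    0≤-contra : b < a → (a - b) * (a + b) ≤ 0ℤ
    0≤-contra _ = ≤-trans (≤-reflexive (e a b)) (subst (a * a - b * b ≤_) (+-inverseʳ (b * b)) (+-monoˡ-≤ (- (b * b)) h))

  ∣a∣≤1⇒a²≤1 : ∀ a → ∣ a ∣ ℕ.≤ 1 → a * a ≤ 1ℤ
  ∣a∣≤1⇒a²≤1 (pos 0)            _ = +≤+ z≤n
  ∣a∣≤1⇒a²≤1 (pos 1)            _ = ≤-refl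
  ∣a∣≤1⇒a²≤1 (pos (suc (suc _))) (s≤s ())
  ∣a∣≤1⇒a²≤1 (-[1+ 0 ])         _ = ≤-refl
  ∣a∣≤1⇒a²≤1 (-[1+ suc _ ])     (s≤s ())

  2^-reflects-≤ : ∀ d ℓ → 2 ℕ.^ d ℕ.≤ 2 ℕ.^ ℓ → d ℕ.≤ ℓ
  2^-reflects-≤ d ℓ h with d ℕ.≤? ℓ
  ... | yes le = le
  ... | no nle = ⊥-elim (ℕ.<⇒≱ (ℕ.^-monoʳ-< 2 (s≤s (s≤s z≤n)) (ℕ.≰⇒> nle)) h)

  module Descent (n m ℓ Y κ p : ℕ) (a : ℕ → Vector) (x : Vector)
    (∣a∣≤1 : ∀ i j → i ℕ.< m → j ℕ.< n → ∣ a i j ∣ ℕ.≤ 1)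
    (unit : ∀ j → j ℕ.< n → ∃[ i ] (i ℕ.< m × (∀ l → l ℕ.< n → a i l ≡ δ j l)))
    (1≤ax : ∀ i → i ℕ.< m → 1ℤ ≤ dot n (a i) x) where

    open Quadratic n public

    -- `H` bounds the value of every scaled row at `x`, `R` the squares of these values and of all
    -- entries of the rows, `E` the effect of rounding on any row, and `Kmax` the total number of
    -- doublings.
    H R E P Kmax : ℤ
    H = pos (2 ℕ.^ ℓ)
    R = H * H
    E = 2ℤ * (N * (N * R))
    P = pos p
    Kmax = pos (m ℕ.* ℓ)

    -- The factor of the initial ball is `R * pos κ`, and each of the two updates of a rescaling
    -- adds `4R`.
    Kof : ℤ → ℤ
    Kof U = R * (pos κ + pos 8 * U)

    -- The rows r are the rows of a scaled by powers of two, y counts how often each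
    -- of them has been added to z since the last rescaling.
    record State : Set where
      constructor state
      field
        G : Matrix
        r : ℕ → Vector
        y : ℕ → ℤ

      z : Vector
      z j = Σ m (λ i → y i * r i j)

    total : (ℕ → ℕ) → ℤ
    total d = Σ m (λ i → pos (d i))

    -- `slim` lets every row drift by `4E` per rescaling. `short` is the perceptron bound: an
    -- addition increases the value of the form at `z` by at most `2P`, with room to spare for the
    -- drift.
    record Inv (s : State) : Set where
      open State s
      field
        d       : ℕ → ℕ
        rows    : ∀ i j → i ℕ.< m → j ℕ.< n → r i j ≡ pos (2 ℕ.^ d i) * a i j
        heights : ∀ i → i ℕ.< m → dot n (r i) x ≤ H
        y≥0     : ∀ i → i ℕ.< m → 0ℤ ≤ y i
        y<Y     : ∀ i → i ℕ.< m → y i + 1ℤ ≤ pos Y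

        ellipsoid : Contains P x G (Kof (total d))
        slim      : ∀ i → i ℕ.< m → q G (r i) ≤ P + pos 4 * E * total d
        short     : q G z ≤ 2ℤ * P * Σ m y

      -- Every step increases Φ.
      U Φ : ℤ
      U = total d
      Φ = U * (pos m * pos Y) + Σ m y

    q-cong : ∀ G {u v} → (∀ j → j ℕ.< n → u j ≡ v j) → q G u ≡ q G v
    q-cong G h = dot-cong n h λ i _ → dot-cong n {G i} {G i} (λ _ _ → refl) h

    q-scale : ∀ G → Symmetric G → ∀ c w → q G (c ⊙ w) ≡ c * c * q G w
    q-scale G s c w = trans (q-cong G {c ⊙ w} {c ⊙ w ⊕ 0ℤ ⊙ w} (λ j _ → e₁ c (w j)))
      (trans (q-comb G s c w 0ℤ w) (e₂ (c * c * q G w) (q G w) (form G w w) c))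
      where
      e₁ : ∀ c w → c * w ≡ c * w + pos 0 * w
      e₁ = solve-∀
      e₂ : ∀ a b f c → a + pos 2 * (c * pos 0) * f + pos 0 * pos 0 * b ≡ a
      e₂ = solve-∀

    0<H : 0ℤ < H
    0<H = +<+ (ℕ.m^n>0 2 ℓ)

    0<R : 0ℤ < R
    0<R = 0<* 0<H 0<H

    0≤N : 0ℤ ≤ N
    0≤N = 0≤pos n

    0≤E : 0ℤ ≤ E
    0≤E = 0≤* (0≤pos 2) (0≤* 0≤N (0≤* 0≤N (<⇒≤ 0<R)))

    module Derived {s} (I : Inv s) where
      open State s
      open Inv I

      scaled-dot : ∀ i → i ℕ.< m → dot n (r i) x ≡ pos (2 ℕ.^ d i) * dot n (a i) x
      scaled-dot i i<m = trans (dot-cong n (λ j → rows i j i<m) (λ _ _ → refl)) (dot-⊙ˡ n (pos (2 ℕ.^ d i)) (a i) x)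

      -- This is where the solution has to satisfy `1 ≤ a · x`: together with `heights` it caps the
      -- doublings of each row by `ℓ`.
      2^d≤rx : ∀ i → i ℕ.< m → pos (2 ℕ.^ d i) ≤ dot n (r i) x
      2^d≤rx i i<m = ≤-trans (≤-trans (≤-reflexive (sym (*-identityʳ (pos (2 ℕ.^ d i)))))
        (0≤i-j⇒j≤i (subst (0ℤ ≤_) (e (pos (2 ℕ.^ d i)) (dot n (a i) x)) (0≤* (0≤pos (2 ℕ.^ d i)) (gap (1≤ax i i<m))))))
        (≤-reflexive (sym (scaled-dot i i<m)))
        where
        e : ∀ h t → h * (t - pos 1) ≡ h * t - h * pos 1
        e = solve-∀

      0<rx : ∀ i → i ℕ.< m → 0ℤ < dot n (r i) x
      0<rx i i<m = <-≤-trans (+<+ (ℕ.m^n>0 2 (d i))) (2^d≤rx i i<m)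

      2^d≤H : ∀ i → i ℕ.< m → pos (2 ℕ.^ d i) ≤ H
      2^d≤H i i<m = ≤-trans (2^d≤rx i i<m) (heights i i<m)

      U≤ : U ≤ Kmax
      U≤ = ≤-trans (Σ-mono m {λ i → pos (d i)} {λ _ → pos ℓ} λ i i<m → +≤+ (2^-reflects-≤ (d i) ℓ (drop‿+≤+ (2^d≤H i i<m))))
        (≤-reflexive (trans (Σ-const m (pos ℓ)) (sym (pos-* m ℓ))))

      0≤U : 0ℤ ≤ U
      0≤U = Σ-nonneg m λ i _ → 0≤pos (d i)

      ridge≤ : ∀ i → i ℕ.< m → ridge (r i) ≤ E
      ridge≤ i i<m = 0≤i-j⇒j≤i (subst (0ℤ ≤_) (e N (N * R) (norm² (r i))) (0≤* (0≤* (0≤pos 2) 0≤N) (gap norm≤)))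
        where
        e : ∀ N a b → pos 2 * N * (a - b) ≡ pos 2 * (N * a) - pos 2 * (N * b)
        e = solve-∀
        entry : ∀ j → j ℕ.< n → r i j * r i j ≤ R
        entry j j<n = 0≤i-j⇒j≤i (subst (0ℤ ≤_) (trans (e′ H (pos (2 ℕ.^ d i)) (a i j)) (cong (λ t → R - t * t) (sym (rows i j i<m j<n))))
          (0≤+ (0≤* (gap (2^d≤H i i<m)) (0≤+ (<⇒≤ 0<H) (0≤pos (2 ℕ.^ d i))))
               (0≤* (0≤square (pos (2 ℕ.^ d i))) (gap (∣a∣≤1⇒a²≤1 (a i j) (∣a∣≤1 i j i<m j<n))))))
          where
          e′ : ∀ H h a → (H - h) * (H + h) + h * h * (pos 1 - a * a) ≡ H * H - h * a * (h * a)
          e′ = solve-∀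
        norm≤ : norm² (r i) ≤ N * R
        norm≤ = ≤-trans (Σ-mono n {λ j → r i j * r i j} {λ _ → R} entry) (≤-reflexive (Σ-const n R))

      Φ≤ : Φ ≤ Kmax * (pos m * pos Y) + pos m * pos Y
      Φ≤ = +-mono-≤ doublings counts
        where
        e : ∀ k u t → (k - u) * t ≡ k * t - u * t
        e = solve-∀
        doublings : U * (pos m * pos Y) ≤ Kmax * (pos m * pos Y)
        doublings = 0≤i-j⇒j≤i (subst (0ℤ ≤_) (e Kmax U (pos m * pos Y)) (0≤* (gap U≤) (0≤* (0≤pos m) (0≤pos Y))))
        counts : Σ m y ≤ pos m * pos Y
        counts = ≤-trans (Σ-mono m {y} {λ _ → pos Y} λ i i<m → ≤-trans (subst (_≤ y i + 1ℤ) (+-identityʳ (y i)) (+-monoʳ-≤ (y i) (0≤pos 1))) (y<Y i i<m))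
          (≤-reflexive (Σ-const m (pos Y)))

    module Step {s} (I : Inv s) (0<κ : 0 ℕ.< κ) (0<P : 0ℤ < P) (0<Y : 0ℤ < pos Y)
      (hP : pos 16 * E * Kmax ≤ P) (hP′ : pos 4 * E ≤ P) (hY : pos 8 * pos m * (pos κ + pos 8 * Kmax) ≤ pos Y)
      (k : ℕ) (k<m : k ℕ.< m) where
      open State s
      open Inv I
      open Derived I
      open Contains ellipsoid

      -- The drift accumulated so far is at most `4 E * Kmax`, a quarter of `P` by `hP`.
      fit : ∀ i → i ℕ.< m → pos 4 * q G (r i) ≤ pos 5 * P
      fit i i<m = 0≤i-j⇒j≤i (subst (0ℤ ≤_) (e (q G (r i)) P E U Kmax)
        (0≤+ (0≤+ (0≤* (0≤pos 4) (gap (slim i i<m))) (0≤* (0≤* (0≤pos 16) 0≤E) (gap U≤))) (gap hP)))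
        where
        e : ∀ q P E U K → pos 4 * (P + pos 4 * E * U - q) + pos 16 * E * (K - U) + (P - pos 16 * E * K) ≡ pos 5 * P - pos 4 * q
        e = solve-∀

      module Updated {G₁ G₂ : Matrix} (S₁ : Symmetric G₁) (S₂ : Symmetric G₂)
        (R₁ : Rounded (2ℤ * P) G (λ i → dot n (G i) (r k)) G₁) (R₂ : Rounded P G₁ (λ i → dot n (G₁ i) (r k)) G₂) where

        ρ≤R : dot n (r k) x * dot n (r k) x ≤ R
        ρ≤R = 0≤i-j⇒j≤i (subst (0ℤ ≤_) (e H (dot n (r k) x)) (0≤* (gap (heights k k<m)) (0≤+ (<⇒≤ 0<H) (<⇒≤ (0<rx k k<m)))))
          where
          e : ∀ H h → (H - h) * (H + h) ≡ H * H - h * h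
          e = solve-∀

        module T = TwoSteps {P} {x} {G} {Kof U} {R} {E} {r k} {G₁} {G₂} 0<P 0<R ellipsoid ρ≤R (fit k k<m) hP′ (ridge≤ k k<m) S₁ S₂ R₁ R₂

        -- Every unit vector is one of the original rows, and scaling it up by a power of two only
        -- increases the form. So the diagonal inherits the bounds on the rows, and `entry≤` extends
        -- them to all entries.
        entries : ∀ i j → i ℕ.< n → j ℕ.< n → ∣ G₂ i j ∣ ℕ.≤ 2 ℕ.* p
        entries = entry≤ 0<P T.contains₂ (2 ℕ.* p) λ j j<n → ≤-trans (basis≤ j (unit j j<n)) (≤-reflexive (sym (pos-* 2 p)))
          where
          basis≤ : ∀ j → ∃[ i ] (i ℕ.< m × (∀ l → l ℕ.< n → a i l ≡ δ j l)) → q G₂ (basis j) ≤ pos 2 * P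
          basis≤ j (i , i<m , ai≡) = 0≤i-j⇒j≤i (cancel-0≤ (pos 4) 0<4 (subst (0ℤ ≤_) (e (q G₂ (basis j)) (pos h) (q G (r i)) (q G₂ (r i)) P E)
            (0≤+ (0≤+ (0≤+ (0≤+ (0≤* (0≤pos 4) (0≤* (gap h²≥1) (q≥0 0<P T.contains₂ (basis j)))) (0≤* (0≤pos 4) (gap (≤-reflexive (sym scaled)))))
                (0≤* (0≤pos 4) (gap (T.grows (r i) (ridge≤ i i<m))))) (gap (fit i i<m))) (0≤+ (0≤* (0≤pos 2) (gap hP′)) (<⇒≤ 0<P)))))
            where
            h = 2 ℕ.^ d i
            scaled : q G₂ (r i) ≡ pos h * pos h * q G₂ (basis j)
            scaled = trans (q-cong G₂ {r i} {pos h ⊙ basis j} λ l l<n → trans (rows i l i<m l<n) (cong (pos h *_) (ai≡ l l<n)))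
              (q-scale G₂ S₂ (pos h) (basis j))
            h²≥1 : 1ℤ ≤ pos h * pos h
            h²≥1 = ≤-trans (+≤+ (ℕ.*-mono-≤ (ℕ.m^n>0 2 (d i)) (ℕ.m^n>0 2 (d i)))) (≤-reflexive (pos-* h h))
            e : ∀ b h q q′ P E → pos 4 * ((h * h - pos 1) * b) + pos 4 * (q′ - h * h * b) + pos 4 * (q + pos 2 * E - q′)
                  + (pos 5 * P - pos 4 * q) + (pos 2 * (P - pos 4 * E) + P) ≡ pos 4 * (pos 2 * P - b)
            e = solve-∀

      module Bad (bad : form G (r k) z ≤ 0ℤ) where

        z′ : Vector
        z′ = 1ℤ ⊙ z ⊕ 1ℤ ⊙ r k

        yδ : ℕ → ℤ
        yδ i = y i + δ k i

        z-yδ : ∀ j → Σ m (λ i → yδ i * r i j) ≡ z′ j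
        z-yδ j = trans (Σ-cong m λ i _ → *-distribʳ-+ (r i j) (y i) (δ k i))
          (trans (Σ-+ m (λ i → y i * r i j) (λ i → δ k i * r i j)) (cong₂ _+_ (sym (*-identityˡ (z j)))
            (trans (Σ-δ m k (λ i → r i j) k<m) (sym (*-identityˡ (r k j))))))

        Σyδ : Σ m yδ ≡ Σ m y + 1ℤ
        Σyδ = trans (Σ-+ m y (δ k)) (cong (Σ m y +_) (trans (Σ-cong m λ i _ → sym (*-identityʳ (δ k i))) (Σ-δ m k (λ _ → 1ℤ) k<m)))

        -- The perceptron argument: the mixed term is nonpositive because row `k` is violated by
        -- `G z`, so adding the row increases the form by at most its own value.
        short′ : q G z′ ≤ 2ℤ * P * Σ m yδ
        short′ = 0≤i-j⇒j≤i (cancel-0≤ (pos 4) 0<4 (subst (0ℤ ≤_) eq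
          (0≤+ (0≤+ (0≤+ (0≤* (0≤pos 4) (gap short)) (0≤* (0≤pos 8) (gap bad))) (gap (fit k k<m))) (0≤* (0≤pos 3) (<⇒≤ 0<P)))))
          where
          e : ∀ z f r P y → pos 4 * (pos 2 * P * y - z) + pos 8 * (pos 0 - f) + (pos 5 * P - pos 4 * r) + pos 3 * P
                ≡ pos 4 * (pos 2 * P * (y + pos 1) - (pos 1 * pos 1 * z + pos 2 * (pos 1 * pos 1) * f + pos 1 * pos 1 * r))
          e = solve-∀
          eq = trans (e (q G z) (form G (r k) z) (q G (r k)) P (Σ m y))
            (cong₂ (λ s t → pos 4 * (2ℤ * P * s - t)) (sym Σyδ)
              (trans (cong (λ f → 1ℤ * 1ℤ * q G z + 2ℤ * (1ℤ * 1ℤ) * f + 1ℤ * 1ℤ * q G (r k)) (form-sym G symmetric (r k) z))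
                (sym (q-comb G symmetric 1ℤ z 1ℤ (r k)))))

        yδ≥0 : ∀ i → i ℕ.< m → 0ℤ ≤ yδ i
        yδ≥0 i i<m = 0≤+ (y≥0 i i<m) (δ≥0 k i)
          where
          δ≥0 : ∀ k i → 0ℤ ≤ δ k i
          δ≥0 k i with i ℕ.≟ k
          ... | yes refl = subst (0ℤ ≤_) (sym (δ-refl k)) (0≤pos 1)
          ... | no ne    = subst (0ℤ ≤_) (sym (δ-≢ λ e → ne (sym e))) (0≤pos 0)

        count : (y′ : ℕ → ℤ) → (∀ i → i ℕ.< m → y′ i ≡ yδ i) → y k + 1ℤ + 1ℤ ≤ pos Y →
                Σ[ I′ ∈ Inv (state G r y′) ] (Φ + 1ℤ ≤ Inv.Φ I′)
        count y′ y′≡ room = record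
          { d = d ; rows = rows ; heights = heights
          ; y≥0 = λ i i<m → subst (0ℤ ≤_) (sym (y′≡ i i<m)) (yδ≥0 i i<m)
          ; y<Y = λ i i<m → subst (λ t → t + 1ℤ ≤ pos Y) (sym (y′≡ i i<m)) (room′ i i<m)
          ; ellipsoid = ellipsoid ; slim = slim
          ; short = subst₂ _≤_ (q-cong G {z′} λ j _ → trans (sym (z-yδ j)) (Σ-cong m λ i i<m → cong (_* r i j) (sym (y′≡ i i<m))))
              (cong (2ℤ * P *_) (Σ-cong m λ i i<m → sym (y′≡ i i<m))) short′
          } , ≤-reflexive (trans (+-assoc (U * (pos m * pos Y)) (Σ m y) 1ℤ) (cong (U * (pos m * pos Y) +_)
                (trans (sym Σyδ) (Σ-cong m λ i i<m → sym (y′≡ i i<m)))))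
          where
          room′ : ∀ i → i ℕ.< m → yδ i + 1ℤ ≤ pos Y
          room′ i i<m with i ℕ.≟ k
          ... | yes refl = subst (λ t → y k + t + 1ℤ ≤ pos Y) (sym (δ-refl k)) room
          ... | no ne    = subst (λ t → y i + t + 1ℤ ≤ pos Y) (sym (δ-≢ λ e → ne (sym e)))
                             (subst (λ t → t + 1ℤ ≤ pos Y) (sym (+-identityʳ (y i))) (y<Y i i<m))

        -- Row k occurs at least Y times in z, while z is short: hence r k · x ≤ H / 2.
        thin : pos Y ≤ y k + 1ℤ → 2ℤ * dot n (r k) x ≤ H
        -- Put `K = Kof U`. All terms of `z′ · x` are nonnegative, so `Y h ≤ z′ · x`, while
        -- containment and shortness give `(z′ · x)² ≤ 2 K m Y`. Hence `Y h² ≤ 2 K m`, and `hY` was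
        -- chosen so that `4 h² ≤ R` follows.
        thin full = square-reflects-≤ (0≤* (0≤pos 2) 0≤h) (<⇒≤ 0<H) (0≤i-j⇒j≤i (cancel-0≤ (pos Y) 0<Y (subst (0ℤ ≤_) (e₂ (pos Y) h R (Kof U) (pos m) (pos κ) U Kmax)
            (0≤+ (0≤+ (0≤* (0≤pos 4) (gap Yh²≤)) (0≤* (<⇒≤ 0<R) (gap hY))) (0≤* (0≤* (0≤* (0≤pos 64) (0≤pos m)) (<⇒≤ 0<R)) (gap U≤))))))
          where
          h = dot n (r k) x
          0≤h = <⇒≤ (0<rx k k<m)
          zx = dot n z′ x
          zx≡ : zx ≡ Σ m (λ i → yδ i * dot n (r i) x)
          zx≡ = trans (dot-sym n z′ x) (trans (dot-cong n {x} {x} (λ _ _ → refl) λ j _ → sym (z-yδ j)) (trans (dot-Σ n m x (λ i → yδ i ⊙ r i))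
            (Σ-cong m λ i _ → trans (dot-⊙ n (yδ i) x (r i)) (cong (yδ i *_) (dot-sym n x (r i))))))
          Yh≤ : pos Y * h ≤ zx
          Yh≤ = ≤-trans (0≤i-j⇒j≤i (subst (0ℤ ≤_) (e (pos Y) (y k) h) (0≤* (gap full) 0≤h)))
            (≤-trans (≤-reflexive (cong (λ t → (y k + t) * h) (sym (δ-refl k))))
              (≤-trans (term≤Σ m k {λ i → yδ i * dot n (r i) x} k<m λ i i<m → 0≤* (yδ≥0 i i<m) (<⇒≤ (0<rx i i<m))) (≤-reflexive (sym zx≡))))
            where
            e : ∀ Y y h → (y + pos 1 - Y) * h ≡ (y + pos 1) * h - Y * h
            e = solve-∀
          Σyδ≤ : Σ m yδ ≤ pos m * pos Y
          Σyδ≤ = ≤-trans (Σ-mono m {yδ} {λ _ → pos Y} λ i i<m → ≤-trans (+-monoʳ-≤ (y i) (δ≤1 k i)) (y<Y i i<m)) (≤-reflexive (Σ-const m (pos Y)))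
            where
            δ≤1 : ∀ k i → δ k i ≤ 1ℤ
            δ≤1 k i with i ℕ.≟ k
            ... | yes refl = ≤-reflexive (δ-refl k)
            ... | no ne    = subst (_≤ 1ℤ) (sym (δ-≢ λ e → ne (sym e))) (0≤pos 1)
          zx²≤ : zx * zx ≤ 2ℤ * Kof U * (pos m * pos Y)
          zx²≤ = cancel-≤ P 0<P (≤-trans (contains z′) (≤-trans
            (0≤i-j⇒j≤i (subst (0ℤ ≤_) (e (Kof U) (q G z′) P (Σ m yδ) (pos m * pos Y))
              (0≤+ (0≤* (<⇒≤ 0<K) (gap short′)) (0≤* (0≤* (0≤* (0≤pos 2) (<⇒≤ 0<P)) (<⇒≤ 0<K)) (gap Σyδ≤)))))
            ≤-refl))
            where
            e : ∀ K q P y M → K * (pos 2 * P * y - q) + pos 2 * P * K * (M - y) ≡ P * (pos 2 * K * M) - K * q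
            e = solve-∀
          Yh²≤ : pos Y * (h * h) ≤ 2ℤ * Kof U * pos m
          Yh²≤ = cancel-≤ (pos Y) 0<Y (0≤i-j⇒j≤i (subst (0ℤ ≤_) (e (pos Y) h zx (Kof U) (pos m))
            (0≤+ (gap zx²≤) (0≤* (gap Yh≤) (0≤+ (0≤* (0≤pos Y) 0≤h) (≤-trans (0≤* (0≤pos Y) 0≤h) Yh≤))))))
            where
            e : ∀ Y h z K m → pos 2 * K * (m * Y) - z * z + (z - Y * h) * (Y * h + z) ≡ Y * (pos 2 * K * m) - Y * (Y * (h * h))
            e = solve-∀
          e₂ : ∀ Y h R K m κ U V → pos 4 * (pos 2 * (R * (κ + pos 8 * U)) * m - Y * (h * h)) + R * (Y - pos 8 * m * (κ + pos 8 * V)) + pos 64 * m * R * (V - U)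
                 ≡ Y * (R - pos 2 * h * (pos 2 * h))
          e₂ = solve-∀

        rescale : ∀ {G₁ G₂ : Matrix} (S₁ : Symmetric G₁) (S₂ : Symmetric G₂)
          (R₁ : Rounded (2ℤ * P) G (λ i → dot n (G i) (r k)) G₁) (R₂ : Rounded P G₁ (λ i → dot n (G₁ i) (r k)) G₂) →
          (r′ : ℕ → Vector) → (∀ i j → i ℕ.< m → j ℕ.< n → r′ i j ≡ (1ℤ + δ k i) * r i j) →
          (y′ : ℕ → ℤ) → (∀ i → i ℕ.< m → y′ i ≡ 0ℤ) → pos Y ≤ y k + 1ℤ →
          Σ[ I′ ∈ Inv (state G₂ r′ y′) ] (Φ + 1ℤ ≤ Inv.Φ I′)
        rescale {G₁} {G₂} S₁ S₂ R₁ R₂ r′ r′≡ y′ y′≡ full = I′ , progress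
          where
          open Updated S₁ S₂ R₁ R₂
          d′ : ℕ → ℕ
          d′ i = d i ℕ.+ ∣ δ k i ∣
          at-k : ∀ j → j ℕ.< n → r′ k j ≡ (2ℤ ⊙ r k) j
          at-k j j<n = trans (r′≡ k j k<m j<n) (cong (λ t → (1ℤ + t) * r k j) (δ-refl k))
          off-k : ∀ i → i ℕ.< m → i ≢ k → ∀ j → j ℕ.< n → r′ i j ≡ r i j
          off-k i i<m ne j j<n = trans (r′≡ i j i<m j<n) (trans (cong (λ t → (1ℤ + t) * r i j) (δ-≢ λ e → ne (sym e))) (*-identityˡ (r i j)))
          U′ : ℤ
          U′ = Σ m (λ i → pos (d′ i))
          U′≡ : U′ ≡ U + 1ℤ
          U′≡ = trans (Σ-cong m λ i _ → cong (pos (d i) +_) (0≤i⇒+∣i∣≡i (δ≥0 k i)))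
            (trans (Σ-+ m (λ i → pos (d i)) (δ k)) (cong (U +_) (trans (Σ-cong m λ i _ → sym (*-identityʳ (δ k i))) (Σ-δ m k (λ _ → 1ℤ) k<m))))
            where
            δ≥0 : ∀ k i → 0ℤ ≤ δ k i
            δ≥0 k i with i ℕ.≟ k
            ... | yes refl = subst (0ℤ ≤_) (sym (δ-refl k)) (0≤pos 1)
            ... | no ne    = subst (0ℤ ≤_) (sym (δ-≢ λ e → ne (sym e))) (0≤pos 0)
          rows′ : ∀ i j → i ℕ.< m → j ℕ.< n → r′ i j ≡ pos (2 ℕ.^ d′ i) * a i j
          rows′ i j i<m j<n with i ℕ.≟ k
          ... | yes refl = trans (at-k j j<n) (trans (cong (2ℤ *_) (rows k j i<m j<n)) (trans (sym (*-assoc 2ℤ (pos (2 ℕ.^ d k)) (a k j)))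
                  (cong (_* a k j) (trans (sym (pos-* 2 (2 ℕ.^ d k))) (cong (λ t → pos (2 ℕ.^ t)) (trans (ℕ.+-comm 1 (d k)) (cong (λ t → d k ℕ.+ ∣ t ∣) (sym (δ-refl k)))))))))
          ... | no ne    = trans (off-k i i<m ne j j<n) (trans (rows i j i<m j<n)
                  (cong (λ t → pos (2 ℕ.^ t) * a i j) (trans (sym (ℕ.+-identityʳ (d i))) (cong (λ t → d i ℕ.+ ∣ t ∣) (sym (δ-≢ λ e → ne (sym e)))))))
          heights′ : ∀ i → i ℕ.< m → dot n (r′ i) x ≤ H
          heights′ i i<m with i ℕ.≟ k
          ... | yes refl = subst (_≤ H) (sym (trans (dot-cong n {r′ k} {2ℤ ⊙ r k} {x} {x} at-k (λ _ _ → refl)) (dot-⊙ˡ n 2ℤ (r k) x))) (thin full)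
          ... | no ne    = subst (_≤ H) (sym (dot-cong n {r′ i} {r i} {x} {x} (off-k i i<m ne) (λ _ _ → refl))) (heights i i<m)
          slim′ : ∀ i → i ℕ.< m → q G₂ (r′ i) ≤ P + pos 4 * E * (U + 1ℤ)
          slim′ i i<m with i ℕ.≟ k
          ... | yes refl = ≤-trans (≤-reflexive (trans (q-cong G₂ at-k) (q-scale G₂ S₂ 2ℤ (r k)))) (≤-trans T.shrinks
                  (0≤i-j⇒j≤i (subst (0ℤ ≤_) (e P E U) (0≤* (0≤* (0≤pos 4) 0≤E) 0≤U))))
            where
            e : ∀ P E U → pos 4 * E * U ≡ P + pos 4 * E * (U + pos 1) - (P + pos 4 * E)
            e = solve-∀
          ... | no ne    = ≤-trans (≤-reflexive (q-cong G₂ (off-k i i<m ne))) (≤-trans (T.grows (r i) (ridge≤ i i<m))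
                  (0≤i-j⇒j≤i (subst (0ℤ ≤_) (e P E U (q G (r i))) (0≤+ (gap (slim i i<m)) (0≤* (0≤pos 2) 0≤E)))))
            where
            e : ∀ P E U q → P + pos 4 * E * U - q + pos 2 * E ≡ P + pos 4 * E * (U + pos 1) - (q + pos 2 * E)
            e = solve-∀
          z₀ : ∀ j → Σ m (λ i → y′ i * r′ i j) ≡ 0ℤ
          z₀ j = Σ-zero m λ i i<m → trans (cong (_* r′ i j) (y′≡ i i<m)) (*-zeroˡ (r′ i j))
          K≡ : Kof U + pos 4 * R + pos 4 * R ≡ Kof (U + 1ℤ)
          K≡ = e R (pos κ) U
            where
            e : ∀ R κ U → R * (κ + pos 8 * U) + pos 4 * R + pos 4 * R ≡ R * (κ + pos 8 * (U + pos 1))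
            e = solve-∀
          Σy′ : Σ m y′ ≡ 0ℤ
          Σy′ = Σ-zero m y′≡
          I′ : Inv (state G₂ r′ y′)
          I′ = record
            { d = d′ ; rows = rows′ ; heights = heights′
            ; y≥0 = λ i i<m → ≤-reflexive (sym (y′≡ i i<m))
            ; y<Y = λ i i<m → subst (λ t → t + 1ℤ ≤ pos Y) (sym (y′≡ i i<m)) (i<j⇒suc[i]≤j 0<Y)
            ; ellipsoid = subst (Contains P x G₂) (trans K≡ (cong Kof (sym U′≡))) T.contains₂
            ; slim = λ i i<m → subst (λ u → q G₂ (r′ i) ≤ P + pos 4 * E * u) (sym U′≡) (slim′ i i<m)
            ; short = ≤-reflexive (trans (Σ-zero n λ j _ → trans (cong (_* dot n (G₂ j) (λ j → Σ m (λ i → y′ i * r′ i j))) (z₀ j)) (*-zeroˡ (dot n (G₂ j) (λ j → Σ m (λ i → y′ i * r′ i j)))))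
                (sym (trans (cong (2ℤ * P *_) Σy′) (*-zeroʳ (2ℤ * P)))))
            }
          progress : Φ + 1ℤ ≤ Inv.Φ I′
          -- Resetting the counts loses at most `m * (Y - 1)`, as each of them is below `Y`; the
          -- additional doubling contributes `m * Y`.
          progress = subst (Φ + 1ℤ ≤_) (sym (cong₂ (λ u s → u * (pos m * pos Y) + s) U′≡ Σy′))
            (0≤i-j⇒j≤i (subst (0ℤ ≤_) (e U (pos m * pos Y) (Σ m y) (pos m)) (0≤+ (gap Σy≤) (gap 1≤m))))
            where
            1≤m : 1ℤ ≤ pos m
            1≤m = +≤+ (ℕ.≤-trans (s≤s z≤n) k<m)
            Σy≤ : Σ m y + pos m ≤ pos m * pos Y
            Σy≤ = subst₂ _≤_ (trans (Σ-+ m y (λ _ → 1ℤ)) (cong (Σ m y +_) (trans (Σ-const m 1ℤ) (*-identityʳ (pos m))))) (Σ-const m (pos Y))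
              (Σ-mono m {λ i → y i + 1ℤ} {λ _ → pos Y} y<Y)
            e : ∀ U M s m → M - (s + m) + (m - pos 1) ≡ (U + pos 1) * M + pos 0 - (U * M + s + pos 1)
            e = solve-∀

    module Initial (g : ℕ) (0<κ : 0 ℕ.< κ) (0<Y : 0ℤ < pos Y) (hκ : P * N ≤ pos κ * pos g) (hg : pos g * N ≤ P)
      (ax≤H : ∀ i → i ℕ.< m → dot n (a i) x ≤ H)
      (s : State) (G≡ : ∀ i j → i ℕ.< n → j ℕ.< n → State.G s i j ≡ pos g * δ i j)
      (r≡ : ∀ i j → i ℕ.< m → j ℕ.< n → State.r s i j ≡ a i j) (y≡ : ∀ i → i ℕ.< m → State.y s i ≡ 0ℤ) where
      open State s

      q≡ : ∀ w → q G w ≡ pos g * norm² w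
      q≡ w = trans (Σ-cong n λ i i<n → trans (cong (w i *_) (inner i i<n)) (e (w i) (pos g))) (Σ-* n (pos g) (λ i → w i * w i))
        where
        e : ∀ w g → w * (g * w) ≡ g * (w * w)
        e = solve-∀
        inner : ∀ i → i ℕ.< n → dot n (G i) w ≡ pos g * w i
        inner i i<n = trans (Σ-cong n λ j j<n → trans (cong (_* w j) (G≡ i j i<n j<n)) (*-assoc (pos g) (δ i j) (w j)))
          (trans (Σ-* n (pos g) (λ j → δ i j * w j)) (cong (pos g *_) (Σ-δ n i w i<n)))

      0≤x : ∀ j → j ℕ.< n → 0ℤ ≤ x j × x j ≤ H
      0≤x j j<n with unit j j<n
      ... | i , i<m , ai≡ = subst (0ℤ ≤_) x≡ (≤-trans (0≤pos 1) (1≤ax i i<m)) , subst (_≤ H) x≡ (ax≤H i i<m)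
        where
        x≡ : dot n (a i) x ≡ x j
        x≡ = trans (Σ-cong n λ l l<n → cong (_* x l) (ai≡ l l<n)) (Σ-δ n j x j<n)

      -- The unit rows put the entries of `x` between 0 and `H`, so `young` applies to each pair of
      -- coordinates with `R` as the bound on `x i * x j`.
      cauchy-schwarz : ∀ w → dot n w x * dot n w x ≤ R * (N * norm² w)
      cauchy-schwarz w = 0≤i-j⇒j≤i (cancel-0≤ 2ℤ 0<2 (subst (0ℤ ≤_)
        (trans (expand 0ℤ 0ℤ 0ℤ (- 2ℤ) R R G G x w) (final (q G w) R N (norm² w) (dot n w x)))
        (double-nonneg λ i j i<n j<n → subst (0ℤ ≤_) (entry R (G i j) (δ i j) (x i) (x j) (w i) (w j))
          (young R (x i * x j) (w i) (w j)
            (0≤+ (<⇒≤ 0<R) (0≤* (proj₁ (0≤x i i<n)) (proj₁ (0≤x j j<n))))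
            (subst (0ℤ ≤_) (split H (x i) (x j)) (0≤+ (0≤* (<⇒≤ 0<H) (gap (proj₂ (0≤x j j<n)))) (0≤* (proj₁ (0≤x j j<n)) (gap (proj₂ (0≤x i i<n))))))))))
        where
        split : ∀ H a b → H * (H - b) + b * (H - a) ≡ H * H - a * b
        split = solve-∀
        entry : ∀ R G D a b u v → R * (u * u) + R * (v * v) - pos 2 * (a * b * (u * v)) ≡
          pos 0 * (u * (G * v)) + (pos 0 * (u * (G * v)) + (pos 0 * (D * (u * v)) + (- pos 2 * (u * a * (v * b)) + (R * (u * u) + (R * (v * v) + pos 0)))))
        entry = solve-∀
        final : ∀ Q R N W p → pos 0 * Q + (pos 0 * Q + (pos 0 * W + (- pos 2 * (p * p) + (R * (N * W) + (R * (N * W) + pos 0)))))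
          ≡ pos 2 * (R * (N * W) - p * p)
        final = solve-∀

      norm≥0 : ∀ w → 0ℤ ≤ norm² w
      norm≥0 w = Σ-nonneg n λ i _ → 0≤square (w i)

      initial : Inv s
      initial = record
        { d = λ _ → 0
        ; rows = λ i j i<m j<n → trans (r≡ i j i<m j<n) (sym (*-identityˡ (a i j)))
        ; heights = λ i i<m → subst (_≤ H) (sym (dot-cong n {r i} {a i} {x} {x} (λ j → r≡ i j i<m) (λ _ _ → refl))) (ax≤H i i<m)
        ; y≥0 = λ i i<m → ≤-reflexive (sym (y≡ i i<m))
        ; y<Y = λ i i<m → subst (λ t → t + 1ℤ ≤ pos Y) (sym (y≡ i i<m)) (i<j⇒suc[i]≤j 0<Y)
        ; ellipsoid = record
            { symmetric = λ i j i<n j<n → trans (G≡ i j i<n j<n) (trans (cong (pos g *_) (δ-sym i j)) (sym (G≡ j i j<n i<n)))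
            ; 0<K = subst (0ℤ <_) (sym K≡) (0<* 0<R (+<+ 0<κ))
            ; contains = λ w → ≤-trans (0≤i-j⇒j≤i (subst (0ℤ ≤_) (e P R N (norm² w) (dot n w x) (pos κ) (pos g))
                (0≤+ (0≤* 0≤P (gap (cauchy-schwarz w))) (0≤* (0≤* (<⇒≤ 0<R) (norm≥0 w)) (gap hκ)))))
                (≤-reflexive (sym (cong₂ _*_ K≡ (q≡ w))))
            }
        ; slim = λ i i<m → ≤-trans (≤-reflexive (q≡ (r i))) (≤-trans (≤-trans
            (0≤i-j⇒j≤i (subst (0ℤ ≤_) (e′ (pos g) N (norm² (r i))) (0≤* (0≤pos g) (gap (norm≤ i i<m))))) hg)
            (≤-reflexive (sym (trans (cong (λ u → P + pos 4 * E * u) total≡) (e₀ P E)))))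
        ; short = ≤-reflexive (trans (Σ-zero n λ j _ → trans (cong (_* dot n (G j) z) (z≡ j)) (*-zeroˡ (dot n (G j) z)))
            (sym (trans (cong (2ℤ * P *_) (Σ-zero m y≡)) (*-zeroʳ (2ℤ * P)))))
        }
        where
        0≤P = 0≤pos p
        total≡ : total (λ _ → 0) ≡ 0ℤ
        total≡ = Σ-zero m λ _ _ → refl
        K≡ : Kof (total (λ _ → 0)) ≡ R * pos κ
        K≡ = trans (cong Kof total≡) (cong (R *_) (+-identityʳ (pos κ)))
        e : ∀ P R N W t κ g → P * (R * (N * W) - t * t) + R * W * (κ * g - P * N) ≡ R * κ * (g * W) - P * (t * t)
        e = solve-∀
        e′ : ∀ g N W → g * (N - W) ≡ g * N - g * W
        e′ = solve-∀
        e₀ : ∀ P E → P + pos 4 * E * pos 0 ≡ P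
        e₀ = solve-∀
        norm≤ : ∀ i → i ℕ.< m → norm² (r i) ≤ N
        norm≤ i i<m = ≤-trans (Σ-mono n {λ j → r i j * r i j} {λ _ → 1ℤ} λ j j<n →
            subst (λ t → t * t ≤ 1ℤ) (sym (r≡ i j i<m j<n)) (∣a∣≤1⇒a²≤1 (a i j) (∣a∣≤1 i j i<m j<n)))
          (≤-reflexive (trans (Σ-const n 1ℤ) (*-identityʳ N)))
        z≡ : ∀ j → z j ≡ 0ℤ
        z≡ j = Σ-zero m λ i i<m → trans (cong (_* r i j) (y≡ i i<m)) (*-zeroˡ (r i j))

-- The algorithm on lists and its polynomial-time computability

module Algorithm where

  open TreeStack
  open PolyTime
  open PolyTimeFold
  open PolyTimeList
  open Binary
  open PolyTimeArithmetic
  open Sums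
  open import Data.Integer as ℤ using (ℤ; -[1+_]; _⊖_; ∣_∣; 0ℤ; 1ℤ) renaming (+_ to pos)
  import Data.Integer.Properties as ℤ
  open import Data.List.Relation.Unary.All as All using (All; []; _∷_)
  import Data.List.Relation.Unary.All.Properties as All
  open import Data.Nat using (ℕ; zero; suc; _+_; _*_; _≤_; z≤n; s≤s; ⌊_/2⌋)
  open import Data.Nat.Properties

  tab : {A : Set} → ℕ → (ℕ → A) → List A
  tab n f = map f (upTo n)

  entry : List (List ℤ) → ℕ → ℕ → ℤ
  entry M i j = nth 0ℤ (nth [] M i) j

  bits : ℤ → ℕ
  bits z = bitLength ∣ z ∣

  bits-+ : ∀ a b → bits (a ℤ.+ b) ≤ suc (bits a + bits b)
  bits-+ a b = ≤-trans (bitLength-mono (ℤ.∣i+j∣≤∣i∣+∣j∣ a b)) (bitLength-+ ∣ a ∣ ∣ b ∣)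

  halves : ℕ → ℕ → ℕ
  halves p n = fold n ⌊_/2⌋ p

  -- z / 2 ^ p, rounded towards zero.
  shift : ℕ → ℤ → ℤ
  shift p z = halves p (z ⁺) ⊖ halves p (z ⁻)

  fits : ℕ → ℕ → Bool
  fits W n = null (fold (toBits n) tail W)

  -- Keeps the entries of the matrix short on infeasible inputs as well, for which
  -- nothing else bounds them.
  clip : ℕ → ℤ → ℤ
  clip W z = if fits W (z ⁺) ∧ fits W (z ⁻) then z else 0ℤ

  subtract : ℕ → ℕ → List (List ℤ) → List ℤ → List (List ℤ)
  subtract n p G g = tab n λ i → tab n λ j →
    (entry G i j ℤ.+ pos n ℤ.* δ i j) ℤ.- shift p (nth 0ℤ g i ℤ.* nth 0ℤ g j)

  apply : ℕ → List (List ℤ) → List ℤ → List ℤ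
  apply n G v = tab n λ i → Σ n λ j → entry G i j ℤ.* nth 0ℤ v j

  combine : ℕ → ℕ → List (List ℤ) → List ℤ → List ℤ
  combine n m r y = tab n λ j → Σ m λ i → nth 0ℤ y i ℤ.* entry r i j

  slacks : ℕ → ℕ → List (List ℤ) → List ℤ → List ℤ
  slacks n m r v = tab m λ i → Σ n λ j → entry r i j ℤ.* nth 0ℤ v j

  -- A left fold cannot stop early, so after the first nonpositive entry the state is frozen; until
  -- then the number counts the entries passed and thus ends as the index of the hit.
  found : Bool × ℕ → ℤ → Bool × ℕ
  found (b , k) z = if b then (b , k) else if nonPositive z then (true , k) else (false , suc k)

  search : List ℤ → Bool × ℕ
  search = foldl found (false , 0)

  paramTy stateTy : Ty
  paramTy = (un ⊗ un) ⊗ ((un ⊗ un) ⊗ int)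
  stateTy = list (list int) ⊗ (list (list int) ⊗ list int)

  Param LState : Set
  Param  = ⟦ paramTy ⟧
  LState = ⟦ stateTy ⟧

  solution : ℕ → ℕ → LState → List ℤ
  solution n m (G , (r , y)) = apply n G (combine n m r y)

  violated : ℕ → ℕ → LState → Bool × ℕ
  violated n m s = search (slacks n m (proj₁ (proj₂ s)) (solution n m s))

  counted : ℕ → ℕ → LState → LState
  counted m k (G , (r , y)) = G , (r , tab m λ i → nth 0ℤ y i ℤ.+ δ k i)

  shrunk : ℕ → ℕ → ℕ → List (List ℤ) → List ℤ → List (List ℤ)
  -- The exponents `suc p` and `p` are the denominators `2P` and `P` of the two successive updates.
  shrunk n p W G r = let G₁ = subtract n (suc p) G (apply n G r)
                         G₂ = subtract n p G₁ (apply n G₁ r)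
                     in tab n λ i → tab n λ j → clip W (entry G₂ i j)

  doubled : ℕ → ℕ → ℕ → List (List ℤ) → List (List ℤ)
  doubled n m k r = tab m λ i → tab n λ j → (1ℤ ℤ.+ δ k i) ℤ.* entry r i j

  rescaled : ℕ → ℕ → ℕ → ℕ → ℕ → LState → LState
  rescaled n m p W k (G , (r , y)) = shrunk n p W G (nth [] r k) , (doubled n m k r , tab m λ _ → 0ℤ)

  opaque
    step : Param → LState → LState
    step ((n , m) , ((p , W) , Y)) s =
      if proj₁ (violated n m s)
      -- True when one more addition would raise the count of the violated row to `Y`: the row is
      -- then doubled instead of added.
      then if nonPositive (Y ℤ.- (nth 0ℤ (proj₂ (proj₂ s)) (proj₂ (violated n m s)) ℤ.+ 1ℤ))
           then rescaled n m p W (proj₂ (violated n m s)) s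
           else counted m (proj₂ (violated n m s)) s
      else s

  private
    Σ-foldl : ∀ n f → foldl (λ s i → s ℤ.+ f i) 0ℤ (upTo n) ≡ Σ n f
    Σ-foldl zero    f = refl
    Σ-foldl (suc n) f = trans (cong (foldl (λ s i → s ℤ.+ f i) 0ℤ) (sym (upTo-∷ʳ n)))
      (trans (foldl-++ (λ s i → s ℤ.+ f i) 0ℤ (upTo n) (n ∷ [])) (cong (ℤ._+ f n) (Σ-foldl n f)))

    halves-mono : ∀ p n → halves p n ≤ n
    halves-mono zero    n = ≤-refl
    halves-mono (suc p) n = ≤-trans (⌊n/2⌋≤n (halves p n)) (halves-mono p n)

  module _ {γ : Ty} where

    ↑_ : ∀ {σ τ} {f : ⟦ γ ⟧ → ⟦ τ ⟧} → PT {γ} {τ} f → PT {γ ⊗ σ} {τ} (λ g → f (proj₁ g))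
    ↑ p = pt-∘ p pt-fst

    abstract
      pt-tab : ∀ {σ} {n : ⟦ γ ⟧ → ℕ} {f : ⟦ γ ⊗ un ⟧ → ⟦ σ ⟧} → PT {γ} {un} n → PT {γ ⊗ un} {σ} f →
               PT {γ} {list σ} (λ g → tab (n g) (λ i → f (g , i)))
      pt-tab p q = pt-map q (pt-upTo p)

      -- Partial sums are measured by bit length, which grows at each addend by at most its own bit
      -- length plus one.
      pt-Σ : ∀ {n : ⟦ γ ⟧ → ℕ} {f : ⟦ γ ⊗ un ⟧ → ℤ} → PT {γ} {un} n → PT {γ ⊗ un} {int} f →
             PT {γ} {int} (λ g → Σ (n g) (λ i → f (g , i)))
      pt-Σ {n} {f} p q = pt-ext (λ g → Σ-foldl (n g) (λ i → f (g , i)))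
        (pt-foldlᵐ {γ} {un} {int} {λ ((g , s) , i) → s ℤ.+ f (g , i)} (pt-+ (pt-∘ pt-snd pt-fst) (pt-∘ q (pt-pair (pt-∘ pt-fst pt-fst) pt-snd)))
          (pt-upTo p) (pt-const {σ = int} 0ℤ) bits (con 3 ⊞ con 8 ⊠ var) (con 0) (con 1 ⊞ out q ⊚ (con 1 ⊞ var)) sz-int (λ _ → z≤n)
          λ g s i → ≤-trans (bits-+ s (f (g , i))) (≤-trans (≤-reflexive (sym (+-suc (bits s) (bits (f (g , i))))))
            (+-monoʳ-≤ (bits s) (s≤s (≤-trans (bitLength≤sz-int (f (g , i))) (sz-out q (g , i)))))))

      pt-neg : ∀ {z : ⟦ γ ⟧ → ℤ} → PT {γ} {int} z → PT {γ} {int} (λ g → ℤ.- z g)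
      pt-neg {z} p = pt-ext (λ g → e (z g)) (pt-⊖ (pt-⁻ p) (pt-⁺ p))
        where
        e : ∀ z → z ⁻ ⊖ z ⁺ ≡ ℤ.- z
        e (pos zero)    = refl
        e (pos (suc n)) = refl
        e (-[1+ n ])    = refl

      pt-δ : ∀ {i j : ⟦ γ ⟧ → ℕ} → PT {γ} {un} i → PT {γ} {un} j → PT {γ} {int} (λ g → δ (i g) (j g))
      pt-δ p q = pt-if (pt-≡ᵘ p q) (pt-const {σ = int} 1ℤ) (pt-const {σ = int} 0ℤ)

      pt-entry : ∀ {M : ⟦ γ ⟧ → List (List ℤ)} {i j : ⟦ γ ⟧ → ℕ} → PT {γ} {list (list int)} M → PT {γ} {un} i → PT {γ} {un} j →
                 PT {γ} {int} (λ g → entry (M g) (i g) (j g))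
      pt-entry pM p q = pt-nth {σ = int} 0ℤ (pt-nth {σ = list int} [] pM p) q

      pt-halves : ∀ {p n : ⟦ γ ⟧ → ℕ} → PT {γ} {un} p → PT {γ} {bn} n → PT {γ} {bn} (λ g → halves (p g) (n g))
      pt-halves {p} {n} pp pn = pt-fold {γ} {bn} {λ y → ⌊ proj₂ y /2⌋} (pt-half pt-snd) pp pn (con 1 ⊞ con 4 ⊠ out pn)
        λ g k _ → ≤-trans (sz-bn (halves k (n g))) (s≤s (*-monoʳ-≤ 4
          (≤-trans (bitLength-mono (halves-mono k (n g))) (≤-trans (bitLength≤sz (n g)) (sz-out pn g)))))

      pt-shift : ∀ {p : ⟦ γ ⟧ → ℕ} {z : ⟦ γ ⟧ → ℤ} → PT {γ} {un} p → PT {γ} {int} z → PT {γ} {int} (λ g → shift (p g) (z g))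
      pt-shift pp pz = pt-⊖ (pt-halves pp (pt-⁺ pz)) (pt-halves pp (pt-⁻ pz))

      pt-fits : ∀ {W n : ⟦ γ ⟧ → ℕ} → PT {γ} {un} W → PT {γ} {bn} n → PT {γ} {bool} (λ g → fits (W g) (n g))
      pt-fits pW pn = pt-null (pt-fold⁺ {γ} {list bool} {λ y → tail (proj₂ y)} (pt-tail pt-snd) pW (pt-toBits pn) (con 0)
        λ g s → ≤-trans (sz-tail bool s) (m≤m+n _ 0))

      pt-clip : ∀ {W : ⟦ γ ⟧ → ℕ} {z : ⟦ γ ⟧ → ℤ} → PT {γ} {un} W → PT {γ} {int} z → PT {γ} {int} (λ g → clip (W g) (z g))
      pt-clip pW pz = pt-if (pt-∧ (pt-fits pW (pt-⁺ pz)) (pt-fits pW (pt-⁻ pz))) pz (pt-const {σ = int} 0ℤ)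

  module _ {γ : Ty} {n : ⟦ γ ⟧ → ℕ} (pn : PT {γ} {un} n) where

    abstract
      pt-subtract : ∀ {p G g} → PT {γ} {un} p → PT {γ} {list (list int)} G → PT {γ} {list int} g →
                    PT {γ} {list (list int)} (λ x → subtract (n x) (p x) (G x) (g x))
      pt-subtract pp pG pg = pt-tab pn (pt-tab (↑ pn)
        (pt-+ (pt-+ (pt-entry (↑ ↑ pG) (↑ pt-snd) pt-snd) (pt-* (pt-pos (pt-un→bn (↑ ↑ pn))) (pt-δ (↑ pt-snd) pt-snd)))
              (pt-neg (pt-shift (↑ ↑ pp) (pt-* (pt-nth {σ = int} 0ℤ (↑ ↑ pg) (↑ pt-snd)) (pt-nth {σ = int} 0ℤ (↑ ↑ pg) pt-snd))))))

      pt-apply : ∀ {G v} → PT {γ} {list (list int)} G → PT {γ} {list int} v → PT {γ} {list int} (λ x → apply (n x) (G x) (v x))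
      pt-apply pG pv = pt-tab pn (pt-Σ (↑ pn) (pt-* (pt-entry (↑ ↑ pG) (↑ pt-snd) pt-snd) (pt-nth {σ = int} 0ℤ (↑ ↑ pv) pt-snd)))

    module _ {m : ⟦ γ ⟧ → ℕ} (pm : PT {γ} {un} m) where

      abstract
        pt-combine : ∀ {r y} → PT {γ} {list (list int)} r → PT {γ} {list int} y →
                     PT {γ} {list int} (λ x → combine (n x) (m x) (r x) (y x))
        pt-combine pr py = pt-tab pn (pt-Σ (↑ pm) (pt-* (pt-nth {σ = int} 0ℤ (↑ ↑ py) pt-snd) (pt-entry (↑ ↑ pr) pt-snd (↑ pt-snd))))

        pt-slacks : ∀ {r v} → PT {γ} {list (list int)} r → PT {γ} {list int} v →
                    PT {γ} {list int} (λ x → slacks (n x) (m x) (r x) (v x))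
        pt-slacks pr pv = pt-tab pm (pt-Σ (↑ pn) (pt-* (pt-entry (↑ ↑ pr) (↑ pt-snd) pt-snd) (pt-nth {σ = int} 0ℤ (↑ ↑ pv) pt-snd)))

        pt-search : ∀ {l} → PT {γ} {list int} l → PT {γ} {bool ⊗ un} (λ x → search (l x))
        pt-search pl = pt-foldl⁺ {γ} {int} {bool ⊗ un} {λ ((_ , s) , z) → found s z}
          (pt-if (pt-∘ pt-fst (pt-∘ pt-snd pt-fst)) (pt-∘ pt-snd pt-fst)
            (pt-if (pt-nonPositive pt-snd) (pt-pair (pt-const {σ = bool} true) (pt-∘ pt-snd (pt-∘ pt-snd pt-fst)))
              (pt-pair (pt-const {σ = bool} false) (pt-suc (pt-∘ pt-snd (pt-∘ pt-snd pt-fst))))))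
          pl (pt-const {σ = bool ⊗ un} (false , 0)) (con 2) λ g s z → grow s z
          where
          grow : ∀ s z → sz (bool ⊗ un) (found s z) ≤ sz (bool ⊗ un) s + 2
          grow (true , k)  z = m≤m+n _ 2
          grow (false , k) z with nonPositive z
          ... | true  = ≤-reflexive (+-comm 2 _)
          ... | false = ≤-reflexive (+-comm 2 _)

        pt-violated : ∀ {s} → PT {γ} {stateTy} s → PT {γ} {bool ⊗ un} (λ x → violated (n x) (m x) (s x))
        pt-violated {s} ps = pt-search (pt-slacks pr (pt-apply (pt-∘ pt-fst ps) (pt-combine pr (pt-∘ pt-snd (pt-∘ pt-snd ps)))))
          where
          pr : PT {γ} {list (list int)} (λ x → proj₁ (proj₂ (s x)))
          pr = pt-∘ (pt-fst {list (list int)} {list int}) (pt-∘ (pt-snd {list (list int)}) ps)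

        pt-counted : ∀ {k s} → PT {γ} {un} k → PT {γ} {stateTy} s → PT {γ} {stateTy} (λ x → counted (m x) (k x) (s x))
        pt-counted {k} {s} pk ps = pt-pair (pt-∘ pt-fst ps) (pt-pair (pt-∘ pt-fst (pt-∘ pt-snd ps))
          (pt-tab pm (pt-+ (pt-nth {σ = int} 0ℤ (↑ (pt-∘ pt-snd (pt-∘ pt-snd ps))) pt-snd) (pt-δ (↑ pk) pt-snd))))

      abstract
        pt-shrunk : ∀ {p W G r} → PT {γ} {un} p → PT {γ} {un} W → PT {γ} {list (list int)} G → PT {γ} {list int} r →
                    PT {γ} {list (list int)} (λ x → shrunk (n x) (p x) (W x) (G x) (r x))
        pt-shrunk {p} {W} {G} {r} pp pW pG pr = pt-tab pn (pt-tab (↑ pn) (pt-clip (↑ ↑ pW) (pt-entry (↑ ↑ pG₂) (↑ pt-snd) pt-snd)))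
          where
          G₁ : ⟦ γ ⟧ → List (List ℤ)
          G₁ x = subtract (n x) (suc (p x)) (G x) (apply (n x) (G x) (r x))
          pG₁ : PT {γ} {list (list int)} G₁
          pG₁ = pt-subtract (pt-suc pp) pG (pt-apply pG pr)
          pG₂ : PT {γ} {list (list int)} (λ x → subtract (n x) (p x) (G₁ x) (apply (n x) (G₁ x) (r x)))
          pG₂ = pt-subtract pp pG₁ (pt-apply pG₁ pr)

        pt-doubled : ∀ {k r} → PT {γ} {un} k → PT {γ} {list (list int)} r →
                     PT {γ} {list (list int)} (λ x → doubled (n x) (m x) (k x) (r x))
        pt-doubled pk pr = pt-tab pm (pt-tab (↑ pn)
          (pt-* (pt-+ (pt-const {σ = int} 1ℤ) (pt-δ (↑ ↑ pk) (↑ pt-snd))) (pt-entry (↑ ↑ pr) (↑ pt-snd) pt-snd)))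

        pt-rescaled : ∀ {p W k s} → PT {γ} {un} p → PT {γ} {un} W → PT {γ} {un} k → PT {γ} {stateTy} s →
                      PT {γ} {stateTy} (λ x → rescaled (n x) (m x) (p x) (W x) (k x) (s x))
        pt-rescaled {p} {W} {k} {s} pp pW pk ps = pt-pair {σ = list (list int)} {τ = list (list int) ⊗ list int}
          (pt-shrunk {p} {W} {λ x → proj₁ (s x)} {λ x → nth [] (proj₁ (proj₂ (s x))) (k x)} pp pW (pt-∘ pt-fst ps) (pt-nth {σ = list int} [] pr pk))
          (pt-pair {σ = list (list int)} {τ = list int} (pt-doubled pk pr) (pt-tab pm (pt-const {σ = int} 0ℤ)))
          where
          pr : PT {γ} {list (list int)} (λ x → proj₁ (proj₂ (s x)))
          pr = pt-∘ (pt-fst {list (list int)} {list int}) (pt-∘ (pt-snd {list (list int)}) ps)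

  private
    Γ : Ty
    Γ = paramTy ⊗ stateTy

    n∙ m∙ p∙ W∙ k∙ : ⟦ Γ ⟧ → ℕ
    n∙ (((n , m) , ((p , W) , Y)) , s) = n
    m∙ (((n , m) , ((p , W) , Y)) , s) = m
    p∙ (((n , m) , ((p , W) , Y)) , s) = p
    W∙ (((n , m) , ((p , W) , Y)) , s) = W
    k∙ x = proj₂ (violated (n∙ x) (m∙ x) (proj₂ x))

    full∙ : ⟦ Γ ⟧ → Bool
    full∙ x = nonPositive (proj₂ (proj₂ (proj₁ x)) ℤ.- (nth 0ℤ (proj₂ (proj₂ (proj₂ x))) (k∙ x) ℤ.+ 1ℤ))

  opaque
    unfolding step

    pt-step : PT {paramTy ⊗ stateTy} {stateTy} (λ (par , s) → step par s)
    pt-step = whole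
      where
      n : PT {paramTy ⊗ stateTy} {un} n∙
      n = pt-∘ pt-fst (pt-∘ pt-fst pt-fst)
      m : PT {paramTy ⊗ stateTy} {un} m∙
      m = pt-∘ pt-snd (pt-∘ pt-fst pt-fst)
      p : PT {paramTy ⊗ stateTy} {un} p∙
      p = pt-∘ pt-fst (pt-∘ pt-fst (pt-∘ pt-snd pt-fst))
      W : PT {paramTy ⊗ stateTy} {un} W∙
      W = pt-∘ pt-snd (pt-∘ pt-fst (pt-∘ pt-snd pt-fst))
      Y : PT {paramTy ⊗ stateTy} {int} (λ x → proj₂ (proj₂ (proj₁ x)))
      Y = pt-∘ pt-snd (pt-∘ pt-snd pt-fst)
      s : PT {paramTy ⊗ stateTy} {stateTy} (λ (par , s) → s)
      s = pt-snd
      hit : PT {paramTy ⊗ stateTy} {bool ⊗ un} (λ x → violated (n∙ x) (m∙ x) (proj₂ x))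
      hit = pt-violated n m s
      k : PT {paramTy ⊗ stateTy} {un} k∙
      k = pt-∘ pt-snd hit
      grown : PT {paramTy ⊗ stateTy} {stateTy} (λ x → rescaled (n∙ x) (m∙ x) (p∙ x) (W∙ x) (k∙ x) (proj₂ x))
      grown = pt-rescaled n m {p∙} {W∙} {k∙} {proj₂} p W k s
      more : PT {paramTy ⊗ stateTy} {stateTy} (λ x → counted (m∙ x) (k∙ x) (proj₂ x))
      more = pt-counted n m {k∙} {proj₂} k s
      act : PT {paramTy ⊗ stateTy} {stateTy}
        (λ x → if full∙ x then rescaled (n∙ x) (m∙ x) (p∙ x) (W∙ x) (k∙ x) (proj₂ x) else counted (m∙ x) (k∙ x) (proj₂ x))
      full : PT {paramTy ⊗ stateTy} {bool} full∙
      full = pt-nonPositive (pt-+ Y (pt-neg (pt-+ (pt-nth {σ = int} 0ℤ (pt-∘ pt-snd (pt-∘ pt-snd s)) k) (pt-const {σ = int} 1ℤ))))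
      act = pt-if full grown more
      hit₁ : PT {paramTy ⊗ stateTy} {bool} (λ x → proj₁ (violated (n∙ x) (m∙ x) (proj₂ x)))
      hit₁ = pt-∘ pt-fst hit
      whole : PT {paramTy ⊗ stateTy} {stateTy} (λ (par , s) → step par s)
      whole = pt-if hit₁ act s

-- Growth of the numbers, independent of feasibility

module AlgorithmSize where

  open Algorithm

  open TreeStack
  open PolyTime
  open PolyTimeFold
  open PolyTimeList
  open Binary
  open PolyTimeArithmetic
  open Sums
  open import Data.Integer as ℤ using (ℤ; -[1+_]; ∣_∣; 0ℤ; 1ℤ) renaming (+_ to pos)
  import Data.Integer.Properties as ℤ
  open import Data.List.Relation.Unary.All as All using (All; []; _∷_)
  import Data.List.Relation.Unary.All.Properties as All
  open import Data.Nat using (ℕ; zero; suc; _+_; _*_; _^_; _≤_; z≤n; s≤s; _≡ᵇ_)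
  open import Data.Nat.Properties
  open import Data.Nat.Tactic.RingSolver using (solve-∀)

  Row : ℕ → ℕ → List ℤ → Set
  Row L b xs = length xs ≤ L × All (λ z → bits z ≤ b) xs

  Rows : ℕ → ℕ → List (List ℤ) → Set
  Rows L b M = length M ≤ L × All (Row L b) M

  record Sized (L b : ℕ) (s : LState) : Set where
    constructor sized
    field
      matrix : Rows L b (proj₁ s)
      rows   : Rows L b (proj₁ (proj₂ s))
      counts : Row L b (proj₂ (proj₂ s))

  private
    Row-mono : ∀ {L L′ b b′ xs} → L ≤ L′ → b ≤ b′ → Row L b xs → Row L′ b′ xs
    Row-mono l h (len , all) = ≤-trans len l , All.map (λ z → ≤-trans z h) all

    Rows-mono : ∀ {L L′ b b′ M} → L ≤ L′ → b ≤ b′ → Rows L b M → Rows L′ b′ M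
    Rows-mono l h (len , all) = ≤-trans len l , All.map (Row-mono l h) all

    Sized-mono : ∀ {L L′ b b′} s → L ≤ L′ → b ≤ b′ → Sized L b s → Sized L′ b′ s
    Sized-mono _ l h (sized G r y) = sized (Rows-mono l h G) (Rows-mono l h r) (Row-mono l h y)

    length-tab : ∀ {A : Set} n (f : ℕ → A) → length (tab n f) ≡ n
    length-tab n f = trans (length-map f (upTo n)) (length-upTo n)

    All-tab : ∀ {A : Set} {P : A → Set} n {f : ℕ → A} → (∀ i → P (f i)) → All P (tab n f)
    All-tab n h = All.map⁺ (All.universal h (upTo n))

    Row-tab : ∀ {L b} n {f : ℕ → ℤ} → n ≤ L → (∀ i → bits (f i) ≤ b) → Row L b (tab n f)
    Row-tab n {f} n≤L h = ≤-trans (≤-reflexive (length-tab n f)) n≤L , All-tab n h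

    Rows-tab : ∀ {L b} n {f : ℕ → List ℤ} → n ≤ L → (∀ i → Row L b (f i)) → Rows L b (tab n f)
    Rows-tab n {f} n≤L h = ≤-trans (≤-reflexive (length-tab n f)) n≤L , All-tab n h

    All-nth : ∀ {A : Set} {P : A → Set} {d xs} → P d → All P xs → ∀ i → P (nth d xs i)
    All-nth pd []       i       = pd
    All-nth pd (p ∷ ps) zero    = p
    All-nth pd (p ∷ ps) (suc i) = All-nth pd ps i

    bits-nth : ∀ {L b xs} → Row L b xs → ∀ i → bits (nth 0ℤ xs i) ≤ b
    bits-nth {b = b} (_ , all) = All-nth {P = λ z → bits z ≤ b} z≤n all

    bits-entry : ∀ {L b M} → Rows L b M → ∀ i j → bits (entry M i j) ≤ b
    bits-entry {L} {b} (_ , all) i j = bits-nth {L} {b} (All-nth {P = Row L b} (z≤n , []) all i) j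

    null-drop : ∀ W (xs : List Bool) → null (fold xs tail W) ≡ true → length xs ≤ W
    null-drop zero    []       _ = z≤n
    null-drop zero    (_ ∷ _)  ()
    null-drop (suc W) []       _ = z≤n
    null-drop (suc W) (x ∷ xs) e = s≤s (null-drop W xs (trans (cong null (fold-shift tail (x ∷ xs) W)) e))

    bits-clip : ∀ W z → bits (clip W z) ≤ W
    bits-clip W (pos n) with fits W n in e | fits W 0
    ... | true  | true  = null-drop W (toBits n) e
    ... | true  | false = z≤n
    ... | false | _     = z≤n
    bits-clip W (-[1+ n ]) with fits W 0 | fits W (suc n) in e
    ... | true  | true  = null-drop W (toBits (suc n)) e
    ... | true  | false = z≤n
    ... | false | _     = z≤n

    suc-bits : ∀ {b k} → bitLength k ≤ b → bitLength (k + k) ≤ suc b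
    suc-bits {b} {k} h = ≤-trans (bitLength-double k) (s≤s h)

    bits-double : ∀ k i z b → bits z ≤ b → bits ((1ℤ ℤ.+ δ k i) ℤ.* z) ≤ suc b
    bits-double k i z b h with k ≡ᵇ i
    ... | true  = ≤-trans (bitLength-mono (≤-reflexive (trans (ℤ.abs-* (pos 2) z) (cong (∣ z ∣ +_) (+-identityʳ ∣ z ∣))))) (suc-bits {b} {∣ z ∣} h)
    ... | false = ≤-trans (bitLength-mono (≤-reflexive (trans (ℤ.abs-* (pos 1) z) (+-identityʳ ∣ z ∣)))) (m≤n⇒m≤1+n h)

    bits-increment : ∀ k i z b → bits z ≤ b → bits (z ℤ.+ δ k i) ≤ suc b
    bits-increment k i z b h = ≤-trans (bitLength-mono (≤-trans (ℤ.∣i+j∣≤∣i∣+∣j∣ z (δ k i)) (+-monoʳ-≤ ∣ z ∣ (δ≤1 k i)))) (bitLength≤ (suc b)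
      (≤-trans (s≤s (≤-reflexive (+-comm ∣ z ∣ 1))) (≤-trans (+-mono-≤ {1} {2 ^ b} (m^n>0 2 b) (<-≤-trans (<2^bitLength ∣ z ∣) (^-monoʳ-≤ 2 h)))
        (≤-reflexive (cong (2 ^ b +_) (sym (+-identityʳ _)))))))
      where
      δ≤1 : ∀ k i → ∣ δ k i ∣ ≤ 1
      δ≤1 k i with k ≡ᵇ i
      ... | true  = ≤-refl
      ... | false = z≤n

  opaque
    unfolding step

    -- Rows at most double and counts increase by at most 1, so they gain one bit per step, while
    -- new matrix entries are clipped to `W` bits. Nothing is assumed about solvability, so the run
    -- takes polynomial time on every input.
    sized-step : ∀ {L b} par s → proj₁ (proj₁ par) ≤ L → proj₂ (proj₁ par) ≤ L → proj₂ (proj₁ (proj₂ par)) ≤ b →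
                 Sized L b s → Sized L (suc b) (step par s)
    sized-step {L} {b} ((n , m) , ((p , W) , Y)) s@(G , (r , y)) n≤L m≤L W≤b S@(sized SG Sr Sy) =
      if-both (Sized L (suc b)) (proj₁ (violated n m s))
        (if-both (Sized L (suc b)) (nonPositive (Y ℤ.- (nth 0ℤ y k ℤ.+ 1ℤ)))
          (sized (Rows-tab n n≤L (λ i → Row-tab n n≤L λ j → m≤n⇒m≤1+n (≤-trans (bits-clip W _) W≤b)))
                 (Rows-tab m m≤L (λ i → Row-tab n n≤L λ j → bits-double k i (entry r i j) b (bits-entry Sr i j)))
                 (Row-tab m m≤L λ _ → z≤n))
          (sized (Rows-mono ≤-refl (n≤1+n b) SG) (Rows-mono ≤-refl (n≤1+n b) Sr)
                 (Row-tab m m≤L λ i → bits-increment k i (nth 0ℤ y i) b (bits-nth Sy i))))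
        (Sized-mono s ≤-refl (n≤1+n b) S)
      where
      k : ℕ
      k = proj₂ (violated n m s)
      if-both : ∀ {A : Set} (P : A → Set) b {x y} → P x → P y → P (if b then x else y)
      if-both P false px py = py
      if-both P true  px py = px

  private
    sz-All : ∀ σ B xs → All (λ x → sz σ x ≤ B) xs → sz (list σ) xs ≤ 1 + length xs * suc B
    sz-All σ B []       []       = ≤-refl
    sz-All σ B (x ∷ xs) (h ∷ hs) = s≤s (≤-trans (+-mono-≤ h (sz-All σ B xs hs)) (≤-reflexive (+-suc B _)))

    rowSize rowsSize : Poly
    rowSize  = con 1 ⊞ var ⊠ (con 4 ⊞ con 8 ⊠ var)
    rowsSize = con 1 ⊞ var ⊠ (con 1 ⊞ rowSize)

    sz-Row : ∀ V xs → Row V V xs → sz (list int) xs ≤ eval rowSize V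
    sz-Row V xs (len , all) = ≤-trans (sz-All int (3 + 8 * V) xs (All.map (λ {z} h → ≤-trans (sz-int z) (+-monoʳ-≤ 3 (*-monoʳ-≤ 8 h))) all))
      (s≤s (*-monoˡ-≤ (4 + 8 * V) len))

    sz-Rows : ∀ V M → Rows V V M → sz (list (list int)) M ≤ eval rowsSize V
    sz-Rows V M (len , all) = ≤-trans (sz-All (list int) (eval rowSize V) M (All.map (λ {xs} → sz-Row V xs) all))
      (s≤s (*-monoˡ-≤ (suc (eval rowSize V)) len))

    Row-sz : ∀ xs → Row (sz (list int) xs) (sz (list int) xs) xs
    Row-sz xs = length≤sz int xs , all xs
      where
      all : ∀ xs → All (λ z → bits z ≤ sz (list int) xs) xs
      all []       = []
      all (z ∷ xs) = m≤n⇒m≤1+n (≤-trans (bitLength≤sz-int z) (m≤m+n (sz int z) _)) ∷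
        All.map (λ h → m≤n⇒m≤1+n (≤-trans h (m≤n+m _ (sz int z)))) (all xs)

    Rows-sz : ∀ M → Rows (sz (list (list int)) M) (sz (list (list int)) M) M
    Rows-sz M = length≤sz (list int) M , all M
      where
      all : ∀ M → All (Row (sz (list (list int)) M) (sz (list (list int)) M)) M
      all []       = []
      all (xs ∷ M) = Row-mono le le (Row-sz xs) ∷ All.map (Row-mono le′ le′) (all M)
        where
        le : sz (list int) xs ≤ sz (list (list int)) (xs ∷ M)
        le = m≤n⇒m≤1+n (m≤m+n _ _)
        le′ : sz (list (list int)) M ≤ sz (list (list int)) (xs ∷ M)
        le′ = m≤n⇒m≤1+n (m≤n+m _ (sz (list int) xs))

    sized-sz : ∀ s → Sized (sz stateTy s) (sz stateTy s) s
    sized-sz (G , (r , y)) = sized (Rows-mono g g (Rows-sz G)) (Rows-mono r≤ r≤ (Rows-sz r)) (Row-mono y≤ y≤ (Row-sz y))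
      where
      a = sz (list (list int)) G
      b = sz (list (list int)) r
      c = sz (list int) y
      g : a ≤ suc (a + suc (b + c))
      g = m≤n⇒m≤1+n (m≤m+n a _)
      r≤ : b ≤ suc (a + suc (b + c))
      r≤ = m≤n⇒m≤1+n (≤-trans (m≤n⇒m≤1+n (m≤m+n b c)) (m≤n+m _ a))
      y≤ : c ≤ suc (a + suc (b + c))
      y≤ = m≤n⇒m≤1+n (≤-trans (m≤n⇒m≤1+n (m≤n+m c b)) (m≤n+m _ a))

    fold-invariant : ∀ {A : Set} {f : A → A} (Q : ℕ → A → Set) → (∀ k s → Q k s → Q (suc k) (f s)) → ∀ {s} → Q 0 s → ∀ k → Q k (fold s f k)
    fold-invariant Q h q zero    = q
    fold-invariant Q h q (suc k) = h k _ (fold-invariant Q h q k)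

    sized-fold : ∀ {L b} par s → proj₁ (proj₁ par) ≤ L → proj₂ (proj₁ par) ≤ L → proj₂ (proj₁ (proj₂ par)) ≤ b →
      Sized L b s → ∀ k → Sized L (k + b) (fold s (step par) k)
    sized-fold {L} {b} par s n≤L m≤L W≤b = fold-invariant (λ k s → Sized L (k + b) s)
      λ k s → sized-step par s n≤L m≤L (≤-trans W≤b (m≤n+m b k))

  abstract
    stateSize : Poly
    stateSize = con 2 ⊞ rowsSize ⊞ rowsSize ⊞ rowSize

    sz-Sized : ∀ V s → Sized V V s → sz stateTy s ≤ eval stateSize V
    sz-Sized V (G , (r , y)) (sized SG Sr Sy) = ≤-trans (s≤s (+-mono-≤ (sz-Rows V G SG) (s≤s (+-mono-≤ (sz-Rows V r Sr) (sz-Row V y Sy)))))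
      (≤-reflexive (e (eval rowsSize V) (eval rowSize V)))
      where
      e : ∀ a b → suc (a + suc (a + b)) ≡ 2 + a + a + b
      e = solve-∀

  module _ {γ : Ty} where

    abstract
      pt-run : ∀ {par : ⟦ γ ⟧ → Param} {s : ⟦ γ ⟧ → LState} {T : ⟦ γ ⟧ → ℕ} → PT {γ} {paramTy} par → PT {γ} {stateTy} s → PT {γ} {un} T →
               PT {γ} {stateTy} (λ g → fold (s g) (step (par g)) (T g))
      pt-run {par} {s} {T} pp ps pT = pt-fold {γ} {stateTy} {λ y → step (par (proj₁ y)) (proj₂ y)}
        (pt-∘ pt-step (pt-pair (pt-∘ pp pt-fst) pt-snd)) pT ps (stateSize ⊚ (out pp ⊞ out ps ⊞ out pT)) λ g k k≤T → bound g k k≤T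
        where
        first : ∀ a b c d e → a + b ≤ suc (suc (a + b) + suc (suc (c + d) + e))
        first a b c d e = m≤n⇒m≤1+n (m≤n⇒m≤1+n (m≤m+n (a + b) _))
        fourth : ∀ a b c d e → d ≤ suc (suc (a + b) + suc (suc (c + d) + e))
        fourth a b c d e = m≤n⇒m≤1+n (≤-trans (m≤n⇒m≤1+n (≤-trans (m≤n⇒m≤1+n (m≤n+m d c)) (m≤m+n (suc (c + d)) e))) (m≤n+m _ (suc (a + b))))
        bound : ∀ g k → k ≤ T g → sz stateTy (fold (s g) (step (par g)) k) ≤ eval stateSize (eval (out pp) (sz γ g) + eval (out ps) (sz γ g) + eval (out pT) (sz γ g))
        bound g k k≤T = sz-Sized V (fold (s g) (step (par g)) k) (Sized-mono (fold (s g) (step (par g)) k) ≤-refl k+b≤V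
            (sized-fold {V} {A + B} (par g) (s g) n≤V m≤V W≤b (Sized-mono (s g) s≤V s≤b (sized-sz (s g))) k))
          where
          n m p W A B C V : ℕ
          n = proj₁ (proj₁ (par g))
          m = proj₂ (proj₁ (par g))
          p = proj₁ (proj₁ (proj₂ (par g)))
          W = proj₂ (proj₁ (proj₂ (par g)))
          Y : ℤ
          Y = proj₂ (proj₂ (par g))
          A = eval (out pp) (sz γ g)
          B = eval (out ps) (sz γ g)
          C = eval (out pT) (sz γ g)
          V = A + B + C
          A≤V : A ≤ V
          A≤V = ≤-trans (m≤m+n A B) (m≤m+n (A + B) C)
          nm≤ : sz un n + sz un m ≤ A
          nm≤ = ≤-trans (first (sz un n) (sz un m) (sz un p) (sz un W) (sz int Y)) (sz-out pp g)
          W≤A : W ≤ A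
          W≤A = ≤-trans (≤sz-un W) (≤-trans (fourth (sz un n) (sz un m) (sz un p) (sz un W) (sz int Y)) (sz-out pp g))
          n≤V : n ≤ V
          n≤V = ≤-trans (≤-trans (≤sz-un n) (m≤m+n _ (sz un m))) (≤-trans nm≤ A≤V)
          m≤V : m ≤ V
          m≤V = ≤-trans (≤-trans (≤sz-un m) (m≤n+m _ (sz un n))) (≤-trans nm≤ A≤V)
          W≤b : W ≤ A + B
          W≤b = ≤-trans W≤A (m≤m+n A B)
          s≤V : sz stateTy (s g) ≤ V
          s≤V = ≤-trans (sz-out ps g) (≤-trans (m≤n+m B A) (m≤m+n (A + B) C))
          s≤b : sz stateTy (s g) ≤ A + B
          s≤b = ≤-trans (sz-out ps g) (m≤n+m B A)
          k+b≤V : k + (A + B) ≤ V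
          k+b≤V = ≤-trans (≤-reflexive (+-comm k (A + B))) (+-monoʳ-≤ (A + B) (≤-trans k≤T (≤-trans (≤sz-un (T g)) (sz-out pT g))))

-- What the list operations compute

module ListSpecification where

  open PolyTime using (toBits)
  open PolyTimeList using (nth; null; tail; fold-shift)
  open Binary using (half-spec; odd; weightOf; bitLength≤)
  open PolyTimeArithmetic using (nonPositive)
  open Sums
  open Forms
  open Invariant
  open Algorithm
  open import Data.Integer using (ℤ; -[1+_]; +≤+; -≤+; +<+; 0ℤ; _+_; _*_; _-_; -_; _≤_; _<_; ∣_∣; _⊖_) renaming (+_ to pos)
  open import Data.Integer.Properties
  open import Data.Integer.Tactic.RingSolver using (solve-∀)
  open import Data.Nat as ℕ using (ℕ; zero; suc; z≤n; s≤s; ⌊_/2⌋)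
  import Data.Nat.Properties as ℕ
  import Data.Nat.Tactic.RingSolver as ℕ-Solver

  nth-tab : ∀ {A : Set} (d : A) n f i → i ℕ.< n → nth d (tab n f) i ≡ f i
  nth-tab d n f i i<n = trans (cong (λ xs → nth d xs i) (map-upTo f n)) (go f n i i<n)
    where
    go : ∀ f n i → i ℕ.< n → nth d (applyUpTo f n) i ≡ f i
    go f (suc n) zero    _         = refl
    go f (suc n) (suc i) (s≤s i<n) = go (f ∘ suc) n i i<n

  entry-tab : ∀ m n (f : ℕ → ℕ → ℤ) i j → i ℕ.< m → j ℕ.< n → entry (tab m λ i → tab n (f i)) i j ≡ f i j
  entry-tab m n f i j i<m j<n = trans (cong (λ xs → nth 0ℤ xs j) (nth-tab [] m (λ i → tab n (f i)) i i<m)) (nth-tab 0ℤ n (f i) j j<n)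

  null-increment : ∀ n → null (toBits (suc n)) ≡ false
  null-increment n with toBits n
  ... | []        = refl
  ... | false ∷ _ = refl
  ... | true ∷ _  = refl

  nonPositive⇒≤0 : ∀ z → nonPositive z ≡ true → z ≤ 0ℤ
  nonPositive⇒≤0 (pos zero)    _ = ≤-refl
  nonPositive⇒≤0 (-[1+ n ])    _ = -≤+
  nonPositive⇒≤0 (pos (suc n)) e with trans (sym e) (null-increment n)
  ... | ()

  positive⇒>0 : ∀ z → nonPositive z ≡ false → 0ℤ < z
  positive⇒>0 (pos (suc n)) _ = +<+ (s≤s z≤n)

  private
    found-true : ∀ k l → foldl found (true , k) l ≡ (true , k)
    found-true k []      = refl
    found-true k (z ∷ l) = found-true k l

    search-from : ∀ l k₀ →
      (∃[ i ] (i ℕ.< length l × nth 0ℤ l i ≤ 0ℤ × foldl found (false , k₀) l ≡ (true , k₀ ℕ.+ i)))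
      ⊎ ((∀ i → i ℕ.< length l → 0ℤ < nth 0ℤ l i) × proj₁ (foldl found (false , k₀) l) ≡ false)
    search-from []      k₀ = inj₂ ((λ i ()) , refl)
    search-from (z ∷ l) k₀ with nonPositive z in e
    ... | true  = inj₁ (0 , s≤s z≤n , nonPositive⇒≤0 z e , trans (found-true k₀ l) (cong (true ,_) (sym (ℕ.+-identityʳ k₀))))
    ... | false with search-from l (suc k₀)
    ...   | inj₁ (i , i< , h , r) = inj₁ (suc i , s≤s i< , h , trans r (cong (true ,_) (sym (ℕ.+-suc k₀ i))))
    ...   | inj₂ (all , r)        = inj₂ ((λ { zero _ → positive⇒>0 z e ; (suc i) (s≤s i<) → all i i< }) , r)

  search-spec : ∀ l →
    (∃[ k ] (k ℕ.< length l × nth 0ℤ l k ≤ 0ℤ × search l ≡ (true , k)))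
    ⊎ ((∀ i → i ℕ.< length l → 0ℤ < nth 0ℤ l i) × proj₁ (search l) ≡ false)
  search-spec l = search-from l 0

  search-none : ∀ l → (∀ i → i ℕ.< length l → 0ℤ < nth 0ℤ l i) → proj₁ (search l) ≡ false
  search-none l h with search-spec l
  ... | inj₂ (_ , e) = e
  ... | inj₁ (k , k< , k≤0 , _) = ⊥-elim (<⇒≱ (h k k<) k≤0)

  halves-spec : ∀ p n → 2 ℕ.^ p ℕ.* halves p n ℕ.≤ n × n ℕ.≤ 2 ℕ.^ p ℕ.* halves p n ℕ.+ 2 ℕ.^ p
  halves-spec zero    n = ℕ.≤-reflexive (ℕ.+-identityʳ n) , ℕ.≤-trans (ℕ.≤-reflexive (sym (ℕ.+-identityʳ n))) (ℕ.m≤m+n (n ℕ.+ 0) 1)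
  halves-spec (suc p) n with halves-spec p n
  ... | lo , hi = ℕ.≤-trans (ℕ.≤-reflexive (e₁ P h)) (ℕ.≤-trans (ℕ.*-monoʳ-≤ P (ℕ.≤-trans (ℕ.m≤n+m (h ℕ.+ h) w) (ℕ.≤-reflexive (sym (half-spec k))))) lo)
                , ℕ.≤-trans hi (ℕ.≤-trans (ℕ.+-monoˡ-≤ P (ℕ.*-monoʳ-≤ P (ℕ.≤-trans (ℕ.≤-reflexive (half-spec k)) (ℕ.+-monoˡ-≤ (h ℕ.+ h) (w≤1 (odd k)))))) (ℕ.≤-reflexive (e₂ P h)))
    where
    P = 2 ℕ.^ p
    k = halves p n
    h = ⌊ k /2⌋
    w = weightOf (odd k)
    w≤1 : ∀ b → weightOf b ℕ.≤ 1
    w≤1 false = z≤n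
    w≤1 true  = ℕ.≤-refl
    e₁ : ∀ P h → (P ℕ.+ (P ℕ.+ 0)) ℕ.* h ≡ P ℕ.* (h ℕ.+ h)
    e₁ = ℕ-Solver.solve-∀
    e₂ : ∀ P h → P ℕ.* (1 ℕ.+ (h ℕ.+ h)) ℕ.+ P ≡ (P ℕ.+ (P ℕ.+ 0)) ℕ.* h ℕ.+ (P ℕ.+ (P ℕ.+ 0))
    e₂ = ℕ-Solver.solve-∀

  halves-0 : ∀ p → halves p 0 ≡ 0
  halves-0 zero    = refl
  halves-0 (suc p) = cong ⌊_/2⌋ (halves-0 p)

  -- One of the two parts of an integer is 0 and stays 0, so the error is that of halving a single
  -- natural number `p` times, at most one unit.
  shift-spec : ∀ p z → let d = pos (2 ℕ.^ p) in 0ℤ ≤ d + (d * shift p z - z) × 0ℤ ≤ d - (d * shift p z - z)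
  shift-spec p (pos n) rewrite halves-0 p with halves-spec p n
  ... | lo , hi = subst (0ℤ ≤_) (trans (cong (_- pos n) (trans (pos-+ (D ℕ.* h) D) (cong (_+ d) (pos-* D h)))) (e₁ d (pos h) (pos n))) (gap (+≤+ hi)) ,
      subst (0ℤ ≤_) (trans (cong (λ t → d + (pos n - t)) (pos-* D h)) (e₂ d (pos h) (pos n))) (0≤+ (0≤pos D) (gap (+≤+ lo)))
    where
    D = 2 ℕ.^ p
    d = pos D
    h = halves p n
    e₁ : ∀ d h n → d * h + d - n ≡ d + (d * h - n)
    e₁ = solve-∀
    e₂ : ∀ d h n → d + (n - d * h) ≡ d - (d * h - n)
    e₂ = solve-∀
  shift-spec p (-[1+ n ]) rewrite halves-0 p with halves-spec p (suc n)
  ... | lo , hi = subst (0ℤ ≤_) (trans (cong (λ t → d + (s - t)) (pos-* D h)) (trans (e₁ d (pos h) s) (cong (λ t → d + (d * t + s)) (sym 0⊖)))) (0≤+ (0≤pos D) (gap (+≤+ lo))) ,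
      subst (0ℤ ≤_) (trans (cong (_- s) (trans (pos-+ (D ℕ.* h) D) (cong (_+ d) (pos-* D h)))) (trans (e₂ d (pos h) s) (cong (λ t → d - (d * t + s)) (sym 0⊖)))) (gap (+≤+ hi))
    where
    D = 2 ℕ.^ p
    d = pos D
    h = halves p (suc n)
    s = pos (suc n)
    0⊖ : 0 ⊖ h ≡ - pos h
    0⊖ = 0⊖n≡-n h
      where
      0⊖n≡-n : ∀ n → 0 ⊖ n ≡ - pos n
      0⊖n≡-n zero    = refl
      0⊖n≡-n (suc n) = refl
    e₁ : ∀ d h s → d + (s - d * h) ≡ d + (d * - h + s)
    e₁ = solve-∀
    e₂ : ∀ d h s → d * h + d - s ≡ d - (d * - h + s)
    e₂ = solve-∀

  drop-null : ∀ W (xs : List Bool) → length xs ℕ.≤ W → null (fold xs tail W) ≡ true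
  drop-null zero    []       _       = refl
  drop-null (suc W) []       _       = trans (cong null (sym (fold-shift tail [] W))) (drop-null W [] z≤n)
  drop-null (suc W) (x ∷ xs) (s≤s h) = trans (cong null (sym (fold-shift tail (x ∷ xs) W))) (drop-null W xs h)

  clip-id : ∀ W z → ∣ z ∣ ℕ.< 2 ℕ.^ W → clip W z ≡ z
  clip-id W (pos n)    h rewrite drop-null W (toBits n) (bitLength≤ W h) | drop-null W [] z≤n = refl
  clip-id W (-[1+ n ]) h rewrite drop-null W (toBits (suc n)) (bitLength≤ W h) | drop-null W [] z≤n = refl

  module _ (n : ℕ) where
    open Quadratic n

    subtract-rounded : ∀ p G g → Rounded (pos (2 ℕ.^ p)) (entry G) (nth 0ℤ g) (entry (subtract n p G g))
    subtract-rounded p G g i j i<n j<n with shift-spec p (nth 0ℤ g i * nth 0ℤ g j)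
    ... | lo , hi = subst (λ e → 0ℤ ≤ d + e) (sym same) lo , subst (λ e → 0ℤ ≤ d - e) (sym same) hi
      where
      d = pos (2 ℕ.^ p)
      t = nth 0ℤ g i * nth 0ℤ g j
      e : ∀ d x s t → d * (x - (x - s)) - t ≡ d * s - t
      e = solve-∀
      same : d * (entry G i j + pos n * δ i j - entry (subtract n p G g) i j) - t ≡ d * shift p t - t
      same = trans (cong (λ u → d * (entry G i j + pos n * δ i j - u) - t) (entry-tab n n _ i j i<n j<n))
        (e d (entry G i j + pos n * δ i j) (shift p t) t)

    subtract-symmetric : ∀ p G g → Symmetric (entry G) → Symmetric (entry (subtract n p G g))
    subtract-symmetric p G g s i j i<n j<n = trans (entry-tab n n _ i j i<n j<n)
      (trans (cong₂ (λ a t → a - shift p t) (cong₂ (λ u v → u + pos n * v) (s i j i<n j<n) (δ-sym i j)) (*-comm (nth 0ℤ g i) (nth 0ℤ g j)))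
        (sym (entry-tab n n _ j i j<n i<n)))

    rounded-cong : ∀ {d G g g′ G′} → (∀ i → i ℕ.< n → g i ≡ g′ i) → Rounded d G g G′ → Rounded d G g′ G′
    rounded-cong {d} {G} {g} {g′} {G′} h R i j i<n j<n =
      subst (λ t → 0ℤ ≤ d + (d * (G i j + pos n * δ i j - G′ i j) - t) × 0ℤ ≤ d - (d * (G i j + pos n * δ i j - G′ i j) - t))
        (cong₂ _*_ (h i i<n) (h j j<n)) (R i j i<n j<n)

    rounded-congʳ : ∀ {d G g G′ G″} → (∀ i j → i ℕ.< n → j ℕ.< n → G′ i j ≡ G″ i j) → Rounded d G g G′ → Rounded d G g G″
    rounded-congʳ {d} {G} {g} h R i j i<n j<n =
      subst (λ u → 0ℤ ≤ d + (d * (G i j + pos n * δ i j - u) - g i * g j) × 0ℤ ≤ d - (d * (G i j + pos n * δ i j - u) - g i * g j))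
        (h i j i<n j<n) (R i j i<n j<n)

    nth-apply : ∀ G v i → i ℕ.< n → nth 0ℤ (apply n G v) i ≡ dot n (entry G i) (nth 0ℤ v)
    nth-apply G v i i<n = nth-tab 0ℤ n _ i i<n

-- A feasible system is solved within the step bound

module AlgorithmCorrectness where

  open PolyTimeList using (nth)
  open PolyTimeArithmetic using (nonPositive)
  open Sums
  open Forms
  open Invariant
  open Algorithm
  open ListSpecification
  open import Data.Integer using (ℤ; +<+; 0ℤ; 1ℤ; _+_; _*_; _-_; -_; _≤_; _<_; ∣_∣) renaming (+_ to pos)
  open import Data.Integer.Properties
  open import Data.Integer.Tactic.RingSolver using (solve-∀)
  open import Data.Nat as ℕ using (ℕ; zero; suc)
  import Data.Nat.Properties as ℕ

  opaque
    unfolding step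

    step-none : ∀ {n m p W Y} s → proj₁ (violated n m s) ≡ false → step ((n , m) , ((p , W) , Y)) s ≡ s
    step-none {n} {m} {p} {W} {Y} s e = cong (λ b → if b
        then if nonPositive (Y - (nth 0ℤ (proj₂ (proj₂ s)) (proj₂ (violated n m s)) + 1ℤ))
             then rescaled n m p W (proj₂ (violated n m s)) s else counted m (proj₂ (violated n m s)) s
        else s) e

    step-full : ∀ {n m p W Y k} s → violated n m s ≡ (true , k) →
      nonPositive (Y - (nth 0ℤ (proj₂ (proj₂ s)) k + 1ℤ)) ≡ true → step ((n , m) , ((p , W) , Y)) s ≡ rescaled n m p W k s
    step-full {n} {m} {p} {W} {Y} {k} s e e′ = trans (cong (λ v → if proj₁ v
        then if nonPositive (Y - (nth 0ℤ (proj₂ (proj₂ s)) (proj₂ v) + 1ℤ))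
             then rescaled n m p W (proj₂ v) s else counted m (proj₂ v) s
        else s) e) (cong (λ b → if b then rescaled n m p W k s else counted m k s) e′)

    step-room : ∀ {n m p W Y k} s → violated n m s ≡ (true , k) →
      nonPositive (Y - (nth 0ℤ (proj₂ (proj₂ s)) k + 1ℤ)) ≡ false → step ((n , m) , ((p , W) , Y)) s ≡ counted m k s
    step-room {n} {m} {p} {W} {Y} {k} s e e′ = trans (cong (λ v → if proj₁ v
        then if nonPositive (Y - (nth 0ℤ (proj₂ (proj₂ s)) (proj₂ v) + 1ℤ))
             then rescaled n m p W (proj₂ v) s else counted m (proj₂ v) s
        else s) e) (cong (λ b → if b then rescaled n m p W k s else counted m k s) e′)

  module Correctness (n m ℓ Y κ p W : ℕ) (a : ℕ → Vector) (x : Vector)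
    (∣a∣≤1 : ∀ i j → i ℕ.< m → j ℕ.< n → ∣ a i j ∣ ℕ.≤ 1)
    (unit : ∀ j → j ℕ.< n → ∃[ i ] (i ℕ.< m × (∀ l → l ℕ.< n → a i l ≡ δ j l)))
    (1≤ax : ∀ i → i ℕ.< m → 1ℤ ≤ dot n (a i) x) where

    open Descent n m ℓ Y κ (2 ℕ.^ p) a x ∣a∣≤1 unit 1≤ax public

    view : LState → State
    view (G , (r , y)) = state (entry G) (entry r) (nth 0ℤ y)

    par : Param
    par = (n , m) , ((p , W) , pos Y)

    slack≡ : ∀ s i → i ℕ.< m → nth 0ℤ (slacks n m (proj₁ (proj₂ s)) (solution n m s)) i
      ≡ form (State.G (view s)) (State.r (view s) i) (State.z (view s))
    slack≡ s@(G , (r , y)) i i<m = trans (nth-tab 0ℤ m _ i i<m)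
      (dot-cong n {entry r i} {entry r i} (λ _ _ → refl) λ l l<n → trans (nth-apply n G (combine n m r y) l l<n)
        (dot-cong n {entry G l} {entry G l} (λ _ _ → refl) λ j j<n → nth-tab 0ℤ n (λ j → Σ m (λ i → nth 0ℤ y i * entry r i j)) j j<n))

    length-slacks : ∀ s → length (slacks n m (proj₁ (proj₂ s)) (solution n m s)) ≡ m
    length-slacks s = trans (length-map _ (upTo m)) (length-upTo m)

    violated-spec : ∀ s →
      (∃[ k ] (k ℕ.< m × form (State.G (view s)) (State.r (view s) k) (State.z (view s)) ≤ 0ℤ × violated n m s ≡ (true , k)))
      ⊎ ((∀ i → i ℕ.< m → 0ℤ < dot n (State.r (view s) i) (nth 0ℤ (solution n m s))) × proj₁ (violated n m s) ≡ false)
    violated-spec s with search-spec (slacks n m (proj₁ (proj₂ s)) (solution n m s))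
    ... | inj₁ (k , k< , h , e) = let k<m = subst (k ℕ.<_) (length-slacks s) k< in inj₁ (k , k<m , subst (_≤ 0ℤ) (slack≡ s k k<m) h , e)
    ... | inj₂ (all , e) = inj₂ ((λ i i<m → subst (0ℤ <_) (nth-tab 0ℤ m _ i i<m) (all i (subst (i ℕ.<_) (sym (length-slacks s)) i<m))) , e)

    module Run (0<κ : 0 ℕ.< κ) (0<Y : 0ℤ < pos Y) (hP : pos 16 * E * Kmax ≤ P) (hP′ : pos 4 * E ≤ P)
      (hY : pos 8 * pos m * (pos κ + pos 8 * Kmax) ≤ pos Y) (hW : 2 ℕ.* 2 ℕ.^ p ℕ.< 2 ℕ.^ W) where

      0<P : 0ℤ < P
      0<P = +<+ (ℕ.m^n>0 2 p)

      progress : ∀ s (I : Inv (view s)) k → k ℕ.< m →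
        form (State.G (view s)) (State.r (view s) k) (State.z (view s)) ≤ 0ℤ → violated n m s ≡ (true , k) →
        Σ[ I′ ∈ Inv (view (step par s)) ] (Inv.Φ I + 1ℤ ≤ Inv.Φ I′)
      progress s@(G , (r , y)) I k k<m bad e = branch (nonPositive t) refl
        where
        Goal : LState → Set
        Goal u = Σ[ I′ ∈ Inv (view u) ] (Inv.Φ I + 1ℤ ≤ Inv.Φ I′)
        t = pos Y - (nth 0ℤ y k + 1ℤ)
        open Step I 0<κ 0<P 0<Y hP hP′ hY k k<m
        open Bad bad

        more : nonPositive t ≡ false → Goal (counted m k s)
        more e′ = count (nth 0ℤ (tab m λ i → nth 0ℤ y i + δ k i)) (λ i i<m → nth-tab 0ℤ m (λ i → nth 0ℤ y i + δ k i) i i<m)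
          (0≤i-j⇒j≤i (subst (0ℤ ≤_) (e″ (pos Y) (nth 0ℤ y k)) (gap (i<j⇒suc[i]≤j (positive⇒>0 t e′)))))
          where
          e″ : ∀ Y y → Y - (y + pos 1) - pos 1 ≡ Y - (y + pos 1 + pos 1)
          e″ = solve-∀

        rk : List ℤ
        rk = nth [] r k
        G₁ G₂ : List (List ℤ)
        G₁ = subtract n (suc p) G (apply n G rk)
        G₂ = subtract n p G₁ (apply n G₁ rk)
        S₀ : Symmetric (entry G)
        S₀ = Contains.symmetric (Inv.ellipsoid I)
        S₁ : Symmetric (entry G₁)
        S₁ = subtract-symmetric n (suc p) G (apply n G rk) S₀
        S₂ : Symmetric (entry G₂)
        S₂ = subtract-symmetric n p G₁ (apply n G₁ rk) S₁
        R₁ : Rounded (2ℤ * P) (entry G) (λ i → dot n (entry G i) (entry r k)) (entry G₁)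
        R₁ = subst (λ d → Rounded d (entry G) (λ i → dot n (entry G i) (entry r k)) (entry G₁)) (pos-* 2 (2 ℕ.^ p))
          (rounded-cong n {pos (2 ℕ.^ suc p)} {entry G} {nth 0ℤ (apply n G rk)} {λ i → dot n (entry G i) (entry r k)} {entry G₁}
            (nth-apply n G rk) (subtract-rounded n (suc p) G (apply n G rk)))
        R₂ : Rounded P (entry G₁) (λ i → dot n (entry G₁ i) (entry r k)) (entry G₂)
        R₂ = rounded-cong n {P} {entry G₁} {nth 0ℤ (apply n G₁ rk)} {λ i → dot n (entry G₁ i) (entry r k)} {entry G₂}
            (nth-apply n G₁ rk) (subtract-rounded n p G₁ (apply n G₁ rk))
        G₃ : List (List ℤ)
        G₃ = shrunk n p W G rk
        -- On a feasible system clipping changes nothing: the invariant bounds the entries by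
        -- `2 * 2 ^ p`, which fits into `W` bits by `hW`.
        G₃≡ : ∀ i j → i ℕ.< n → j ℕ.< n → entry G₂ i j ≡ entry G₃ i j
        G₃≡ i j i<n j<n = sym (trans (entry-tab n n (λ i j → clip W (entry G₂ i j)) i j i<n j<n)
          (clip-id W (entry G₂ i j) (ℕ.≤-<-trans (Updated.entries S₁ S₂ R₁ R₂ i j i<n j<n) hW)))
        S₃ : Symmetric (entry G₃)
        S₃ i j i<n j<n = trans (sym (G₃≡ i j i<n j<n)) (trans (S₂ i j i<n j<n) (G₃≡ j i j<n i<n))
        R₃ : Rounded P (entry G₁) (λ i → dot n (entry G₁ i) (entry r k)) (entry G₃)
        R₃ = rounded-congʳ n {P} {entry G₁} {λ i → dot n (entry G₁ i) (entry r k)} {entry G₂} {entry G₃} G₃≡ R₂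

        grown : nonPositive t ≡ true → Goal (rescaled n m p W k s)
        grown e′ = rescale S₁ S₃ R₁ R₃ (entry (doubled n m k r)) (entry-tab m n (λ i j → (1ℤ + δ k i) * entry r i j))
          (nth 0ℤ (tab m λ _ → 0ℤ)) (nth-tab 0ℤ m (λ _ → 0ℤ))
          (0≤i-j⇒j≤i (subst (0ℤ ≤_) (e″ (pos Y) (nth 0ℤ y k)) (gap (nonPositive⇒≤0 t e′))))
          where
          e″ : ∀ Y y → pos 0 - (Y - (y + pos 1)) ≡ y + pos 1 - Y
          e″ = solve-∀

        branch : ∀ b → nonPositive t ≡ b → Goal (step par s)
        branch true  e′ = subst Goal {rescaled n m p W k s} {step par s} (sym (step-full {n} {m} {p} {W} {pos Y} {k} s e e′)) (grown e′)
        branch false e′ = subst Goal {counted m k s} {step par s} (sym (step-room {n} {m} {p} {W} {pos Y} {k} s e e′)) (more e′)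

      after : LState → ℕ → LState
      after s t = fold s (step par) t

      -- A state without violated row is a fixed point of `step`, so success persists; otherwise
      -- each of the `t` steps has raised the potential by at least 1.
      reach : ∀ s → Inv (view s) → ∀ t → Σ[ I ∈ Inv (view (after s t)) ] (proj₁ (violated n m (after s t)) ≡ false ⊎ pos t ≤ Inv.Φ I)
      reach s I zero = I , inj₂ (0≤+ (0≤* (Derived.0≤U I) (0≤* (0≤pos m) (0≤pos Y))) (Σ-nonneg m (Inv.y≥0 I)))
      reach s I (suc t) with reach s I t | violated-spec (after s t)
      ... | I′ , _ | inj₂ (_ , e) = subst Goal (sym (step-none (after s t) e)) (I′ , inj₁ e)
        where
        Goal : LState → Set
        Goal u = Σ[ I ∈ Inv (view u) ] (proj₁ (violated n m u) ≡ false ⊎ pos (suc t) ≤ Inv.Φ I)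
      ... | I′ , inj₁ none | inj₁ (k , _ , _ , e) with trans (sym (cong proj₁ e)) none
      ...   | ()
      reach s I (suc t) | I′ , inj₂ t≤ | inj₁ (k , k<m , bad , e) with progress (after s t) I′ k k<m bad e
      ...   | I″ , Φ+1≤ = I″ , inj₂ (≤-trans (≤-reflexive (cong pos (ℕ.+-comm 1 t))) (≤-trans (+-monoˡ-≤ 1ℤ t≤) Φ+1≤))

      -- `T` exceeds the largest possible potential, so a state without violated row has been
      -- reached. Its candidate is positive on the scaled rows, and the positive scaling factors
      -- cancel.
      succeeds : ∀ s → Inv (view s) → ∀ T → Kmax * (pos m * pos Y) + pos m * pos Y < pos T →
        ∀ i → i ℕ.< m → 0ℤ < dot n (a i) (nth 0ℤ (solution n m (after s T)))
      succeeds s I T hT i i<m with reach s I T | violated-spec (after s T)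
      ... | I′ , inj₂ T≤ | _ = ⊥-elim (<⇒≱ hT (≤-trans T≤ (Derived.Φ≤ I′)))
      ... | I′ , inj₁ none | inj₁ (k , _ , _ , e) with trans (sym (cong proj₁ e)) none
      ...   | ()
      succeeds s I T hT i i<m | I′ , inj₁ none | inj₂ (all , _) = cancel-0< (pos (2 ℕ.^ d i)) (0≤pos (2 ℕ.^ d i)) (subst (0ℤ <_)
          (trans (dot-cong n (λ j j<n → rows i j i<m j<n) (λ _ _ → refl)) (dot-⊙ˡ n (pos (2 ℕ.^ d i)) (a i) v)) (all i i<m))
        where
        open Inv I′
        v : Vector
        v = nth 0ℤ (solution n m (after s T))
        cancel-0< : ∀ c {b} → 0ℤ ≤ c → 0ℤ < c * b → 0ℤ < b
        cancel-0< c {b} 0≤c h = ≰⇒> λ b≤0 → <⇒≱ h (0≤i-j⇒j≤i (subst (0ℤ ≤_) (e c b) (0≤* 0≤c (gap b≤0))))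
          where
          e : ∀ c b → c * (pos 0 - b) ≡ pos 0 - c * b
          e = solve-∀

-- Choice of the parameters as functions of one size bound

module Parameters where

  open TreeStack
  open PolyTime
  open PolyTimeList
  open Binary
  open PolyTimeArithmetic
  open Sums using (δ)
  open Algorithm
  open AlgorithmSize
  open import Data.Integer as ℤ using (ℤ; 0ℤ) renaming (+_ to pos)
  open import Data.Nat using (ℕ; zero; suc; _+_; _*_; _^_; _<_; z≤n; s≤s)
  open import Data.Nat.Properties

  power : ℕ → ℕ
  power g = fold 1 (λ k → k + k) g

  power≡ : ∀ g → power g ≡ 2 ^ g
  power≡ zero    = refl
  power≡ (suc g) = cong₂ _+_ (power≡ g) (trans (power≡ g) (sym (+-identityʳ (2 ^ g))))

  -- The exponents here and below are generous: only the inequalities of module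
  -- Estimates matter.
  precision : ℕ → ℕ → ℕ
  precision n λ′ = λ′ ^ 3 + bitLength n

  -- The components are `n`, `m`, `p`, `W` and `Y`. The width `W` is `p + 2` because entries up to
  -- `2 * 2 ^ p` must survive clipping.
  parameters : ℕ → ℕ → ℕ → Param
  parameters n m λ′ = (n , m) , ((precision n λ′ , suc (suc (precision n λ′))) , pos (λ′ ^ 8))

  start : ℕ → ℕ → ℕ → List (List ℤ) → LState
  start n m λ′ r = (tab n λ i → tab n λ j → pos (power (λ′ ^ 3)) ℤ.* δ i j) , (r , tab m λ _ → 0ℤ)

  final : ℕ → ℕ → ℕ → List (List ℤ) → LState
  final n m λ′ r = fold (start n m λ′ r) (step (parameters n m λ′)) (λ′ ^ 13)

  -- The candidate of the final state is tested against the original rows and not the scaled ones,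
  -- so a positive answer carries its own witness, whatever happened during the run.
  feasible : ℕ → ℕ → ℕ → List (List ℤ) → Bool
  feasible n m λ′ r = not (proj₁ (search (slacks n m r (solution n m (final n m λ′ r)))))

  module _ {γ : Ty} {n m λ′ : ⟦ γ ⟧ → ℕ} (pn : PT {γ} {un} n) (pm : PT {γ} {un} m) (pλ : PT {γ} {un} λ′) where

    abstract
      pt-power : ∀ {g : ⟦ γ ⟧ → ℕ} → PT {γ} {un} g → PT {γ} {bn} (λ x → power (g x))
      pt-power {g} pg = pt-fold {γ} {bn} {λ y → proj₂ y + proj₂ y} (pt-double pt-snd) pg (pt-const {σ = bn} 1) (con 1 ⊞ con 4 ⊠ (con 1 ⊞ out pg))
        λ x k k≤g → ≤-trans (sz-bn (power k)) (s≤s (*-monoʳ-≤ 4 (≤-trans (bitLength≤ (suc k) (power< k))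
          (s≤s (≤-trans k≤g (≤-trans (≤sz-un (g x)) (sz-out pg x)))))))
        where
        power< : ∀ k → power k < 2 ^ suc k
        power< k = subst (_< 2 ^ suc k) (sym (power≡ k)) (^-monoʳ-< 2 (s≤s (s≤s z≤n)) (≤-refl {suc k}))

      pt-precision : PT {γ} {un} (λ x → precision (n x) (λ′ x))
      pt-precision = pt-+ᵘ (pt-^ᵘ 3 pλ) (pt-length (pt-toBits (pt-un→bn pn)))

      pt-parameters : PT {γ} {paramTy} (λ x → parameters (n x) (m x) (λ′ x))
      pt-parameters = pt-pair (pt-pair pn pm) (pt-pair (pt-pair pt-precision (pt-suc (pt-suc pt-precision))) (pt-pos (pt-un→bn (pt-^ᵘ 8 pλ))))

      pt-start : ∀ {r} → PT {γ} {list (list int)} r → PT {γ} {stateTy} (λ x → start (n x) (m x) (λ′ x) (r x))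
      pt-start pr = pt-pair (pt-tab pn (pt-tab (↑ pn) (pt-* (↑ ↑ (pt-pos (pt-power (pt-^ᵘ 3 pλ)))) (pt-δ (↑ pt-snd) pt-snd))))
        (pt-pair pr (pt-tab pm (pt-const {σ = int} 0ℤ)))

      pt-final : ∀ {r} → PT {γ} {list (list int)} r → PT {γ} {stateTy} (λ x → final (n x) (m x) (λ′ x) (r x))
      pt-final {r} pr = pt-run {γ} {λ x → parameters (n x) (m x) (λ′ x)} {λ x → start (n x) (m x) (λ′ x) (r x)} {λ x → λ′ x ^ 13}
        pt-parameters (pt-start pr) (pt-^ᵘ 13 pλ)

      pt-feasible : ∀ {r} → PT {γ} {list (list int)} r → PT {γ} {bool} (λ x → feasible (n x) (m x) (λ′ x) (r x))
      pt-feasible {r} pr = pt-not (pt-∘ pt-fst (pt-search pn pm {λ x → slacks (n x) (m x) (r x) (solution (n x) (m x) (final (n x) (m x) (λ′ x) (r x)))}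
        (pt-slacks pn pm {r} {λ x → solution (n x) (m x) (final (n x) (m x) (λ′ x) (r x))} pr (pt-solution (pt-final pr)))))
        where
        pt-solution : ∀ {s} → PT {γ} {stateTy} s → PT {γ} {list int} (λ x → solution (n x) (m x) (s x))
        pt-solution ps = pt-apply pn (pt-∘ pt-fst ps) (pt-combine pn pm (pt-∘ pt-fst (pt-∘ pt-snd ps)) (pt-∘ pt-snd (pt-∘ pt-snd ps)))

-- Soundness and completeness of the feasibility test

module Feasibility where

  open PolyTimeList using (nth)
  open Binary using (bitLength; bitLength≤; <2^bitLength)
  open Sums
  open Pigeonhole using (siegelBound; NonZeroVector)
  open SmallSolution using (module Vertex; update; update-at; update-<)
  open Algorithm
  open ListSpecification
  open AlgorithmCorrectness
  open Parameters
  open import Data.Integer using (ℤ; -[1+_]; +≤+; -≤+; +<+; 0ℤ; 1ℤ; -1ℤ; _+_; _*_; _-_; -_; _≤_; _<_; ∣_∣) renaming (+_ to pos)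
  open import Data.Integer.Properties
  open import Data.Integer.Tactic.RingSolver using (solve-∀)
  open import Data.Nat as ℕ using (ℕ; zero; suc; z≤n; s≤s)
  import Data.Nat.Properties as ℕ
  import Data.Nat.Tactic.RingSolver as ℕ-Solver

  module Rows (n m : ℕ) (a : ℕ → Vector) (∣a∣≤1 : ∀ i j → i ℕ.< m → j ℕ.< n → ∣ a i j ∣ ℕ.≤ 1)
    (unit : ∀ j → j ℕ.< n → ∃[ i ] (i ℕ.< m × (∀ l → l ℕ.< n → a i l ≡ δ j l)))
    (x : Vector) (0<ax : ∀ i → i ℕ.< m → 0ℤ < dot n (a i) x) where

    private
      -- The last coefficient `-1` homogenises the condition `a · x ≥ 1` to `a · X ≥ X n`.
      φ : ℕ → Vector
      φ i = update (a i) n -1ℤ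

      dot-φ : ∀ i X → dot (suc n) (φ i) X ≡ dot n (a i) X - X n
      dot-φ i X = cong₂ _+_ (Σ-cong n λ j j<n → cong (_* X j) (update-< (a i) n -1ℤ j<n))
        (trans (cong (_* X n) (update-at (a i) n -1ℤ)) (-1*i≡-i (X n)))

      ∣φ∣≤1 : ∀ i j → i ℕ.< m → j ℕ.< suc n → ∣ φ i j ∣ ℕ.≤ 1
      ∣φ∣≤1 i j i<m j< with ℕ.m≤n⇒m<n∨m≡n (ℕ.≤-pred j<)
      ... | inj₁ j<n  = subst (λ t → ∣ t ∣ ℕ.≤ 1) (sym (update-< (a i) n -1ℤ j<n)) (∣a∣≤1 i j i<m j<n)
      ... | inj₂ refl = subst (λ t → ∣ t ∣ ℕ.≤ 1) (sym (update-at (a i) n -1ℤ)) ℕ.≤-refl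

      dot-unit : ∀ {i j} X → j ℕ.< n → (∀ l → l ℕ.< n → a i l ≡ δ j l) → dot n (a i) X ≡ X j
      dot-unit {i} {j} X j<n ai≡ = trans (Σ-cong n λ l l<n → cong (_* X l) (ai≡ l l<n)) (Σ-δ n j X j<n)

      pointed : ∀ D → NonZeroVector (suc n) D → D n ≡ 0ℤ → ∃[ i ] (i ℕ.< m × dot (suc n) (φ i) D ≢ 0ℤ)
      pointed D (j , j< , ne) Dn with ℕ.m≤n⇒m<n∨m≡n (ℕ.≤-pred j<)
      ... | inj₂ refl = ⊥-elim (ne Dn)
      ... | inj₁ j<n with unit j j<n
      ...   | i , i<m , ai≡ = i , i<m , λ e → ne (trans (sym (trans (dot-φ i D) (trans (cong₂ _-_ (dot-unit D j<n ai≡) Dn) (+-identityʳ (D j))))) e)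

      open Vertex n m φ ∣φ∣≤1 pointed

      X₀ : Vector
      X₀ = update x n 1ℤ

      X₀∈ : InCone X₀
      X₀∈ = (λ i i<m → subst (0ℤ ≤_) (sym (trans (dot-φ i X₀) (cong₂ _-_ (dot-cong n {a i} {a i} (λ _ _ → refl) (λ j → update-< x n 1ℤ)) (update-at x n 1ℤ))))
              (gap (i<j⇒suc[i]≤j (0<ax i i<m)))) , subst (0ℤ <_) (sym (update-at x n 1ℤ)) (+<+ (s≤s z≤n))

      vertex = small X₀ X₀∈

    bound : ℕ
    bound = n ℕ.* siegelBound n (suc n) 1

    -- The last coordinate of the vertex may be any positive integer. No division is necessary: the
    -- rows then are at least this integer, and in particular at least 1.
    small-solution : ∃[ v ] ((∀ i → i ℕ.< m → 1ℤ ≤ dot n (a i) v) × (∀ i → i ℕ.< m → dot n (a i) v ≤ pos bound))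
    small-solution = v , (λ i i<m → ≤-trans (i<j⇒suc[i]≤j (proj₂ (proj₁ (proj₂ vertex))))
        (0≤i-j⇒j≤i (subst (0ℤ ≤_) (dot-φ i v) (proj₁ (proj₁ (proj₂ vertex)) i i<m)))) ,
      λ i i<m → ≤-trans (i≤∣i∣ (dot n (a i) v)) (+≤+ (∣Σ∣≤ n (siegelBound n (suc n) 1) λ j j<n → ℕ.≤-trans (ℕ.≤-reflexive (abs-* (a i j) (v j)))
        (ℕ.≤-trans (ℕ.*-mono-≤ (∣a∣≤1 i j i<m j<n) (proj₂ (proj₂ vertex) j)) (ℕ.≤-reflexive (ℕ.*-identityˡ _)))))
      where
      v : Vector
      v = proj₁ vertex
      i≤∣i∣ : ∀ i → i ≤ pos ∣ i ∣
      i≤∣i∣ (pos k)    = ≤-refl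
      i≤∣i∣ (-[1+ k ]) = -≤+

  k<2^k : ∀ k → k ℕ.< 2 ℕ.^ k
  k<2^k zero    = s≤s z≤n
  k<2^k (suc k) = ℕ.≤-trans (s≤s (k<2^k k)) (ℕ.≤-trans (ℕ.+-monoˡ-≤ (2 ℕ.^ k) (ℕ.m^n>0 2 k)) (ℕ.≤-reflexive (cong (2 ℕ.^ k ℕ.+_) (sym (ℕ.+-identityʳ _)))))

  2^bitLength≤ : ∀ n → 2 ℕ.^ bitLength n ℕ.≤ suc (n ℕ.+ n)
  2^bitLength≤ n with 2 ℕ.^ bitLength n ℕ.≤? suc (n ℕ.+ n)
  ... | yes h = h
  ... | no nh with bitLength n in e
  ...   | zero  = ⊥-elim (nh (s≤s z≤n))
  ...   | suc k = ⊥-elim (ℕ.<⇒≱ (ℕ.≤-refl {suc k}) (ℕ.≤-trans (ℕ.≤-reflexive (sym e)) (bitLength≤ k (ℕ.*-cancelˡ-≤ 2 (ℕ.≤-trans (ℕ.≤-reflexive (d n)) (ℕ.≰⇒> nh))))))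
    where
    d : ∀ n → 2 ℕ.* suc n ≡ suc (suc (n ℕ.+ n))
    d = ℕ-Solver.solve-∀

  -- The left side is the base of `siegelBound n (suc n) 1`.
  2n+3≤ : ∀ n → suc (2 ℕ.* (suc n ℕ.* 1)) ℕ.≤ 2 ℕ.^ (2 ℕ.+ n)
  2n+3≤ zero    = ℕ.n≤1+n 3
  2n+3≤ (suc n) = ℕ.≤-trans (ℕ.≤-trans (ℕ.m≤m+n _ (suc (2 ℕ.* n))) (ℕ.≤-reflexive (e n))) (ℕ.*-monoʳ-≤ 2 (2n+3≤ n))
    where
    e : ∀ n → suc (2 ℕ.* (suc (suc n) ℕ.* 1)) ℕ.+ suc (2 ℕ.* n) ≡ 2 ℕ.* suc (2 ℕ.* (suc n ℕ.* 1))
    e = ℕ-Solver.solve-∀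

  module Estimates (n m λ′ : ℕ) (4≤λ : 4 ℕ.≤ λ′) (n+2≤λ : 2 ℕ.+ n ℕ.≤ λ′) (m≤λ : m ℕ.≤ λ′) where

    open ℕ.≤-Reasoning

    -- `ℓ` dominates the exponent `(n + 2)²` that bounds the small solution. `κ` makes up for the
    -- ratio `2 ^ bitLength n` between the scale `P` and the entries of the initial matrix.
    ℓ κ : ℕ
    ℓ = λ′ ℕ.^ 2
    κ = λ′ ℕ.* 2 ℕ.^ bitLength n

    n≤λ : n ℕ.≤ λ′
    n≤λ = ℕ.≤-trans (ℕ.m≤n+m n 2) n+2≤λ

    bound≤ : n ℕ.* siegelBound n (suc n) 1 ℕ.≤ 2 ℕ.^ ℓ
    bound≤ = begin
      n ℕ.* siegelBound n (suc n) 1        ≤⟨ ℕ.*-mono-≤ (ℕ.<⇒≤ (k<2^k n)) (ℕ.^-monoˡ-≤ n (2n+3≤ n)) ⟩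
      2 ℕ.^ n ℕ.* (2 ℕ.^ (2 ℕ.+ n)) ℕ.^ n  ≡⟨ cong (2 ℕ.^ n ℕ.*_) (ℕ.^-*-assoc 2 (2 ℕ.+ n) n) ⟩
      2 ℕ.^ n ℕ.* 2 ℕ.^ ((2 ℕ.+ n) ℕ.* n)  ≡⟨ sym (ℕ.^-distribˡ-+-* 2 n ((2 ℕ.+ n) ℕ.* n)) ⟩
      2 ℕ.^ (n ℕ.+ (2 ℕ.+ n) ℕ.* n)        ≤⟨ ℕ.^-monoʳ-≤ 2 (ℕ.≤-trans (ℕ.m≤m+n _ (4 ℕ.+ n)) (ℕ.≤-trans (ℕ.≤-reflexive (e n)) (ℕ.^-monoˡ-≤ 2 n+2≤λ))) ⟩
      2 ℕ.^ ℓ                              ∎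
      where
      e : ∀ n → n ℕ.+ (2 ℕ.+ n) ℕ.* n ℕ.+ (4 ℕ.+ n) ≡ (2 ℕ.+ n) ℕ.* ((2 ℕ.+ n) ℕ.* 1)
      e = ℕ-Solver.solve-∀

    κ≤ : κ ℕ.≤ 2 ℕ.* λ′ ℕ.^ 2
    κ≤ = begin
      λ′ ℕ.* 2 ℕ.^ bitLength n ≤⟨ ℕ.*-monoʳ-≤ λ′ (2^bitLength≤ n) ⟩
      λ′ ℕ.* suc (n ℕ.+ n)     ≤⟨ ℕ.*-monoʳ-≤ λ′ (ℕ.+-mono-≤ (ℕ.≤-trans (ℕ.n≤1+n (suc n)) n+2≤λ) n≤λ) ⟩
      λ′ ℕ.* (λ′ ℕ.+ λ′)       ≡⟨ e λ′ ⟩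
      2 ℕ.* λ′ ℕ.^ 2           ∎
      where
      e : ∀ k → k ℕ.* (k ℕ.+ k) ≡ 2 ℕ.* (k ℕ.* (k ℕ.* 1))
      e = ℕ-Solver.solve-∀

    hY : 8 ℕ.* m ℕ.* (κ ℕ.+ 8 ℕ.* (m ℕ.* ℓ)) ℕ.≤ λ′ ℕ.^ 8
    hY = begin
      8 ℕ.* m ℕ.* (κ ℕ.+ 8 ℕ.* (m ℕ.* ℓ))                   ≤⟨ ℕ.*-mono-≤ (ℕ.*-monoʳ-≤ 8 m≤λ) (ℕ.+-mono-≤ κ≤ (ℕ.*-monoʳ-≤ 8 (ℕ.*-monoˡ-≤ ℓ m≤λ))) ⟩
      8 ℕ.* λ′ ℕ.* (2 ℕ.* λ′ ℕ.^ 2 ℕ.+ 8 ℕ.* (λ′ ℕ.* ℓ))     ≡⟨ e₁ λ′ ⟩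
      λ′ ℕ.^ 3 ℕ.* (16 ℕ.+ 64 ℕ.* λ′)                        ≤⟨ ℕ.*-monoʳ-≤ (λ′ ℕ.^ 3) small ⟩
      λ′ ℕ.^ 3 ℕ.* λ′ ℕ.^ 5                                  ≡⟨ sym (ℕ.^-distribˡ-+-* λ′ 3 5) ⟩
      λ′ ℕ.^ 8                                               ∎
      where
      e₁ : ∀ k → 8 ℕ.* k ℕ.* (2 ℕ.* (k ℕ.* (k ℕ.* 1)) ℕ.+ 8 ℕ.* (k ℕ.* (k ℕ.* (k ℕ.* 1)))) ≡ (k ℕ.* (k ℕ.* (k ℕ.* 1))) ℕ.* (16 ℕ.+ 64 ℕ.* k)
      e₁ = ℕ-Solver.solve-∀
      e₂ : ∀ k → 64 ℕ.* k ℕ.+ 64 ℕ.* k ≡ 128 ℕ.* k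
      e₂ = ℕ-Solver.solve-∀
      small : 16 ℕ.+ 64 ℕ.* λ′ ℕ.≤ λ′ ℕ.^ 5
      small = begin
        16 ℕ.+ 64 ℕ.* λ′           ≤⟨ ℕ.+-monoˡ-≤ (64 ℕ.* λ′) (ℕ.≤-trans (ℕ.m≤n+m 16 240) (ℕ.*-monoʳ-≤ 64 4≤λ)) ⟩
        64 ℕ.* λ′ ℕ.+ 64 ℕ.* λ′    ≡⟨ e₂ λ′ ⟩
        128 ℕ.* λ′                 ≤⟨ ℕ.*-monoˡ-≤ λ′ (ℕ.m≤n+m 128 128) ⟩
        4 ℕ.^ 4 ℕ.* λ′             ≤⟨ ℕ.*-monoˡ-≤ λ′ (ℕ.^-monoˡ-≤ 4 4≤λ) ⟩
        λ′ ℕ.^ 4 ℕ.* λ′            ≡⟨ ℕ.*-comm (λ′ ℕ.^ 4) λ′ ⟩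
        λ′ ℕ.^ 5                   ∎

    exponent≤ : 5 ℕ.+ 5 ℕ.* λ′ ℕ.+ (ℓ ℕ.+ ℓ) ℕ.≤ λ′ ℕ.^ 3
    exponent≤ = begin
      5 ℕ.+ 5 ℕ.* λ′ ℕ.+ (ℓ ℕ.+ ℓ)       ≤⟨ ℕ.+-monoˡ-≤ (ℓ ℕ.+ ℓ) (ℕ.+-monoˡ-≤ (5 ℕ.* λ′) (ℕ.≤-trans (ℕ.m≤n+m 5 7) (ℕ.*-monoʳ-≤ 3 4≤λ))) ⟩
      3 ℕ.* λ′ ℕ.+ 5 ℕ.* λ′ ℕ.+ (ℓ ℕ.+ ℓ) ≡⟨ e₁ λ′ ⟩
      2 ℕ.* (4 ℕ.* λ′) ℕ.+ 2 ℕ.* ℓ        ≤⟨ ℕ.+-monoˡ-≤ (2 ℕ.* ℓ) (ℕ.*-monoʳ-≤ 2 (ℕ.*-monoˡ-≤ λ′ 4≤λ)) ⟩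
      2 ℕ.* (λ′ ℕ.* λ′) ℕ.+ 2 ℕ.* ℓ       ≡⟨ e₂ λ′ ⟩
      4 ℕ.* ℓ                             ≤⟨ ℕ.*-monoˡ-≤ ℓ 4≤λ ⟩
      λ′ ℕ.^ 3                            ∎
      where
      e₁ : ∀ k → 3 ℕ.* k ℕ.+ 5 ℕ.* k ℕ.+ (k ℕ.* (k ℕ.* 1) ℕ.+ k ℕ.* (k ℕ.* 1)) ≡ 2 ℕ.* (4 ℕ.* k) ℕ.+ 2 ℕ.* (k ℕ.* (k ℕ.* 1))
      e₁ = ℕ-Solver.solve-∀
      e₂ : ∀ k → 2 ℕ.* (k ℕ.* k) ℕ.+ 2 ℕ.* (k ℕ.* (k ℕ.* 1)) ≡ 4 ℕ.* (k ℕ.* (k ℕ.* 1))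
      e₂ = ℕ-Solver.solve-∀

    -- The cubic term of `precision` absorbs both the exponent `2ℓ` of the squared height and the
    -- exponent `5 + 5 * λ′` of a polynomial factor.
    R-bound : ∀ c → c ℕ.≤ 32 ℕ.* λ′ ℕ.^ 5 → c ℕ.* (2 ℕ.^ ℓ ℕ.* 2 ℕ.^ ℓ) ℕ.≤ 2 ℕ.^ precision n λ′
    R-bound c c≤ = begin
      c ℕ.* (2 ℕ.^ ℓ ℕ.* 2 ℕ.^ ℓ)                      ≤⟨ ℕ.*-mono-≤ (ℕ.≤-trans c≤ (ℕ.*-monoʳ-≤ 32 (ℕ.^-monoˡ-≤ 5 (ℕ.<⇒≤ (k<2^k λ′))))) (ℕ.≤-reflexive (sym (ℕ.^-distribˡ-+-* 2 ℓ ℓ))) ⟩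
      32 ℕ.* (2 ℕ.^ λ′) ℕ.^ 5 ℕ.* 2 ℕ.^ (ℓ ℕ.+ ℓ)      ≡⟨ cong (λ t → 32 ℕ.* t ℕ.* 2 ℕ.^ (ℓ ℕ.+ ℓ)) (trans (ℕ.^-*-assoc 2 λ′ 5) (cong (2 ℕ.^_) (ℕ.*-comm λ′ 5))) ⟩
      2 ℕ.^ 5 ℕ.* 2 ℕ.^ (5 ℕ.* λ′) ℕ.* 2 ℕ.^ (ℓ ℕ.+ ℓ) ≡⟨ cong (ℕ._* 2 ℕ.^ (ℓ ℕ.+ ℓ)) (sym (ℕ.^-distribˡ-+-* 2 5 (5 ℕ.* λ′))) ⟩
      2 ℕ.^ (5 ℕ.+ 5 ℕ.* λ′) ℕ.* 2 ℕ.^ (ℓ ℕ.+ ℓ)       ≡⟨ sym (ℕ.^-distribˡ-+-* 2 (5 ℕ.+ 5 ℕ.* λ′) (ℓ ℕ.+ ℓ)) ⟩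
      2 ℕ.^ (5 ℕ.+ 5 ℕ.* λ′ ℕ.+ (ℓ ℕ.+ ℓ))             ≤⟨ ℕ.^-monoʳ-≤ 2 (ℕ.≤-trans exponent≤ (ℕ.m≤m+n (λ′ ℕ.^ 3) (bitLength n))) ⟩
      2 ℕ.^ precision n λ′                             ∎

    0<λ : 0 ℕ.< λ′
    0<λ = ℕ.≤-trans (s≤s z≤n) 4≤λ

    instance
      λ≢0 : ℕ.NonZero λ′
      λ≢0 = ℕ.>-nonZero 0<λ

    hP : 16 ℕ.* (2 ℕ.* (n ℕ.* (n ℕ.* (2 ℕ.^ ℓ ℕ.* 2 ℕ.^ ℓ)))) ℕ.* (m ℕ.* ℓ) ℕ.≤ 2 ℕ.^ precision n λ′
    hP = ℕ.≤-trans (ℕ.≤-reflexive (e n m ℓ (2 ℕ.^ ℓ ℕ.* 2 ℕ.^ ℓ))) (R-bound _ (begin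
      32 ℕ.* (n ℕ.* (n ℕ.* (m ℕ.* ℓ)))     ≤⟨ ℕ.*-monoʳ-≤ 32 (ℕ.*-mono-≤ n≤λ (ℕ.*-mono-≤ n≤λ (ℕ.*-monoˡ-≤ ℓ m≤λ))) ⟩
      32 ℕ.* λ′ ℕ.^ 5                      ∎))
      where
      e : ∀ n m l r → 16 ℕ.* (2 ℕ.* (n ℕ.* (n ℕ.* r))) ℕ.* (m ℕ.* l) ≡ 32 ℕ.* (n ℕ.* (n ℕ.* (m ℕ.* l))) ℕ.* r
      e = ℕ-Solver.solve-∀

    hP′ : 4 ℕ.* (2 ℕ.* (n ℕ.* (n ℕ.* (2 ℕ.^ ℓ ℕ.* 2 ℕ.^ ℓ)))) ℕ.≤ 2 ℕ.^ precision n λ′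
    hP′ = ℕ.≤-trans (ℕ.≤-reflexive (e n (2 ℕ.^ ℓ ℕ.* 2 ℕ.^ ℓ))) (R-bound _ (begin
      8 ℕ.* (n ℕ.* (n ℕ.* 1)) ≤⟨ ℕ.*-mono-≤ (ℕ.m≤n+m 8 24) (ℕ.^-monoˡ-≤ 2 n≤λ) ⟩
      32 ℕ.* λ′ ℕ.^ 2         ≤⟨ ℕ.*-monoʳ-≤ 32 (ℕ.^-monoʳ-≤ λ′ {2} {5} (s≤s (s≤s z≤n))) ⟩
      32 ℕ.* λ′ ℕ.^ 5         ∎))
      where
      e : ∀ n r → 4 ℕ.* (2 ℕ.* (n ℕ.* (n ℕ.* r))) ≡ 8 ℕ.* (n ℕ.* (n ℕ.* 1)) ℕ.* r
      e = ℕ-Solver.solve-∀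

    hκ : 2 ℕ.^ precision n λ′ ℕ.* n ℕ.≤ κ ℕ.* 2 ℕ.^ (λ′ ℕ.^ 3)
    hκ = begin
      2 ℕ.^ precision n λ′ ℕ.* n                          ≡⟨ cong (ℕ._* n) (ℕ.^-distribˡ-+-* 2 (λ′ ℕ.^ 3) (bitLength n)) ⟩
      2 ℕ.^ (λ′ ℕ.^ 3) ℕ.* 2 ℕ.^ bitLength n ℕ.* n        ≤⟨ ℕ.*-monoʳ-≤ (2 ℕ.^ (λ′ ℕ.^ 3) ℕ.* 2 ℕ.^ bitLength n) n≤λ ⟩
      2 ℕ.^ (λ′ ℕ.^ 3) ℕ.* 2 ℕ.^ bitLength n ℕ.* λ′       ≡⟨ e (2 ℕ.^ (λ′ ℕ.^ 3)) (2 ℕ.^ bitLength n) λ′ ⟩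
      κ ℕ.* 2 ℕ.^ (λ′ ℕ.^ 3)                              ∎
      where
      e : ∀ a b c → a ℕ.* b ℕ.* c ≡ c ℕ.* b ℕ.* a
      e = ℕ-Solver.solve-∀

    hg : 2 ℕ.^ (λ′ ℕ.^ 3) ℕ.* n ℕ.≤ 2 ℕ.^ precision n λ′
    hg = ℕ.≤-trans (ℕ.*-monoʳ-≤ (2 ℕ.^ (λ′ ℕ.^ 3)) (ℕ.<⇒≤ (<2^bitLength n))) (ℕ.≤-reflexive (sym (ℕ.^-distribˡ-+-* 2 (λ′ ℕ.^ 3) (bitLength n))))

    hW : 2 ℕ.* 2 ℕ.^ precision n λ′ ℕ.< 2 ℕ.^ (2 ℕ.+ precision n λ′)
    hW = ℕ.^-monoʳ-< 2 (s≤s (s≤s z≤n)) (ℕ.≤-refl {2 ℕ.+ precision n λ′})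

    -- The left side is the maximum of the potential, at most `λ′ ^ 12 + λ′ ^ 9`; one more power of
    -- `λ′` bounds the number of steps.
    hT : m ℕ.* ℓ ℕ.* (m ℕ.* λ′ ℕ.^ 8) ℕ.+ m ℕ.* λ′ ℕ.^ 8 ℕ.< λ′ ℕ.^ 13
    hT = begin-strict
      m ℕ.* ℓ ℕ.* (m ℕ.* λ′ ℕ.^ 8) ℕ.+ m ℕ.* λ′ ℕ.^ 8     ≤⟨ ℕ.+-mono-≤ (ℕ.*-mono-≤ (ℕ.*-monoˡ-≤ ℓ m≤λ) (ℕ.*-monoˡ-≤ (λ′ ℕ.^ 8) m≤λ)) (ℕ.*-monoˡ-≤ (λ′ ℕ.^ 8) m≤λ) ⟩
      λ′ ℕ.^ 3 ℕ.* λ′ ℕ.^ 9 ℕ.+ λ′ ℕ.^ 9                  ≡⟨ cong (ℕ._+ λ′ ℕ.^ 9) (sym (ℕ.^-distribˡ-+-* λ′ 3 9)) ⟩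
      λ′ ℕ.^ 12 ℕ.+ λ′ ℕ.^ 9                              ≤⟨ ℕ.+-monoʳ-≤ (λ′ ℕ.^ 12) (ℕ.^-monoʳ-≤ λ′ {9} {12} (ℕ.m≤n+m 9 3)) ⟩
      λ′ ℕ.^ 12 ℕ.+ λ′ ℕ.^ 12                             ≡⟨ cong (λ′ ℕ.^ 12 ℕ.+_) (sym (ℕ.+-identityʳ (λ′ ℕ.^ 12))) ⟩
      2 ℕ.* λ′ ℕ.^ 12                                     <⟨ ℕ.*-monoˡ-< (λ′ ℕ.^ 12) {{ℕ.m^n≢0 λ′ 12}} (ℕ.≤-trans (s≤s (s≤s (s≤s z≤n))) 4≤λ) ⟩
      λ′ ℕ.^ 13                                           ∎

  feasible-sound : ∀ n m λ′ r → feasible n m λ′ r ≡ true → ∃[ v ] (∀ i → i ℕ.< m → 0ℤ < dot n (entry r i) v)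
  feasible-sound n m λ′ r e = nth 0ℤ v , positive (search-spec l) (not-true e)
    where
    v l : List ℤ
    v = solution n m (final n m λ′ r)
    l = slacks n m r v
    not-true : ∀ {b} → not b ≡ true → b ≡ false
    not-true {false} _ = refl
    positive : (∃[ k ] (k ℕ.< length l × nth 0ℤ l k ≤ 0ℤ × search l ≡ (true , k))) ⊎ ((∀ i → i ℕ.< length l → 0ℤ < nth 0ℤ l i) × proj₁ (search l) ≡ false) →
      proj₁ (search l) ≡ false → ∀ i → i ℕ.< m → 0ℤ < dot n (entry r i) (nth 0ℤ v)
    positive (inj₁ (k , _ , _ , e₁)) e₂ with trans (sym (cong proj₁ e₁)) e₂
    ... | ()
    positive (inj₂ (all , _)) _ i i<m = subst (0ℤ <_) (nth-tab 0ℤ m (λ i → Σ n λ j → entry r i j * nth 0ℤ v j) i i<m)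
      (all i (subst (i ℕ.<_) (sym (trans (length-map (λ i → Σ n λ j → entry r i j * nth 0ℤ v j) (upTo m)) (length-upTo m))) i<m))

  module Complete (n m λ′ : ℕ) (r : List (List ℤ)) (4≤λ : 4 ℕ.≤ λ′) (n+2≤λ : 2 ℕ.+ n ℕ.≤ λ′) (m≤λ : m ℕ.≤ λ′)
    (∣a∣≤1 : ∀ i j → i ℕ.< m → j ℕ.< n → ∣ entry r i j ∣ ℕ.≤ 1)
    (unit : ∀ j → j ℕ.< n → ∃[ i ] (i ℕ.< m × (∀ l → l ℕ.< n → entry r i l ≡ δ j l)))
    (x : Vector) (0<ax : ∀ i → i ℕ.< m → 0ℤ < dot n (entry r i) x) where

    private
      module B = Estimates n m λ′ 4≤λ n+2≤λ m≤λ

      p Y : ℕ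
      p = precision n λ′
      Y = λ′ ℕ.^ 8

      found-small : ∃[ v ] ((∀ i → i ℕ.< m → 1ℤ ≤ dot n (entry r i) v) × (∀ i → i ℕ.< m → dot n (entry r i) v ≤ pos (n ℕ.* siegelBound n (suc n) 1)))
      found-small = Rows.small-solution n m (entry r) ∣a∣≤1 unit x 0<ax

      v : Vector
      v = proj₁ found-small

      open Correctness n m B.ℓ Y B.κ p (2 ℕ.+ p) (entry r) v ∣a∣≤1 unit (proj₁ (proj₂ found-small))

      0<λ^ : ∀ k → 0 ℕ.< λ′ ℕ.^ k
      0<λ^ k = ℕ.m^n>0 λ′ {{B.λ≢0}} k

      0<κ : 0 ℕ.< B.κ
      0<κ = ℕ.*-mono-≤ B.0<λ (ℕ.m^n>0 2 (bitLength n))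

      0<Y : 0ℤ < pos Y
      0<Y = +<+ (0<λ^ 8)

      E≡ : pos (2 ℕ.* (n ℕ.* (n ℕ.* (2 ℕ.^ B.ℓ ℕ.* 2 ℕ.^ B.ℓ)))) ≡ E
      E≡ = trans (pos-* 2 (n ℕ.* (n ℕ.* h²))) (cong (pos 2 *_) (trans (pos-* n (n ℕ.* h²)) (cong (pos n *_) (trans (pos-* n h²) (cong (pos n *_) (pos-* (2 ℕ.^ B.ℓ) (2 ℕ.^ B.ℓ)))))))
        where
        h² : ℕ
        h² = 2 ℕ.^ B.ℓ ℕ.* 2 ℕ.^ B.ℓ

      hP : pos 16 * E * Kmax ≤ P
      hP = ≤-trans (≤-reflexive (sym (trans (pos-* (16 ℕ.* e) (m ℕ.* B.ℓ)) (cong (_* pos (m ℕ.* B.ℓ)) (trans (pos-* 16 e) (cong (pos 16 *_) E≡)))))) (+≤+ B.hP)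
        where
        e : ℕ
        e = 2 ℕ.* (n ℕ.* (n ℕ.* (2 ℕ.^ B.ℓ ℕ.* 2 ℕ.^ B.ℓ)))

      hP′ : pos 4 * E ≤ P
      hP′ = ≤-trans (≤-reflexive (sym (trans (pos-* 4 e) (cong (pos 4 *_) E≡)))) (+≤+ B.hP′)
        where
        e : ℕ
        e = 2 ℕ.* (n ℕ.* (n ℕ.* (2 ℕ.^ B.ℓ ℕ.* 2 ℕ.^ B.ℓ)))

      hY : pos 8 * pos m * (pos B.κ + pos 8 * Kmax) ≤ pos Y
      hY = ≤-trans (≤-reflexive (sym (trans (pos-* (8 ℕ.* m) (B.κ ℕ.+ 8 ℕ.* (m ℕ.* B.ℓ)))
        (cong₂ _*_ (pos-* 8 m) (trans (pos-+ B.κ (8 ℕ.* (m ℕ.* B.ℓ))) (cong (pos B.κ +_) (pos-* 8 (m ℕ.* B.ℓ)))))))) (+≤+ B.hY)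

      s₀ : LState
      s₀ = start n m λ′ r

      I₀ : Inv (view s₀)
      I₀ = Initial.initial (2 ℕ.^ (λ′ ℕ.^ 3)) 0<κ 0<Y
        (≤-trans (≤-reflexive (sym (pos-* (2 ℕ.^ p) n))) (≤-trans (+≤+ B.hκ) (≤-reflexive (pos-* B.κ (2 ℕ.^ (λ′ ℕ.^ 3))))))
        (≤-trans (≤-reflexive (sym (pos-* (2 ℕ.^ (λ′ ℕ.^ 3)) n))) (+≤+ B.hg))
        (λ i i<m → ≤-trans (proj₂ (proj₂ found-small) i i<m) (+≤+ B.bound≤))
        (view s₀)
        (λ i j i<n j<n → trans (entry-tab n n (λ i j → pos (power (λ′ ℕ.^ 3)) * δ i j) i j i<n j<n) (cong (λ g → pos g * δ i j) (power≡ (λ′ ℕ.^ 3))))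
        (λ _ _ _ _ → refl)
        (nth-tab 0ℤ m (λ _ → 0ℤ))

      hT : Kmax * (pos m * pos Y) + pos m * pos Y < pos (λ′ ℕ.^ 13)
      hT = subst (_< pos (λ′ ℕ.^ 13)) (trans (pos-+ (m ℕ.* B.ℓ ℕ.* (m ℕ.* Y)) (m ℕ.* Y))
        (cong₂ _+_ (trans (pos-* (m ℕ.* B.ℓ) (m ℕ.* Y)) (cong (Kmax *_) (pos-* m Y))) (pos-* m Y))) (+<+ B.hT)

    feasible-complete : feasible n m λ′ r ≡ true
    feasible-complete = cong not (search-none l λ i i< → let i<m = subst (i ℕ.<_) length-l i< in
        subst (0ℤ <_) (sym (nth-tab 0ℤ m (λ i → Σ n λ j → entry r i j * nth 0ℤ w j) i i<m))
          (Run.succeeds 0<κ 0<Y hP hP′ hY B.hW s₀ I₀ (λ′ ℕ.^ 13) hT i i<m))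
      where
      w l : List ℤ
      w = solution n m (final n m λ′ r)
      l = slacks n m r w
      length-l : length l ≡ m
      length-l = trans (length-map (λ i → Σ n λ j → entry r i j * nth 0ℤ w j) (upTo m)) (length-upTo m)

-- From words and graphs to inequalities

module Graphs where

  open TreeStack using (≤-by; con)
  open PolyTime
  open PolyTimeFold
  open PolyTimeList
  open PolyTimeArithmetic
  open Sums
  open Pigeonhole using (extend; extend-toℕ)
  open Algorithm
  open AlgorithmSize
  open ListSpecification
  open Parameters
  open Feasibility
  open import Defs
  open import Data.Bool.Properties using (T-≡)
  open import Data.Fin as Fin using (Fin; toℕ; fromℕ<)
  import Data.Fin.Properties as Fin
  open import Data.Integer using (ℤ; +<+; 0ℤ; 1ℤ; -1ℤ; _+_; _*_; _-_; -_; _≤_; _<_; ∣_∣) renaming (+_ to pos)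
  open import Data.Integer.Properties
  open import Data.Integer.Tactic.RingSolver using (solve-∀)
  open import Data.Nat as ℕ using (ℕ; zero; suc; z≤n; s≤s; _≡ᵇ_)
  import Data.Nat.DivMod as ℕ
  import Data.Nat.Properties as ℕ
  import Data.Nat.Tactic.RingSolver as ℕ-Solver
  open import Data.Nat.ListAction using (sum)
  open import Function.Bundles using (Equivalence)
  open import Relation.Binary.Construct.Closure.Transitive using (TransClosure; [_]; _∷_)

  arcAt : ℕ → List Bool → ℕ → ℕ → Bool
  arcAt n bs u v = nth false bs (u ℕ.* n ℕ.+ v)

  adjacent : ℕ → List Bool → ℕ → ℕ → ℤ
  adjacent n bs u v = if arcAt n bs u v ∨ arcAt n bs v u then 1ℤ else 0ℤ

  -- The inequality S(v) > S(u) for an arc (u, v). For any other pair the positivity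
  -- of the label of u; with u = v this covers all vertices.
  coefficient : ℕ → List Bool → ℕ → ℕ → ℕ → ℤ
  coefficient n bs u v j = if arcAt n bs u v then adjacent n bs v j - adjacent n bs u j else δ u j

  inequalities : ℕ → List Bool → List (List ℤ)
  inequalities n bs = concat (tab n λ u → tab n λ v → tab n (coefficient n bs u v))

  Parse : Set
  Parse = Bool × (ℕ × List Bool)

  -- The flag records whether the separator has been read. The matrix bits after it accumulate in
  -- reverse order, which `check` undoes.
  parseStep : Parse → Bool → Parse
  parseStep (seen , (n , bs)) b =
    if seen then (true , (n , b ∷ bs)) else if b then (false , (suc n , bs)) else (true , (n , bs))

  parse : List Bool → Parse
  parse = foldl parseStep (false , (0 , []))

  check : ℕ → Parse → Bool
  check λ′ (seen , (n , bs)) = seen ∧ ((length bs ≡ᵇ n ℕ.* n) ∧ feasible n (n ℕ.* n) λ′ (inequalities n (reverse bs)))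

  -- For a code of a graph with `n` vertices, the length of the word plus 4 is at least 4, `2 + n`
  -- and `n * n`, as the estimates for the parameter `λ′` demand.
  decide : List Bool → Bool
  decide w = check (length w ℕ.+ 4) (parse w)

  module _ {γ : Ty} {n : ⟦ γ ⟧ → ℕ} {bs : ⟦ γ ⟧ → List Bool} (pn : PT {γ} {un} n) (pbs : PT {γ} {list bool} bs) where

    abstract
      pt-arcAt : ∀ {u v} → PT {γ} {un} u → PT {γ} {un} v → PT {γ} {bool} (λ x → arcAt (n x) (bs x) (u x) (v x))
      pt-arcAt pu pv = pt-nth {σ = bool} false pbs (pt-+ᵘ (pt-*ᵘ pu pn) pv)

      pt-adjacent : ∀ {u v} → PT {γ} {un} u → PT {γ} {un} v → PT {γ} {int} (λ x → adjacent (n x) (bs x) (u x) (v x))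
      pt-adjacent pu pv = pt-if (pt-∨ (pt-arcAt pu pv) (pt-arcAt pv pu)) (pt-const {σ = int} 1ℤ) (pt-const {σ = int} 0ℤ)

      pt-coefficient : ∀ {u v j} → PT {γ} {un} u → PT {γ} {un} v → PT {γ} {un} j →
                       PT {γ} {int} (λ x → coefficient (n x) (bs x) (u x) (v x) (j x))
      pt-coefficient pu pv pj = pt-if (pt-arcAt pu pv) (pt-+ (pt-adjacent pv pj) (pt-neg (pt-adjacent pu pj))) (pt-δ pu pj)

  module _ {γ : Ty} {n : ⟦ γ ⟧ → ℕ} {bs : ⟦ γ ⟧ → List Bool} (pn : PT {γ} {un} n) (pbs : PT {γ} {list bool} bs) where

    abstract
      pt-inequalities : PT {γ} {list (list int)} (λ x → inequalities (n x) (bs x))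
      pt-inequalities = pt-concat (pt-tab pn (pt-tab (↑ pn) (pt-tab (↑ ↑ pn) (pt-coefficient (↑ ↑ ↑ pn) (↑ ↑ ↑ pbs) (↑ ↑ pt-snd) (↑ pt-snd) pt-snd))))

  abstract
    pt-parse : PT {list bool} {bool ⊗ (un ⊗ list bool)} parse
    pt-parse = pt-foldl⁺ {list bool} {bool} {bool ⊗ (un ⊗ list bool)} {λ ((_ , s) , b) → parseStep s b}
      (pt-if (pt-∘ pt-fst st) (pt-pair (pt-const {σ = bool} true) (pt-pair pn (pt-cons pt-snd pbs)))
        (pt-if pt-snd (pt-pair (pt-const {σ = bool} false) (pt-pair (pt-suc pn) pbs)) (pt-pair (pt-const {σ = bool} true) (pt-pair pn pbs))))
      pt-id (pt-const {σ = bool ⊗ (un ⊗ list bool)} (false , (0 , []))) (con 10)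
      λ g s b → grow s b
      where
      st : PT {(list bool ⊗ (bool ⊗ (un ⊗ list bool))) ⊗ bool} {bool ⊗ (un ⊗ list bool)} (λ x → proj₂ (proj₁ x))
      st = pt-∘ pt-snd pt-fst
      pn : PT {(list bool ⊗ (bool ⊗ (un ⊗ list bool))) ⊗ bool} {un} (λ x → proj₁ (proj₂ (proj₂ (proj₁ x))))
      pn = pt-∘ pt-fst (pt-∘ pt-snd st)
      pbs : PT {(list bool ⊗ (bool ⊗ (un ⊗ list bool))) ⊗ bool} {list bool} (λ x → proj₂ (proj₂ (proj₂ (proj₁ x))))
      pbs = pt-∘ pt-snd (pt-∘ pt-snd st)
      grow : ∀ s b → sz (bool ⊗ (un ⊗ list bool)) (parseStep s b) ℕ.≤ sz (bool ⊗ (un ⊗ list bool)) s ℕ.+ 10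
      grow (true , (n , bs)) b = ℕ.≤-trans (s≤s (s≤s (s≤s (s≤s (s≤s (ℕ.+-monoʳ-≤ (sz un n) (s≤s (ℕ.+-monoˡ-≤ (sz (list bool) bs) (sz-bool b)))))))))
        (≤-by 6 (e (sz un n) (sz (list bool) bs)))
        where
        e : ∀ a c → 5 ℕ.+ (a ℕ.+ suc (3 ℕ.+ c)) ℕ.+ 6 ≡ 5 ℕ.+ (a ℕ.+ c) ℕ.+ 10
        e = ℕ-Solver.solve-∀
      grow (false , (n , bs)) true = ≤-by 8 (e (sz un n) (sz (list bool) bs))
        where
        e : ∀ a c → 3 ℕ.+ (2 ℕ.+ a ℕ.+ c) ℕ.+ 8 ≡ 3 ℕ.+ (a ℕ.+ c) ℕ.+ 10
        e = ℕ-Solver.solve-∀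
      grow (false , (n , bs)) false = ≤-by 8 (e (sz un n) (sz (list bool) bs))
        where
        e : ∀ a c → 5 ℕ.+ (a ℕ.+ c) ℕ.+ 8 ≡ 3 ℕ.+ (a ℕ.+ c) ℕ.+ 10
        e = ℕ-Solver.solve-∀

    pt-check : ∀ {γ} {λ′ : ⟦ γ ⟧ → ℕ} {s : ⟦ γ ⟧ → Parse} → PT {γ} {un} λ′ → PT {γ} {bool ⊗ (un ⊗ list bool)} s →
               PT {γ} {bool} (λ x → check (λ′ x) (s x))
    pt-check {γ} {λ′} {s} pλ ps = pt-∧ (pt-∘ pt-fst ps) (pt-∧ (pt-≡ᵘ (pt-length pbs) (pt-*ᵘ pn pn))
      (pt-feasible {γ} {λ x → proj₁ (proj₂ (s x))} {λ x → proj₁ (proj₂ (s x)) ℕ.* proj₁ (proj₂ (s x))} {λ′} pn (pt-*ᵘ pn pn) pλ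
        {λ x → inequalities (proj₁ (proj₂ (s x))) (reverse (proj₂ (proj₂ (s x))))} (pt-inequalities pn (pt-reverse pbs))))
      where
      pn : PT {γ} {un} (λ x → proj₁ (proj₂ (s x)))
      pn = pt-∘ pt-fst (pt-∘ (pt-snd {bool}) ps)
      pbs : PT {γ} {list bool} (λ x → proj₂ (proj₂ (s x)))
      pbs = pt-∘ pt-snd (pt-∘ (pt-snd {bool}) ps)

    pt-decide : PT {list bool} {bool} decide
    pt-decide = pt-check {list bool} {λ w → length w ℕ.+ 4} {parse} (pt-+ᵘ (pt-length pt-id) (pt-const {σ = un} 4)) pt-parse

  parse-rest : ∀ n bs w → foldl parseStep (true , (n , bs)) w ≡ (true , (n , List.foldl (λ s b → b ∷ s) bs w))
  parse-rest n bs []      = refl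
  parse-rest n bs (b ∷ w) = parse-rest n (b ∷ bs) w

  parse-unary : ∀ k n w → foldl parseStep (false , (k , [])) (replicate n true ++ w) ≡ foldl parseStep (false , (n ℕ.+ k , [])) w
  parse-unary k zero    w = refl
  parse-unary k (suc n) w = trans (parse-unary (suc k) n w) (cong (λ m → foldl parseStep (false , (m , [])) w) (ℕ.+-suc n k))

  parse-code : ∀ n bs → parse (replicate n true ++ false ∷ bs) ≡ (true , (n , reverse bs))
  parse-code n bs = trans (parse-unary 0 n (false ∷ bs)) (trans (cong (λ m → foldl parseStep (true , (m , [])) bs) (ℕ.+-identityʳ n)) (parse-rest n [] bs))

  shape : ∀ w → (∃[ n ] ∃[ bs ] (w ≡ replicate n true ++ false ∷ bs)) ⊎ proj₁ (parse w) ≡ false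
  shape w = go 0 w
    where
    go : ∀ k w → (∃[ n ] ∃[ bs ] (w ≡ replicate n true ++ false ∷ bs)) ⊎ proj₁ (foldl parseStep (false , (k , [])) w) ≡ false
    go k []          = inj₂ refl
    go k (false ∷ w) = inj₁ (0 , w , refl)
    go k (true ∷ w) with go (suc k) w
    ... | inj₁ (n , bs , e) = inj₁ (suc n , bs , cong (true ∷_) e)
    ... | inj₂ e            = inj₂ e

  module _ {A : Set} (d : A) where

    nth-++ˡ : ∀ xs ys j → j ℕ.< length xs → nth d (xs ++ ys) j ≡ nth d xs j
    nth-++ˡ (x ∷ xs) ys zero    _       = refl
    nth-++ˡ (x ∷ xs) ys (suc j) (s≤s h) = nth-++ˡ xs ys j h

    nth-++ʳ : ∀ xs ys j → nth d (xs ++ ys) (length xs ℕ.+ j) ≡ nth d ys j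
    nth-++ʳ []       ys j = refl
    nth-++ʳ (x ∷ xs) ys j = nth-++ʳ xs ys j

    nth-concat : ∀ n k (F : ℕ → List A) → (∀ i → length (F i) ≡ n) → ∀ u v → u ℕ.< k → v ℕ.< n →
                 nth d (concat (applyUpTo F k)) (u ℕ.* n ℕ.+ v) ≡ nth d (F u) v
    nth-concat n (suc k) F len zero    v _         v<n = nth-++ˡ (F 0) _ v (subst (v ℕ.<_) (sym (len 0)) v<n)
    nth-concat n (suc k) F len (suc u) v (s≤s u<k) v<n =
      trans (cong (nth d (F 0 ++ concat (applyUpTo (F ∘ suc) k))) (trans (ℕ.+-assoc n (u ℕ.* n) v) (cong (ℕ._+ (u ℕ.* n ℕ.+ v)) (sym (len 0)))))
        (trans (nth-++ʳ (F 0) _ (u ℕ.* n ℕ.+ v)) (nth-concat n k (F ∘ suc) (len ∘ suc) u v u<k v<n))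

    nth-ext : ∀ xs ys → length xs ≡ length ys → (∀ i → i ℕ.< length xs → nth d xs i ≡ nth d ys i) → xs ≡ ys
    nth-ext []       []       _ _ = refl
    nth-ext (x ∷ xs) (y ∷ ys) e h = cong₂ _∷_ (h 0 (s≤s z≤n)) (nth-ext xs ys (ℕ.suc-injective e) λ i i< → h (suc i) (s≤s i<))

    nth-cartesian : ∀ {n k} {B : Set} (h : B × Fin n → A) (e : Fin k → B) u v →
      nth d (map h (cartesianProduct (tabulate e) (allFin n))) (toℕ u ℕ.* n ℕ.+ toℕ v) ≡ h (e u , v)
    nth-cartesian {n} {suc k} h e u v = trans (cong (λ l → nth d l (toℕ u ℕ.* n ℕ.+ toℕ v)) (trans (map-++ h (map (e Fin.zero ,_) (allFin n)) _)
        (cong (_++ rest) (sym (map-∘ (allFin n)))))) (cases u)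
      where
      block rest : List A
      block = map (λ v → h (e Fin.zero , v)) (allFin n)
      rest = map h (cartesianProduct (tabulate (e ∘ Fin.suc)) (allFin n))
      length-block : length block ≡ n
      length-block = trans (length-map _ (allFin n)) (length-tabulate id)
      nth-map : ∀ {m} (g : Fin m → A) (f : Fin n → Fin m) i → nth d (map g (tabulate f)) (toℕ i) ≡ g (f i)
      nth-map {m} g f i = go f i
        where
        go : ∀ {l} (f : Fin l → Fin m) i → nth d (map g (tabulate f)) (toℕ i) ≡ g (f i)
        go f Fin.zero    = refl
        go f (Fin.suc i) = go (f ∘ Fin.suc) i
      cases : ∀ u → nth d (block ++ rest) (toℕ u ℕ.* n ℕ.+ toℕ v) ≡ h (e u , v)
      cases Fin.zero    = trans (nth-++ˡ block rest (toℕ v) (subst (toℕ v ℕ.<_) (sym length-block) (Fin.toℕ<n v))) (nth-map (λ v → h (e Fin.zero , v)) id v)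
      cases (Fin.suc u) = trans (cong (nth d (block ++ rest)) (trans (ℕ.+-assoc n (toℕ u ℕ.* n) (toℕ v)) (cong (ℕ._+ (toℕ u ℕ.* n ℕ.+ toℕ v)) (sym length-block))))
        (trans (nth-++ʳ block rest _) (nth-cartesian h (e ∘ Fin.suc) u v))

    length-cartesian : ∀ {n k} {B : Set} (h : B × Fin n → A) (e : Fin k → B) →
      length (map h (cartesianProduct (tabulate e) (allFin n))) ≡ k ℕ.* n
    length-cartesian {n} {zero}  h e = refl
    length-cartesian {n} {suc k} h e = trans (cong length (map-++ h (map (e Fin.zero ,_) (allFin n)) _))
      (trans (length-++ (map h (map (e Fin.zero ,_) (allFin n))))
        (cong₂ ℕ._+_ (trans (length-map h (map (e Fin.zero ,_) (allFin n))) (trans (length-map (e Fin.zero ,_) (allFin n)) (length-tabulate {n = n} id))) (length-cartesian h (e ∘ Fin.suc))))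

  split-index : ∀ n i → i ℕ.< n ℕ.* n → ∃[ u ] ∃[ v ] (u ℕ.< n × v ℕ.< n × i ≡ u ℕ.* n ℕ.+ v)
  split-index n@(suc _) i i< = i ℕ./ n , i ℕ.% n , ℕ.m<n*o⇒m/o<n i< , ℕ.m%n<n i n , trans (ℕ.m≡m%n+[m/n]*n i n) (ℕ.+-comm (i ℕ.% n) _)

  index< : ∀ n u v → u ℕ.< n → v ℕ.< n → u ℕ.* n ℕ.+ v ℕ.< n ℕ.* n
  index< n u v u<n v<n = ℕ.≤-trans (ℕ.+-monoʳ-< (u ℕ.* n) v<n) (ℕ.≤-trans (ℕ.≤-reflexive (ℕ.+-comm (u ℕ.* n) n)) (ℕ.*-monoˡ-≤ n u<n))

  module _ (n : ℕ) (bs : List Bool) where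

    entry-inequalities : ∀ u v j → u ℕ.< n → v ℕ.< n → j ℕ.< n → entry (inequalities n bs) (u ℕ.* n ℕ.+ v) j ≡ coefficient n bs u v j
    entry-inequalities u v j u<n v<n j<n = trans (cong (λ row → nth 0ℤ row j)
        (trans (cong (λ l → nth [] (concat l) (u ℕ.* n ℕ.+ v)) (map-upTo (λ u → tab n λ v → tab n (coefficient n bs u v)) n))
          (trans (nth-concat [] n n (λ u → tab n λ v → tab n (coefficient n bs u v)) (λ u → trans (length-map _ (upTo n)) (length-upTo n)) u v u<n v<n)
            (nth-tab [] n (λ v → tab n (coefficient n bs u v)) v v<n))))
      (nth-tab 0ℤ n (coefficient n bs u v) j j<n)

    neighbourSum : Vector → ℕ → ℤ
    neighbourSum x u = Σ n λ j → adjacent n bs u j * x j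

    row-value : Vector → ℕ → ℕ → ℤ
    row-value x u v = if arcAt n bs u v then neighbourSum x v - neighbourSum x u else x u

    dot-inequalities : ∀ x u v → u ℕ.< n → v ℕ.< n → dot n (entry (inequalities n bs) (u ℕ.* n ℕ.+ v)) x ≡ row-value x u v
    dot-inequalities x u v u<n v<n = trans (Σ-cong n λ j j<n → cong (_* x j) (entry-inequalities u v j u<n v<n j<n)) (value (arcAt n bs u v))
      where
      e : ∀ a b x → (a - b) * x ≡ a * x + -1ℤ * (b * x)
      e = solve-∀
      value : ∀ b → Σ n (λ j → (if b then adjacent n bs v j - adjacent n bs u j else δ u j) * x j) ≡
                    (if b then neighbourSum x v - neighbourSum x u else x u)
      value true  = trans (Σ-cong n λ j _ → e (adjacent n bs v j) (adjacent n bs u j) (x j))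
        (trans (Σ-+ n (λ j → adjacent n bs v j * x j) (λ j → -1ℤ * (adjacent n bs u j * x j)))
          (cong (neighbourSum x v +_) (trans (Σ-* n -1ℤ (λ j → adjacent n bs u j * x j)) (-1*i≡-i (neighbourSum x u)))))
      value false = Σ-δ n u x u<n

    ∣coefficient∣≤1 : ∀ u v j → ∣ coefficient n bs u v j ∣ ℕ.≤ 1
    ∣coefficient∣≤1 u v j with arcAt n bs u v
    ... | false with u ≡ᵇ j
    ...   | true  = ℕ.≤-refl
    ...   | false = z≤n
    ∣coefficient∣≤1 u v j | true with arcAt n bs v j ∨ arcAt n bs j v | arcAt n bs u j ∨ arcAt n bs j u
    ...   | true  | true  = z≤n
    ...   | true  | false = ℕ.≤-refl
    ...   | false | true  = ℕ.≤-refl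
    ...   | false | false = z≤n

  Σ-front : ∀ n f → Σ (suc n) f ≡ f 0 + Σ n (f ∘ suc)
  Σ-front zero    f = trans (+-identityˡ (f 0)) (sym (+-identityʳ (f 0)))
  Σ-front (suc n) f = trans (cong (_+ f (suc n)) (Σ-front n f)) (+-assoc (f 0) _ _)

  sum-filter : ∀ {n} {A : Set} (p : A → Bool) (F : A → ℕ) (e : Fin n → A) (g : ℕ → ℤ) →
    (∀ i → (if p (e i) then pos (F (e i)) else 0ℤ) ≡ g (toℕ i)) → pos (sum (map F (filterᵇ p (tabulate e)))) ≡ Σ n g
  sum-filter {zero}  p F e g h = refl
  sum-filter {suc n} p F e g h with p (e Fin.zero) | h Fin.zero | sum-filter p F (e ∘ Fin.suc) (g ∘ suc) (h ∘ Fin.suc)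
  ... | true  | h₀ | ih = trans (cong₂ _+_ h₀ ih) (sym (Σ-front n g))
  ... | false | h₀ | ih = trans ih (trans (sym (+-identityˡ _)) (trans (cong (_+ Σ n (g ∘ suc)) h₀) (sym (Σ-front n g))))

  module Encoding (D : DAG) (bs : List Bool)
    (arc≡ : ∀ u v → arcAt (DAG.order D) bs (toℕ u) (toℕ v) ≡ DAG.arc D u v) where
    open DAG D

    private
      n = order

    S≡ : (f : V → ℕ) (x : Vector) → (∀ i → pos (f i) ≡ x (toℕ i)) → ∀ u → pos (S f u) ≡ neighbourSum n bs x (toℕ u)
    S≡ f x f≡ u = sum-filter (λ w → arc u w ∨ arc w u) f id (λ j → adjacent n bs (toℕ u) j * x j) term
      where
      scale : ∀ b z → (if b then z else 0ℤ) ≡ (if b then 1ℤ else 0ℤ) * z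
      scale true  z = sym (*-identityˡ z)
      scale false z = sym (*-zeroˡ z)
      term : ∀ i → (if arc u i ∨ arc i u then pos (f i) else 0ℤ) ≡ adjacent n bs (toℕ u) (toℕ i) * x (toℕ i)
      term i = trans (scale (arc u i ∨ arc i u) (pos (f i)))
        (cong₂ (λ b z → (if b then 1ℤ else 0ℤ) * z) (sym (cong₂ _∨_ (arc≡ u i) (arc≡ i u))) (f≡ i))

  matrixOf : DAG → List Bool
  matrixOf D = map (uncurry arc) (cartesianProduct (allFin order) (allFin order))
    where open DAG D

  matrixOf-arc : ∀ D u v → arcAt (DAG.order D) (matrixOf D) (toℕ u) (toℕ v) ≡ DAG.arc D u v
  matrixOf-arc D u v = nth-cartesian false (uncurry (DAG.arc D)) id u v

  ≡ᵇ-true : ∀ {m n} → (m ≡ᵇ n) ≡ true → m ≡ n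
  ≡ᵇ-true {m} {n} e = ℕ.≡ᵇ⇒≡ m n (Equivalence.from T-≡ e)

  decide-code : ∀ n bs → decide (replicate n true ++ false ∷ bs) ≡
    (length bs ≡ᵇ n ℕ.* n) ∧ feasible n (n ℕ.* n) (length (replicate n true ++ false ∷ bs) ℕ.+ 4) (inequalities n bs)
  decide-code n bs = trans (cong (check (length (replicate n true ++ false ∷ bs) ℕ.+ 4)) (parse-code n bs))
    (cong₂ (λ l b → (l ≡ᵇ n ℕ.* n) ∧ feasible n (n ℕ.* n) (length (replicate n true ++ false ∷ bs) ℕ.+ 4) (inequalities n b))
      (length-reverse bs) (reverse-involutive bs))

  decide-complete : ∀ D → HasTopologicalAdditiveNumbering D → decide (encode D) ≡ true
  decide-complete D (f , numbering) = trans (decide-code n bs) (cong₂ _∧_ length-true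
      (Complete.feasible-complete n (n ℕ.* n) λ′ (inequalities n bs) (ℕ.m≤n+m 4 _) n+2≤ m≤ ∣a∣≤1 unit x 0<ax))
    where
    open DAG D
    open IsTopologicalAdditiveNumbering numbering
    n λ′ : ℕ
    n = order
    bs : List Bool
    bs = matrixOf D
    λ′ = length (replicate n true ++ false ∷ bs) ℕ.+ 4
    open Encoding D bs (matrixOf-arc D)
    length-bs : length bs ≡ n ℕ.* n
    length-bs = length-cartesian false (uncurry arc) id
    length-true : (length bs ≡ᵇ n ℕ.* n) ≡ true
    length-true rewrite length-bs = ≡ᵇ-refl (n ℕ.* n)
    length-w : length (replicate n true ++ false ∷ bs) ≡ n ℕ.+ suc (n ℕ.* n)
    length-w = trans (length-++ (replicate n true)) (cong₂ (λ a b → a ℕ.+ suc b) (length-replicate n) length-bs)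
    n+2≤ : 2 ℕ.+ n ℕ.≤ λ′
    n+2≤ = ℕ.≤-trans (ℕ.≤-reflexive (ℕ.+-comm 2 n)) (ℕ.+-mono-≤ (subst (n ℕ.≤_) (sym length-w) (ℕ.m≤m+n n _)) (s≤s (s≤s (z≤n {2}))))
    m≤ : n ℕ.* n ℕ.≤ λ′
    m≤ = ℕ.≤-trans (subst (n ℕ.* n ℕ.≤_) (sym length-w) (ℕ.≤-trans (ℕ.n≤1+n _) (ℕ.m≤n+m _ n))) (ℕ.m≤m+n _ 4)
    x : Vector
    x j = pos (extend f j)
    x≡ : ∀ i → pos (f i) ≡ x (toℕ i)
    x≡ i = cong pos (sym (extend-toℕ f i))
    S≡x : ∀ u → pos (S f u) ≡ neighbourSum n bs x (toℕ u)
    S≡x = S≡ f x x≡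
    ∣a∣≤1 : ∀ i j → i ℕ.< n ℕ.* n → j ℕ.< n → ∣ entry (inequalities n bs) i j ∣ ℕ.≤ 1
    ∣a∣≤1 i j i< j<n with split-index n i i<
    ... | u , v , u<n , v<n , refl = subst (λ t → ∣ t ∣ ℕ.≤ 1) (sym (entry-inequalities n bs u v j u<n v<n j<n)) (∣coefficient∣≤1 n bs u v j)
    loopless : ∀ u → arc u u ≡ false
    loopless u with arc u u in e
    ... | false = refl
    ... | true  = ⊥-elim (acyclic u [ Equivalence.from T-≡ e ])
    -- The row of the pair `(j , j)`: acyclicity excludes a loop at `j`, so the row states the
    -- positivity of the label.
    unit : ∀ j → j ℕ.< n → ∃[ i ] (i ℕ.< n ℕ.* n × (∀ l → l ℕ.< n → entry (inequalities n bs) i l ≡ δ j l))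
    unit j j<n = j ℕ.* n ℕ.+ j , index< n j j j<n j<n , λ l l<n → trans (entry-inequalities n bs j j l j<n j<n l<n)
      (cong (λ b → if b then adjacent n bs j l - adjacent n bs j l else δ j l)
        (subst (λ t → arcAt n bs t t ≡ false) (Fin.toℕ-fromℕ< j<n) (trans (matrixOf-arc D (fromℕ< j<n) (fromℕ< j<n)) (loopless (fromℕ< j<n)))))
    row>0 : ∀ u v → 0ℤ < row-value n bs x (toℕ u) (toℕ v)
    row>0 u v rewrite matrixOf-arc D u v with arc u v in e
    ... | false = subst (0ℤ <_) (x≡ u) (+<+ (positive u))
    ... | true  = subst₂ (λ a b → 0ℤ < b - a) (S≡x u) (S≡x v)
      (subst (_< pos (S f v) - pos (S f u)) (+-inverseʳ (pos (S f u))) (+-monoˡ-< (- pos (S f u)) (+<+ (increasing (Equivalence.from T-≡ e)))))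
    0<ax : ∀ i → i ℕ.< n ℕ.* n → 0ℤ < dot n (entry (inequalities n bs) i) x
    0<ax i i< with split-index n i i<
    ... | u , v , u<n , v<n , refl = subst (0ℤ <_) (sym (dot-inequalities n bs x u v u<n v<n))
      (subst₂ (λ s t → 0ℤ < row-value n bs x s t) (Fin.toℕ-fromℕ< u<n) (Fin.toℕ-fromℕ< v<n) (row>0 (fromℕ< u<n) (fromℕ< v<n)))

  module Sound (n : ℕ) (bs : List Bool) (length-bs : length bs ≡ n ℕ.* n) (x : Vector)
    (0<ax : ∀ i → i ℕ.< n ℕ.* n → 0ℤ < dot n (entry (inequalities n bs) i) x) where

    private
      row>0 : ∀ u v → u ℕ.< n → v ℕ.< n → 0ℤ < row-value n bs x u v
      row>0 u v u<n v<n = subst (0ℤ <_) (dot-inequalities n bs x u v u<n v<n) (0<ax _ (index< n u v u<n v<n))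

      arc′ : Fin n → Fin n → Bool
      arc′ u v = arcAt n bs (toℕ u) (toℕ v)

      -- If the bit of `(u , u)` were set, its row would demand that a sum exceed itself. So every
      -- diagonal row is one for positivity.
      0<x : ∀ u → u ℕ.< n → 0ℤ < x u
      0<x u u<n with arcAt n bs u u | row>0 u u u<n u<n
      ... | false | h = h
      ... | true  | h = ⊥-elim (<-irrefl (sym (+-inverseʳ (neighbourSum n bs x u))) h)

      rises : ∀ u v → T (arc′ u v) → neighbourSum n bs x (toℕ u) < neighbourSum n bs x (toℕ v)
      rises u v a with arcAt n bs (toℕ u) (toℕ v) | row>0 (toℕ u) (toℕ v) (Fin.toℕ<n u) (Fin.toℕ<n v)
      ... | true | h = subst₂ _<_ (+-identityˡ _) (e (neighbourSum n bs x (toℕ v)) (neighbourSum n bs x (toℕ u))) (+-monoˡ-< (neighbourSum n bs x (toℕ u)) h)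
        where
        e : ∀ a b → a - b + b ≡ a
        e = solve-∀

      rises⁺ : ∀ {u v} → TransClosure (λ u v → T (arc′ u v)) u v → neighbourSum n bs x (toℕ u) < neighbourSum n bs x (toℕ v)
      rises⁺ [ a ]   = rises _ _ a
      rises⁺ (a ∷ p) = <-trans (rises _ _ a) (rises⁺ p)

    graph : DAG
    -- The neighbour sums of a solution increase strictly along paths, so a cycle would place a sum
    -- below itself.
    graph = record { order = n ; arc = arc′ ; acyclic = λ v p → <-irrefl refl (rises⁺ p) }

    open Encoding graph bs (λ u v → refl)

    has-numbering : HasTopologicalAdditiveNumbering graph
    has-numbering = f , record
      { positive   = λ v → drop‿+<+ (subst (0ℤ <_) (sym (f≡ v)) (0<x (toℕ v) (Fin.toℕ<n v)))
      ; increasing = λ {u} {v} a → drop‿+<+ (subst₂ _<_ (sym (S≡ f x f≡ u)) (sym (S≡ f x f≡ v)) (rises u v a))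
      }
      where
      f : Fin n → ℕ
      f v = ∣ x (toℕ v) ∣
      f≡ : ∀ v → pos (f v) ≡ x (toℕ v)
      f≡ v = 0≤i⇒+∣i∣≡i (<⇒≤ (0<x (toℕ v) (Fin.toℕ<n v)))

    -- Membership in the language asks for the word itself to be a code, so the graph read off from
    -- the bits has to give them back.
    matrix≡ : matrixOf graph ≡ bs
    matrix≡ = nth-ext false (matrixOf graph) bs (trans len (sym length-bs)) λ i i< → same i (subst (i ℕ.<_) len i<)
      where
      len : length (matrixOf graph) ≡ n ℕ.* n
      len = length-cartesian false (uncurry arc′) id
      same : ∀ i → i ℕ.< n ℕ.* n → nth false (matrixOf graph) i ≡ nth false bs i
      same i i< with split-index n i i<
      ... | u , v , u<n , v<n , refl = subst₂ (λ s t → arcAt n (matrixOf graph) s t ≡ arcAt n bs s t) (Fin.toℕ-fromℕ< u<n) (Fin.toℕ-fromℕ< v<n)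
        (matrixOf-arc graph (fromℕ< u<n) (fromℕ< v<n))

  check-unseen : ∀ λ′ s → proj₁ s ≡ false → check λ′ s ≡ false
  check-unseen λ′ (false , _) _ = refl

  decide-sound : ∀ w → decide w ≡ true → languageOf HasTopologicalAdditiveNumbering w
  decide-sound w e with shape w
  ... | inj₂ unseen = ⊥-elim (absurd (trans (sym e) (check-unseen (length w ℕ.+ 4) (parse w) unseen)))
    where
    absurd : true ≢ false
    absurd ()
  ... | inj₁ (n , bs , refl) = Sound.graph n bs len x h , cong (λ b → replicate n true ++ false ∷ b) (sym (Sound.matrix≡ n bs len x h)) , Sound.has-numbering n bs len x h
    where
    λ′ : ℕ
    λ′ = length (replicate n true ++ false ∷ bs) ℕ.+ 4
    both : (length bs ≡ᵇ n ℕ.* n) ∧ feasible n (n ℕ.* n) λ′ (inequalities n bs) ≡ true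
    both = trans (sym (decide-code n bs)) e
    split : ∀ {a b} → a ∧ b ≡ true → a ≡ true × b ≡ true
    split {true} {true} _ = refl , refl
    len : length bs ≡ n ℕ.* n
    len = ≡ᵇ-true (proj₁ (split both))
    sound : ∃[ v ] (∀ i → i ℕ.< n ℕ.* n → 0ℤ < dot n (entry (inequalities n bs) i) v)
    sound = feasible-sound n (n ℕ.* n) λ′ (inequalities n bs) (proj₂ (split both))
    x : Vector
    x = proj₁ sound
    h : ∀ i → i ℕ.< n ℕ.* n → 0ℤ < dot n (entry (inequalities n bs) i) x
    h = proj₂ sound

  decide-reflects : ∀ w → Reflects (languageOf HasTopologicalAdditiveNumbering w) (decide w)
  decide-reflects w = go (decide w) refl
    where
    absurd : true ≢ false
    absurd ()
    go : ∀ b → decide w ≡ b → Reflects (languageOf HasTopologicalAdditiveNumbering w) b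
    go true  e = ofʸ (decide-sound w e)
    go false e = ofⁿ λ { (D , refl , numbering) → absurd (trans (sym (decide-complete D numbering)) e) }

-- Loading the input and conclusion

module Main where

  open StackMachine
  open TreeStack
  open PolyTime
  open Graphs
  open import Defs
  open import Data.Fin.Patterns using (0F; 1F; 3F)
  open import Data.Nat using (zero; suc; _+_; _*_; _^_; _≤_; z≤n; s≤s)
  open import Data.Nat.Properties
  open import Data.Nat.Tactic.RingSolver using (solve-∀)
  open import Data.Vec using (lookup)

  -- The raw input is not yet a serialised tree. It is reversed onto stack 1, from where the list
  -- can be built starting at its end, on top of the leaf for the empty list.
  unload load-bit load : Cmd
  unload   = loop (match 0F (push 3F false) (push 1F false ▸ push 3F true) (push 1F true ▸ push 3F true))
  load-bit = match 1F (push 3F false)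
    -- Pushes run against prefix order: the tree of the bit, then the tag of the list cell above it.
    -- The bit `true` takes three pushes, two leaves and a node.
    (push 0F false ▸ push 0F true ▸ push 3F true)
    (push 0F false ▸ push 0F false ▸ push 0F true ▸ push 0F true ▸ push 3F true)
  load     = push 0F false ▸ loop load-bit

  private
    step≤ : ∀ k n → k ≤ 6 → k + suc (4 + 7 * n) ≤ 4 + 7 * suc n
    step≤ k n k≤6 = ≤-trans (+-monoˡ-≤ (suc (4 + 7 * n)) k≤6) (≤-reflexive (e n))
      where
      e : ∀ n → 6 + suc (4 + 7 * n) ≡ 4 + 7 * suc n
      e = solve-∀

    unload-ok : ∀ w {b} → Ex unload ⟨ w , b , [] , [] ⟩ ⟨ [] , onto w b , [] , [] ⟩ (4 + 7 * length w)
    unload-ok []          = weaken (n≤1+n 3) (looped {n = 0} (matched (pushes 3F false)) (inj₁ (refl , refl)))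
    unload-ok (false ∷ w) = weaken (step≤ 3 (length w) (s≤s (s≤s (s≤s z≤n)))) (looped (matched (pushes 1F false ▷ pushes 3F true)) (inj₂ (refl , unload-ok w)))
    unload-ok (true ∷ w)  = weaken (step≤ 3 (length w) (s≤s (s≤s (s≤s z≤n)))) (looped (matched (pushes 1F true ▷ pushes 3F true)) (inj₂ (refl , unload-ok w)))

    encoded : List Bool → List Bool
    encoded w = ser (enc (list bool) w) []

    load-loop : ∀ b w → Ex (loop load-bit) ⟨ encoded w , b , [] , [] ⟩ (main (encoded (onto b w))) (4 + 7 * length b)
    load-loop []          w = weaken (n≤1+n 3) (looped {n = 0} (matched (pushes 3F false)) (inj₁ (refl , refl)))
    load-loop (false ∷ b) w = weaken (step≤ 4 (length b) (s≤s (s≤s (s≤s (s≤s z≤n)))))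
      (looped (matched (pushes 0F false ▷ pushes 0F true ▷ pushes 3F true)) (inj₂ (refl , load-loop b (false ∷ w))))
    load-loop (true ∷ b)  w = weaken (step≤ 6 (length b) ≤-refl)
      (looped (matched (pushes 0F false ▷ pushes 0F false ▷ pushes 0F true ▷ pushes 0F true ▷ pushes 3F true)) (inj₂ (refl , load-loop b (true ∷ w))))

    onto-onto : ∀ w b → onto (onto w b) [] ≡ onto b w
    onto-onto []      b = refl
    onto-onto (x ∷ w) b = onto-onto w (x ∷ b)

    length-onto : ∀ w b → length (onto w b) ≡ length w + length b
    length-onto []      b = refl
    length-onto (x ∷ w) b = trans (length-onto w (x ∷ b)) (+-suc (length w) (length b))

  -- For positive `n` the base `2 + n` is at most `3 * n`; at `n = 0` the additive `3 ^ k` takes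
  -- over. This brings the bound into the shape that `InP` prescribes, with one constant in both
  -- places.
  monomial≤ : ∀ k n → (2 + n) ^ k ≤ 3 ^ k * n ^ k + 3 ^ k
  monomial≤ k zero    = ≤-trans (^-monoˡ-≤ k (n≤1+n 2)) (m≤n+m (3 ^ k) _)
  monomial≤ k (suc n) = ≤-trans (≤-trans (^-monoˡ-≤ k (≤-by (2 * n) (e n))) (≤-reflexive (^-distribʳ-* k))) (m≤m+n _ (3 ^ k))
    where
    e : ∀ n → 2 + suc n + 2 * n ≡ 3 * suc n
    e = solve-∀
    ^-distribʳ-* : ∀ k → (3 * suc n) ^ k ≡ 3 ^ k * suc n ^ k
    ^-distribʳ-* zero    = refl
    ^-distribʳ-* (suc k) rewrite ^-distribʳ-* k = e′ 3 (suc n) (3 ^ k) (suc n ^ k)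
      where
      e′ : ∀ a b x y → a * b * (x * y) ≡ a * x * (b * y)
      e′ = solve-∀

  abstract
    polynomial : ∀ p → ∃[ c ] ∃[ k ] (∀ n → eval p n ≤ c * n ^ k + c)
    polynomial p with degree p
    ... | k , h = 3 ^ k , k , λ n → ≤-trans (h n) (monomial≤ k n)

  in-P : ∀ {L : Language} (c : Cmd) (p : Poly) (f : List Bool → Bool) →
    (∀ w → Ex c (main w) (main (ser (encBool (f w)) [])) (eval p (length w))) → (∀ w → Reflects (L w) (f w)) → InP L
  in-P {L} c p f runs reflects = Machine.machine c , a , k , λ w → within w (Machine.decides c {L} {eval p} ran w)
    where
    bounds = polynomial (con 1 ⊞ (p ⊞ p))
    a = proj₁ bounds
    k = proj₁ (proj₂ bounds)
    answer : ∀ b → ∃[ l ] (ser (encBool b) [] ≡ b ∷ l)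
    answer false = _ , refl
    answer true  = _ , refl
    ran : ∀ w → ∃[ b ] ∃[ t ] ∃[ s ] ∃[ l ] (c ⊢ main w ⇓[ t ] s × lookup s 0F ≡ b ∷ l × t ≤ eval p (length w) × Reflects (L w) b)
    ran w = f w , Ex.time (runs w) , main (ser (encBool (f w)) []) , proj₁ (answer (f w)) ,
      Ex.derived (runs w) , proj₂ (answer (f w)) , Ex.within (runs w) , reflects w
    within : ∀ w → ∃[ b ] ∃[ t ] (t ≤ suc (eval p (length w) + eval p (length w)) × Run.HaltsIn (Machine.machine c) t w b × Reflects (L w) b) →
             ∃[ b ] ∃[ t ] (t ≤ a * length w ^ k + a × Run.HaltsIn (Machine.machine c) t w b × Reflects (L w) b)
    within w (b , t , t≤ , halts , r) = b , t , ≤-trans t≤ (proj₂ (proj₂ bounds) (length w)) , halts , r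

  abstract
    program : Cmd
    program = unload ▸ load ▸ PT.cmd pt-decide

    runtime : Poly
    runtime = (con 4 ⊞ con 7 ⊠ var) ⊞ ((con 1 ⊞ (con 4 ⊞ con 7 ⊠ var)) ⊞ PT.bound pt-decide ⊚ (con 1 ⊞ con 4 ⊠ var))

    program-ok : ∀ w → Ex program (main w) (main (ser (encBool (decide w)) [])) (eval runtime (length w))
    program-ok w = unload-ok w ▷ loaded ▷ weaken (eval-mono (PT.bound pt-decide) size≤) (PT.run pt-decide w [])
      where
      loaded : Ex load ⟨ [] , onto w [] , [] , [] ⟩ (main (encoded w)) (1 + (4 + 7 * length w))
      loaded = pushes 0F false ▷ weaken (≤-reflexive (cong (λ l → 4 + 7 * l) (trans (length-onto w []) (+-identityʳ (length w)))))
        (subst (λ v → Ex (loop load-bit) ⟨ encoded [] , onto w [] , [] , [] ⟩ (main (encoded v)) (4 + 7 * length (onto w []))) (onto-onto w []) (load-loop (onto w []) []))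
      size≤ : sz (list bool) w ≤ 1 + 4 * length w
      size≤ = go w
        where
        size-bool : ∀ b → size (encBool b) ≤ 3
        size-bool false = s≤s z≤n
        size-bool true  = ≤-refl
        e : ∀ n → suc (3 + (1 + 4 * n)) ≡ 1 + 4 * suc n
        e = solve-∀
        go : ∀ w → sz (list bool) w ≤ 1 + 4 * length w
        go []      = ≤-refl
        go (b ∷ w) = ≤-trans (s≤s (+-mono-≤ (size-bool b) (go w))) (≤-reflexive (e (length w)))

  decidable-in-polynomial-time : InP (languageOf HasTopologicalAdditiveNumbering)
  decidable-in-polynomial-time = in-P program runtime decide program-ok decide-reflects

open import Defs

proposition2 : InP (languageOf HasTopologicalAdditiveNumbering)
proposition2 = Main.decidable-in-polynomial-time
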